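{- Let $n_1,n_2$ be positive integers and $n=\max\{n_1,n_2\}$. Let $\tau\in S_{n_1}$ be a $k$-Grassmannian permutation whose associated Young diagram $\lambda$ has exactly $2$ rows, and let $w\in S_{n_2}$. Write \[\mathfrak{S}_{w}\, s_{\lambda}(x_1,\dots,x_k)=\sum_{v} c_{w\tau}^{v}\,\mathfrak{S}_{v}.\] Then: (1) if $k=n_2$, then $c_{w\tau}^{v}\in\{0,1\}$ for all $v$; (2) if $k=n_2-1$, then $c_{w\tau}^{v}\in\{0,1\}$ for all $v$; (3) if $k=n_2-2$, then $c_{w\tau}^{v}\in\{0,1,2\}$ for all $v$.
   Context: For $w\in S_N$, $\mathfrak{S}_w$ denotes the Schubert polynomial: $\mathfrak{S}_{w_0}=x_1^{N-1}x_2^{N-2}\cdots x_{N-1}$ for the longest element $w_0\in S_N$, and $\mathfrak{S}_{ws_i}=\partial_i\mathfrak{S}_w$ whenever $w(i)>w(i+1)$, where $\partial_i f=(f-s_if)/(x_i-x_{i+1})$ and $s_i$ swaps $x_i,x_{i+1}$. Permutations in $S_N$ are regarded as permutations of $S_{N'}$ ($N'\ge N$) fixing $N+1,\dots,N'$; Schubert polynomials are stable under this embedding and form a basis of the polynomial ring, so the coefficients $c^v_{w\tau}$ in the expansion are well defined. A permutation $\tau\in S_{N}$ is $k$-Grassmannian if $\tau(1)<\dots<\tau(k)$ and $\tau(k+1)<\dots<\tau(N)$; its associated Young diagram (partition) is $\lambda=(\tau(k)-k,\dots,\tau(2)-2,\tau(1)-1)$ (zero parts removed), and $\mathfrak{S}_\tau=s_\lambda(x_1,\dots,x_k)$,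 the Schur polynomial in $k$ variables, i.e. the sum over semistandard Young tableaux $T$ of shape $\lambda$ with entries in $\{1,\dots,k\}$ of $\prod_i x_i^{t_i}$, $t_i$ the number of entries equal to $i$. -}

module Defs where

open import Data.Nat as ℕ using (ℕ; zero; suc; _∸_; _⊔_; _≡ᵇ_; _<?_)
open import Data.Integer as ℤ using (ℤ; 0ℤ; 1ℤ)
open import Data.List using (List; []; _∷_; _++_; map; concatMap; replicate; upTo; length; filter; allFin)
open import Data.List.Relation.Unary.Unique.Propositional using (Unique)
open import Data.Vec as V using (Vec; lookup; tabulate; _[_]≔_)
open import Data.Fin as F using (Fin; opposite; toℕ)
open import Data.Product using (_×_; _,_; Σ)
open import Data.Sum using (_⊎_)
open import Data.Bool using (Bool; true; false; _∧_; if_then_else_)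
open import Relation.Nullary.Decidable using (_×-dec_)
open import Relation.Binary.PropositionalEquality using (_≡_)

-- A monomial: the exponent of x_{i+1} is the i-th entry (0-based);
-- missing entries are 0.
Mono : Set
Mono = List ℕ

expo : Mono → ℕ → ℕ
expo []      _       = 0
expo (a ∷ m) zero    = a
expo (a ∷ m) (suc i) = expo m i

monoEq : Mono → Mono → Bool
monoEq []      []       = true
monoEq []      (b ∷ m') = (b ≡ᵇ 0) ∧ monoEq [] m'
monoEq (a ∷ m) []       = (a ≡ᵇ 0) ∧ monoEq m []
monoEq (a ∷ m) (b ∷ m') = (a ≡ᵇ b) ∧ monoEq m m'

monoMul : Mono → Mono → Mono
monoMul []      m'       = m'
monoMul (a ∷ m) []       = a ∷ m
monoMul (a ∷ m) (b ∷ m') = (a ℕ.+ b) ∷ monoMul m m'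

-- a polynomial is a formal sum of terms c·x^m (repetitions allowed)
Poly : Set
Poly = List (ℤ × Mono)

coeff : Poly → Mono → ℤ
coeff []            _  = 0ℤ
coeff ((c , m) ∷ p) m' = (if monoEq m m' then c else 0ℤ) ℤ.+ coeff p m'

infix 4 _≈P_
_≈P_ : Poly → Poly → Set
p ≈P q = ∀ m → coeff p m ≡ coeff q m

scaleP : ℤ → Poly → Poly
scaleP c p = map (λ (d , m) → (c ℤ.* d , m)) p

_-P_ : Poly → Poly → Poly
p -P q = p ++ scaleP (ℤ.- 1ℤ) q

_*P_ : Poly → Poly → Poly
p *P q = concatMap (λ (c , m) → map (λ (d , m') → (c ℤ.* d , monoMul m m')) q) p

var : ℕ → Poly
var i = (1ℤ , replicate i 0 ++ (1 ∷ [])) ∷ []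

swapIdx : ℕ → ℕ → ℕ
swapIdx i j = if j ≡ᵇ i then suc i else (if j ≡ᵇ suc i then i else j)

swapMono : ℕ → Mono → Mono
swapMono i m = map (λ j → expo m (swapIdx i j)) (upTo (length m ⊔ suc (suc i)))

swapP : ℕ → Poly → Poly
swapP i p = map (λ (c , m) → (c , swapMono i m)) p

-- g = ∂_{i+1} f , i.e. (x_{i+1} - x_{i+2}) g = f - s_{i+1} f
-- (the polynomial ring is a domain, so g is determined by f)
IsDivDiff : ℕ → Poly → Poly → Set
IsDivDiff i f g = ((var i -P var (suc i)) *P g) ≈P (f -P swapP i f)

-- Permutations in one-line notation (0-based: w(i+1) = lookup w i + 1)

Perm : ℕ → Set
Perm N = Vec (Fin N) N

IsPerm : ∀ {N} → Perm N → Set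
IsPerm {N} w = ∀ (i j : Fin N) → lookup w i ≡ lookup w j → i ≡ j

longest : (N : ℕ) → Perm N
longest N = tabulate opposite

swapPos : ∀ {N} → Perm N → Fin N → Fin N → Perm N
swapPos w i j = (w [ i ]≔ lookup w j) [ j ]≔ lookup w i

staircase : ℕ → Poly
staircase N = (1ℤ , map (λ i → N ∸ suc i) (upTo N)) ∷ []

-- Schubert N w f : f is (a representative of) the Schubert polynomial 𝔖_w, w ∈ S_N
data Schubert (N : ℕ) : Perm N → Poly → Set where
  top  : Schubert N (longest N) (staircase N)
  step : ∀ {w f g} (i j : Fin N) → toℕ j ≡ suc (toℕ i) →
         lookup w j F.< lookup w i →
         IsDivDiff (toℕ i) f g →
         Schubert N w f → Schubert N (swapPos w i j) g

IsGrassmannian : ∀ {N} → ℕ → Perm N → Set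
IsGrassmannian {N} k τ = ∀ (i j : Fin N) → i F.< j →
  (toℕ j ℕ.< k ⊎ k ℕ.≤ toℕ i) → lookup τ i F.< lookup τ j

-- number of nonzero parts τ(i)-i, 1 ≤ i ≤ k, of the associated partition λ
numRows : ∀ {N} → ℕ → Perm N → ℕ
numRows {N} k τ =
  length (filter (λ i → (toℕ i <? k) ×-dec (toℕ i <? toℕ (lookup τ i))) (allFin N))

record Term (M : ℕ) : Set where
  field
    perm  : Perm M
    coef  : ℤ
    poly  : Poly
    isSch : Schubert M perm poly
open Term public

sumTerms : ∀ {M} → List (Term M) → Poly
sumTerms E = concatMap (λ t → scaleP (coef t) (poly t)) E

IsExpansion : Poly → (M : ℕ) → List (Term M) → Set
IsExpansion P M E = Unique (map perm E) × (P ≈P sumTerms E)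

{-# OPTIONS --safe #-}

-- Let ε_v apply the divided differences along a reduced word of v and then take the constant term.  These
-- functionals are dual to the Schubert polynomials and jointly faithful, so c^v_{wτ} = ε_v(𝔖_w s_λ).  As s_λ is
-- symmetric in x_1, …, x_k, every descent of v other than k can be traded for a divided difference of 𝔖_w, so v
-- may be taken k-Grassmannian.  By Jacobi–Trudi
--   s_λ = h_a(x_1..x_k) h_{b+1}(x_1..x_{k-1}) - h_b(x_1..x_k) h_{a+1}(x_1..x_{k-1}),   λ = (a, b + 1),
-- and stripping the two rows of v turns each product into elementary symmetric polynomials in -x_k, -x_{k+1},
-- -x_{k+2} (the "slots"; later variables do not matter because w lies in S_{k+2}).  A one-sided Monk rule evaluates
-- them: the coefficient counts chains of covering transpositions from v to w which bump values into the slots in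
-- two passes.  The values left in the slots determine the chain, and they are determined by w up to one binary
-- choice, or without any choice if w(k+2) is the largest value.  The subtracted product vanishes unless both rows
-- are critical, and then its chains inject into those of the first product.
module Submission where

open import Defs
open import Data.Empty using (⊥-elim; ⊥)
open import Data.Integer as ℤ using (ℤ; 0ℤ; 1ℤ; +_)
import Data.Integer.Properties as ℤₚ
open import Data.List using ([]; _∷_; _++_; map; length; List; concatMap; replicate; applyUpTo; drop; upTo; filter; allFin; cartesianProductWith)
open import Data.List.Relation.Unary.All as All using ([]; _∷_; All)
import Data.List.Relation.Unary.All.Properties as Allₚ
open import Data.List.Relation.Unary.Linked as Linked using (Linked; []; [-]; _∷_)
open import Data.Nat as ℕ using (ℕ; zero; suc; _≤_; z≤n; s≤s; _≡ᵇ_; _⊔_; _<_; _∸_; _<?_; _≟_; _≤?_)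
open import Data.Nat.ListAction using (sum)
import Data.Nat.Properties as ℕₚ
open import Data.Product using (_×_; _,_; proj₁; proj₂; Σ; ∃)
open import Data.Sum as Sum using (inj₁; inj₂; _⊎_)
open import Function using (_∘_)
open import Relation.Binary.Definitions using (tri<; tri≈; tri>; Tri)
open import Relation.Binary.PropositionalEquality as ≡ using (_≡_; _≢_; cong; cong₂; subst; subst₂)
open import Relation.Nullary using (yes; no; ¬_; Dec)
open import Relation.Nullary.Decidable using (_×-dec_; _→-dec_; ¬?)

-- Two kinds of signs obstruct a direct count: Jacobi-Trudi subtracts, and Monk's rule for one
-- variable has terms of both signs. The latter disappear when functionals are evaluated instead of
-- products expanded. For the functional of u, multiplication by -x_s has only positive terms as
-- soon as u(s) is below all later values. For Grassmannian v this holds in every slot, if need be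
-- after exchanging two of them, and treating the slots from the right preserves it. The number of
-- slots comes from the staircase bound on exponents: row operators further right only shift an
-- index, so long rows reduce to short ones. The row stripped first contributes two slots and two
-- divided differences, which stand between the passes and permute the slots. The binary choice has
-- two origins. With one bump in the second pass it is the slot that takes this bump; with two, it
-- is whether the middle slot is bumped in the first pass. For n₂ ≤ k + 1 the permutation w,
-- extended by fixed points, is largest at k + 2 and neither choice remains; so the cases k = n₂ and
-- k = n₂ - 1 are one.

-- Formal sums of monomials as a commutative ring.

module Polynomials where
  open import Data.Integer.Tactic.RingSolver using (solve-∀)
  open import Data.Bool using (true; false; _∧_; if_then_else_; T)
  open ≡
  open import Algebra.Bundles using (CommutativeRing)

  infix 4 _≐_
  _≐_ : Mono → Mono → Set
  m ≐ m' = ∀ i → expo m i ≡ expo m' i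

  ≡ᵇ-true : ∀ a b → (a ≡ᵇ b) ≡ true → a ≡ b
  ≡ᵇ-true a b e = ℕₚ.≡ᵇ⇒≡ a b (subst T (sym e) _)

  ≡ᵇ-refl : ∀ a → (a ≡ᵇ a) ≡ true
  ≡ᵇ-refl zero = refl
  ≡ᵇ-refl (suc a) = ≡ᵇ-refl a

  ∧-true : ∀ {a b} → a ∧ b ≡ true → a ≡ true × b ≡ true
  ∧-true {true} {true} _ = refl , refl

  monoEq-sound : ∀ m m' → monoEq m m' ≡ true → m ≐ m'
  monoEq-sound [] [] e i = refl
  monoEq-sound [] (b ∷ m') e zero = sym (≡ᵇ-true b 0 (proj₁ (∧-true e)))
  monoEq-sound [] (b ∷ m') e (suc i) = monoEq-sound [] m' (proj₂ (∧-true {b ≡ᵇ 0} e)) i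
  monoEq-sound (a ∷ m) [] e zero = ≡ᵇ-true a 0 (proj₁ (∧-true e))
  monoEq-sound (a ∷ m) [] e (suc i) = monoEq-sound m [] (proj₂ (∧-true {a ≡ᵇ 0} e)) i
  monoEq-sound (a ∷ m) (b ∷ m') e zero = ≡ᵇ-true a b (proj₁ (∧-true e))
  monoEq-sound (a ∷ m) (b ∷ m') e (suc i) = monoEq-sound m m' (proj₂ (∧-true {a ≡ᵇ b} e)) i

  monoEq-complete : ∀ m m' → m ≐ m' → monoEq m m' ≡ true
  monoEq-complete [] [] e = refl
  monoEq-complete [] (b ∷ m') e with e 0
  ... | refl = monoEq-complete [] m' (λ i → e (suc i))
  monoEq-complete (a ∷ m) [] e with e 0
  ... | refl = monoEq-complete m [] (λ i → e (suc i))
  monoEq-complete (a ∷ m) (b ∷ m') e with e 0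
  ... | refl rewrite ≡ᵇ-refl a = monoEq-complete m m' (λ i → e (suc i))

  bool-ext : ∀ {a b} → (a ≡ true → b ≡ true) → (b ≡ true → a ≡ true) → a ≡ b
  bool-ext {true} f g = sym (f refl)
  bool-ext {false} {false} f g = refl
  bool-ext {false} {true} f g = g refl

  monoEq-cong : ∀ {m m' k k'} → m ≐ m' → k ≐ k' → monoEq m k ≡ monoEq m' k'
  monoEq-cong {m} {m'} {k} {k'} e e' = bool-ext
    (λ t → monoEq-complete m' k' (λ i → trans (sym (e i)) (trans (monoEq-sound m k t i) (e' i))))
    (λ t → monoEq-complete m k (λ i → trans (e i) (trans (monoEq-sound m' k' t i) (sym (e' i)))))

  expo-mul : ∀ m m' i → expo (monoMul m m') i ≡ expo m i ℕ.+ expo m' i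
  expo-mul [] m' i = refl
  expo-mul (a ∷ m) [] i = sym (ℕₚ.+-identityʳ _)
  expo-mul (a ∷ m) (b ∷ m') zero = refl
  expo-mul (a ∷ m) (b ∷ m') (suc i) = expo-mul m m' i

  monoMul-cong : ∀ {m m' k k'} → m ≐ m' → k ≐ k' → monoMul m k ≐ monoMul m' k'
  monoMul-cong {m} {m'} {k} {k'} e e' i = trans (expo-mul m k i) (trans (cong₂ ℕ._+_ (e i) (e' i)) (sym (expo-mul m' k' i)))

  lin : (Mono → ℤ) → Poly → ℤ
  lin φ [] = 0ℤ
  lin φ ((c , m) ∷ p) = c ℤ.* φ m ℤ.+ lin φ p

  -- Polynomial identities are checked by evaluating every linear functional that ignores the trailing
  -- zeros of monomials.
  Proper : (Mono → ℤ) → Set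
  Proper φ = ∀ {m m'} → m ≐ m' → φ m ≡ φ m'

  δ : Mono → Mono → ℤ
  δ k m = if monoEq m k then 1ℤ else 0ℤ

  δ-proper : ∀ k → Proper (δ k)
  δ-proper k {m} {m'} e = cong (if_then 1ℤ else 0ℤ) (monoEq-cong {m} {m'} {k} {k} e (λ _ → refl))

  coeff-lin : ∀ p k → coeff p k ≡ lin (δ k) p
  coeff-lin [] k = refl
  coeff-lin ((c , m) ∷ p) k = cong₂ ℤ._+_ (h (monoEq m k)) (coeff-lin p k)
    where
    h : ∀ b → (if b then c else 0ℤ) ≡ c ℤ.* (if b then 1ℤ else 0ℤ)
    h true = sym (ℤₚ.*-identityʳ c)
    h false = sym (ℤₚ.*-zeroʳ c)

  lin-cong : ∀ {φ ψ} → (∀ m → φ m ≡ ψ m) → ∀ p → lin φ p ≡ lin ψ p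
  lin-cong e [] = refl
  lin-cong e ((c , m) ∷ p) = cong₂ ℤ._+_ (cong (c ℤ.*_) (e m)) (lin-cong e p)

  lin-++ : ∀ φ p q → lin φ (p ++ q) ≡ lin φ p ℤ.+ lin φ q
  lin-++ φ [] q = sym (ℤₚ.+-identityˡ _)
  lin-++ φ ((c , m) ∷ p) q = trans (cong (λ z → c ℤ.* φ m ℤ.+ z) (lin-++ φ p q)) (sym (ℤₚ.+-assoc (c ℤ.* φ m) _ _))

  lin-scale : ∀ φ c p → lin φ (scaleP c p) ≡ c ℤ.* lin φ p
  lin-scale φ c [] = sym (ℤₚ.*-zeroʳ c)
  lin-scale φ c ((d , m) ∷ p) = trans (cong (λ z → c ℤ.* d ℤ.* φ m ℤ.+ z) (lin-scale φ c p)) (l c d (φ m) (lin φ p))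
    where
    l : ∀ c d a b → c ℤ.* d ℤ.* a ℤ.+ c ℤ.* b ≡ c ℤ.* (d ℤ.* a ℤ.+ b)
    l = solve-∀

  lin-mono : ∀ φ c m q → lin φ (map (λ (d , m') → (c ℤ.* d , monoMul m m')) q) ≡ c ℤ.* lin (λ m' → φ (monoMul m m')) q
  lin-mono φ c m [] = sym (ℤₚ.*-zeroʳ c)
  lin-mono φ c m ((d , m') ∷ q) = trans (cong (λ z → c ℤ.* d ℤ.* φ (monoMul m m') ℤ.+ z) (lin-mono φ c m q)) (l c d (φ (monoMul m m')) _)
    where
    l : ∀ c d a b → c ℤ.* d ℤ.* a ℤ.+ c ℤ.* b ≡ c ℤ.* (d ℤ.* a ℤ.+ b)
    l = solve-∀

  lin-* : ∀ φ p q → lin φ (p *P q) ≡ lin (λ m → lin (λ m' → φ (monoMul m m')) q) p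
  lin-* φ [] q = refl
  lin-* φ ((c , m) ∷ p) q = trans (lin-++ φ (map _ q) (p *P q)) (cong₂ ℤ._+_ (lin-mono φ c m q) (lin-* φ p q))

  lin-0 : ∀ p → lin (λ _ → 0ℤ) p ≡ 0ℤ
  lin-0 [] = refl
  lin-0 ((c , m) ∷ p) = trans (cong₂ ℤ._+_ (ℤₚ.*-zeroʳ c) (lin-0 p)) refl

  lin-fun-+ : ∀ φ ψ p → lin (λ m → φ m ℤ.+ ψ m) p ≡ lin φ p ℤ.+ lin ψ p
  lin-fun-+ φ ψ [] = refl
  lin-fun-+ φ ψ ((c , m) ∷ p) = trans (cong (λ z → c ℤ.* (φ m ℤ.+ ψ m) ℤ.+ z) (lin-fun-+ φ ψ p)) (l c (φ m) (ψ m) _ _)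
    where
    l : ∀ c a b x y → c ℤ.* (a ℤ.+ b) ℤ.+ (x ℤ.+ y) ≡ (c ℤ.* a ℤ.+ x) ℤ.+ (c ℤ.* b ℤ.+ y)
    l = solve-∀

  lin-fun-* : ∀ c φ p → lin (λ m → c ℤ.* φ m) p ≡ c ℤ.* lin φ p
  lin-fun-* c φ [] = sym (ℤₚ.*-zeroʳ c)
  lin-fun-* c φ ((d , m) ∷ p) = trans (cong (λ z → d ℤ.* (c ℤ.* φ m) ℤ.+ z) (lin-fun-* c φ p)) (l c d (φ m) _)
    where
    l : ∀ c d a x → d ℤ.* (c ℤ.* a) ℤ.+ c ℤ.* x ≡ c ℤ.* (d ℤ.* a ℤ.+ x)
    l = solve-∀

  lin-swap : ∀ (ψ : Mono → Mono → ℤ) p q → lin (λ m → lin (ψ m) q) p ≡ lin (λ m' → lin (λ m → ψ m m') p) q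
  lin-swap ψ [] q = sym (lin-0 q)
  lin-swap ψ ((c , m) ∷ p) q = sym (trans (lin-fun-+ (λ m' → c ℤ.* ψ m m') (λ m' → lin (λ m → ψ m m') p) q)
    (cong₂ ℤ._+_ (lin-fun-* c (ψ m) q) (sym (lin-swap ψ p q))))

  -- Monomials may repeat and may differ in trailing zeros, so the whole class of `k` is removed at
  -- once.
  without : Mono → Poly → Poly
  without k [] = []
  without k ((c , m) ∷ p) = if monoEq m k then without k p else (c , m) ∷ without k p

  without-length : ∀ k p → length (without k p) ≤ length p
  without-length k [] = z≤n
  without-length k ((c , m) ∷ p) with monoEq m k
  ... | true = ℕₚ.m≤n⇒m≤1+n (without-length k p)
  ... | false = s≤s (without-length k p)

  lin-without : ∀ {φ} → Proper φ → ∀ k p → lin φ p ≡ lin (δ k) p ℤ.* φ k ℤ.+ lin φ (without k p)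
  lin-without pr k [] = refl
  lin-without {φ} pr k ((c , m) ∷ p) with monoEq m k in eq
  ... | true = trans (cong₂ (λ a b → c ℤ.* a ℤ.+ b) (pr {m} {k} (monoEq-sound m k eq)) (lin-without pr k p)) (l c (φ k) (lin (δ k) p) (lin φ (without k p)))
    where
    l : ∀ c a b d → c ℤ.* a ℤ.+ (b ℤ.* a ℤ.+ d) ≡ (c ℤ.* 1ℤ ℤ.+ b) ℤ.* a ℤ.+ d
    l = solve-∀
  ... | false = trans (cong (λ z → c ℤ.* φ m ℤ.+ z) (lin-without pr k p)) (l c (φ m) (φ k) (lin (δ k) p) (lin φ (without k p)))
    where
    l : ∀ c e a b d → c ℤ.* e ℤ.+ (b ℤ.* a ℤ.+ d) ≡ (c ℤ.* 0ℤ ℤ.+ b) ℤ.* a ℤ.+ (c ℤ.* e ℤ.+ d)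
    l = solve-∀

  -- Induction on the number of terms, bounded by `n`: the head monomial has total coefficient zero,
  -- so deleting its whole class changes neither `lin φ` nor any coefficient.
  lin-zero : ∀ n p → length p ≤ n → (∀ k → lin (δ k) p ≡ 0ℤ) → ∀ {φ} → Proper φ → lin φ p ≡ 0ℤ
  lin-zero n [] _ z pr = refl
  lin-zero (suc n) q@((c , m) ∷ p) (s≤s l) z {φ} pr =
    trans (lin-without {φ} pr m q) (cong₂ ℤ._+_ (trans (cong (ℤ._* φ m) (z m)) refl) (lin-zero n (without m q) len z' pr))
    where
    mm : monoEq m m ≡ true
    mm = monoEq-complete m m (λ _ → refl)
    len : length (without m q) ≤ n
    len rewrite mm = ℕₚ.≤-trans (without-length m p) l
    z' : ∀ k → lin (δ k) (without m q) ≡ 0ℤ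
    z' k = trans (sym (ℤₚ.+-identityˡ _)) (trans (cong (ℤ._+ lin (δ k) (without m q)) (sym (cong (ℤ._* δ k m) (z m))))
           (trans (sym (lin-without {δ k} (λ {a} {b} → δ-proper k {a} {b}) m q)) (z k)))

  -- Apply `lin-zero` to `p -P q`. Together with `lin⇒≈` this lets the ring laws be checked monomial
  -- by monomial.
  lin-resp : ∀ {p q} → p ≈P q → ∀ {φ} → Proper φ → lin φ p ≡ lin φ q
  lin-resp {p} {q} e {φ} pr = ℤₚ.i-j≡0⇒i≡j _ _ (trans (sym (d φ)) (lin-zero _ (p -P q) ℕₚ.≤-refl
      (λ k → trans (d (δ k)) (ℤₚ.i≡j⇒i-j≡0 (trans (sym (coeff-lin p k)) (trans (e k) (coeff-lin q k))))) {φ} pr))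
    where
    d : ∀ ψ → lin ψ (p -P q) ≡ lin ψ p ℤ.- lin ψ q
    d ψ = trans (lin-++ ψ p _) (cong (λ z → lin ψ p ℤ.+ z) (trans (lin-scale ψ (ℤ.- 1ℤ) q) (ℤₚ.-1*i≡-i _)))

  lin⇒≈ : ∀ {p q} → (∀ {φ} → Proper φ → lin φ p ≡ lin φ q) → p ≈P q
  lin⇒≈ {p} {q} h k = trans (coeff-lin p k) (trans (h {δ k} (λ {a} {b} → δ-proper k {a} {b})) (sym (coeff-lin q k)))

  lin-proper : ∀ {ψ : Mono → Mono → ℤ} → (∀ m' {m k} → m ≐ k → ψ m m' ≡ ψ k m') → ∀ q → Proper (λ m → lin (ψ m) q)
  lin-proper pr q e = lin-cong (λ m' → pr m' e) q

  mul-properˡ : ∀ {φ} → Proper φ → ∀ m → Proper (λ m' → φ (monoMul m m'))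
  mul-properˡ pr m {k} {k'} e = pr (monoMul-cong {m} {m} {k} {k'} (λ _ → refl) e)

  mul-properʳ : ∀ {φ} → Proper φ → ∀ m' → Proper (λ m → φ (monoMul m m'))
  mul-properʳ pr m {k} {k'} e = pr (monoMul-cong {k} {k'} {m} {m} e (λ _ → refl))

  negP : Poly → Poly
  negP = scaleP (ℤ.- 1ℤ)

  oneP : Poly
  oneP = (1ℤ , []) ∷ []

  ≈P-sym : ∀ {p q} → p ≈P q → q ≈P p
  ≈P-sym e k = sym (e k)
  ≈P-trans : ∀ {p q r} → p ≈P q → q ≈P r → p ≈P r
  ≈P-trans e f k = trans (e k) (f k)

  +P-cong : ∀ {p p' q q'} → p ≈P p' → q ≈P q' → p ++ q ≈P p' ++ q'
  +P-cong {p} {p'} {q} {q'} e f = lin⇒≈ {p ++ q} {p' ++ q'} λ {φ} pr →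
    trans (lin-++ φ p q) (trans (cong₂ ℤ._+_ (lin-resp {p} {p'} e {φ} pr) (lin-resp {q} {q'} f {φ} pr)) (sym (lin-++ φ p' q')))

  scaleP-cong : ∀ c {p q} → p ≈P q → scaleP c p ≈P scaleP c q
  scaleP-cong c {p} {q} e = lin⇒≈ {scaleP c p} {scaleP c q} λ {φ} pr →
    trans (lin-scale φ c p) (trans (cong (c ℤ.*_) (lin-resp {p} {q} e {φ} pr)) (sym (lin-scale φ c q)))

  *P-cong : ∀ {p p' q q'} → p ≈P p' → q ≈P q' → p *P q ≈P p' *P q'
  *P-cong {p} {p'} {q} {q'} e f = lin⇒≈ {p *P q} {p' *P q'} λ {φ} pr →
    trans (lin-* φ p q) (trans (lin-resp {p} {p'} e (λ {m} {k} → lin-proper {λ m m' → φ (monoMul m m')} (λ m' {m} {k} → mul-properʳ {φ} pr m' {m} {k}) q {m} {k}))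
     (trans (lin-cong (λ m → lin-resp {q} {q'} f (λ {a} {b} → mul-properˡ {φ} pr m {a} {b})) p') (sym (lin-* φ p' q'))))

  monoMul-comm : ∀ m m' → monoMul m m' ≐ monoMul m' m
  monoMul-comm m m' i = trans (expo-mul m m' i) (trans (ℕₚ.+-comm (expo m i) (expo m' i)) (sym (expo-mul m' m i)))

  monoMul-assoc : ∀ a b c → monoMul (monoMul a b) c ≐ monoMul a (monoMul b c)
  monoMul-assoc a b c i = trans (expo-mul (monoMul a b) c i) (trans (cong (ℕ._+ expo c i) (expo-mul a b i)) (trans (ℕₚ.+-assoc (expo a i) _ _)
    (sym (trans (expo-mul a (monoMul b c) i) (cong (expo a i ℕ.+_) (expo-mul b c i))))))

  *P-comm : ∀ p q → p *P q ≈P q *P p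
  *P-comm p q = lin⇒≈ {p *P q} {q *P p} λ {φ} pr → trans (lin-* φ p q) (trans (lin-swap _ p q)
    (trans (lin-cong (λ m' → lin-cong (λ m → pr (monoMul-comm m m')) p) q) (sym (lin-* φ q p))))

  *P-assoc : ∀ p q r → (p *P q) *P r ≈P p *P (q *P r)
  *P-assoc p q r = lin⇒≈ {(p *P q) *P r} {p *P (q *P r)} λ {φ} pr → trans (lin-* φ (p *P q) r) (trans (lin-* _ p q)
    (trans (lin-cong (λ m → trans (lin-cong (λ m' → lin-cong (λ m'' → pr (monoMul-assoc m m' m'')) r) q) (sym (lin-* _ q r))) p)
     (sym (lin-* φ p (q *P r)))))

  *P-distribʳ : ∀ p q r → (q ++ r) *P p ≈P (q *P p) ++ (r *P p)
  *P-distribʳ p q r = lin⇒≈ {(q ++ r) *P p} {(q *P p) ++ (r *P p)} λ {φ} pr → trans (lin-* φ (q ++ r) p) (trans (lin-++ _ q r)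
    (trans (cong₂ ℤ._+_ (sym (lin-* φ q p)) (sym (lin-* φ r p))) (sym (lin-++ φ (q *P p) (r *P p)))))

  *P-identityˡ : ∀ p → oneP *P p ≈P p
  *P-identityˡ p = lin⇒≈ {oneP *P p} {p} λ {φ} pr → trans (lin-* φ oneP p) (trans (ℤₚ.+-identityʳ _) (ℤₚ.*-identityˡ _))

  PolyRing : CommutativeRing _ _
  PolyRing = record
    { Carrier = Poly ; _≈_ = _≈P_ ; _+_ = _++_ ; _*_ = _*P_ ; -_ = negP ; 0# = [] ; 1# = oneP
    ; isCommutativeRing = record
      { isRing = record
        { +-isAbelianGroup = record
          { isGroup = record
            { isMonoid = record
              { isSemigroup = record
                { isMagma = record
                  { isEquivalence = record { refl = λ _ → refl ; sym = λ {p} {q} → ≈P-sym {p} {q} ; trans = λ {p} {q} {r} → ≈P-trans {p} {q} {r} }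
                  ; ∙-cong = λ {p} {p'} {q} {q'} → +P-cong {p} {p'} {q} {q'} }
                ; assoc = λ p q r → lin⇒≈ {(p ++ q) ++ r} {p ++ (q ++ r)} λ {φ} _ → trans (lin-++ φ (p ++ q) r) (trans (cong (ℤ._+ lin φ r) (lin-++ φ p q))
                     (trans (ℤₚ.+-assoc (lin φ p) _ _) (sym (trans (lin-++ φ p (q ++ r)) (cong (λ z → lin φ p ℤ.+ z) (lin-++ φ q r)))))) }
              ; identity = (λ p k → refl) , (λ p → lin⇒≈ {p ++ []} {p} λ {φ} _ → trans (lin-++ φ p []) (ℤₚ.+-identityʳ _)) }
            ; inverse = (λ p → lin⇒≈ {negP p ++ p} {[]} λ {φ} _ → trans (lin-++ φ (negP p) p) (trans (cong (ℤ._+ lin φ p) (trans (lin-scale φ (ℤ.- 1ℤ) p) (ℤₚ.-1*i≡-i _))) (ℤₚ.+-inverseˡ (lin φ p))))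
                      , (λ p → lin⇒≈ {p ++ negP p} {[]} λ {φ} _ → trans (lin-++ φ p (negP p)) (trans (cong (λ z → lin φ p ℤ.+ z) (trans (lin-scale φ (ℤ.- 1ℤ) p) (ℤₚ.-1*i≡-i _))) (ℤₚ.+-inverseʳ (lin φ p))))
            ; ⁻¹-cong = λ {p} {q} → scaleP-cong (ℤ.- 1ℤ) {p} {q} }
          ; comm = λ p q → lin⇒≈ {p ++ q} {q ++ p} λ {φ} _ → trans (lin-++ φ p q) (trans (ℤₚ.+-comm (lin φ p) _) (sym (lin-++ φ q p))) }
        ; *-cong = λ {p} {p'} {q} {q'} → *P-cong {p} {p'} {q} {q'}
        ; *-assoc = *P-assoc
        ; *-identity = *P-identityˡ , (λ p → ≈P-trans {p *P oneP} {oneP *P p} {p} (*P-comm p oneP) (*P-identityˡ p))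
        ; distrib = (λ p q r → ≈P-trans {p *P (q ++ r)} {(q ++ r) *P p} {(p *P q) ++ (p *P r)} (*P-comm p (q ++ r))
                      (≈P-trans {(q ++ r) *P p} {(q *P p) ++ (r *P p)} {(p *P q) ++ (p *P r)} (*P-distribʳ p q r)
                        (+P-cong {q *P p} {p *P q} {r *P p} {p *P r} (*P-comm q p) (*P-comm r p)))) , *P-distribʳ }
      ; *-comm = *P-comm } }

-- Adjacent swaps and divided differences of polynomials.

module DividedDifferences where
  open Polynomials
  open import Data.Integer.Tactic.RingSolver using (solve-∀)
  import Data.List.Properties as Listₚ
  open import Data.Bool using (true; false; if_then_else_)
  open ≡

  -- A recursive form of `swapIdx`, for which the commutation and braid laws reduce to small
  -- indices.
  sw : ℕ → ℕ → ℕ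
  sw zero zero = 1
  sw zero (suc zero) = 0
  sw zero (suc (suc k)) = suc (suc k)
  sw (suc i) zero = zero
  sw (suc i) (suc k) = suc (sw i k)

  swapIdx≡sw : ∀ i k → swapIdx i k ≡ sw i k
  swapIdx≡sw zero zero = refl
  swapIdx≡sw zero (suc zero) = refl
  swapIdx≡sw zero (suc (suc k)) = refl
  swapIdx≡sw (suc i) zero = refl
  swapIdx≡sw (suc i) (suc k) = trans (h (k ≡ᵇ i) (k ≡ᵇ suc i)) (cong suc (swapIdx≡sw i k))
    where
    h : ∀ b b' → (if b then suc (suc i) else (if b' then suc i else suc k)) ≡ suc (if b then suc i else (if b' then i else k))
    h true b' = refl
    h false true = refl
    h false false = refl

  sw-invol : ∀ i k → sw i (sw i k) ≡ k
  sw-invol zero zero = refl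
  sw-invol zero (suc zero) = refl
  sw-invol zero (suc (suc k)) = refl
  sw-invol (suc i) zero = refl
  sw-invol (suc i) (suc k) = cong suc (sw-invol i k)

  sw-at : ∀ i → sw i i ≡ suc i
  sw-at zero = refl
  sw-at (suc i) = cong suc (sw-at i)

  sw-at' : ∀ i → sw i (suc i) ≡ i
  sw-at' zero = refl
  sw-at' (suc i) = cong suc (sw-at' i)

  sw-fix : ∀ i k → k ≢ i → k ≢ suc i → sw i k ≡ k
  sw-fix zero zero p q = ⊥-elim (p refl)
  sw-fix zero (suc zero) p q = ⊥-elim (q refl)
  sw-fix zero (suc (suc k)) p q = refl
  sw-fix (suc i) zero p q = refl
  sw-fix (suc i) (suc k) p q = cong suc (sw-fix i k (p ∘ cong suc) (q ∘ cong suc))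

  sw-far : ∀ i j k → suc i < j → sw i (sw j k) ≡ sw j (sw i k)
  sw-far zero (suc zero) k (s≤s ())
  sw-far zero (suc (suc j)) zero l = refl
  sw-far zero (suc (suc j)) (suc zero) l = refl
  sw-far zero (suc (suc j)) (suc (suc k)) l = refl
  sw-far (suc i) (suc j) zero l = refl
  sw-far (suc i) (suc j) (suc k) (s≤s l) = cong suc (sw-far i j k l)

  sw-braid : ∀ i k → sw i (sw (suc i) (sw i k)) ≡ sw (suc i) (sw i (sw (suc i) k))
  sw-braid zero zero = refl
  sw-braid zero (suc zero) = refl
  sw-braid zero (suc (suc zero)) = refl
  sw-braid zero (suc (suc (suc k))) = refl
  sw-braid (suc i) zero = refl
  sw-braid (suc i) (suc k) = cong suc (sw-braid i k)

  expo-applyUpTo : ∀ (f : ℕ → ℕ) n j → j < n → expo (applyUpTo f n) j ≡ f j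
  expo-applyUpTo f (suc n) zero l = refl
  expo-applyUpTo f (suc n) (suc j) (s≤s l) = expo-applyUpTo (f ∘ suc) n j l

  expo-applyUpTo-beyond : ∀ (f : ℕ → ℕ) n j → n ≤ j → expo (applyUpTo f n) j ≡ 0
  expo-applyUpTo-beyond f zero j l = refl
  expo-applyUpTo-beyond f (suc n) (suc j) (s≤s l) = expo-applyUpTo-beyond (f ∘ suc) n j l

  expo-beyond : ∀ m j → length m ≤ j → expo m j ≡ 0
  expo-beyond [] j l = refl
  expo-beyond (a ∷ m) (suc j) (s≤s l) = expo-beyond m j l

  expo-swap : ∀ i m j → expo (swapMono i m) j ≡ expo m (sw i j)
  expo-swap i m j = trans (cong (λ l → expo l j) (Listₚ.map-upTo (λ j → expo m (swapIdx i j)) N)) h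
    where
    N = length m ⊔ suc (suc i)
    h : expo (applyUpTo (λ j → expo m (swapIdx i j)) N) j ≡ expo m (sw i j)
    h with j ℕ.<? N
    ... | yes l = trans (expo-applyUpTo _ N j l) (cong (expo m) (swapIdx≡sw i j))
    ... | no l = trans (expo-applyUpTo-beyond _ N j N≤j) (sym (trans (cong (expo m) (sw-fix i j
          (λ { refl → ℕₚ.<-irrefl refl (ℕₚ.≤-trans (ℕₚ.n≤1+n _) (ℕₚ.≤-trans (ℕₚ.m≤n⊔m (length m) (suc (suc i))) N≤j)) })
          (λ { refl → ℕₚ.<-irrefl refl (ℕₚ.≤-trans (ℕₚ.m≤n⊔m (length m) (suc (suc i))) N≤j) })))
          (expo-beyond m j (ℕₚ.≤-trans (ℕₚ.m≤m⊔n (length m) _) N≤j))))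
      where N≤j = ℕₚ.≮⇒≥ l

  expo-swap² : ∀ i j m k → expo (swapMono i (swapMono j m)) k ≡ expo m (sw j (sw i k))
  expo-swap² i j m k = trans (expo-swap i (swapMono j m) k) (expo-swap j m (sw i k))

  expo-swap³ : ∀ i j l m k → expo (swapMono i (swapMono j (swapMono l m))) k ≡ expo m (sw l (sw j (sw i k)))
  expo-swap³ i j l m k = trans (expo-swap i (swapMono j (swapMono l m)) k) (expo-swap² j l m (sw i k))

  lin-swapP : ∀ φ i p → lin φ (swapP i p) ≡ lin (φ ∘ swapMono i) p
  lin-swapP φ i [] = refl
  lin-swapP φ i ((c , m) ∷ p) = cong (λ z → c ℤ.* φ (swapMono i m) ℤ.+ z) (lin-swapP φ i p)

  swap-proper : ∀ {φ} → Proper φ → ∀ i → Proper (φ ∘ swapMono i)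
  swap-proper pr i {m} {m'} e = pr {swapMono i m} {swapMono i m'} (λ j → trans (expo-swap i m j) (trans (e _) (sym (expo-swap i m' j))))

  swapP-cong : ∀ i {p q} → p ≈P q → swapP i p ≈P swapP i q
  swapP-cong i {p} {q} e = lin⇒≈ {swapP i p} {swapP i q} λ {φ} pr → trans (lin-swapP φ i p)
    (trans (lin-resp {p} {q} e (λ {a} {b} → swap-proper {φ} pr i {a} {b})) (sym (lin-swapP φ i q)))

  swapP-+ : ∀ i p q → swapP i (p ++ q) ≈P swapP i p ++ swapP i q
  swapP-+ i p q = lin⇒≈ {swapP i (p ++ q)} {swapP i p ++ swapP i q} λ {φ} pr → trans (lin-swapP φ i (p ++ q)) (trans (lin-++ _ p q)
    (trans (cong₂ ℤ._+_ (sym (lin-swapP φ i p)) (sym (lin-swapP φ i q))) (sym (lin-++ φ (swapP i p) (swapP i q)))))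

  swapP-* : ∀ i p q → swapP i (p *P q) ≈P swapP i p *P swapP i q
  swapP-* i p q = lin⇒≈ {swapP i (p *P q)} {swapP i p *P swapP i q} λ {φ} pr → trans (lin-swapP φ i (p *P q)) (trans (lin-* _ p q)
    (trans (lin-cong (λ m → trans (lin-cong (λ m' → pr {swapMono i (monoMul m m')} {monoMul (swapMono i m) (swapMono i m')} (h m m')) q)
        (sym (lin-swapP (λ m' → φ (monoMul (swapMono i m) m')) i q))) p)
     (trans (sym (lin-swapP _ i p)) (sym (lin-* φ (swapP i p) (swapP i q))))))
    where
    h : ∀ m m' → swapMono i (monoMul m m') ≐ monoMul (swapMono i m) (swapMono i m')
    h m m' j = trans (expo-swap i (monoMul m m') j) (trans (expo-mul m m' _) (sym (trans (expo-mul (swapMono i m) (swapMono i m') j)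
       (cong₂ ℕ._+_ (expo-swap i m j) (expo-swap i m' j)))))

  swapP-1 : ∀ i → swapP i oneP ≈P oneP
  swapP-1 i = lin⇒≈ {swapP i oneP} {oneP} λ {φ} pr → cong (λ z → 1ℤ ℤ.* z ℤ.+ 0ℤ) (pr {swapMono i []} {[]} (expo-swap i []))

  swapP-invol : ∀ i p → swapP i (swapP i p) ≈P p
  swapP-invol i p = lin⇒≈ {swapP i (swapP i p)} {p} λ {φ} pr → trans (lin-swapP φ i (swapP i p)) (trans (lin-swapP _ i p)
    (lin-cong (λ m → pr {swapMono i (swapMono i m)} {m} (λ k → trans (expo-swap² i i m k) (cong (expo m) (sw-invol i k)))) p))

  swapP-far : ∀ i j → suc i < j → ∀ p → swapP i (swapP j p) ≈P swapP j (swapP i p)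
  swapP-far i j l p = lin⇒≈ {swapP i (swapP j p)} {swapP j (swapP i p)} λ {φ} pr → trans (trans (lin-swapP φ i (swapP j p)) (lin-swapP _ j p))
    (trans (lin-cong (λ m → pr {swapMono i (swapMono j m)} {swapMono j (swapMono i m)} (λ k →
       trans (expo-swap² i j m k) (trans (cong (expo m) (sym (sw-far i j k l))) (sym (expo-swap² j i m k))))) p)
     (sym (trans (lin-swapP φ j (swapP i p)) (lin-swapP _ i p))))

  swapP-braid : ∀ i p → swapP i (swapP (suc i) (swapP i p)) ≈P swapP (suc i) (swapP i (swapP (suc i) p))
  swapP-braid i p = lin⇒≈ {swapP i (swapP (suc i) (swapP i p))} {swapP (suc i) (swapP i (swapP (suc i) p))} λ {φ} pr →
    trans (trans (lin-swapP φ i (swapP (suc i) (swapP i p))) (trans (lin-swapP _ (suc i) (swapP i p)) (lin-swapP _ i p)))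
    (trans (lin-cong (λ m → pr {swapMono i (swapMono (suc i) (swapMono i m))} {swapMono (suc i) (swapMono i (swapMono (suc i) m))} (λ k →
        trans (expo-swap³ i (suc i) i m k) (trans (cong (expo m) (sw-braid i k)) (sym (expo-swap³ (suc i) i (suc i) m k))))) p)
     (sym (trans (lin-swapP φ (suc i) (swapP i (swapP (suc i) p))) (trans (lin-swapP _ i (swapP (suc i) p)) (lin-swapP _ (suc i) p)))))

  vm : ℕ → Mono
  vm i = replicate i 0 ++ (1 ∷ [])

  eqℕ : ℕ → ℕ → ℕ
  eqℕ zero zero = 1
  eqℕ zero (suc j) = 0
  eqℕ (suc i) zero = 0
  eqℕ (suc i) (suc j) = eqℕ i j

  expo-vm : ∀ i j → expo (vm i) j ≡ eqℕ i j
  expo-vm zero zero = refl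
  expo-vm zero (suc j) = refl
  expo-vm (suc i) zero = refl
  expo-vm (suc i) (suc j) = expo-vm i j

  eqℕ-refl : ∀ i → eqℕ i i ≡ 1
  eqℕ-refl zero = refl
  eqℕ-refl (suc i) = eqℕ-refl i

  eqℕ-sw : ∀ i k j → eqℕ k (sw i j) ≡ eqℕ (sw i k) j
  eqℕ-sw zero zero zero = refl
  eqℕ-sw zero zero (suc zero) = refl
  eqℕ-sw zero zero (suc (suc j)) = refl
  eqℕ-sw zero (suc zero) zero = refl
  eqℕ-sw zero (suc zero) (suc zero) = refl
  eqℕ-sw zero (suc zero) (suc (suc j)) = refl
  eqℕ-sw zero (suc (suc k)) zero = refl
  eqℕ-sw zero (suc (suc k)) (suc zero) = refl
  eqℕ-sw zero (suc (suc k)) (suc (suc j)) = refl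
  eqℕ-sw (suc i) zero zero = refl
  eqℕ-sw (suc i) zero (suc j) = refl
  eqℕ-sw (suc i) (suc k) zero = refl
  eqℕ-sw (suc i) (suc k) (suc j) = eqℕ-sw i k j

  swapP-var : ∀ i k → swapP i (var k) ≈P var (sw i k)
  swapP-var i k = lin⇒≈ {swapP i (var k)} {var (sw i k)} λ {φ} pr → cong (λ z → 1ℤ ℤ.* z ℤ.+ 0ℤ)
    (pr {swapMono i (vm k)} {vm (sw i k)} (λ j → trans (expo-swap i (vm k) j) (trans (expo-vm k (sw i j)) (trans (eqℕ-sw i k j) (sym (expo-vm (sw i k) j))))))

  decr : ℕ → Mono → Mono
  decr j [] = []
  decr zero (a ∷ m) = ℕ.pred a ∷ m
  decr (suc j) (a ∷ m) = a ∷ decr j m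

  expo-decr : ∀ j m b → expo m j ≡ suc b → monoMul (vm j) (decr j m) ≐ m
  expo-decr zero (a ∷ m) b refl zero = refl
  expo-decr zero (a ∷ m) b refl (suc k) = refl
  expo-decr (suc j) (a ∷ m) b e zero = refl
  expo-decr (suc j) (a ∷ m) b e (suc k) = expo-decr j m b e k

  lin-var* : ∀ φ i g → lin φ (var i *P g) ≡ lin (λ m → φ (monoMul (vm i) m)) g
  lin-var* φ i g = trans (lin-* φ (var i) g) (trans (ℤₚ.+-identityʳ _) (ℤₚ.*-identityˡ _))

  lin-vv* : ∀ φ i j g → lin φ ((var i -P var j) *P g) ≡ lin (λ m → φ (monoMul (vm i) m)) g ℤ.- lin (λ m → φ (monoMul (vm j) m)) g
  lin-vv* φ i j g = trans (lin-* φ (var i -P var j) g) (l (lin (λ m → φ (monoMul (vm i) m)) g) (lin (λ m → φ (monoMul (vm j) m)) g))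
    where
    l : ∀ a b → 1ℤ ℤ.* a ℤ.+ ((ℤ.- 1ℤ) ℤ.* b ℤ.+ 0ℤ) ≡ a ℤ.- b
    l = solve-∀

  δ-mul-cancel : ∀ v k m → δ (monoMul v k) (monoMul v m) ≡ δ k m
  δ-mul-cancel v k m = cong (if_then 1ℤ else 0ℤ) (bool-ext
    (λ t → monoEq-complete m k (λ i → ℕₚ.+-cancelˡ-≡ (expo v i) _ _ (trans (sym (expo-mul v m i)) (trans (monoEq-sound (monoMul v m) (monoMul v k) t i) (expo-mul v k i)))))
    (λ t → monoEq-complete (monoMul v m) (monoMul v k) (monoMul-cong {v} {v} {m} {k} (λ _ → refl) (monoEq-sound m k t))))

  δ-absent : ∀ j k → expo k j ≡ 0 → ∀ m → δ k (monoMul (vm j) m) ≡ 0ℤ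
  δ-absent j k e m with monoEq (monoMul (vm j) m) k in eq
  ... | false = refl
  ... | true with trans (sym (trans (monoEq-sound (monoMul (vm j) m) k eq j) e)) (trans (expo-mul (vm j) m j) (cong (ℕ._+ expo m j) (trans (expo-vm j j) (eqℕ-refl j))))
  ...   | ()

  δ-cong : ∀ {k k'} → k ≐ k' → ∀ m → δ k m ≡ δ k' m
  δ-cong {k} {k'} e m = cong (if_then 1ℤ else 0ℤ) (monoEq-cong {m} {m} {k} {k'} (λ _ → refl) e)

  eqℕ-suc : ∀ i → eqℕ i (suc i) ≡ 0
  eqℕ-suc zero = refl
  eqℕ-suc (suc i) = eqℕ-suc i

  -- The coefficient of `g` at `k` equals the one at `k` times x_i over x_(i+1). Each such move
  -- lowers the exponent of x_(i+1); once it is zero, the product with x_(i+1) has no matching term.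
  cancelP : ∀ i g → (var i -P var (suc i)) *P g ≈P [] → g ≈P []
  cancelP i g e k = trans (coeff-lin g k) (go (expo k (suc i)) k refl)
    where
    both : ∀ k → lin (λ m → δ k (monoMul (vm i) m)) g ≡ lin (λ m → δ k (monoMul (vm (suc i)) m)) g
    both k = ℤₚ.i-j≡0⇒i≡j _ _ (trans (sym (lin-vv* (δ k) i (suc i) g)) (trans (sym (coeff-lin ((var i -P var (suc i)) *P g) k)) (e k)))
    same : ∀ k → expo (monoMul (vm i) k) (suc i) ≡ expo k (suc i)
    same k = trans (expo-mul (vm i) k (suc i)) (cong (ℕ._+ expo k (suc i)) (trans (expo-vm i (suc i)) (eqℕ-suc i)))
    start : ∀ k → lin (δ k) g ≡ lin (λ m → δ (monoMul (vm i) k) (monoMul (vm (suc i)) m)) g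
    start k = trans (sym (lin-cong (λ m → δ-mul-cancel (vm i) k m) g)) (both (monoMul (vm i) k))
    go : ∀ b k → expo k (suc i) ≡ b → lin (δ k) g ≡ 0ℤ
    go zero k eb = trans (start k) (trans (lin-cong (δ-absent (suc i) (monoMul (vm i) k) (trans (same k) eb)) g) (lin-0 g))
    go (suc b) k eb = trans (start k) (trans (lin-cong (λ m → trans (δ-cong {monoMul (vm i) k} {monoMul (vm (suc i)) k'} (λ j → sym (kk j)) (monoMul (vm (suc i)) m))
          (δ-mul-cancel (vm (suc i)) k' m)) g) (go b k' eb'))
      where
      k' = decr (suc i) (monoMul (vm i) k)
      kk : monoMul (vm (suc i)) k' ≐ monoMul (vm i) k
      kk = expo-decr (suc i) (monoMul (vm i) k) b (trans (same k) eb)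
      eb' : expo k' (suc i) ≡ b
      eb' = ℕₚ.suc-injective (trans (sym (trans (expo-mul (vm (suc i)) k' (suc i)) (cong (ℕ._+ expo k' (suc i)) (trans (expo-vm i i) (eqℕ-refl i))))) (trans (kk (suc i)) (trans (same k) eb)))

  -- The quotient of x^(a+1) y^k - y^(a+k+1) by x - y, that is, the sum of x^i y^(a+k-i) for i from
  -- `a` down to 0.
  pos : ℕ → ℕ → List (ℤ × ℕ × ℕ)
  pos zero k = (1ℤ , 0 , k) ∷ []
  pos (suc a) k = (1ℤ , suc a , k) ∷ pos a (suc k)

  -- The quotient of x^a y^b - x^b y^a by x - y; common factors x y are split off until one exponent
  -- is zero.
  D : ℕ → ℕ → List (ℤ × ℕ × ℕ)
  D zero zero = []
  D (suc a) zero = pos a 0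
  D zero (suc b) = map (λ (c , k , l) → (ℤ.- c , k , l)) (pos b 0)
  D (suc a) (suc b) = map (λ (c , k , l) → (c , suc k , suc l)) (D a b)

  ∂M : ℕ → Mono → Poly
  ∂M zero m = map (λ (c , a , b) → (c , a ∷ b ∷ drop 2 m)) (D (expo m 0) (expo m 1))
  ∂M (suc i) m = map (λ (c , m') → (c , expo m 0 ∷ m')) (∂M i (drop 1 m))

  ∂P : ℕ → Poly → Poly
  ∂P i p = concatMap (λ (c , m) → scaleP c (∂M i m)) p

  lin-∂P : ∀ φ i p → lin φ (∂P i p) ≡ lin (λ m → lin φ (∂M i m)) p
  lin-∂P φ i [] = refl
  lin-∂P φ i ((c , m) ∷ p) = trans (lin-++ φ (scaleP c (∂M i m)) (∂P i p)) (cong₂ ℤ._+_ (lin-scale φ c (∂M i m)) (lin-∂P φ i p))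

  -- The value of `ψ` on x - y times the encoded quotient, which telescopes in `T₂-pos`.
  T₂ : (ℕ → ℕ → ℤ) → List (ℤ × ℕ × ℕ) → ℤ
  T₂ ψ [] = 0ℤ
  T₂ ψ ((c , a , b) ∷ l) = c ℤ.* (ψ (suc a) b ℤ.- ψ a (suc b)) ℤ.+ T₂ ψ l

  T₂-pos : ∀ ψ a k → T₂ ψ (pos a k) ≡ ψ (suc a) k ℤ.- ψ 0 (suc (a ℕ.+ k))
  T₂-pos ψ zero k = trans (ℤₚ.+-identityʳ _) (ℤₚ.*-identityˡ _)
  T₂-pos ψ (suc a) k = trans (cong (λ z → 1ℤ ℤ.* (ψ (suc (suc a)) k ℤ.- ψ (suc a) (suc k)) ℤ.+ z) (trans (T₂-pos ψ a (suc k)) (cong (λ z → ψ (suc a) (suc k) ℤ.- ψ 0 (suc z)) (ℕₚ.+-suc a k))))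
    (l (ψ (suc (suc a)) k) (ψ (suc a) (suc k)) _)
    where
    l : ∀ x y z → 1ℤ ℤ.* (x ℤ.- y) ℤ.+ (y ℤ.- z) ≡ x ℤ.- z
    l = solve-∀

  T₂-neg : ∀ ψ l → T₂ ψ (map (λ (c , k , l) → (ℤ.- c , k , l)) l) ≡ ℤ.- T₂ ψ l
  T₂-neg ψ [] = refl
  T₂-neg ψ ((c , a , b) ∷ l) = trans (cong (λ z → (ℤ.- c) ℤ.* (ψ (suc a) b ℤ.- ψ a (suc b)) ℤ.+ z) (T₂-neg ψ l)) (s c (ψ (suc a) b ℤ.- ψ a (suc b)) (T₂ ψ l))
    where
    s : ∀ c x y → (ℤ.- c) ℤ.* x ℤ.+ (ℤ.- y) ≡ ℤ.- (c ℤ.* x ℤ.+ y)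
    s = solve-∀

  T₂-shift : ∀ ψ l → T₂ ψ (map (λ (c , k , l) → (c , suc k , suc l)) l) ≡ T₂ (λ a b → ψ (suc a) (suc b)) l
  T₂-shift ψ [] = refl
  T₂-shift ψ ((c , a , b) ∷ l) = cong (λ z → c ℤ.* (ψ (suc (suc a)) (suc b) ℤ.- ψ (suc a) (suc (suc b))) ℤ.+ z) (T₂-shift ψ l)

  T₂-D : ∀ ψ a b → T₂ ψ (D a b) ≡ ψ a b ℤ.- ψ b a
  T₂-D ψ zero zero = sym (ℤₚ.i≡j⇒i-j≡0 {ψ 0 0} refl)
  T₂-D ψ (suc a) zero = trans (T₂-pos ψ a 0) (cong (λ z → ψ (suc a) 0 ℤ.- ψ 0 (suc z)) (ℕₚ.+-identityʳ a))
  T₂-D ψ zero (suc b) = trans (T₂-neg ψ (pos b 0)) (trans (cong ℤ.-_ (trans (T₂-pos ψ b 0) (cong (λ z → ψ (suc b) 0 ℤ.- ψ 0 (suc z)) (ℕₚ.+-identityʳ b)))) (s (ψ (suc b) 0) (ψ 0 (suc b))))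
    where
    s : ∀ x y → ℤ.- (x ℤ.- y) ≡ y ℤ.- x
    s = solve-∀
  T₂-D ψ (suc a) (suc b) = trans (T₂-shift ψ (D a b)) (T₂-D _ a b)

  ∂M-spec : ∀ {φ} → Proper φ → ∀ i m → lin φ ((var i -P var (suc i)) *P ∂M i m) ≡ φ m ℤ.- φ (swapMono i m)
  ∂M-spec {φ} pr i m = trans (lin-vv* φ i (suc i) (∂M i m)) (go {φ} pr i m)
    where
    go : ∀ {φ} → Proper φ → ∀ i m → lin (λ k → φ (monoMul (vm i) k)) (∂M i m) ℤ.- lin (λ k → φ (monoMul (vm (suc i)) k)) (∂M i m) ≡ φ m ℤ.- φ (swapMono i m)
    go {φ} pr zero m = trans (t (D (expo m 0) (expo m 1))) (trans (T₂-D _ (expo m 0) (expo m 1))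
       (cong₂ ℤ._-_ (pr {expo m 0 ∷ expo m 1 ∷ drop 2 m} {m} (e1 m)) (pr {expo m 1 ∷ expo m 0 ∷ drop 2 m} {swapMono 0 m} (λ j → trans (e2 m j) (sym (expo-swap 0 m j))))))
      where
      e1 : ∀ m → (expo m 0 ∷ expo m 1 ∷ drop 2 m) ≐ m
      e1 [] zero = refl
      e1 [] (suc zero) = refl
      e1 [] (suc (suc j)) = refl
      e1 (a ∷ []) zero = refl
      e1 (a ∷ []) (suc zero) = refl
      e1 (a ∷ []) (suc (suc j)) = refl
      e1 (a ∷ b ∷ m) zero = refl
      e1 (a ∷ b ∷ m) (suc zero) = refl
      e1 (a ∷ b ∷ m) (suc (suc j)) = refl
      e2 : ∀ m j → expo (expo m 1 ∷ expo m 0 ∷ drop 2 m) j ≡ expo m (sw 0 j)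
      e2 m zero = refl
      e2 m (suc zero) = refl
      e2 [] (suc (suc j)) = refl
      e2 (a ∷ []) (suc (suc j)) = refl
      e2 (a ∷ b ∷ m) (suc (suc j)) = refl
      ψ : ℕ → ℕ → ℤ
      ψ a b = φ (a ∷ b ∷ drop 2 m)
      t : ∀ l → lin (λ k → φ (monoMul (vm 0) k)) (map (λ (c , a , b) → (c , a ∷ b ∷ drop 2 m)) l) ℤ.- lin (λ k → φ (monoMul (vm 1) k)) (map (λ (c , a , b) → (c , a ∷ b ∷ drop 2 m)) l) ≡ T₂ ψ l
      t [] = refl
      t ((c , a , b) ∷ l) = trans (s c (ψ (suc a) b) (ψ a (suc b)) _ _) (cong (λ z → c ℤ.* (ψ (suc a) b ℤ.- ψ a (suc b)) ℤ.+ z) (t l))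
        where
        s : ∀ c x y p q → (c ℤ.* x ℤ.+ p) ℤ.- (c ℤ.* y ℤ.+ q) ≡ c ℤ.* (x ℤ.- y) ℤ.+ (p ℤ.- q)
        s = solve-∀
    go {φ} pr (suc i) m = trans (cong₂ ℤ._-_ (sh (vm i) (∂M i (drop 1 m))) (sh (vm (suc i)) (∂M i (drop 1 m))))
      (trans (go {λ k → φ (expo m 0 ∷ k)} (λ {a} {b} e → pr {expo m 0 ∷ a} {expo m 0 ∷ b} (λ { zero → refl ; (suc j) → e j })) i (drop 1 m))
       (cong₂ ℤ._-_ (pr {expo m 0 ∷ drop 1 m} {m} (e1 m)) (pr {expo m 0 ∷ swapMono i (drop 1 m)} {swapMono (suc i) m} (λ j → trans (e2 j) (sym (expo-swap (suc i) m j))))))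
      where
      e0 : ∀ m j → expo (drop 1 m) j ≡ expo m (suc j)
      e0 [] j = refl
      e0 (a ∷ m) j = refl
      e1 : ∀ m → (expo m 0 ∷ drop 1 m) ≐ m
      e1 m zero = refl
      e1 m (suc j) = e0 m j
      e2 : ∀ j → expo (expo m 0 ∷ swapMono i (drop 1 m)) j ≡ expo m (sw (suc i) j)
      e2 zero = refl
      e2 (suc j) = trans (expo-swap i (drop 1 m) j) (e0 m _)
      sh : ∀ v q → lin (λ k → φ (monoMul (0 ∷ v) k)) (map (λ (c , m') → (c , expo m 0 ∷ m')) q) ≡ lin (λ k → φ (expo m 0 ∷ monoMul v k)) q
      sh v [] = refl
      sh v ((c , k) ∷ q) = cong (λ z → c ℤ.* φ (expo m 0 ∷ monoMul v k) ℤ.+ z) (sh v q)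

  lin-sub : ∀ φ ψ a b → (∀ m → a m ℤ.- b m ≡ φ m ℤ.- ψ m) → ∀ f → lin a f ℤ.- lin b f ≡ lin φ f ℤ.- lin ψ f
  lin-sub φ ψ a b e [] = refl
  lin-sub φ ψ a b e ((c , m) ∷ f) = trans (s c (a m) (b m) (lin a f) (lin b f)) (trans (cong₂ (λ x y → c ℤ.* x ℤ.+ y) (e m) (lin-sub φ ψ a b e f)) (sym (s c (φ m) (ψ m) (lin φ f) (lin ψ f))))
    where
    s : ∀ c x y p q → (c ℤ.* x ℤ.+ p) ℤ.- (c ℤ.* y ℤ.+ q) ≡ c ℤ.* (x ℤ.- y) ℤ.+ (p ℤ.- q)
    s = solve-∀

  lin-minus : ∀ φ p q → lin φ (p -P q) ≡ lin φ p ℤ.- lin φ q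
  lin-minus φ p q = trans (lin-++ φ p _) (cong (λ z → lin φ p ℤ.+ z) (trans (lin-scale φ (ℤ.- 1ℤ) q) (ℤₚ.-1*i≡-i _)))

  ∂P-spec : ∀ i f → IsDivDiff i f (∂P i f)
  ∂P-spec i f = lin⇒≈ {(var i -P var (suc i)) *P ∂P i f} {f -P swapP i f} λ {φ} pr →
    let a = λ m → lin (λ k → φ (monoMul (vm i) k)) (∂M i m)
        b = λ m → lin (λ k → φ (monoMul (vm (suc i)) k)) (∂M i m) in
    trans (lin-vv* φ i (suc i) (∂P i f)) (trans (cong₂ ℤ._-_ (lin-∂P (λ k → φ (monoMul (vm i) k)) i f) (lin-∂P (λ k → φ (monoMul (vm (suc i)) k)) i f))
    (trans (lin-sub φ (φ ∘ swapMono i) a b (λ m → trans (sym (lin-vv* φ i (suc i) (∂M i m))) (∂M-spec {φ} pr i m)) f)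
     (sym (trans (lin-minus φ f (swapP i f)) (cong (λ z → lin φ f ℤ.- z) (lin-swapP φ i f))))))

-- A ring solver with integer coefficients.

module IntegerSolver where
  open import Data.Maybe using (Maybe; just; nothing)
  open import Algebra.Bundles using (CommutativeRing; RawRing)
  open import Level using (0ℓ)

  -- Ring solver with integer coefficients, an integer being a pair (a , b) that stands for a - b.
  module RingSolve (R : CommutativeRing 0ℓ 0ℓ) where
    open CommutativeRing R
    open import Algebra.Solver.Ring.AlmostCommutativeRing using (fromCommutativeRing; _-Raw-AlmostCommutative⟶_)
    open import Algebra.Properties.Semiring.Mult semiring using (×-homo-+; ×1-homo-*; ×-congˡ) renaming (_×_ to _·_)
    open import Algebra.Properties.Ring (CommutativeRing.ring R) using (-‿+-comm; x[y-z]≈xy-xz; [y-z]x≈yx-zx; -‿involutive; -0#≈0#)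
    open import Algebra.Properties.CommutativeSemigroup +-commutativeSemigroup using (interchange)
    open import Relation.Binary.Reasoning.Setoid setoid

    private
      C : RawRing 0ℓ 0ℓ
      C = record
        { Carrier = ℕ × ℕ ; _≈_ = _≡_
        ; _+_ = λ (a , b) (c , d) → (a ℕ.+ c , b ℕ.+ d)
        ; _*_ = λ (a , b) (c , d) → (a ℕ.* c ℕ.+ b ℕ.* d , a ℕ.* d ℕ.+ b ℕ.* c)
        ; -_ = λ (a , b) → (b , a) ; 0# = (0 , 0) ; 1# = (1 , 0) }

      n : ℕ → Carrier
      n a = a · 1#
      val : ℕ × ℕ → Carrier
      val (a , b) = n a - n b

      sub-+ : ∀ A B C D → (A + C) - (B + D) ≈ (A - B) + (C - D)
      sub-+ A B C D = trans (+-congˡ (sym (-‿+-comm B D))) (interchange A C (- B) (- D))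

      neg-sub : ∀ A B → - (A - B) ≈ B - A
      neg-sub A B = trans (sym (-‿+-comm A (- B))) (trans (+-congˡ (-‿involutive B)) (+-comm _ _))

      sub-* : ∀ A B C D → (A * C + B * D) - (A * D + B * C) ≈ (A - B) * (C - D)
      sub-* A B C D = begin
        (A * C + B * D) - (A * D + B * C) ≈⟨ sub-+ _ _ _ _ ⟩
        (A * C - A * D) + (B * D - B * C) ≈⟨ +-cong (x[y-z]≈xy-xz A C D) (neg-sub (B * C) (B * D)) ⟨
        A * (C - D) + - (B * C - B * D) ≈⟨ +-congˡ (-‿cong (x[y-z]≈xy-xz B C D)) ⟨
        A * (C - D) - B * (C - D) ≈⟨ [y-z]x≈yx-zx (C - D) A B ⟨
        (A - B) * (C - D) ∎

      hom : C -Raw-AlmostCommutative⟶ fromCommutativeRing R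
      hom = record
        { ⟦_⟧ = val
        ; +-homo = λ (a , b) (c , d) → trans (+-cong (×-homo-+ 1# a c) (-‿cong (×-homo-+ 1# b d))) (sub-+ _ _ _ _)
        ; *-homo = λ (a , b) (c , d) → trans (+-cong (m a c b d) (-‿cong (m a d b c))) (sub-* _ _ _ _)
        ; -‿homo = λ (a , b) → sym (neg-sub (n a) (n b))
        ; 0-homo = -‿inverseʳ 0#
        ; 1-homo = trans (+-cong (+-identityʳ 1#) -0#≈0#) (+-identityʳ 1#) }
        where
        m : ∀ a c b d → n (a ℕ.* c ℕ.+ b ℕ.* d) ≈ n a * n c + n b * n d
        m a c b d = trans (×-homo-+ 1# (a ℕ.* c) (b ℕ.* d)) (+-cong (×1-homo-* a c) (×1-homo-* b d))

      -- Two pairs have the same value in every commutative ring once a + d = c + b holds for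
      -- natural numbers, and this is decidable.
      dec : ∀ p q → Maybe (val p ≈ val q)
      dec (a , b) (c , d) with a ℕ.+ d ℕ.≟ c ℕ.+ b
      ... | no _ = nothing
      ... | yes e = just (begin
          n a - n b ≈⟨ +-identityʳ _ ⟨
          (n a - n b) + 0# ≈⟨ +-congˡ (-‿inverseʳ (n d)) ⟨
          (n a - n b) + (n d - n d) ≈⟨ sub-+ _ _ _ _ ⟨
          (n a + n d) - (n b + n d) ≈⟨ +-cong (trans (sym (×-homo-+ 1# a d)) (trans (×-congˡ e) (×-homo-+ 1# c b))) (-‿cong (+-comm _ _)) ⟩
          (n c + n b) - (n d + n b) ≈⟨ sub-+ _ _ _ _ ⟩
          (n c - n d) + (n b - n b) ≈⟨ +-congˡ (-‿inverseʳ (n b)) ⟩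
          (n c - n d) + 0# ≈⟨ +-identityʳ _ ⟩
          n c - n d ∎)

    open import Algebra.Solver.Ring C (fromCommutativeRing R) hom dec public using (solve; _:=_; _:+_; _:*_; _:-_; :-_; Polynomial)

-- Rings with divided differences; complete homogeneous polynomials.

module DifferenceRings where
  open DividedDifferences using (sw; sw-at; sw-at'; sw-fix)
  open IntegerSolver
  open import Algebra.Bundles using (CommutativeRing)
  open import Level using (0ℓ)

  module RingIds (R : CommutativeRing 0ℓ 0ℓ) where
    open CommutativeRing R
    open RingSolve R

    leib-id : ∀ f sf g sg → (f - sf) * g + sf * (g - sg) ≈ f * g - sf * sg
    leib-id = solve 4 (λ f sf g sg → ((f :- sf) :* g :+ sf :* (g :- sg)) := (f :* g :- sf :* sg)) refl
    leib-d : ∀ d f g h k → d * (f * g + h * k) ≈ (d * f) * g + h * (d * k)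
    leib-d = solve 5 (λ d f g h k → (d :* (f :* g :+ h :* k)) := ((d :* f) :* g :+ h :* (d :* k))) refl
    dist- : ∀ d f g → d * (f - g) ≈ d * f - d * g
    dist- = solve 3 (λ d f g → (d :* (f :- g)) := (d :* f :- d :* g)) refl
    dist+ : ∀ d f g → d * (f + g) ≈ d * f + d * g
    dist+ = solve 3 (λ d f g → (d :* (f :+ g)) := (d :* f :+ d :* g)) refl
    add-id : ∀ f sf g sg → (f - sf) + (g - sg) ≈ (f + g) - (sf + sg)
    add-id = solve 4 (λ f sf g sg → ((f :- sf) :+ (g :- sg)) := ((f :+ g) :- (sf :+ sg))) refl
    neg-id : ∀ f sf → - (f - sf) ≈ (- f) - (- sf)
    neg-id = solve 2 (λ f sf → (:- (f :- sf)) := ((:- f) :- (:- sf))) refl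
    neg-d : ∀ d f → d * (- f) ≈ - (d * f)
    neg-d = solve 2 (λ d f → (d :* (:- f)) := (:- (d :* f))) refl
    braid-id₁ : ∀ c b f g → (c * b) * (f - g) ≈ c * (b * f) - b * (c * g)
    braid-id₁ = solve 4 (λ c b f g → ((c :* b) :* (f :- g)) := (c :* (b :* f) :- b :* (c :* g))) refl
    braid-id₂ : ∀ p q r f g h → (p - r) * (f - g) - (q - r) * (f - h) ≈ ((p - q) * f - (p - r) * g) + (q - r) * h
    braid-id₂ = solve 6 (λ p q r f g h → ((p :- r) :* (f :- g) :- (q :- r) :* (f :- h)) := (((p :- q) :* f :- (p :- r) :* g) :+ (q :- r) :* h)) refl
    braid-id₃ : ∀ p q r f g h → (p - r) * (f - g) - (p - q) * (f - h) ≈ ((q - r) * f - (p - r) * g) + (p - q) * h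
    braid-id₃ = solve 6 (λ p q r f g h → ((p :- r) :* (f :- g) :- (p :- q) :* (f :- h)) := (((q :- r) :* f :- (p :- r) :* g) :+ (p :- q) :* h)) refl
    sum6 : ∀ f a b c d e → ((f - a) - (b - c)) + (d - e) ≈ ((f - b) - (a - d)) + (c - e)
    sum6 = solve 6 (λ f a b c d e → (((f :- a) :- (b :- c)) :+ (d :- e)) := (((f :- b) :- (a :- d)) :+ (c :- e))) refl
    triple : ∀ a b c f → (c * b) * (a * f) ≈ a * (b * (c * f))
    triple = solve 4 (λ a b c f → ((c :* b) :* (a :* f)) := (a :* (b :* (c :* f)))) refl
    triple' : ∀ a b c f → (c * a) * (b * f) ≈ a * (b * (c * f))
    triple' = solve 4 (λ a b c f → ((c :* a) :* (b :* f)) := (a :* (b :* (c :* f)))) refl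
    plus-minus : ∀ a b → (a + b) - b ≈ a
    plus-minus = solve 2 (λ a b → ((a :+ b) :- b) := (a)) refl
    h-id : ∀ p q H K → q * (H - p * K) + p * H ≈ p * (H - q * K) + q * H
    h-id = solve 4 (λ p q H K → (q :* (H :- p :* K) :+ p :* H) := (p :* (H :- q :* K) :+ q :* H)) refl
    assoc-swap : ∀ a b c → (a + b) + c ≈ (a + c) + b
    assoc-swap = solve 3 (λ a b c → ((a :+ b) :+ c) := ((a :+ c) :+ b)) refl
    row-id : ∀ h h' x f d → h * f + (h' - x * h) * d ≈ h * (f - x * d) + h' * d
    row-id = solve 5 (λ h h' x f d → (h :* f :+ (h' :- x :* h) :* d) := (h :* (f :- x :* d) :+ h' :* d)) refl
    A-id : ∀ x d f → - (x * d - f) ≈ f - x * d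
    A-id = solve 3 (λ x d f → (:- (x :* d :- f)) := (f :- x :* d)) refl
    comm3 : ∀ k h f → k * (h * f) ≈ h * (k * f)
    comm3 = solve 3 (λ k h f → (k :* (h :* f)) := (h :* (k :* f))) refl
    A-lin : ∀ k x f d → k * f - x * (k * d) ≈ k * (f - x * d)
    A-lin = solve 4 (λ k x f d → (k :* f :- x :* (k :* d)) := (k :* (f :- x :* d))) refl
    negneg-* : ∀ a b → a * b ≈ - ((- a) * b)
    negneg-* = solve 2 (λ a b → (a :* b) := (:- ((:- a) :* b))) refl
    neg-swap : ∀ f g → - (g - f) ≈ f - g
    neg-swap = solve 2 (λ f g → (:- (g :- f)) := (f :- g)) refl
    hedge-id : ∀ B p q K → (p - q) * K ≈ B - ((B + q * K) - p * K)
    hedge-id = solve 4 (λ B p q K → ((p :- q) :* K) := (B :- ((B :+ q :* K) :- p :* K))) refl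
    fix-id₁ : ∀ u y v w → (u * y + v) + u * w ≈ v + u * (w + y)
    fix-id₁ = solve 4 (λ u y v w → ((u :* y :+ v) :+ u :* w) := (v :+ u :* (w :+ y))) refl
    fix-id₂ : ∀ u y v w t → (u * y + v) + (u * w + t) ≈ v + (u * (w + y) + t)
    fix-id₂ = solve 5 (λ u y v w t → ((u :* y :+ v) :+ (u :* w :+ t)) := (v :+ (u :* (w :+ y) :+ t))) refl
    neg-mul : ∀ x f → (- x) * f ≈ - (x * f)
    neg-mul = solve 2 (λ x f → ((:- x) :* f) := (:- (x :* f))) refl

  -- The interface behind which polynomials are used; `PolyDR` is the instance. `V` is the staircase
  -- bound that Schubert polynomials obey, and `V-vanish` removes divided differences beyond the
  -- last variable.
  record DiffRing : Set₁ where
    field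
      R : CommutativeRing 0ℓ 0ℓ
    open CommutativeRing R hiding (zero) public
    field
      x : ℕ → Carrier
      s ∂ : ℕ → Carrier → Carrier
      s-cong : ∀ i {f g} → f ≈ g → s i f ≈ s i g
      s-+ : ∀ i f g → s i (f + g) ≈ s i f + s i g
      s-* : ∀ i f g → s i (f * g) ≈ s i f * s i g
      s-1 : ∀ i → s i 1# ≈ 1#
      s-x : ∀ i j → s i (x j) ≈ x (sw i j)
      s-invol : ∀ i f → s i (s i f) ≈ f
      s-far : ∀ i j → suc i < j → ∀ f → s i (s j f) ≈ s j (s i f)
      s-braid : ∀ i f → s i (s (suc i) (s i f)) ≈ s (suc i) (s i (s (suc i) f))
      cancel : ∀ i f → (x i - x (suc i)) * f ≈ 0# → f ≈ 0#
      ∂-spec : ∀ i f → (x i - x (suc i)) * ∂ i f ≈ f - s i f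
      -- constant term
      c₀ : Carrier → ℤ
      c₀-cong : ∀ {f g} → f ≈ g → c₀ f ≡ c₀ g
      c₀-+ : ∀ f g → c₀ (f + g) ≡ c₀ f ℤ.+ c₀ g
      c₀-neg : ∀ f → c₀ (- f) ≡ ℤ.- c₀ f
      c₀-x : ∀ j f → c₀ (x j * f) ≡ ℤ.0ℤ
      c₀-1 : c₀ 1# ≡ ℤ.1ℤ
      -- V p n f : the exponent of x_j in f is at most n - 1 - j, for all j ≥ p
      V : ℕ → ℕ → Carrier → Set
      V-cong : ∀ {p n f g} → f ≈ g → V p n f → V p n g
      V-+ : ∀ {p n f g} → V p n f → V p n g → V p n (f + g)
      V-neg : ∀ {p n f} → V p n f → V p n (- f)
      V-0 : ∀ {p n} → V p n 0#
      V-1 : ∀ {p n} → V p n 1#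
      V-∂ : ∀ {p n f} i → p ≤ i → V p n f → V p n (∂ i f)
      V-x∂ : ∀ {p n f} i → p ≤ i → V p n f → V p n (x i * ∂ i f)
      V-x : ∀ {p n f} j → j < p → V p n f → V p n (x j * f)
      V-vanish : ∀ {p n f} i → p ≤ i → n ≤ suc i → V p n f → ∂ i f ≈ 0#
      V-mono : ∀ {p p' n n' f} → p ≤ p' → n ≤ n' → V p n f → V p' n' f

  module Alg (DR : DiffRing) where
    open DiffRing DR
    open RingIds R
    open import Relation.Binary.Reasoning.Setoid setoid
    open import Algebra.Properties.Ring (CommutativeRing.ring R) using (-‿involutive; x+x≈x⇒x≈0)
    open import Algebra.Properties.AbelianGroup (CommutativeRing.+-abelianGroup R) using (⁻¹-anti-homo-∙)

    d : ℕ → Carrier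
    d i = x i - x (suc i)

    diff0 : ∀ {f g} → f - g ≈ 0# → f ≈ g
    diff0 {f} {g} e = begin
      f ≈⟨ +-identityʳ f ⟨ f + 0# ≈⟨ +-congˡ (-‿inverseˡ g) ⟨ f + (- g + g) ≈⟨ +-assoc _ _ _ ⟨ (f - g) + g ≈⟨ +-congʳ e ⟩ 0# + g ≈⟨ +-identityˡ g ⟩ g ∎

    cancel≈ : ∀ i {f g} → d i * f ≈ d i * g → f ≈ g
    cancel≈ i {f} {g} e = diff0 (cancel i (f - g) (trans (dist- (d i) f g) (trans (+-congʳ e) (-‿inverseʳ _))))

    -‿cong₂ : ∀ {a b c e} → a ≈ b → c ≈ e → a - c ≈ b - e
    -‿cong₂ p q = +-cong p (-‿cong q)

    s-0 : ∀ i → s i 0# ≈ 0#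
    s-0 i = x+x≈x⇒x≈0 _ (trans (sym (s-+ i 0# 0#)) (s-cong i (+-identityˡ 0#)))

    s-neg : ∀ i f → s i (- f) ≈ - s i f
    s-neg i f = diff0 (trans (+-congˡ (-‿cong refl)) (trans (+-congˡ (-‿involutive (s i f))) (trans (sym (s-+ i (- f) f)) (trans (s-cong i (-‿inverseˡ f)) (s-0 i)))))

    s-minus : ∀ i f g → s i (f - g) ≈ s i f - s i g
    s-minus i f g = trans (s-+ i f (- g)) (+-congˡ (s-neg i g))

    s-xx : ∀ i j k → s i (x j - x k) ≈ x (sw i j) - x (sw i k)
    s-xx i j k = trans (s-minus i (x j) (x k)) (-‿cong₂ (s-x i j) (s-x i k))

    x-cong : ∀ {i j} → i ≡ j → x i ≈ x j
    x-cong ≡.refl = refl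

    ∂-cong : ∀ i {f g} → f ≈ g → ∂ i f ≈ ∂ i g
    ∂-cong i {f} {g} e = cancel≈ i (trans (∂-spec i f) (trans (-‿cong₂ e (s-cong i e)) (sym (∂-spec i g))))

    -- Most laws of `∂` below are obtained by checking the defining equation and cancelling x_i -
    -- x_(i+1).
    ∂-uniq : ∀ i f {g} → d i * g ≈ f - s i f → g ≈ ∂ i f
    ∂-uniq i f e = cancel≈ i (trans e (sym (∂-spec i f)))

    ∂-+ : ∀ i f g → ∂ i (f + g) ≈ ∂ i f + ∂ i g
    ∂-+ i f g = sym (∂-uniq i (f + g) (trans (dist+ (d i) _ _) (trans (+-cong (∂-spec i f) (∂-spec i g)) (trans (add-id _ _ _ _) (-‿cong₂ refl (sym (s-+ i f g)))))))

    ∂-neg : ∀ i f → ∂ i (- f) ≈ - ∂ i f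
    ∂-neg i f = sym (∂-uniq i (- f) (trans (neg-d (d i) _) (trans (-‿cong (∂-spec i f)) (trans (neg-id _ _) (-‿cong₂ refl (sym (s-neg i f)))))))

    ∂-minus : ∀ i f g → ∂ i (f - g) ≈ ∂ i f - ∂ i g
    ∂-minus i f g = trans (∂-+ i f (- g)) (+-congˡ (∂-neg i g))

    ∂-inv0 : ∀ i f → s i f ≈ f → ∂ i f ≈ 0#
    ∂-inv0 i f e = cancel i (∂ i f) (trans (∂-spec i f) (trans (-‿cong₂ refl e) (-‿inverseʳ f)))

    ∂0⇒inv : ∀ i f → ∂ i f ≈ 0# → s i f ≈ f
    ∂0⇒inv i f e = sym (diff0 (trans (sym (∂-spec i f)) (trans (*-congˡ e) (zeroʳ _))))

    ∂-0 : ∀ i → ∂ i 0# ≈ 0#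
    ∂-0 i = ∂-inv0 i 0# (s-0 i)

    s-d : ∀ i → s i (d i) ≈ - d i
    s-d i = trans (s-xx i i (suc i)) (trans (-‿cong₂ (x-cong (sw-at i)) (x-cong (sw-at' i))) (sym (trans (⁻¹-anti-homo-∙ (x i) (- x (suc i))) (+-congʳ (-‿involutive (x (suc i)))))))

    ∂-sym : ∀ i f → s i (∂ i f) ≈ ∂ i f
    ∂-sym i f = ∂-uniq i f (begin
      d i * s i (∂ i f) ≈⟨ negneg-* (d i) _ ⟩
      - ((- d i) * s i (∂ i f)) ≈⟨ -‿cong (*-congʳ (s-d i)) ⟨
      - (s i (d i) * s i (∂ i f)) ≈⟨ -‿cong (s-* i _ _) ⟨
      - s i (d i * ∂ i f) ≈⟨ -‿cong (s-cong i (∂-spec i f)) ⟩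
      - s i (f - s i f) ≈⟨ -‿cong (s-minus i f (s i f)) ⟩
      - (s i f - s i (s i f)) ≈⟨ -‿cong (-‿cong₂ refl (s-invol i f)) ⟩
      - (s i f - f) ≈⟨ neg-swap f (s i f) ⟩
      f - s i f ∎)

    ∂-nil : ∀ i f → ∂ i (∂ i f) ≈ 0#
    ∂-nil i f = ∂-inv0 i _ (∂-sym i f)

    leibniz : ∀ i f g → ∂ i (f * g) ≈ ∂ i f * g + s i f * ∂ i g
    leibniz i f g = sym (∂-uniq i (f * g) (trans (leib-d (d i) _ _ _ _) (trans (+-cong (*-congʳ (∂-spec i f)) (*-congˡ (∂-spec i g))) (trans (leib-id f (s i f) g (s i g)) (-‿cong₂ refl (sym (s-* i f g)))))))

    ∂-inv* : ∀ i k f → s i k ≈ k → ∂ i (k * f) ≈ k * ∂ i f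
    ∂-inv* i k f e = trans (leibniz i k f) (trans (+-cong (trans (*-congʳ (∂-inv0 i k e)) (zeroˡ f)) (*-congʳ e)) (+-identityˡ _))

    s-x-fix : ∀ i j → j ≢ i → j ≢ suc i → s i (x j) ≈ x j
    s-x-fix i j p q = trans (s-x i j) (x-cong (sw-fix i j p q))

    ∂-x : ∀ i j f → j ≢ i → j ≢ suc i → ∂ i (x j * f) ≈ x j * ∂ i f
    ∂-x i j f p q = ∂-inv* i (x j) f (s-x-fix i j p q)

    ∂x₁ : ∀ i → ∂ i (x (suc i)) ≈ - 1#
    ∂x₁ i = sym (∂-uniq i (x (suc i)) (trans (trans (*-comm _ _) (trans (neg-mul 1# _) (trans (-‿cong (*-identityˡ _)) (neg-swap (x (suc i)) (x i))))) (-‿cong₂ refl (sym (trans (s-x i (suc i)) (x-cong (sw-at' i)))))))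

    -- By `∂-X` this is `∂ i` after multiplication by -x_(i+1). It arises in `row` as the part of
    -- the Leibniz rule that lowers the degree of `h`.
    A : ℕ → Carrier → Carrier
    A i f = f - x i * ∂ i f

    A-cong : ∀ i {f g} → f ≈ g → A i f ≈ A i g
    A-cong i e = -‿cong₂ e (*-congˡ (∂-cong i e))

    X : ℕ → Carrier → Carrier
    X j f = - (x j * f)

    X-cong : ∀ j {f g} → f ≈ g → X j f ≈ X j g
    X-cong j e = -‿cong (*-congˡ e)

    ∂-X : ∀ i f → ∂ i (X (suc i) f) ≈ A i f
    ∂-X i f = trans (∂-neg i _) (trans (-‿cong (trans (leibniz i (x (suc i)) f) (trans (+-cong (*-congʳ (∂x₁ i)) (*-congʳ (trans (s-x i (suc i)) (x-cong (sw-at' i))))) (trans (+-congʳ (trans (neg-mul 1# f) (-‿cong (*-identityˡ f)))) (+-comm _ _))))) (A-id (x i) (∂ i f) f))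

    ∂-X-fix : ∀ i j f → j ≢ i → j ≢ suc i → ∂ i (X j f) ≈ X j (∂ i f)
    ∂-X-fix i j f p q = trans (∂-neg i _) (-‿cong (∂-x i j f p q))

    s∂-far : ∀ i j f → s i (d j) ≈ d j → (∀ g → s i (s j g) ≈ s j (s i g)) → s i (∂ j f) ≈ ∂ j (s i f)
    s∂-far i j f e c = ∂-uniq j (s i f) (trans (*-congʳ (sym e)) (trans (sym (s-* i _ _)) (trans (s-cong i (∂-spec j f)) (trans (s-minus i f (s j f)) (-‿cong₂ refl (c f))))))

    ∂-far : ∀ i j → suc i < j → ∀ f → ∂ i (∂ j f) ≈ ∂ j (∂ i f)
    ∂-far i j l f = cancel≈ i (begin
      d i * ∂ i (∂ j f) ≈⟨ ∂-spec i _ ⟩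
      ∂ j f - s i (∂ j f) ≈⟨ -‿cong₂ refl (s∂-far i j f (trans (s-xx i j (suc j)) (-‿cong₂ (x-cong (sw-fix i j n1 n2)) (x-cong (sw-fix i (suc j) n3 n4)))) (s-far i j l)) ⟩
      ∂ j f - ∂ j (s i f) ≈⟨ ∂-minus j f (s i f) ⟨
      ∂ j (f - s i f) ≈⟨ ∂-cong j (∂-spec i f) ⟨
      ∂ j (d i * ∂ i f) ≈⟨ ∂-inv* j (d i) _ (trans (s-xx j i (suc i)) (-‿cong₂ (x-cong (sw-fix j i m1 m2)) (x-cong (sw-fix j (suc i) m3 m4)))) ⟩
      d i * ∂ j (∂ i f) ∎)
      where
      n1 : j ≢ i
      n1 ≡.refl = ℕₚ.<-irrefl ≡.refl (ℕₚ.<-trans (ℕₚ.n<1+n i) l)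
      n2 : j ≢ suc i
      n2 ≡.refl = ℕₚ.<-irrefl ≡.refl l
      n3 : suc j ≢ i
      n3 ≡.refl = ℕₚ.<-asym l (ℕₚ.m≤n⇒m≤1+n ℕₚ.≤-refl)
      n4 : suc j ≢ suc i
      n4 e = n1 (ℕₚ.suc-injective e)
      m1 : i ≢ j
      m1 e = n1 (≡.sym e)
      m2 : i ≢ suc j
      m2 e = n3 (≡.sym e)
      m3 : suc i ≢ j
      m3 e = n2 (≡.sym e)
      m4 : suc i ≢ suc j
      m4 e = n4 (≡.sym e)

    private
      sw-lo : ∀ i → sw (suc i) i ≡ i
      sw-lo i = sw-fix (suc i) i (λ e → ℕₚ.1+n≢n (≡.sym e)) (λ e → ℕₚ.m≢1+m+n i {1} (≡.trans e (≡.cong suc (ℕₚ.+-comm 1 i))))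
      sw-hi : ∀ i → sw i (suc (suc i)) ≡ suc (suc i)
      sw-hi i = sw-fix i (suc (suc i)) (λ e → ℕₚ.m≢1+m+n i {1} (≡.trans (≡.sym e) (≡.cong suc (ℕₚ.+-comm 1 i)))) (λ e → ℕₚ.1+n≢n (ℕₚ.suc-injective e))

    c : ℕ → Carrier
    c i = x i - x (suc (suc i))

    -- The swap of x_(i+1) and x_(i+2) turns x_i - x_(i+2) into x_i - x_(i+1), which can be
    -- cancelled.
    cancel-c : ∀ i {f g} → c i * f ≈ c i * g → f ≈ g
    cancel-c i {f} {g} e = trans (sym (s-invol (suc i) f)) (trans (s-cong (suc i) (cancel≈ i
        (trans (t f) (trans (s-cong (suc i) e) (sym (t g)))))) (s-invol (suc i) g))
      where
      t : ∀ f → d i * s (suc i) f ≈ s (suc i) (c i * f)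
      t f = sym (trans (s-* (suc i) _ _) (*-congʳ (trans (s-xx (suc i) i (suc (suc i))) (-‿cong₂ (x-cong (sw-lo i)) (x-cong (sw-at' (suc i)))))))

    -- Multiplied by the three differences of x_i, x_(i+1), x_(i+2), both sides become the
    -- alternating sum of the six images of `f` under permutations of these variables; `s-braid`
    -- identifies the two forms of the longest one.
    ∂-braid : ∀ i f → ∂ i (∂ (suc i) (∂ i f)) ≈ ∂ (suc i) (∂ i (∂ (suc i) f))
    ∂-braid i f = cancel-c i (cancel≈ (suc i) (cancel≈ i (trans (sym (triple _ _ _ _)) (trans lhs (trans (trans (sum6 _ _ _ _ _ _) (+-congˡ (-‿cong₂ refl (s-braid i f)))) (trans (sym rhs) (triple' _ _ _ _)))))))
      where
      a = d i
      b = d (suc i)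
      cc = c i
      s1a : s (suc i) a ≈ cc
      s1a = trans (s-xx (suc i) i (suc i)) (-‿cong₂ (x-cong (sw-lo i)) (x-cong (sw-at (suc i))))
      s0b : s i b ≈ cc
      s0b = trans (s-xx i (suc i) (suc (suc i))) (-‿cong₂ (x-cong (sw-at' i)) (x-cong (sw-hi i)))
      s0c : s i cc ≈ b
      s0c = trans (s-xx i i (suc (suc i))) (-‿cong₂ (x-cong (sw-at i)) (x-cong (sw-hi i)))
      s1c : s (suc i) cc ≈ a
      s1c = trans (s-xx (suc i) i (suc (suc i))) (-‿cong₂ (x-cong (sw-lo i)) (x-cong (sw-at' (suc i))))
      lhs : (cc * b) * (a * ∂ i (∂ (suc i) (∂ i f))) ≈ ((f - s i f) - (s (suc i) f - s (suc i) (s i f))) + (s i (s (suc i) f) - s i (s (suc i) (s i f)))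
      lhs = begin
        (cc * b) * (a * ∂ i f2) ≈⟨ *-congˡ (∂-spec i f2) ⟩
        (cc * b) * (f2 - s i f2) ≈⟨ braid-id₁ cc b f2 (s i f2) ⟩
        cc * (b * f2) - b * (cc * s i f2) ≈⟨ -‿cong₂ (*-congˡ (∂-spec (suc i) f1)) (*-congˡ (trans (*-congʳ (sym s0b)) (trans (sym (s-* i _ _)) (trans (s-cong i (∂-spec (suc i) f1)) (trans (s-minus i _ _) (-‿cong₂ (∂-sym i f) refl)))))) ⟩
        cc * (f1 - s (suc i) f1) - b * (f1 - s i (s (suc i) f1)) ≈⟨ braid-id₂ _ _ _ _ _ _ ⟩
        (a * f1 - cc * s (suc i) f1) + b * s i (s (suc i) f1) ≈⟨ +-cong (-‿cong₂ (∂-spec i f) e2) (trans (*-congʳ (sym s0c)) (trans (sym (s-* i _ _)) (trans (s-cong i e2) (s-minus i _ _)))) ⟩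
        _ ∎
        where
        f1 = ∂ i f
        f2 = ∂ (suc i) f1
        e2 : cc * s (suc i) f1 ≈ s (suc i) f - s (suc i) (s i f)
        e2 = trans (*-congʳ (sym s1a)) (trans (sym (s-* (suc i) _ _)) (trans (s-cong (suc i) (∂-spec i f)) (s-minus (suc i) _ _)))
      rhs : (cc * a) * (b * ∂ (suc i) (∂ i (∂ (suc i) f))) ≈ ((f - s (suc i) f) - (s i f - s i (s (suc i) f))) + (s (suc i) (s i f) - s (suc i) (s i (s (suc i) f)))
      rhs = begin
        (cc * a) * (b * ∂ (suc i) f2) ≈⟨ *-congˡ (∂-spec (suc i) f2) ⟩
        (cc * a) * (f2 - s (suc i) f2) ≈⟨ braid-id₁ cc a f2 (s (suc i) f2) ⟩
        cc * (a * f2) - a * (cc * s (suc i) f2) ≈⟨ -‿cong₂ (*-congˡ (∂-spec i f1)) (*-congˡ (trans (*-congʳ (sym s1a)) (trans (sym (s-* (suc i) _ _)) (trans (s-cong (suc i) (∂-spec i f1)) (trans (s-minus (suc i) _ _) (-‿cong₂ (∂-sym (suc i) f) refl)))))) ⟩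
        cc * (f1 - s i f1) - a * (f1 - s (suc i) (s i f1)) ≈⟨ braid-id₃ _ _ _ _ _ _ ⟩
        (b * f1 - cc * s i f1) + a * s (suc i) (s i f1) ≈⟨ +-cong (-‿cong₂ (∂-spec (suc i) f) e2) (trans (*-congʳ (sym s1c)) (trans (sym (s-* (suc i) _ _)) (trans (s-cong (suc i) e2) (s-minus (suc i) _ _)))) ⟩
        _ ∎
        where
        f1 = ∂ (suc i) f
        f2 = ∂ i f1
        e2 : cc * s i f1 ≈ s i f - s i (s (suc i) f)
        e2 = trans (*-congʳ (sym s0b)) (trans (sym (s-* i _ _)) (trans (s-cong i (∂-spec (suc i) f)) (s-minus i _ _)))

    -- h m k : complete homogeneous symmetric polynomial of degree m in x_0 .. x_{k-1}
    h : ℕ → ℕ → Carrier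
    h zero k = 1#
    h (suc m) zero = 0#
    h (suc m) (suc k) = h (suc m) k + x k * h m (suc k)

    s-h-above : ∀ i m k → k ≤ i → s i (h m k) ≈ h m k
    s-h-above i zero k l = s-1 i
    s-h-above i (suc m) zero l = s-0 i
    s-h-above i (suc m) (suc k) l = trans (s-+ i _ _) (+-cong (s-h-above i (suc m) k (ℕₚ.<⇒≤ l))
      (trans (s-* i _ _) (*-cong (s-x-fix i k (λ e → ℕₚ.<⇒≢ l e) (λ e → ℕₚ.<⇒≢ (ℕₚ.m≤n⇒m≤1+n l) e)) (s-h-above i m (suc k) l))))

    -- In k + 1 variables h_(m+1) is h_(m+1) - x_(k+1) h_m of k + 2 variables, and the swap changes
    -- only x_(k+1) into x_k. The symmetry is a hypothesis because `s-h-base` calls this lemma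
    -- inside its own induction.
    s-h-edge' : ∀ k m → s k (h (suc m) (suc (suc k))) ≈ h (suc m) (suc (suc k)) → s k (h m (suc (suc k))) ≈ h m (suc (suc k)) →
      s k (h (suc m) (suc k)) ≈ h (suc m) (suc (suc k)) - x k * h m (suc (suc k))
    s-h-edge' k m e e' = trans (s-cong k (sym (plus-minus (h (suc m) (suc k)) (x (suc k) * h m (suc (suc k)))))) (trans (s-minus k _ _)
      (-‿cong₂ e (trans (s-* k _ _) (*-cong (trans (s-x k (suc k)) (x-cong (sw-at' k))) e'))))

    s-h-base : ∀ i m → s i (h m (suc (suc i))) ≈ h m (suc (suc i))
    s-h-base i zero = s-1 i
    s-h-base i (suc zero) = begin
      s i ((h 1 i + x i * 1#) + x (suc i) * 1#) ≈⟨ trans (s-+ i _ _) (+-cong (trans (s-+ i _ _) (+-cong (s-h-above i 1 i ℕₚ.≤-refl) (trans (s-* i _ _) (*-cong (trans (s-x i i) (x-cong (sw-at i))) (s-1 i))))) (trans (s-* i _ _) (*-cong (trans (s-x i (suc i)) (x-cong (sw-at' i))) (s-1 i)))) ⟩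
      (h 1 i + x (suc i) * 1#) + x i * 1# ≈⟨ assoc-swap _ _ _ ⟩
      _ ∎
    s-h-base i (suc (suc m)) = begin
      s i ((h (2 ℕ.+ m) i + p * h (suc m) (suc i)) + q * H) ≈⟨ trans (s-+ i _ _) (+-cong (trans (s-+ i _ _) (+-cong (s-h-above i (2 ℕ.+ m) i ℕₚ.≤-refl) (trans (s-* i _ _) (*-cong (trans (s-x i i) (x-cong (sw-at i))) (s-h-edge' i m (s-h-base i (suc m)) (s-h-base i m)))))) (trans (s-* i _ _) (*-cong (trans (s-x i (suc i)) (x-cong (sw-at' i))) (s-h-base i (suc m))))) ⟩
      (h (2 ℕ.+ m) i + q * (H - p * K)) + p * H ≈⟨ +-assoc _ _ _ ⟩
      h (2 ℕ.+ m) i + (q * (H - p * K) + p * H) ≈⟨ +-congˡ (h-id p q H K) ⟩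
      h (2 ℕ.+ m) i + (p * (H - q * K) + q * H) ≈⟨ +-assoc _ _ _ ⟨
      (h (2 ℕ.+ m) i + p * (H - q * K)) + q * H ≈⟨ +-congʳ (+-congˡ (*-congˡ (plus-minus _ _))) ⟩
      _ ∎
      where
      p = x i
      q = x (suc i)
      H = h (suc m) (suc (suc i))
      K = h m (suc (suc i))

    s-h-below : ∀ i m k → suc i < k → s i (h m k) ≈ h m k
    s-h-below i zero k l = s-1 i
    s-h-below i (suc m) (suc k) (s≤s l) with ℕₚ.m≤n⇒m<n∨m≡n l
    ... | inj₂ ≡.refl = s-h-base i (suc m)
    ... | inj₁ l' = trans (s-+ i _ _) (+-cong (s-h-below i (suc m) k l')
      (trans (s-* i _ _) (*-cong (s-x-fix i k (λ { ≡.refl → ℕₚ.<-irrefl ≡.refl (ℕₚ.<-trans (ℕₚ.n<1+n k) l') }) (λ { ≡.refl → ℕₚ.<-irrefl ≡.refl l' })) (s-h-below i m (suc k) (s≤s l)))))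

    s-h-edge : ∀ k m → s k (h (suc m) (suc k)) ≈ h (suc m) (suc (suc k)) - x k * h m (suc (suc k))
    s-h-edge k m = s-h-edge' k m (s-h-base k (suc m)) (s-h-base k m)

    ∂-h-edge : ∀ k m → ∂ k (h (suc m) (suc k)) ≈ h m (suc (suc k))
    ∂-h-edge k m = sym (∂-uniq k (h (suc m) (suc k)) (trans (hedge-id (h (suc m) (suc k)) (x k) (x (suc k)) (h m (suc (suc k)))) (-‿cong₂ refl (sym (s-h-edge k m)))))

    -- Leibniz rule; the edge formulas supply two terms with h_m, which combine to `A k f`.
    row : ∀ k m f → ∂ k (h (suc m) (suc k) * f) ≈ h m (suc (suc k)) * A k f + h (suc m) (suc (suc k)) * ∂ k f
    row k m f = trans (leibniz k _ f) (trans (+-cong (*-congʳ (∂-h-edge k m)) (*-congʳ (s-h-edge k m))) (row-id _ _ _ _ _))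

    -- cv a k z = Σ_{c ≤ a} h_{a-c}(x_0..x_{k-1}) z_c
    cv : ℕ → ℕ → (ℕ → Carrier) → Carrier
    cv zero k z = h zero k * z zero
    cv (suc a) k z = h (suc a) k * z zero + cv a k (λ c → z (suc c))

    cv-cong : ∀ a k {z z'} → (∀ c → z c ≈ z' c) → cv a k z ≈ cv a k z'
    cv-cong zero k e = *-congˡ (e zero)
    cv-cong (suc a) k e = +-cong (*-congˡ (e zero)) (cv-cong a k (λ c → e (suc c)))

    -- With `z` read as a power series in t, this is ∂_q + t A_q, or ∂_q after multiplication by 1 -
    -- t x_(q+1). It is what a divided difference does to the coefficients of a convolution while
    -- the `h` gain a variable.
    stepZ : ℕ → (ℕ → Carrier) → ℕ → Carrier
    stepZ q z zero = ∂ q (z zero)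
    stepZ q z (suc c) = ∂ q (z (suc c)) + A q (z c)

    cv-step : ∀ a k z → ∂ k (cv a (suc k) z) ≈ cv a (suc (suc k)) (stepZ k z)
    cv-step zero k z = ∂-inv* k 1# _ (s-1 k)
    cv-step (suc a) k z = trans (∂-+ k _ _) (trans (+-cong (row k a (z zero)) (cv-step a k (λ c → z (suc c)))) (fix a))
      where
      y = A k (z zero)
      k2 = suc (suc k)
      fix : ∀ a → (h a k2 * y + h (suc a) k2 * ∂ k (z zero)) + cv a k2 (stepZ k (λ c → z (suc c))) ≈ h (suc a) k2 * ∂ k (z zero) + cv a k2 (λ c → stepZ k z (suc c))
      fix zero = fix-id₁ _ _ _ _
      fix (suc a) = fix-id₂ _ _ _ _ _

-- Reduced words of permutations.

module Words where
  open DividedDifferences using (sw; sw-at; sw-at'; sw-fix; sw-invol)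
  open import Data.Nat using (_+_)
  open ℕₚ
  open ≡

  -- punch p enumerates ℕ without p.
  punch : ℕ → ℕ → ℕ
  punch zero j = suc j
  punch (suc p) zero = zero
  punch (suc p) (suc j) = suc (punch p j)

  punch-lo : ∀ p j → j < p → punch p j ≡ j
  punch-lo (suc p) zero l = refl
  punch-lo (suc p) (suc j) (s≤s l) = cong suc (punch-lo p j l)

  punch-hi : ∀ p j → p ≤ j → punch p j ≡ suc j
  punch-hi zero j l = refl
  punch-hi (suc p) (suc j) (s≤s l) = cong suc (punch-hi p j l)

  punch-≢ : ∀ p j → punch p j ≢ p
  punch-≢ zero j ()
  punch-≢ (suc p) zero ()
  punch-≢ (suc p) (suc j) e = punch-≢ p j (suc-injective e)

  punch-inj : ∀ p i j → punch p i ≡ punch p j → i ≡ j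
  punch-inj zero i j e = suc-injective e
  punch-inj (suc p) zero zero e = refl
  punch-inj (suc p) (suc i) (suc j) e = cong suc (punch-inj p i j (suc-injective e))

  punch-≤ : ∀ p j → punch p j ≤ suc j
  punch-≤ zero j = ≤-refl
  punch-≤ (suc p) zero = z≤n
  punch-≤ (suc p) (suc j) = s≤s (punch-≤ p j)

  punch-mono : ∀ p {i j} → i < j → punch p i < punch p j
  punch-mono zero l = s≤s l
  punch-mono (suc p) {zero} {suc j} l = s≤s z≤n
  punch-mono (suc p) {suc i} {suc j} (s≤s l) = s≤s (punch-mono p l)

  sw-punch₁ : ∀ i j → sw i (punch i j) ≡ punch (suc i) j
  sw-punch₁ zero zero = refl
  sw-punch₁ zero (suc j) = refl
  sw-punch₁ (suc i) zero = refl
  sw-punch₁ (suc i) (suc j) = cong suc (sw-punch₁ i j)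

  sw-punch₂ : ∀ i p j → suc i < p → sw i (punch p j) ≡ punch p (sw i j)
  sw-punch₂ zero (suc zero) j (s≤s ())
  sw-punch₂ zero (suc (suc p)) zero l = refl
  sw-punch₂ zero (suc (suc p)) (suc zero) l = refl
  sw-punch₂ zero (suc (suc p)) (suc (suc j)) l = refl
  sw-punch₂ (suc i) (suc p) zero l = refl
  sw-punch₂ (suc i) (suc p) (suc j) (s≤s l) = cong suc (sw-punch₂ i p j l)

  sw-punch₃ : ∀ i p j → p ≤ i → sw (suc i) (punch p j) ≡ punch p (sw i j)
  sw-punch₃ i zero j l = refl
  sw-punch₃ (suc i) (suc p) zero (s≤s l) = refl
  sw-punch₃ (suc i) (suc p) (suc j) (s≤s l) = cong suc (sw-punch₃ i p j l)

  Perm[_] : ℕ → (ℕ → ℕ) → Set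
  Perm[ N ] u = (∀ {i} → i < N → u i < N) × (∀ {i j} → i < N → j < N → u i ≡ u j → i ≡ j)

  Inj : ℕ → (ℕ → ℕ) → Set
  Inj N u = ∀ {i j} → i < N → j < N → u i ≡ u j → i ≡ j

  IsMax : ℕ → (ℕ → ℕ) → ℕ → Set
  IsMax n u p = p ≤ n × (∀ j → j ≤ n → j ≢ p → u j < u p)

  opaque
    -- position of the largest of u 0, …, u n
    mp : ℕ → (ℕ → ℕ) → ℕ
    mp zero u = 0
    mp (suc n) u with u (mp n u) <? u (suc n)
    ... | yes _ = suc n
    ... | no _ = mp n u

  opaque
    unfolding mp
    mp-≤ : ∀ n (u : ℕ → ℕ) → mp n u ≤ n
    mp-≤ zero u = z≤n
    mp-≤ (suc n) u with u (mp n u) <? u (suc n)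
    ... | yes _ = ≤-refl
    ... | no _ = m≤n⇒m≤1+n (mp-≤ n u)

  opaque
    unfolding mp
    mp-max : ∀ n (u : ℕ → ℕ) j → j ≤ n → u j ≤ u (mp n u)
    mp-max zero u zero l = ≤-refl
    mp-max (suc n) u j l with u (mp n u) <? u (suc n) | m≤n⇒m<n∨m≡n l
    ... | yes _ | inj₂ refl = ≤-refl
    ... | no q | inj₂ refl = ≮⇒≥ q
    ... | yes q | inj₁ (s≤s l') = <⇒≤ (≤-<-trans (mp-max n u j l') q)
    ... | no q | inj₁ (s≤s l') = mp-max n u j l'

  mp-isMax : ∀ n u → Inj (suc n) u → IsMax n u (mp n u)
  mp-isMax n u inj = mp-≤ n u , λ j l ne → ≤∧≢⇒< (mp-max n u j l) (λ e → ne (inj (s≤s l) (s≤s (mp-≤ n u)) e))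

  mp-uniq : ∀ n u p → IsMax n u p → mp n u ≡ p
  mp-uniq n u p (l , q) with mp n u ≟ p
  ... | yes e = e
  ... | no ne = ⊥-elim (<⇒≱ (q (mp n u) (mp-≤ n u) ne) (mp-max n u p l))

  opaque
    unfolding mp
    mp-cong : ∀ n {u v} → (∀ j → j ≤ n → u j ≡ v j) → mp n u ≡ mp n v
    mp-cong zero e = refl
    mp-cong (suc n) {u} {v} e with mp-cong n {u} {v} (λ j l → e j (m≤n⇒m≤1+n l))
    ... | r with u (mp n u) <? u (suc n) | v (mp n v) <? v (suc n)
    ... | yes _ | yes _ = refl
    ... | no _ | no _ = r
    ... | yes p | no q = ⊥-elim (q (subst₂ _<_ (trans (e _ (m≤n⇒m≤1+n (mp-≤ n u))) (cong v r)) (e _ ≤-refl) p))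
    ... | no p | yes q = ⊥-elim (p (subst₂ _<_ (sym (trans (e _ (m≤n⇒m≤1+n (mp-≤ n u))) (cong v r))) (sym (e _ ≤-refl)) q))

  rng : ℕ → ℕ → List ℕ
  rng zero p = []
  rng (suc c) p = p ∷ rng c (suc p)

  -- A reduced word of u, first letter to be applied first: move the maximum to the end, then recurse.
  word : ℕ → (ℕ → ℕ) → List ℕ
  word zero u = []
  word (suc n) u = rng (n ∸ mp n u) (mp n u) ++ word n (u ∘ punch (mp n u))

  punch-< : ∀ {n p j} → p ≤ n → j < n → punch p j ≤ n
  punch-< {n} {p} {j} l k = ≤-trans (punch-≤ p j) k

  word-cong : ∀ N {u v} → (∀ j → j < N → u j ≡ v j) → word N u ≡ word N v
  word-cong zero e = refl
  word-cong (suc n) {u} {v} e with mp n u | mp n v | mp-cong n {u} {v} (λ j l → e j (s≤s l)) | mp-≤ n u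
  ... | p | .p | refl | pl = cong (rng (n ∸ p) p ++_) (word-cong n (λ j l → e _ (s≤s (punch-< pl l))))

  word-max : ∀ n u p → IsMax n u p → word (suc n) u ≡ rng (n ∸ p) p ++ word n (u ∘ punch p)
  word-max n u p m with mp n u | mp-uniq n u p m
  ... | .p | refl = refl

  word-extend : ∀ n u → (∀ j → j < n → u j < u n) → word (suc n) u ≡ word n u
  word-extend n u q = trans (word-max n u n (≤-refl , λ j l ne → q j (≤∧≢⇒< l ne)))
    (trans (cong (λ c → rng c n ++ word n (u ∘ punch n)) (n∸n≡0 n)) (word-cong n (λ j l → cong u (punch-lo n j l))))

  Inj-punch : ∀ {n u p} → p ≤ n → Inj (suc n) u → Inj n (u ∘ punch p)
  Inj-punch {p = p} pl inj a b e = punch-inj p _ _ (inj (s≤s (punch-< pl a)) (s≤s (punch-< pl b)) e)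

  sw-< : ∀ i {N j} → suc i < N → j < N → sw i j < N
  sw-< i {N} {j} l k with j ≟ i | j ≟ suc i
  ... | yes refl | _ = subst (_< N) (sym (sw-at i)) l
  ... | no _ | yes refl = subst (_< N) (sym (sw-at' i)) (<-trans (n<1+n i) l)
  ... | no a | no b = subst (_< N) (sym (sw-fix i j a b)) k

  sw-inj : ∀ i {j k} → sw i j ≡ sw i k → j ≡ k
  sw-inj i {j} {k} e = trans (sym (sw-invol i j)) (trans (cong (sw i) e) (sw-invol i k))

  Inj-sw : ∀ {N u} i → suc i < N → Inj N u → Inj N (u ∘ sw i)
  Inj-sw i l inj a b e = sw-inj i (inj (sw-< i l a) (sw-< i l b) e)

  Perm-sw : ∀ {N u} i → suc i < N → Perm[ N ] u → Perm[ N ] (u ∘ sw i)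
  Perm-sw {N} {u} i l (b , inj) = (λ a → b (sw-< i l a)) , λ a c e → sw-inj i (inj (sw-< i l a) (sw-< i l c) e)

  infix 4 _~_
  -- Commutation and braid moves without cancellation: they preserve the length, and divided
  -- differences respect them.
  data _~_ : List ℕ → List ℕ → Set where
    ~refl : ∀ {a} → a ~ a
    ~sym : ∀ {a b} → a ~ b → b ~ a
    ~trans : ∀ {a b c} → a ~ b → b ~ c → a ~ c
    ~far : ∀ {i j a} → suc i < j → (i ∷ j ∷ a) ~ (j ∷ i ∷ a)
    ~braid : ∀ {i a} → (i ∷ suc i ∷ i ∷ a) ~ (suc i ∷ i ∷ suc i ∷ a)
    ~cons : ∀ {k a b} → a ~ b → (k ∷ a) ~ (k ∷ b)

  ~prefix : ∀ c {a b} → a ~ b → (c ++ a) ~ (c ++ b)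
  ~prefix [] e = e
  ~prefix (k ∷ c) e = ~cons (~prefix c e)

  ~length : ∀ {a b} → a ~ b → length a ≡ length b
  ~length ~refl = refl
  ~length (~sym e) = sym (~length e)
  ~length (~trans e f) = trans (~length e) (~length f)
  ~length (~far l) = refl
  ~length ~braid = refl
  ~length (~cons e) = cong suc (~length e)

  past : ∀ i c p w → suc i < p → (i ∷ rng c p ++ w) ~ (rng c p ++ i ∷ w)
  past i zero p w l = ~refl
  past i (suc c) p w l = ~trans (~far l) (~cons (past i c (suc p) w (m≤n⇒m≤1+n l)))

  -- The letter i + 1 commutes with the letters below i, then a braid move turns i + 1, i, i + 1
  -- into i, i + 1, i, and the last i commutes with the rest of the run.
  past-mid : ∀ i c p w → p ≤ i → suc i < p + c → (suc i ∷ rng c p ++ w) ~ (rng c p ++ i ∷ w)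
  past-mid i zero p w l l' = ⊥-elim (<⇒≱ (<-trans (n<1+n i) (subst (suc i <_) (+-identityʳ p) l')) l)
  past-mid i (suc c) p w l l' with m≤n⇒m<n∨m≡n l
  ... | inj₁ p<i = ~trans (~sym (~far (s≤s p<i))) (~cons (past-mid i c (suc p) w p<i (subst (suc i <_) (+-suc p c) l')))
  past-mid i (suc zero) .i w l l' | inj₂ refl = ⊥-elim (<-irrefl (sym (+-comm i 1)) l')
  past-mid i (suc (suc c)) .i w l l' | inj₂ refl = ~trans (~sym ~braid) (~cons (~cons (past i c (suc (suc i)) w ≤-refl)))

  -- By the position `p` of the maximum. For p = i + 1 the letter `i` lengthens the run; otherwise
  -- it passes the run into the remaining word, lowered by one if p < i. The ascent excludes p = i.
  asc-word : ∀ N u i → suc i < N → Inj N u → u i < u (suc i) → (i ∷ word N u) ~ word N (u ∘ sw i)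
  asc-word (suc n) u i (s≤s l) inj a = go (<-cmp (suc i) p)
    where
    p = mp n u
    isM = mp-isMax n u inj
    pl = proj₁ isM
    q = proj₂ isM
    open import Relation.Binary.Definitions using (Tri; tri<; tri≈; tri>)
    go : Tri (suc i < p) (suc i ≡ p) (p < suc i) → (i ∷ word (suc n) u) ~ word (suc n) (u ∘ sw i)
    go (tri≈ _ e _) = subst (λ w → (i ∷ word (suc n) u) ~ w) (sym (trans (word-max n (u ∘ sw i) i im)
        (trans (cong (λ c → rng c i ++ word n (u ∘ sw i ∘ punch i)) (m∸si l)) (cong₂ (λ c w → i ∷ rng (n ∸ c) c ++ w) e
          (word-cong n (λ j _ → cong u (trans (sw-punch₁ i j) (cong (λ z → punch z j) e)))))))) ~refl
      where
      m∸si : ∀ {n i} → suc i ≤ n → n ∸ i ≡ suc (n ∸ suc i)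
      m∸si {suc n} {zero} (s≤s l) = refl
      m∸si {suc n} {suc i} (s≤s l) = m∸si l
      im : IsMax n (u ∘ sw i) i
      im = <⇒≤ l , λ j jl ne → subst (u (sw i j) <_) (cong u (trans (sym e) (sym (sw-at i))))
             (q (sw i j) (≤-pred (sw-< i (s≤s l) (s≤s jl))) (λ e' → ne (sw-inj i (trans e' (trans (sym e) (sym (sw-at i)))))))
    go (tri< sl _ _) = ~trans (past i (n ∸ p) p _ sl) (subst (λ w → (rng (n ∸ p) p ++ i ∷ word n (u ∘ punch p)) ~ w)
        (sym (word-max n (u ∘ sw i) p im))
        (~prefix (rng (n ∸ p) p) (subst (λ w → (i ∷ word n (u ∘ punch p)) ~ w) (word-cong n (λ j _ → cong u (sym (sw-punch₂ i p j sl))))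
          (asc-word n (u ∘ punch p) i (≤-trans sl pl) (Inj-punch pl inj) (subst₂ _<_ (cong u (sym (punch-lo p i (<-trans (n<1+n i) sl)))) (cong u (sym (punch-lo p (suc i) sl))) a)))))
      where
      fp : sw i p ≡ p
      fp = sw-fix i p (λ e → <⇒≢ (<-trans (n<1+n i) sl) (sym e)) (λ e → <⇒≢ sl (sym e))
      im : IsMax n (u ∘ sw i) p
      im = pl , λ j jl ne → subst (u (sw i j) <_) (cong u (sym fp)) (q (sw i j) (≤-pred (sw-< i (s≤s l) (s≤s jl))) (λ e' → ne (sw-inj i (trans e' (sym fp)))))
    go (tri> _ _ (s≤s p≤i)) with m≤n⇒m<n∨m≡n p≤i
    ... | inj₂ e = ⊥-elim (<⇒≱ a (subst (λ z → u (suc i) ≤ u z) e (<⇒≤ (q (suc i) l (λ e' → 1+n≢n (trans e' e))))))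
    ... | inj₁ p<i = case i p<i l refl
      where
      case : ∀ i₀ → p < i₀ → suc i₀ ≤ n → i₀ ≡ i → (i ∷ word (suc n) u) ~ word (suc n) (u ∘ sw i)
      case (suc i') (s≤s p≤i') l' refl = ~trans (past-mid i' (n ∸ p) p _ p≤i' (subst (suc i' <_) (sym (m+[n∸m]≡n pl)) (<-≤-trans (n<1+n (suc i')) l')))
         (subst (λ w → (rng (n ∸ p) p ++ i' ∷ word n (u ∘ punch p)) ~ w) (sym (word-max n (u ∘ sw i) p im))
          (~prefix (rng (n ∸ p) p) (subst (λ w → (i' ∷ word n (u ∘ punch p)) ~ w) (word-cong n (λ j _ → cong u (sym (sw-punch₃ i' p j p≤i'))))
          (asc-word n (u ∘ punch p) i' l' (Inj-punch pl inj) (subst₂ _<_ (cong u (sym (punch-hi p i' p≤i'))) (cong u (sym (punch-hi p (suc i') (m≤n⇒m≤1+n p≤i')))) a)))))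
        where
        fp : sw (suc i') p ≡ p
        fp = sw-fix (suc i') p (λ e → <⇒≢ p<i e) (λ e → <⇒≢ (m≤n⇒m≤1+n p<i) e)
        im : IsMax n (u ∘ sw (suc i')) p
        im = pl , λ j jl ne → subst (u (sw (suc i') j) <_) (cong u (sym fp)) (q (sw (suc i') j) (≤-pred (sw-< (suc i') (s≤s l) (s≤s jl))) (λ e' → ne (sw-inj (suc i') (trans e' (sym fp)))))

  rng-letters : ∀ c p N → c + p < N → All (λ i → suc i < N) (rng c p)
  rng-letters zero p N l = []
  rng-letters (suc c) p N l = ≤-<-trans (s≤s (m≤n+m p c)) l ∷ rng-letters c (suc p) N (subst (_< N) (sym (+-suc c p)) l)

  word-letters : ∀ N u → All (λ i → suc i < N) (word N u)
  word-letters zero u = []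
  word-letters (suc n) u = Allₚ.++⁺ (rng-letters (n ∸ mp n u) (mp n u) (suc n) (s≤s (≤-reflexive (m∸n+n≡m (mp-≤ n u)))))
    (All.map m≤n⇒m≤1+n (word-letters n _))

-- Transpositions, covers and cycles.

module Transpositions where
  open DividedDifferences using (sw; sw-at; sw-at'; sw-fix)
  open Words
  open import Data.Nat using (_+_)
  open ℕₚ
  open ≡

  opaque
    tr : ℕ → ℕ → ℕ → ℕ
    tr a b j with j ≟ a | j ≟ b
    ... | yes _ | _ = b
    ... | no _ | yes _ = a
    ... | no _ | no _ = j

  opaque
    unfolding tr
    tr-l : ∀ a b → tr a b a ≡ b
    tr-l a b with a ≟ a | a ≟ b
    ... | yes _ | _ = refl
    ... | no n | _ = ⊥-elim (n refl)

  opaque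
    unfolding tr
    tr-r : ∀ a b → tr a b b ≡ a
    tr-r a b with b ≟ a | b ≟ b
    ... | yes e | _ = e
    ... | no _ | yes _ = refl
    ... | no _ | no n = ⊥-elim (n refl)

  opaque
    unfolding tr
    tr-o : ∀ a b j → j ≢ a → j ≢ b → tr a b j ≡ j
    tr-o a b j p q with j ≟ a | j ≟ b
    ... | yes e | _ = ⊥-elim (p e)
    ... | no _ | yes e = ⊥-elim (q e)
    ... | no _ | no _ = refl

  tr-invol : ∀ a b j → tr a b (tr a b j) ≡ j
  tr-invol a b j with j ≟ a | j ≟ b
  ... | yes refl | _ = trans (cong (tr a b) (tr-l a b)) (tr-r a b)
  ... | no _ | yes refl = trans (cong (tr a b) (tr-r a b)) (tr-l a b)
  ... | no p | no q = trans (cong (tr a b) (tr-o a b j p q)) (tr-o a b j p q)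

  tr-inj : ∀ a b {j k} → tr a b j ≡ tr a b k → j ≡ k
  tr-inj a b {j} {k} e = trans (sym (tr-invol a b j)) (trans (cong (tr a b) e) (tr-invol a b k))

  opaque
    unfolding tr
    tr-< : ∀ {a b N j} → a < N → b < N → j < N → tr a b j < N
    tr-< {a} {b} {N} {j} p q l with j ≟ a | j ≟ b
    ... | yes _ | _ = q
    ... | no _ | yes _ = p
    ... | no _ | no _ = l

  Inj-tr : ∀ {N u a b} → a < N → b < N → Inj N u → Inj N (u ∘ tr a b)
  Inj-tr {a = a} {b} p q inj x y e = tr-inj a b (inj (tr-< p q x) (tr-< p q y) e)

  Perm-tr : ∀ {N u a b} → a < N → b < N → Perm[ N ] u → Perm[ N ] (u ∘ tr a b)
  Perm-tr {a = a} {b} p q (b' , inj) = (λ x → b' (tr-< p q x)) , λ x y e → tr-inj a b (inj (tr-< p q x) (tr-< p q y) e)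

  tr-punch : ∀ p i s j → tr (punch p i) (punch p s) (punch p j) ≡ punch p (tr i s j)
  tr-punch p i s j with j ≟ i | j ≟ s
  ... | yes refl | _ = trans (tr-l (punch p i) (punch p s)) (cong (punch p) (sym (tr-l i s)))
  ... | no _ | yes refl = trans (tr-r (punch p i) (punch p s)) (cong (punch p) (sym (tr-r i s)))
  ... | no a | no b = trans (tr-o _ _ _ (λ e → a (punch-inj p j i e)) (λ e → b (punch-inj p j s e))) (cong (punch p) (sym (tr-o i s j a b)))

  -- The transposition of positions i < s is a covering step down in Bruhat order.
  Cov : (ℕ → ℕ) → ℕ → ℕ → Set
  Cov u i s = u s < u i × (∀ {l} → l < s → i < l → ¬ (u s < u l × u l < u i))

  opaque
    cov? : ∀ u i s → Dec (Cov u i s)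
    cov? u i s = (u s <? u i) ×-dec allUpTo? (λ l → (i <? l) →-dec ¬? ((u s <? u l) ×-dec (u l <? u i))) s

  ∑ : ℕ → (ℕ → ℤ) → ℤ
  ∑ zero f = 0ℤ
  ∑ (suc n) f = ∑ n f ℤ.+ f n

  ∑-cong : ∀ n {f g} → (∀ i → i < n → f i ≡ g i) → ∑ n f ≡ ∑ n g
  ∑-cong zero e = refl
  ∑-cong (suc n) e = cong₂ ℤ._+_ (∑-cong n (λ i l → e i (m≤n⇒m≤1+n l))) (e n ≤-refl)

  ∑-zero : ∀ n f → (∀ i → i < n → f i ≡ 0ℤ) → ∑ n f ≡ 0ℤ
  ∑-zero zero f e = refl
  ∑-zero (suc n) f e = cong₂ ℤ._+_ (∑-zero n f (λ i l → e i (m≤n⇒m≤1+n l))) (e n ≤-refl)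

  ∑-punch : ∀ n p f → p ≤ n → ∑ (suc n) f ≡ f p ℤ.+ ∑ n (f ∘ punch p)
  ∑-punch zero zero f z≤n = ℤₚ.+-comm 0ℤ (f 0)
  ∑-punch (suc n) p f l with m≤n⇒m<n∨m≡n l
  ... | inj₂ refl = trans (ℤₚ.+-comm (∑ (suc n) f) (f (suc n))) (cong (λ z → f (suc n) ℤ.+ z) (∑-cong (suc n) (λ i k → cong f (sym (punch-lo (suc n) i k)))))
  ... | inj₁ (s≤s l') = trans (cong₂ ℤ._+_ (∑-punch n p f l') (cong f (sym (punch-hi p n l')))) (ℤₚ.+-assoc (f p) (∑ n (f ∘ punch p)) (f (punch p n)))

  -- cycle carrying position p + c to p and shifting p, …, p + c - 1 up
  cy : ℕ → ℕ → ℕ → ℕ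
  cy zero p j = j
  cy (suc c) p j = cy c (suc p) (sw p j)

  cy-lo : ∀ c p j → j < p → cy c p j ≡ j
  cy-lo zero p j l = refl
  cy-lo (suc c) p j l = trans (cong (cy c (suc p)) (sw-fix p j (λ e → <⇒≢ l e) (λ e → <⇒≢ (m≤n⇒m≤1+n l) e))) (cy-lo c (suc p) j (m≤n⇒m≤1+n l))

  cy-at : ∀ c p → cy c p p ≡ c + p
  cy-at zero p = refl
  cy-at (suc c) p = trans (cong (cy c (suc p)) (sw-at p)) (trans (cy-at c (suc p)) (+-suc c p))

  cy-mid : ∀ c p j → p ≤ j → j < c + p → cy c p (suc j) ≡ j
  cy-mid zero p j l l' = ⊥-elim (<⇒≱ l' l)
  cy-mid (suc c) p j l l' with j ≟ p
  ... | yes refl = trans (cong (cy c (suc p)) (sw-at' p)) (cy-lo c (suc p) p ≤-refl)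
  ... | no n = trans (cong (cy c (suc p)) (sw-fix p (suc j) (λ e → <⇒≱ (n<1+n j) (subst (_≤ j) (sym e) l)) (λ e → n (suc-injective e))))
     (cy-mid c (suc p) j (≤∧≢⇒< l (λ e → n (sym e))) (subst (j <_) (sym (+-suc c p)) l'))

  cy-hi : ∀ c p j → c + p < j → cy c p j ≡ j
  cy-hi zero p j l = refl
  cy-hi (suc c) p j l = trans (cong (cy c (suc p)) (sw-fix p j (λ { refl → <⇒≱ l (m≤n+m p (suc c)) }) (λ { refl → <⇒≱ l (s≤s (m≤n+m p c)) })))
    (cy-hi c (suc p) j (subst (_< j) (sym (+-suc c p)) l))

  -- Deleting position `p` and cycling is the same as transposing `p` with c + p + 1 and deleting
  -- the latter. In `monk` this turns a chain of divided differences into a transposition.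
  cy-tr : ∀ c p j → punch p (cy c p j) ≡ tr p (suc (c + p)) (punch (suc (c + p)) j)
  cy-tr c p j with <-cmp j p
  ... | tri< l _ _ = trans (cong (punch p) (cy-lo c p j l)) (trans (punch-lo p j l)
      (sym (trans (cong (tr p _) (punch-lo (suc (c + p)) j (<-trans l (s≤s (m≤n+m p c))))) (tr-o p (suc (c + p)) j (<⇒≢ l) (<⇒≢ (<-trans l (s≤s (m≤n+m p c))))))))
  ... | tri≈ _ refl _ = trans (cong (punch p) (cy-at c p)) (trans (punch-hi p (c + p) (m≤n+m p c))
      (sym (trans (cong (tr p _) (punch-lo (suc (c + p)) p (s≤s (m≤n+m p c)))) (tr-l p _))))
  cy-tr c p (suc j) | tri> _ _ (s≤s l) with suc (c + p) ≤? suc j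
  ... | yes (s≤s k) = trans (cong (punch p) (cy-hi c p (suc j) (s≤s k))) (trans (punch-hi p (suc j) (m≤n⇒m≤1+n l))
      (sym (trans (cong (tr p _) (punch-hi (suc (c + p)) (suc j) (s≤s k))) (tr-o p (suc (c + p)) (suc (suc j)) (λ { refl → 1+n≰n (≤-trans (m≤n⇒m≤1+n ≤-refl) l) }) (λ e → <⇒≢ (s≤s (s≤s k)) (sym e))))))
  ... | no k = trans (cong (punch p) (cy-mid c p j l (≤-pred (≰⇒> k)))) (trans (punch-hi p j l)
      (sym (trans (cong (tr p _) (punch-lo (suc (c + p)) (suc j) (≰⇒> k))) (tr-o p (suc (c + p)) (suc j) (λ { refl → 1+n≰n l }) (λ e → k (≤-reflexive (sym e)))))))

  below-suc : ∀ {m} {P : ℕ → Set} → (∀ {k} → k < m → P k) → P m → ∀ {k} → k < suc m → P k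
  below-suc q r l with m≤n⇒m<n∨m≡n (≤-pred l)
  ... | inj₁ l' = q l'
  ... | inj₂ refl = r

  counterexample : ∀ m {P : ℕ → Set} → (∀ k → Dec (P k)) → ¬ (∀ {k} → k < m → P k) → Σ ℕ λ k → k < m × ¬ P k
  counterexample zero P? n = ⊥-elim (n λ ())
  counterexample (suc m) {P} P? n with P? m
  ... | no r = m , ≤-refl , r
  ... | yes r with counterexample m P? (λ q → n (below-suc {m} {P} q r))
  ...   | k , l , r' = k , m≤n⇒m≤1+n l , r'

  when : {A : Set} → Dec A → ℤ → ℤ
  when (yes _) z = z
  when (no _) z = 0ℤ

-- The functionals, row stripping and the one-sided Monk rule.

module Functionals where
  open DividedDifferences using (sw; sw-at; sw-at'; sw-invol)
  open DifferenceRings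
  open Words
  open Transpositions

  module Eps (DR : DiffRing) where
    open DiffRing DR
    open Alg DR
    open RingIds R using (plus-minus)

    ∂* : List ℕ → Carrier → Carrier
    ∂* [] f = f
    ∂* (i ∷ w) f = ∂* w (∂ i f)

    ∂*-cong : ∀ w {f g} → f ≈ g → ∂* w f ≈ ∂* w g
    ∂*-cong [] e = e
    ∂*-cong (i ∷ w) e = ∂*-cong w (∂-cong i e)

    ∂*-++ : ∀ w w' f → ∂* (w ++ w') f ≡ ∂* w' (∂* w f)
    ∂*-++ [] w' f = ≡.refl
    ∂*-++ (i ∷ w) w' f = ∂*-++ w w' (∂ i f)

    ∂*-+ : ∀ w f g → ∂* w (f + g) ≈ ∂* w f + ∂* w g
    ∂*-+ [] f g = refl
    ∂*-+ (i ∷ w) f g = trans (∂*-cong w (∂-+ i f g)) (∂*-+ w _ _)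

    ∂*-neg : ∀ w f → ∂* w (- f) ≈ - ∂* w f
    ∂*-neg [] f = refl
    ∂*-neg (i ∷ w) f = trans (∂*-cong w (∂-neg i f)) (∂*-neg w _)

    ∂*-0 : ∀ w → ∂* w 0# ≈ 0#
    ∂*-0 [] = refl
    ∂*-0 (i ∷ w) = trans (∂*-cong w (∂-0 i)) (∂*-0 w)

    ~-sound : ∀ {a b} → a ~ b → ∀ f → ∂* a f ≈ ∂* b f
    ~-sound ~refl f = refl
    ~-sound (~sym e) f = sym (~-sound e f)
    ~-sound (~trans e e') f = trans (~-sound e f) (~-sound e' f)
    ~-sound (~far {i} {j} {a} l) f = ∂*-cong a (sym (∂-far i j l f))
    ~-sound (~braid {i} {a}) f = ∂*-cong a (∂-braid i f)
    ~-sound (~cons {k} e) f = ~-sound e (∂ k f)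

    opaque
      ε : ℕ → (ℕ → ℕ) → Carrier → ℤ
      ε N u f = c₀ (∂* (word N u) f)

    opaque
      unfolding ε
      ε-def : ∀ N u f → ε N u f ≡ c₀ (∂* (word N u) f)
      ε-def N u f = ≡.refl

      ε-nil : ∀ u f → ε 0 u f ≡ c₀ f
      ε-nil u f = ≡.refl

    opaque
      unfolding ε
      ε-cong : ∀ N u {f g} → f ≈ g → ε N u f ≡ ε N u g
      ε-cong N u e = c₀-cong (∂*-cong (word N u) e)

    opaque
      unfolding ε
      ε-permcong : ∀ N {u v} f → (∀ j → j < N → u j ≡ v j) → ε N u f ≡ ε N v f
      ε-permcong N f e = cong (λ w → c₀ (∂* w f)) (word-cong N e)

    opaque
      unfolding ε
      ε-+ : ∀ N u f g → ε N u (f + g) ≡ ε N u f ℤ.+ ε N u g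
      ε-+ N u f g = ≡.trans (c₀-cong (∂*-+ (word N u) f g)) (c₀-+ _ _)

    opaque
      unfolding ε
      ε-neg : ∀ N u f → ε N u (- f) ≡ ℤ.- ε N u f
      ε-neg N u f = ≡.trans (c₀-cong (∂*-neg (word N u) f)) (c₀-neg _)

    ε-minus : ∀ N u f g → ε N u (f - g) ≡ ε N u f ℤ.- ε N u g
    ε-minus N u f g = ≡.trans (ε-+ N u f (- g)) (cong (λ z → ε N u f ℤ.+ z) (ε-neg N u g))

    c₀-0 : c₀ 0# ≡ 0ℤ
    c₀-0 = ≡.trans (c₀-cong (sym (zeroʳ (x 0)))) (c₀-x 0 0#)

    opaque
      unfolding ε
      ε-0 : ∀ N u → ε N u 0# ≡ 0ℤ
      ε-0 N u = ≡.trans (c₀-cong (∂*-0 (word N u))) c₀-0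

    ε-≈0 : ∀ N u {f} → f ≈ 0# → ε N u f ≡ 0ℤ
    ε-≈0 N u e = ≡.trans (ε-cong N u e) (ε-0 N u)

    opaque
      unfolding ε
      -- By `asc-word`, the letter `i` followed by the word of `u` is a word of `u ∘ sw i`.
      ε-asc : ∀ N u i f → suc i < N → Inj N u → u i < u (suc i) → ε N u (∂ i f) ≡ ε N (u ∘ sw i) f
      ε-asc N u i f l inj a = c₀-cong (~-sound (asc-word N u i l inj a) f)

    -- At a descent the word of `u` may be taken to begin with `i`, and `∂ i` squares to zero.
    ε-desc : ∀ N u i f → suc i < N → Inj N u → u (suc i) < u i → ε N u (∂ i f) ≡ 0ℤ
    ε-desc N u i f l inj a = ≡.trans (≡.trans (ε-permcong N (∂ i f) (λ j _ → cong u (≡.sym (sw-invol i j))))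
      (≡.sym (ε-asc N (u ∘ sw i) i (∂ i f) l (Inj-sw i l inj) (subst₂ _<_ (cong u (≡.sym (sw-at i))) (cong u (≡.sym (sw-at' i))) a))))
      (ε-≈0 N (u ∘ sw i) (∂-nil i f))

    opaque
      unfolding ε
      ε-ext : ∀ n u f → (∀ j → j < n → u j < u n) → ε (suc n) u f ≡ ε n u f
      ε-ext n u f q = cong (λ w → c₀ (∂* w f)) (word-extend n u q)

    opaque
      unfolding ε
      ε-max : ∀ n u p f → IsMax n u p → ε (suc n) u f ≡ ε n (u ∘ punch p) (∂* (rng (n ∸ p) p) f)
      ε-max n u p f m = ≡.trans (cong (λ w → c₀ (∂* w f)) (word-max n u p m)) (cong c₀ (∂*-++ (rng (n ∸ p) p) (word n (u ∘ punch p)) f))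

    ∂*-inv : ∀ w k f → All (λ i → s i k ≈ k) w → ∂* w (k * f) ≈ k * ∂* w f
    ∂*-inv [] k f a = refl
    ∂*-inv (i ∷ w) k f (e ∷ a) = trans (∂*-cong w (∂-inv* i k f e)) (∂*-inv w k _ a)

    c₀-h : ∀ m k f → c₀ (h (suc m) k * f) ≡ 0ℤ
    c₀-h m zero f = ≡.trans (c₀-cong (zeroˡ f)) c₀-0
    c₀-h m (suc k) f = ≡.trans (c₀-cong (trans (distribʳ f _ _) (+-congˡ (*-assoc _ _ _)))) (≡.trans (c₀-+ _ _) (cong₂ ℤ._+_ (c₀-h m k f) (c₀-x k _)))

    opaque
      unfolding ε
      -- The word swaps only among the first N ≤ K variables, which h_(m+1) does not notice; it is
      -- pulled out, and its constant term is zero.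
      ε-h : ∀ N K u m f → N ≤ K → ε N u (h (suc m) K * f) ≡ 0ℤ
      ε-h N K u m f l = ≡.trans (c₀-cong (∂*-inv (word N u) _ f (All.map (λ {i} q → s-h-below i (suc m) K (ℕₚ.≤-trans q l)) (word-letters N u)))) (c₀-h m K _)

    -- By `ε-h` only the summand with h_0 survives.
    ε-cv : ∀ N K u a z → N ≤ K → ε N u (cv a K z) ≡ ε N u (z a)
    ε-cv N K u zero z l = ε-cong N u (*-identityˡ _)
    ε-cv N K u (suc a) z l = ≡.trans (ε-+ N u _ _) (≡.trans (cong₂ ℤ._+_ (ε-h N K u a (z zero) l) (ε-cv N K u a (λ c → z (suc c)) l)) (ℤₚ.+-identityˡ _))

    z0 : Carrier → ℕ → Carrier
    z0 F zero = F
    z0 F (suc c) = 0#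

    cv-0 : ∀ a k → cv a k (λ _ → 0#) ≈ 0#
    cv-0 zero k = zeroʳ _
    cv-0 (suc a) k = trans (+-cong (zeroʳ _) (cv-0 a k)) (+-identityˡ 0#)

    cv-z0 : ∀ a k F → cv a k (z0 F) ≈ h a k * F
    cv-z0 zero k F = refl
    cv-z0 (suc a) k F = trans (+-congˡ (cv-0 a k)) (+-identityʳ _)

    ZZ : ℕ → ℕ → (ℕ → Carrier) → ℕ → Carrier
    ZZ zero p z = z
    ZZ (suc c) p z = ZZ c (suc p) (stepZ p z)

    ∂*-cv : ∀ c p a z → ∂* (rng c p) (cv a (suc p) z) ≈ cv a (suc (p ℕ.+ c)) (ZZ c p z)
    ∂*-cv zero p a z = ≡.subst (λ q → cv a (suc p) z ≈ cv a (suc q) z) (≡.sym (ℕₚ.+-identityʳ p)) refl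
    ∂*-cv (suc c) p a z = trans (∂*-cong (rng c (suc p)) (cv-step a p z)) (trans (∂*-cv c (suc p) a (stepZ p z))
      (≡.subst (λ q → cv a (suc (suc p ℕ.+ c)) (ZZ c (suc p) (stepZ p z)) ≈ cv a (suc q) (ZZ c (suc p) (stepZ p z))) (≡.sym (ℕₚ.+-suc p c)) refl))

    -- The run that moves the maximum to the end enlarges the variable set of `h` step by step up to
    -- n + 1 variables; there `ε-cv` leaves one coefficient of the row operators `ZZ`.
    ε-row : ∀ n u p a F → IsMax n u p → ε (suc n) u (h a (suc p) * F) ≡ ε n (u ∘ punch p) (ZZ (n ∸ p) p (z0 F) a)
    ε-row n u p a F m = ≡.trans (ε-max n u p _ m) (≡.trans (ε-cong n (u ∘ punch p) (trans (∂*-cong (rng (n ∸ p) p) (sym (cv-z0 a (suc p) F))) (∂*-cv (n ∸ p) p a (z0 F))))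
      (ε-cv n (suc (p ℕ.+ (n ∸ p))) (u ∘ punch p) a _ (ℕₚ.≤-trans (ℕₚ.n≤1+n n) (s≤s (ℕₚ.≤-reflexive (≡.sym (ℕₚ.m+[n∸m]≡n (proj₁ m))))))))

    ∂*-X : ∀ w j f → All (λ i → j ≢ i × j ≢ suc i) w → ∂* w (X j f) ≈ X j (∂* w f)
    ∂*-X [] j f a = refl
    ∂*-X (i ∷ w) j f ((p , q) ∷ a) = trans (∂*-cong w (∂-X-fix i j f p q)) (∂*-X w j _ a)

    c₀-X : ∀ j f → c₀ (X j f) ≡ 0ℤ
    c₀-X j f = ≡.trans (c₀-neg _) (cong ℤ.-_ (c₀-x j f))

    opaque
      unfolding ε
      ε-X-top : ∀ N u j f → N ≤ j → ε N u (X j f) ≡ 0ℤ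
      ε-X-top N u j f l = ≡.trans (c₀-cong (∂*-X (word N u) j f (All.map (λ {i} q → (λ e → ℕₚ.<⇒≱ (ℕₚ.<-trans (ℕₚ.n<1+n i) q) (≡.subst (N ≤_) e l)) , (λ e → ℕₚ.<⇒≱ q (≡.subst (N ≤_) e l))) (word-letters N u)))) (c₀-X j _)

    rng-≥ : ∀ {P : ℕ → Set} c p → (∀ i → p ≤ i → i < c ℕ.+ p → P i) → All P (rng c p)
    rng-≥ zero p q = []
    rng-≥ {P} (suc c) p q = q p ℕₚ.≤-refl (s≤s (ℕₚ.m≤n+m p c)) ∷ rng-≥ c (suc p) (λ i l l' → q i (ℕₚ.<⇒≤ l) (≡.subst (i <_) (ℕₚ.+-suc c p) l'))

    rng-++ : ∀ c d p → rng (c ℕ.+ d) p ≡ rng c p ++ rng d (c ℕ.+ p)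
    rng-++ zero d p = ≡.refl
    rng-++ (suc c) d p = cong (p ∷_) (≡.trans (rng-++ c d (suc p)) (cong (λ q → rng c (suc p) ++ rng d q) (ℕₚ.+-suc c p)))

    ∂*-far1 : ∀ i w f → All (λ j → suc i < j) w → ∂* w (∂ i f) ≈ ∂ i (∂* w f)
    ∂*-far1 i [] f a = refl
    ∂*-far1 i (j ∷ w) f (l ∷ a) = trans (∂*-cong w (sym (∂-far i j l f))) (∂*-far1 i w _ a)

    ∂*-far : ∀ w w' f → All (λ i → All (λ j → suc i < j) w') w → ∂* w' (∂* w f) ≈ ∂* w (∂* w' f)
    ∂*-far [] w' f a = refl
    ∂*-far (i ∷ w) w' f (e ∷ a) = trans (∂*-far w w' (∂ i f) a) (∂*-cong w (∂*-far1 i w' f e))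

    cy-< : ∀ c p {N j} → c ℕ.+ p < N → j < N → cy c p j < N
    cy-< zero p l k = k
    cy-< (suc c) p {N} l k = cy-< c (suc p) (≡.subst (_< N) (≡.sym (ℕₚ.+-suc c p)) l) (sw-< p (ℕₚ.≤-<-trans (s≤s (ℕₚ.m≤n+m p c)) l) k)

    cy-inj : ∀ c p {j k} → cy c p j ≡ cy c p k → j ≡ k
    cy-inj zero p e = e
    cy-inj (suc c) p e = sw-inj p (cy-inj c (suc p) e)

    Inj-cy : ∀ {N u} c p → c ℕ.+ p < N → Inj N u → Inj N (u ∘ cy c p)
    Inj-cy c p l inj a b e = cy-inj c p (inj (cy-< c p l a) (cy-< c p l b) e)

    -- Read from its last letter, the chain moves the value at c + p down past smaller ones, so
    -- `ε-asc` applies at every letter.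
    ε-chain : ∀ N u c p f → Inj N u → c ℕ.+ p < N → (∀ l → p ≤ l → l < c ℕ.+ p → u l < u (c ℕ.+ p)) →
      ε N u (∂* (rng c p) f) ≡ ε N (u ∘ cy c p) f
    ε-chain N u zero p f inj l q = ≡.refl
    ε-chain N u (suc c) p f inj l q = ≡.trans
      (ε-chain N u c (suc p) (∂ p f) inj l' (λ k a b → subst (λ z → u k < u z) (≡.sym (ℕₚ.+-suc c p)) (q k (ℕₚ.<⇒≤ a) (subst (k <_) (ℕₚ.+-suc c p) b))))
      (ε-asc N (u ∘ cy c (suc p)) p f (ℕₚ.≤-<-trans (s≤s (ℕₚ.m≤n+m p c)) l) (Inj-cy c (suc p) l' inj)
        (subst₂ _<_ (cong u (≡.sym (cy-lo c (suc p) p ℕₚ.≤-refl))) (cong u (≡.trans (≡.sym (ℕₚ.+-suc c p)) (≡.sym (cy-at c (suc p))))) (q p ℕₚ.≤-refl (s≤s (ℕₚ.m≤n+m p c)))))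
      where
      l' : c ℕ.+ suc p < N
      l' = subst (_< N) (≡.sym (ℕₚ.+-suc c p)) l

    -- The value moves down until it meets the nearest larger one, where `ε-desc` applies.
    ε-chain0 : ∀ N u c p f → Inj N u → c ℕ.+ p < N → ∀ l → p ≤ l → l < c ℕ.+ p → u (c ℕ.+ p) < u l → ε N u (∂* (rng c p) f) ≡ 0ℤ
    ε-chain0 N u zero p f inj cl l a b d = ⊥-elim (ℕₚ.<⇒≱ b a)
    ε-chain0 N u (suc c) p f inj cl l a b d with ℕₚ.m≤n⇒m<n∨m≡n a
    ... | inj₁ a' = ε-chain0 N u c (suc p) (∂ p f) inj (subst (_< N) (≡.sym (ℕₚ.+-suc c p)) cl) l a' (subst (l <_) (≡.sym (ℕₚ.+-suc c p)) b) (subst (λ z → u z < u l) (≡.sym (ℕₚ.+-suc c p)) d)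
    ... | inj₂ ≡.refl = case (allUpTo? (λ k → u (suc (p ℕ.+ k)) <? u (c ℕ.+ suc p)) c)
      where
      open import Data.Nat.Properties using (allUpTo?)
      cl' = subst (_< N) (≡.sym (ℕₚ.+-suc c p)) cl
      case : Dec (∀ {k} → k < c → u (suc (p ℕ.+ k)) < u (c ℕ.+ suc p)) → ε N u (∂* (rng (suc c) p) f) ≡ 0ℤ
      case (yes q) = ≡.trans (ε-chain N u c (suc p) (∂ p f) inj cl' (λ k a b → subst (λ z → u z < u (c ℕ.+ suc p)) (ℕₚ.m+[n∸m]≡n a)
           (q {k ∸ suc p} (ℕₚ.+-cancelʳ-< (suc p) _ _ (subst (_< c ℕ.+ suc p) (≡.sym (ℕₚ.m∸n+n≡m a)) b)))))
         (ε-desc N (u ∘ cy c (suc p)) p f (ℕₚ.≤-<-trans (s≤s (ℕₚ.m≤n+m p c)) cl) (Inj-cy c (suc p) cl' inj)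
           (subst₂ _<_ (cong u (≡.trans (≡.sym (ℕₚ.+-suc c p)) (≡.sym (cy-at c (suc p))))) (cong u (≡.sym (cy-lo c (suc p) p ℕₚ.≤-refl))) d))
      case (no q) with counterexample c (λ k → u (suc (p ℕ.+ k)) <? u (c ℕ.+ suc p)) q
      ... | k , kl , r = ε-chain0 N u c (suc p) (∂ p f) inj cl' (suc (p ℕ.+ k)) (s≤s (ℕₚ.m≤m+n p k)) kl'
          (ℕₚ.≤∧≢⇒< (ℕₚ.≮⇒≥ r) (λ e → ℕₚ.<⇒≢ kl' (≡.sym (inj cl' (ℕₚ.<-trans kl' cl') e))))
        where
        kl' : suc (p ℕ.+ k) < c ℕ.+ suc p
        kl' = subst (suc (p ℕ.+ k) <_) (≡.sym (ℕₚ.+-suc c p)) (s≤s (subst (_< c ℕ.+ p) (ℕₚ.+-comm k p) (ℕₚ.+-monoˡ-< p kl)))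

    κ : ℕ → (ℕ → ℕ) → ℕ → ℕ → Carrier → ℤ
    κ N u i s F = when (cov? u i s) (ε N (u ∘ tr i s) F)

    κ-yes : ∀ N u i s F → Cov u i s → κ N u i s F ≡ ε N (u ∘ tr i s) F
    κ-yes N u i s F c with cov? u i s
    ... | yes _ = ≡.refl
    ... | no n = ⊥-elim (n c)

    κ-no : ∀ N u i s F → ¬ Cov u i s → κ N u i s F ≡ 0ℤ
    κ-no N u i s F c with cov? u i s
    ... | yes y = ⊥-elim (c y)
    ... | no _ = ≡.refl

    κ-match : ∀ {N N' u u' i i' s s' F F'} → (Cov u i s → Cov u' i' s') → (Cov u' i' s' → Cov u i s) → ε N (u ∘ tr i s) F ≡ ε N' (u' ∘ tr i' s') F' → κ N u i s F ≡ κ N' u' i' s' F'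
    κ-match {N} {N'} {u} {u'} {i} {i'} {s} {s'} {F} {F'} f g e with cov? u i s
    ... | yes c = ≡.trans e (≡.sym (κ-yes N' u' i' s' F' (f c)))
    ... | no c = ≡.sym (κ-no N' u' i' s' F' (λ d → c (g d)))

    -- The deleted position carries the maximum, which never lies strictly between the two values of
    -- a cover, so covers correspond under `punch p`.
    κ-punch : ∀ n u p i s F → IsMax n u p → i < n → s < n →
      κ n (u ∘ punch p) i s (∂* (rng (n ∸ p) p) F) ≡ κ (suc n) u (punch p i) (punch p s) F
    κ-punch n u p i s F (pl , q) il sl = κ-match {n} {suc n} {u ∘ punch p} {u} {i} {punch p i} {s} {punch p s}
       (λ (a , b) → a , λ {l} ls il' → to a b l ls il' (l ≟ p))
       (λ (a , b) → a , λ {l} ls il' → b (punch-mono p ls) (punch-mono p il'))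
       (≡.sym (≡.trans (ε-max n (u ∘ tr (punch p i) (punch p s)) p F im) (ε-permcong n _ (λ j _ → cong u (tr-punch p i s j)))))
      where
      to : (u (punch p s) < u (punch p i)) → (∀ {l} → l < s → i < l → ¬ (u (punch p s) < u (punch p l) × u (punch p l) < u (punch p i))) →
           ∀ l → l < punch p s → punch p i < l → Dec (l ≡ p) → ¬ (u (punch p s) < u l × u l < u (punch p i))
      to a b .p ls il' (yes ≡.refl) (_ , d) = ℕₚ.<-asym d (q (punch p i) (punch-< pl il) (punch-≢ p i))
      to a b l ls il' (no ne) (c , d) with pre p l ne
        where
        open import Data.Product using (∃)
        pre : ∀ p l → l ≢ p → ∃ λ k → punch p k ≡ l
        pre zero zero ne = ⊥-elim (ne ≡.refl)
        pre zero (suc l) ne = l , ≡.refl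
        pre (suc p) zero ne = zero , ≡.refl
        pre (suc p) (suc l) ne with pre p l (λ e → ne (cong suc e))
        ... | k , e = suc k , cong suc e
      ... | k , ≡.refl = b (unmono ls) (unmono il') (c , d)
        where
        unmono : ∀ {a b} → punch p a < punch p b → a < b
        unmono {a} {b} l with a <? b
        ... | yes r = r
        ... | no r with ℕₚ.m≤n⇒m<n∨m≡n (ℕₚ.≮⇒≥ r)
        ...   | inj₁ r' = ⊥-elim (ℕₚ.<-asym l (punch-mono p r'))
        ...   | inj₂ ≡.refl = ⊥-elim (ℕₚ.<-irrefl ≡.refl l)
      fp : tr (punch p i) (punch p s) p ≡ p
      fp = tr-o _ _ p (λ e → punch-≢ p i (≡.sym e)) (λ e → punch-≢ p s (≡.sym e))
      im : IsMax n (u ∘ tr (punch p i) (punch p s)) p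
      im = pl , λ j jl ne → subst (u (tr (punch p i) (punch p s) j) <_) (cong u (≡.sym fp))
        (q _ (ℕₚ.≤-pred (tr-< (s≤s (punch-< pl il)) (s≤s (punch-< pl sl)) (s≤s jl))) (λ e → ne (tr-inj _ _ (≡.trans e (≡.sym fp)))))

    -- Monk's rule for -x_s; the hypothesis on u s kills the terms that transpose s with a later position.
    monk : ∀ N u s F → Inj N u → s < N → (∀ j → s < j → j < N → u s < u j) → ε N u (X s F) ≡ ∑ s (λ i → κ N u i s F)
    monk (suc n) u s F inj (s≤s sl) os = go (ℕₚ.<-cmp s p)
      where
      p = mp n u
      im = mp-isMax n u inj
      pl = proj₁ im
      q = proj₂ im
      u' = u ∘ punch p
      W = rng (n ∸ p) p
      inj' : Inj n u'
      inj' = Inj-punch pl inj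
      go : Tri (s < p) (s ≡ p) (p < s) → ε (suc n) u (X s F) ≡ ∑ s (λ i → κ (suc n) u i s F)
      -- With the maximum at `s` the hypothesis forces s = n. Nothing can be bumped into `s`, and
      -- x_n lies beyond all letters: both sides are zero.
      go (tri≈ _ e _) with ℕₚ.m≤n⇒m<n∨m≡n sl
      ... | inj₁ s<n = ⊥-elim (ℕₚ.<-asym (os n s<n ℕₚ.≤-refl) (subst (λ z → u n < u z) (≡.sym e) (q n ℕₚ.≤-refl (λ e' → ℕₚ.<⇒≢ s<n (≡.trans e (≡.sym e'))))))
      ... | inj₂ ≡.refl = ≡.trans (≡.trans (ε-ext n u _ (λ j jl → subst (λ z → u j < u z) (≡.sym e) (q j (ℕₚ.<⇒≤ jl) (λ e' → ℕₚ.<⇒≢ jl (≡.trans e' (≡.sym e)))))) (ε-X-top n u n F ℕₚ.≤-refl))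
          (≡.sym (∑-zero n _ (λ i il → κ-no (suc n) u i n F (λ (c , _) → ℕₚ.<-asym c (subst (λ z → u i < u z) (≡.sym e) (q i (ℕₚ.<⇒≤ il) (λ e' → ℕₚ.<⇒≢ il (≡.trans e' (≡.sym e)))))))))
      -- The run begins right of x_s and commutes with it.
      go (tri< s<p _ _) = ≡.trans (ε-max n u p _ im) (≡.trans (ε-cong n u' (∂*-X W s F (rng-≥ (n ∸ p) p (λ i a _ → (λ e → ℕₚ.<⇒≱ s<p (subst (p ≤_) (≡.sym e) a)) , (λ e → ℕₚ.<⇒≱ s<p (ℕₚ.≤-trans a (subst (i ≤_) (≡.sym e) (ℕₚ.n≤1+n i))))))))
        (≡.trans (monk n u' s (∂* W F) inj' sn os')
          (∑-cong s (λ i il → ≡.trans (κ-punch n u p i s F im (ℕₚ.<-trans il sn) sn) (cong₂ (λ a b → κ (suc n) u a b F) (punch-lo p i (ℕₚ.<-trans il s<p)) ps)))))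
        where
        ps = punch-lo p s s<p
        sn : s < n
        sn = ℕₚ.<-≤-trans s<p pl
        os' : ∀ j → s < j → j < n → u' s < u' j
        os' j a b = subst (λ z → u z < u' j) (≡.sym ps) (os (punch p j) (subst (_< punch p j) ps (punch-mono p a)) (s≤s (punch-< pl b)))
      go (tri> _ _ p<s) = case s p<s sl ≡.refl
        where
        case : ∀ s₀ → p < s₀ → s₀ ≤ n → s₀ ≡ s → ε (suc n) u (X s F) ≡ ∑ s (λ i → κ (suc n) u i s F)
        case (suc s') (s≤s p≤s') sn ≡.refl = ≡.trans (ε-max n u p _ im) (≡.trans (ε-cong n u' split) (≡.trans (ε-+ n u' _ _)
            (≡.trans (cong₂ ℤ._+_ first second) (≡.sym (∑-punch s' p (λ i → κ (suc n) u i s F) p≤s')))))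
          where
          ct = s' ∸ p
          cp : ct ℕ.+ p ≡ s'
          cp = ℕₚ.m∸n+n≡m p≤s'
          W₁ = rng ct p
          W₂ = rng (n ∸ s) s
          Weq : W ≡ W₁ ++ s' ∷ W₂
          Weq = ≡.trans (cong (λ z → rng z p) (≡.trans (arith p≤s' sn) ≡.refl)) (≡.trans (rng-++ ct (suc (n ∸ s)) p) (cong (λ z → W₁ ++ rng (suc (n ∸ s)) z) cp))
            where
            arith : ∀ {p s' n} → p ≤ s' → suc s' ≤ n → n ∸ p ≡ (s' ∸ p) ℕ.+ suc (n ∸ suc s')
            arith {p} {s'} {n} a b = ℕₚ.+-cancelʳ-≡ p _ _ (≡.trans (ℕₚ.m∸n+n≡m (ℕₚ.≤-trans a (ℕₚ.<⇒≤ b))) (≡.sym (≡.trans (ℕₚ.+-assoc (s' ∸ p) (suc (n ∸ suc s')) p)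
               (≡.trans (cong ((s' ∸ p) ℕ.+_) (ℕₚ.+-comm (suc (n ∸ suc s')) p)) (≡.trans (≡.sym (ℕₚ.+-assoc (s' ∸ p) p (suc (n ∸ suc s')))) (≡.trans (cong (ℕ._+ suc (n ∸ suc s')) (ℕₚ.m∸n+n≡m a))
                (≡.trans (ℕₚ.+-suc s' _) (ℕₚ.m+[n∸m]≡n b))))))))
          G = ∂* W₁ F
          W-F : ∀ f → ∂* W f ≡ ∂* W₂ (∂ s' (∂* W₁ f))
          W-F f = ≡.trans (cong (λ w → ∂* w f) Weq) (∂*-++ W₁ (s' ∷ W₂) f)
          -- The letter s - 1 of the run meets x_s. By `∂-X` it produces a term without x_s, which
          -- is the summand i = p, and a term with x_(s-1) for the induction, where `punch p` lowers
          -- `s` by one.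
          split : ∂* W (X s F) ≈ ∂* W₂ G + X s' (∂* W F)
          split = trans (reflexive (W-F (X s F))) (trans (∂*-cong W₂ (trans (∂-cong s' (∂*-X W₁ s F (rng-≥ ct p (λ i a b → (λ { ≡.refl → ℕₚ.<⇒≱ (ℕₚ.<-trans (ℕₚ.n<1+n s') (subst (i <_) cp b)) ℕₚ.≤-refl }) , (λ e → ℕₚ.<⇒≢ (subst (i <_) cp b) (≡.sym (ℕₚ.suc-injective e)))))))
             (∂-X s' G))) (trans (∂*-+ W₂ G _) (+-congˡ (trans (∂*-X W₂ s' (∂ s' G) (rng-≥ (n ∸ s) s (λ i a _ → (λ e → ℕₚ.<⇒≱ a (ℕₚ.≤-reflexive (≡.sym e))) , (λ e → ℕₚ.<⇒≱ a (ℕₚ.≤-trans (ℕₚ.n≤1+n i) (ℕₚ.≤-reflexive (≡.sym e)))))))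
              (X-cong s' (sym (reflexive (W-F F))))))))
          ps' : punch p s' ≡ s
          ps' = punch-hi p s' p≤s'
          os' : ∀ j → s' < j → j < n → u' s' < u' j
          os' j a b = subst (λ z → u z < u' j) (≡.sym ps') (os (punch p j) (subst (_< punch p j) ps' (punch-mono p a)) (s≤s (punch-< pl b)))
          second : ε n u' (X s' (∂* W F)) ≡ ∑ s' (λ i → κ (suc n) u (punch p i) s F)
          second = ≡.trans (monk n u' s' (∂* W F) inj' sn os') (∑-cong s' (λ i il → ≡.trans (κ-punch n u p i s' F im (ℕₚ.<-trans il sn) sn) (cong (λ b → κ (suc n) u (punch p i) b F) ps')))
          H = ∂* W₂ F
          comm : ∂* W₂ G ≈ ∂* W₁ H
          comm = ∂*-far W₁ W₂ F (rng-≥ ct p (λ i _ b → rng-≥ (n ∸ s) s (λ j a _ → ℕₚ.≤-trans (s≤s (subst (i <_) cp b)) a)))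
          cpn : ct ℕ.+ p < n
          cpn = subst (_< n) (≡.sym cp) sn
          val : u' (ct ℕ.+ p) ≡ u s
          val = cong u (≡.trans (cong (punch p) cp) ps')
          -- Without the letter s - 1 the run falls into two commuting chains. For a cover the lower
          -- one cycles and the upper one is the run of `u ∘ tr p s`, whose maximum is at `s`;
          -- otherwise the lower one meets a larger value and gives zero.
          first : ε n u' (∂* W₂ G) ≡ κ (suc n) u p s F
          first with cov? u p s
          ... | yes (_ , cv) = ≡.trans (ε-cong n u' comm) (≡.trans (ε-chain n u' ct p H inj' cpn (λ l a b → subst (u' l <_) (≡.sym val) (lt l a (subst (l <_) cp b))))
               (≡.trans (ε-permcong n H (λ j _ → cong u (≡.trans (cy-tr ct p j) (cong (λ z → tr p (suc z) (punch (suc z) j)) cp)))) (≡.sym (ε-max n (u ∘ tr p s) s F im'))))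
            where
            lt : ∀ l → p ≤ l → l < s' → u (punch p l) < u s
            lt l a b = ℕₚ.≤∧≢⇒< (ℕₚ.≮⇒≥ (λ d → cv (s≤s b) (s≤s a) (subst (λ z → u s < u z) (punch-hi p l a) d , q (suc l) (ℕₚ.≤-trans b (ℕₚ.<⇒≤ sn)) (λ e → ℕₚ.<⇒≢ (s≤s a) (≡.sym e)))))
               (λ e → ℕₚ.<⇒≢ (s≤s b) (≡.trans (≡.sym (punch-hi p l a)) (inj (s≤s (punch-< pl (ℕₚ.<-trans b sn))) (s≤s sn) e)))
            im' : IsMax n (u ∘ tr p s) s
            im' = sn , λ j jl ne → subst (u (tr p s j) <_) (cong u (≡.sym (tr-r p s))) (q (tr p s j) (ℕₚ.≤-pred (tr-< {p} {s} {suc n} (s≤s pl) (s≤s sn) (s≤s jl))) (λ e → ne (tr-inj p s (≡.trans e (≡.sym (tr-r p s))))))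
          ... | no nc = ≡.trans (ε-cong n u' comm) (bad (allUpTo? (λ l → (p <? l) →-dec (u l <? u s)) s))
            where
            open import Data.Nat.Properties using (allUpTo?)
            open import Relation.Nullary.Decidable using (_→-dec_)
            us<up : u s < u p
            us<up = q s sn (λ e → ℕₚ.<⇒≢ (s≤s p≤s') (≡.sym e))
            bad : Dec (∀ {l} → l < s → p < l → u l < u s) → ε n u' (∂* W₁ H) ≡ 0ℤ
            bad (yes r) = ⊥-elim (nc (us<up , λ ls il (d , _) → ℕₚ.<-asym d (r ls il)))
            bad (no r) with counterexample s (λ l → (p <? l) →-dec (u l <? u s)) r
            ... | l₀ , ls₀ , d₀ with p <? l₀ | u l₀ <? u s
            ...   | no a | _ = ⊥-elim (d₀ (λ b → ⊥-elim (a b)))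
            ...   | yes _ | yes b = ⊥-elim (d₀ (λ _ → b))
            bad (no r) | suc l , s≤s ls , _ | yes (s≤s pl') | no d = ε-chain0 n u' ct p H inj' cpn l pl' (subst (l <_) (≡.sym cp) ls) (subst₂ _<_ (≡.sym val) (cong u (≡.sym (punch-hi p l pl')))
                 (ℕₚ.≤∧≢⇒< (ℕₚ.≮⇒≥ d) (λ e → ℕₚ.<⇒≢ (s≤s ls) (≡.sym (inj (s≤s sn) (s≤s (ℕₚ.≤-trans ls (ℕₚ.<⇒≤ sn))) e)))))

-- Counting bump paths.

module PathCounting where
  open Words
  open Transpositions
  open import Data.Nat using (_+_)
  open ℕₚ
  open ≡

  opaque
    ∑ᴺ : ℕ → (ℕ → ℕ) → ℕ
    ∑ᴺ zero f = 0
    ∑ᴺ (suc n) f = ∑ᴺ n f + f n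

  whenᴺ : {A : Set} → Dec A → ℕ → ℕ
  whenᴺ (yes _) z = z
  whenᴺ (no _) z = 0

  when-pos : ∀ {A : Set} (d : Dec A) z → 0 < whenᴺ d z → A × 0 < z
  when-pos (yes a) z l = a , l

  when-yes : ∀ {A : Set} (d : Dec A) z → A → whenᴺ d z ≡ z
  when-yes (yes a) z _ = refl
  when-yes (no n) z a = ⊥-elim (n a)

  when-≤ : ∀ {A : Set} (d : Dec A) {z k} → z ≤ k → whenᴺ d z ≤ k
  when-≤ (yes _) l = l
  when-≤ (no _) l = z≤n

  opaque
    unfolding ∑ᴺ
    ∑ᴺ-pos : ∀ n f → 0 < ∑ᴺ n f → Σ ℕ λ i → i < n × 0 < f i
    ∑ᴺ-pos (suc n) f l with f n in e
    ... | suc k = n , ≤-refl , subst (0 <_) (sym e) (s≤s z≤n)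
    ... | zero with ∑ᴺ-pos n f (subst (0 <_) (+-identityʳ _) l)
    ...   | i , a , b = i , m≤n⇒m≤1+n a , b

  opaque
    unfolding ∑ᴺ
    ∑ᴺ-has : ∀ n f i → i < n → f i ≤ ∑ᴺ n f
    ∑ᴺ-has (suc n) f i l with m≤n⇒m<n∨m≡n (≤-pred l)
    ... | inj₁ l' = ≤-trans (∑ᴺ-has n f i l') (m≤m+n _ _)
    ... | inj₂ refl = m≤n+m _ _

  pos-+ : ∀ a b → 0 < a + b → 0 < a ⊎ 0 < b
  pos-+ zero b l = inj₂ l
  pos-+ (suc a) b l = inj₁ (s≤s z≤n)

  0or : ∀ a → a ≡ 0 ⊎ 0 < a
  0or zero = inj₁ refl
  0or (suc a) = inj₂ (s≤s z≤n)

  +≤1 : ∀ a b → a ≤ 1 → b ≤ 1 → (0 < a → 0 < b → ⊥) → a + b ≤ 1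
  +≤1 a b p q ex with 0or a | 0or b
  ... | inj₁ refl | _ = q
  ... | inj₂ l | inj₁ refl = subst (_≤ 1) (sym (+-identityʳ a)) p
  ... | inj₂ l | inj₂ l' = ⊥-elim (ex l l')

  opaque
    unfolding ∑ᴺ
    ∑ᴺ≤1 : ∀ n f → (∀ i → i < n → f i ≤ 1) → (∀ i j → i < n → j < n → 0 < f i → 0 < f j → i ≡ j) → ∑ᴺ n f ≤ 1
    ∑ᴺ≤1 zero f b u = z≤n
    ∑ᴺ≤1 (suc n) f b u = +≤1 _ _ (∑ᴺ≤1 n f (λ i l → b i (m≤n⇒m≤1+n l)) (λ i j a c → u i j (m≤n⇒m≤1+n a) (m≤n⇒m≤1+n c))) (b n ≤-refl)
      (λ p q → let (i , l , r) = ∑ᴺ-pos n f p in <⇒≢ l (u i n (m≤n⇒m≤1+n l) ≤-refl r q))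

  -- Number of ways, weighted by K, to bump B of the slots ss, taken in the given order.
  cnt : List ℕ → ℕ → ((ℕ → ℕ) → ℕ) → (ℕ → ℕ) → ℕ
  cnt [] zero K u = K u
  cnt [] (suc B) K u = 0
  cnt (s ∷ ss) zero K u = cnt ss zero K u
  cnt (s ∷ ss) (suc B) K u = cnt ss (suc B) K u + ∑ᴺ s (λ i → whenᴺ (cov? u i s) (cnt ss B K (u ∘ tr i s)))

  data Reach : List ℕ → ℕ → (ℕ → ℕ) → (ℕ → ℕ) → Set where
    done : ∀ {u} → Reach [] 0 u u
    skip : ∀ {s ss B u v} → Reach ss B u v → Reach (s ∷ ss) B u v
    bump : ∀ {s ss B u v} i → i < s → Cov u i s → Reach ss B (u ∘ tr i s) v → Reach (s ∷ ss) (suc B) u v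

  cnt-pos : ∀ ss B K u → 0 < cnt ss B K u → Σ (ℕ → ℕ) λ v → Reach ss B u v × 0 < K v
  cnt-pos [] zero K u l = u , done , l
  cnt-pos (s ∷ ss) zero K u l = let (v , r , k) = cnt-pos ss zero K u l in v , skip r , k
  cnt-pos (s ∷ ss) (suc B) K u l with pos-+ (cnt ss (suc B) K u) _ l
  ... | inj₁ l' = let (v , r , k) = cnt-pos ss (suc B) K u l' in v , skip r , k
  ... | inj₂ l' with ∑ᴺ-pos s _ l'
  ...   | i , il , p with when-pos (cov? u i s) _ p
  ...     | c , p' = let (v , r , k) = cnt-pos ss B K (u ∘ tr i s) p' in v , bump i il c r , k

  pos-cnt : ∀ {ss B u v} K → Reach ss B u v → 0 < K v → 0 < cnt ss B K u
  pos-cnt K done k = k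
  pos-cnt {B = zero} K (skip r) k = pos-cnt K r k
  pos-cnt {B = suc B} K (skip r) k = ≤-trans (pos-cnt K r k) (m≤m+n _ _)
  pos-cnt {s ∷ ss} {suc B} {u} K (bump i il c r) k = ≤-trans (subst (0 <_) (sym (when-yes (cov? u i s) _ c)) (pos-cnt K r k))
    (≤-trans (∑ᴺ-has s (λ i → whenᴺ (cov? u i s) (cnt ss B K (u ∘ tr i s))) i il) (m≤n+m _ _))

  Desc : List ℕ → Set
  Desc ss = Linked (λ a b → b < a) ss

  reach-above : ∀ {ss B u v} j → Reach ss B u v → All (_< j) ss → v j ≡ u j
  reach-above j done a = refl
  reach-above j (skip r) (_ ∷ a) = reach-above j r a
  reach-above {u = u} j (bump {s} i il c r) (l ∷ a) = trans (reach-above j r a) (cong u (tr-o i s j (λ { refl → <-asym il l }) (λ { refl → <-irrefl refl l })))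

  desc-all : ∀ {s ss} → Desc (s ∷ ss) → All (_< s) ss
  desc-all [-] = []
  desc-all (l ∷ d) = l ∷ All.map (λ k → <-trans k l) (desc-all d)

  -- Bumps at later, smaller slots leave the value at `s` alone, so this value tells whether `s` was
  -- bumped and from where. Endpoints that agree in all slots have the same path.
  cnt≤1 : ∀ n ss B K u → Inj n u → Desc ss → All (_< n) ss →
    (∀ v → Reach ss B u v → K v ≤ 1) →
    (∀ v v' → Reach ss B u v → Reach ss B u v' → 0 < K v → 0 < K v' → All (λ s → v s ≡ v' s) ss) → cnt ss B K u ≤ 1
  cnt≤1 n [] zero K u inj d a b q = b u done
  cnt≤1 n [] (suc B) K u inj d a b q = z≤n
  cnt≤1 n (s ∷ ss) zero K u inj d (_ ∷ a) b q = cnt≤1 n ss zero K u inj (Linked.tail d) a (λ v r → b v (skip r)) (λ v v' r r' k k' → All.tail (q v v' (skip r) (skip r') k k'))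
  cnt≤1 n (s ∷ ss) (suc B) K u inj d (sn ∷ a) b q = +≤1 _ _
    (cnt≤1 n ss (suc B) K u inj (Linked.tail d) a (λ v r → b v (skip r)) (λ v v' r r' k k' → All.tail (q v v' (skip r) (skip r') k k')))
    (∑ᴺ≤1 s _ each uniq)
    (λ p p' → excl p p')
    where
    below = desc-all d
    val : ∀ i → i < s → ∀ {B v} → Reach ss B (u ∘ tr i s) v → v s ≡ u i
    val i il r = trans (reach-above s r below) (cong u (tr-r i s))
    each : ∀ i → i < s → whenᴺ (cov? u i s) (cnt ss B K (u ∘ tr i s)) ≤ 1
    each i il with cov? u i s
    ... | no _ = z≤n
    ... | yes c = cnt≤1 n ss B K (u ∘ tr i s) (Inj-tr (<-trans il sn) sn inj) (Linked.tail d) a (λ v r → b v (bump i il c r))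
         (λ v v' r r' k k' → All.tail (q v v' (bump i il c r) (bump i il c r') k k'))
    uniq : ∀ i j → i < s → j < s → 0 < whenᴺ (cov? u i s) (cnt ss B K (u ∘ tr i s)) → 0 < whenᴺ (cov? u j s) (cnt ss B K (u ∘ tr j s)) → i ≡ j
    uniq i j il jl p p' with when-pos (cov? u i s) _ p | when-pos (cov? u j s) _ p'
    ... | c , p₁ | c' , p₂ with cnt-pos ss B K (u ∘ tr i s) p₁ | cnt-pos ss B K (u ∘ tr j s) p₂
    ... | v , r , k | v' , r' , k' = inj (<-trans il sn) (<-trans jl sn)
         (trans (sym (val i il r)) (trans (All.head (q v v' (bump i il c r) (bump j jl c' r') k k')) (val j jl r')))
    excl : 0 < cnt ss (suc B) K u → 0 < ∑ᴺ s (λ i → whenᴺ (cov? u i s) (cnt ss B K (u ∘ tr i s))) → ⊥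
    excl p p' with cnt-pos ss (suc B) K u p | ∑ᴺ-pos s _ p'
    ... | v , r , k | i , il , p₂ with when-pos (cov? u i s) _ p₂
    ... | c , p₃ with cnt-pos ss B K (u ∘ tr i s) p₃
    ... | v' , r' , k' = <⇒≢ il (inj (<-trans il sn) sn
          (trans (sym (val i il r')) (trans (sym (All.head (q v v' (skip r) (bump i il c r') k k'))) (reach-above s r below))))

  opaque
    unfolding ∑ᴺ
    ∑ᴺ-+ : ∀ n f g → ∑ᴺ n (λ i → f i + g i) ≡ ∑ᴺ n f + ∑ᴺ n g
    ∑ᴺ-+ zero f g = refl
    ∑ᴺ-+ (suc n) f g = trans (cong (_+ (f n + g n)) (∑ᴺ-+ n f g)) (+-interchange (∑ᴺ n f) (∑ᴺ n g) (f n) (g n))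
      where
      open import Algebra.Properties.CommutativeSemigroup +-commutativeSemigroup using () renaming (interchange to +-interchange)

  opaque
    unfolding ∑ᴺ
    ∑ᴺ-cong : ∀ n {f g} → (∀ i → f i ≡ g i) → ∑ᴺ n f ≡ ∑ᴺ n g
    ∑ᴺ-cong zero e = refl
    ∑ᴺ-cong (suc n) e = cong₂ _+_ (∑ᴺ-cong n e) (e n)

  cnt-+ : ∀ ss B K K₁ K₂ u → (∀ v → K v ≡ K₁ v + K₂ v) → cnt ss B K u ≡ cnt ss B K₁ u + cnt ss B K₂ u
  cnt-+ [] zero K K₁ K₂ u e = e u
  cnt-+ [] (suc B) K K₁ K₂ u e = refl
  cnt-+ (s ∷ ss) zero K K₁ K₂ u e = cnt-+ ss zero K K₁ K₂ u e
  cnt-+ (s ∷ ss) (suc B) K K₁ K₂ u e = trans (cong₂ _+_ (cnt-+ ss (suc B) K K₁ K₂ u e)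
      (trans (∑ᴺ-cong s (λ i → w (cov? u i s) i)) (∑ᴺ-+ s _ _))) (+-interchange (cnt ss (suc B) K₁ u) (cnt ss (suc B) K₂ u) _ _)
    where
    open import Algebra.Properties.CommutativeSemigroup +-commutativeSemigroup using () renaming (interchange to +-interchange)
    w : ∀ {A : Set} (d : Dec A) i → whenᴺ d (cnt ss B K (u ∘ tr i s)) ≡ whenᴺ d (cnt ss B K₁ (u ∘ tr i s)) + whenᴺ d (cnt ss B K₂ (u ∘ tr i s))
    w (yes _) i = cnt-+ ss B K K₁ K₂ (u ∘ tr i s) e
    w (no _) i = refl

  -- The weight is split according to `P`, and `cnt≤1` bounds both parts.
  cnt≤2 : ∀ n ss B K u {P : (ℕ → ℕ) → Set} (P? : ∀ v → Dec (P v)) → Inj n u → Desc ss → All (_< n) ss →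
    (∀ v → Reach ss B u v → K v ≤ 1) →
    (∀ v v' → Reach ss B u v → Reach ss B u v' → 0 < K v → 0 < K v' → (P v × P v') ⊎ (¬ P v × ¬ P v') → All (λ s → v s ≡ v' s) ss) → cnt ss B K u ≤ 2
  cnt≤2 n ss B K u {P} P? inj d a b q = subst (_≤ 2) (sym (cnt-+ ss B K K₁ K₂ u split)) (+-mono-≤
     (cnt≤1 n ss B K₁ u inj d a (λ v r → when-≤ (P? v) (b v r)) (λ v v' r r' k k' → let (p , l) = when-pos (P? v) _ k ; (p' , l') = when-pos (P? v') _ k' in q v v' r r' l l' (inj₁ (p , p'))))
     (cnt≤1 n ss B K₂ u inj d a (λ v r → when-≤ (¬? (P? v)) (b v r)) (λ v v' r r' k k' → let (p , l) = when-pos (¬? (P? v)) _ k ; (p' , l') = when-pos (¬? (P? v')) _ k' in q v v' r r' l l' (inj₂ (p , p')))))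
    where
    open import Relation.Nullary.Decidable using (¬?)
    K₁ = λ v → whenᴺ (P? v) (K v)
    K₂ = λ v → whenᴺ (¬? (P? v)) (K v)
    split : ∀ v → K v ≡ K₁ v + K₂ v
    split v with P? v
    ... | yes _ = sym (+-identityʳ _)
    ... | no _ = refl

-- The endpoint of two passes determines the slot values between them.

module SlotPaths where
  open DividedDifferences using (sw; sw-at; sw-at'; sw-fix)
  open Words
  open Transpositions
  open PathCounting
  open ℕₚ
  open ≡

  data Step (u : ℕ → ℕ) (s : ℕ) : (ℕ → ℕ) → Set where
    stay : Step u s u
    hop : ∀ i → i < s → Cov u i s → Step u s (u ∘ tr i s)

  step-slot : ∀ {u s v} → Step u s v → v s ≡ u s ⊎ Σ ℕ λ i → i < s × Cov u i s × v s ≡ u i × v i ≡ u s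
  step-slot stay = inj₁ refl
  step-slot {u} {s} (hop i l c) = inj₂ (i , l , c , cong u (tr-r i s) , cong u (tr-l i s))

  step-below : ∀ {u s v} → Step u s v → ∀ j → j < s → v j ≡ u j ⊎ (v j ≡ u s × v s ≡ u j × Cov u j s)
  step-below stay j l = inj₁ refl
  step-below {u} {s} (hop i il c) j l = go (j ≟ i)
    where
    go : Dec (j ≡ i) → u (tr i s j) ≡ u j ⊎ (u (tr i s j) ≡ u s × u (tr i s s) ≡ u j × Cov u j s)
    go (yes refl) = inj₂ (cong u (tr-l j s) , cong u (tr-r j s) , c)
    go (no ne) = inj₁ (cong u (tr-o i s j ne (<⇒≢ l)))

  step-above : ∀ {u s v} → Step u s v → ∀ j → s < j → v j ≡ u j
  step-above stay j l = refl
  step-above {u} {s} (hop i il c) j l = cong u (tr-o i s j (λ e → <⇒≢ (<-trans il l) (sym e)) (λ e → <⇒≢ l (sym e)))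

  step-det : ∀ {n u s v v'} → Inj n u → s < n → Step u s v → Step u s v' → v s ≡ v' s → v ≡ v'
  step-det inj sn stay stay e = refl
  step-det {u = u} {s} inj sn stay (hop i il (c , _)) e = ⊥-elim (<⇒≢ c (trans e (cong u (tr-r i s))))
  step-det {u = u} {s} inj sn (hop i il (c , _)) stay e = ⊥-elim (<⇒≢ c (trans (sym e) (cong u (tr-r i s))))
  step-det {u = u} {s} inj sn (hop i il c) (hop j jl c') e with inj (<-trans il sn) (<-trans jl sn) (trans (sym (cong u (tr-r i s))) (trans e (cong u (tr-r j s))))
  ... | refl = refl

  step-inj : ∀ {n u s v} → s < n → Inj n u → Step u s v → Inj n v
  step-inj sn inj stay = inj
  step-inj sn inj (hop i il c) = Inj-tr (<-trans il sn) sn inj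

  step-≥ : ∀ {u s v} → Step u s v → u s ≤ v s
  step-≥ stay = ≤-refl
  step-≥ {u} {s} (hop i il (c , _)) = <⇒≤ (subst (u s <_) (cong u (sym (tr-r i s))) c)

  Max₂ : ℕ → ℕ → ℕ → Set
  Max₂ f a b = (f ≡ a ⊎ f ≡ b) × a ≤ f × b ≤ f

  Max₂-uniq : ∀ {f g a b} → Max₂ f a b → Max₂ g a b → f ≡ g
  Max₂-uniq (inj₁ refl , _ , l) (inj₁ refl , _) = refl
  Max₂-uniq (inj₁ refl , _ , l) (inj₂ refl , k , _) = ≤-antisym k l
  Max₂-uniq (inj₂ refl , l , _) (inj₁ refl , _ , k) = ≤-antisym k l
  Max₂-uniq (inj₂ refl , _) (inj₂ refl , _) = refl

  Max₃ : ℕ → ℕ → ℕ → ℕ → Set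
  Max₃ f a b c = (f ≡ a ⊎ f ≡ b ⊎ f ≡ c) × a ≤ f × b ≤ f × c ≤ f

  Max₃-≤ : ∀ {f g a b c} → Max₃ f a b c → Max₃ g a b c → f ≤ g
  Max₃-≤ (inj₁ refl , _) (_ , l , _) = l
  Max₃-≤ (inj₂ (inj₁ refl) , _) (_ , _ , l , _) = l
  Max₃-≤ (inj₂ (inj₂ refl) , _) (_ , _ , _ , l) = l

  module Slots (m : ℕ) where
    s₁ s₂ s₃ n : ℕ
    s₁ = suc m
    s₂ = suc s₁
    s₃ = suc s₂
    n = suc s₃

    s₁<n : s₁ < n
    s₁<n = s≤s (s≤s (m≤n⇒m≤1+n (m≤n⇒m≤1+n ≤-refl)))
    s₂<n : s₂ < n
    s₂<n = s≤s (m≤n⇒m≤1+n ≤-refl)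
    s₃<n : s₃ < n
    s₃<n = ≤-refl
    s₁<s₃ : s₁ < s₃
    s₁<s₃ = m≤n⇒m≤1+n ≤-refl

    lo<n : ∀ {a} → a ≤ s₁ → a < n
    lo<n l = ≤-<-trans l s₁<n
    lo≢₂ : ∀ {a} → a ≤ s₁ → a ≢ s₂
    lo≢₂ l refl = 1+n≰n l
    lo≢₃ : ∀ {a} → a ≤ s₁ → a ≢ s₃
    lo≢₃ l refl = 1+n≰n (≤-trans (n≤1+n _) l)

    -- brings the value at s₃ to position s₁
    U : (ℕ → ℕ) → ℕ → ℕ
    U v = v ∘ sw s₂ ∘ sw s₁

    U-lo : ∀ v j → j ≤ m → U v j ≡ v j
    U-lo v j l = cong v (trans (cong (sw s₂) (sw-fix s₁ j (<⇒≢ (s≤s l)) (<⇒≢ (s≤s (m≤n⇒m≤1+n l))))) (sw-fix s₂ j (<⇒≢ (s≤s (m≤n⇒m≤1+n l))) (<⇒≢ (s≤s (m≤n⇒m≤1+n (m≤n⇒m≤1+n l))))))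
    U₁ : ∀ v → U v s₁ ≡ v s₃
    U₁ v = cong v (trans (cong (sw s₂) (sw-at s₁)) (sw-at s₂))
    U₂ : ∀ v → U v s₂ ≡ v s₁
    U₂ v = cong v (trans (cong (sw s₂) (sw-at' s₁)) (sw-fix s₂ s₁ (<⇒≢ ≤-refl) (<⇒≢ s₁<s₃)))
    U₃ : ∀ v → U v s₃ ≡ v s₂
    U₃ v = cong v (trans (cong (sw s₂) (sw-fix s₁ s₃ (λ e → <⇒≢ s₁<s₃ (sym e)) (λ e → <⇒≢ ≤-refl (sym e)))) (sw-at' s₂))

    -- A cover tested only at positions up to `s₁`; in this form it is unaffected by an exchange of
    -- `s₂` and `s₃`.
    CW : (ℕ → ℕ) → ℕ → ℕ → Set
    CW u a s = u s < u a × (∀ l → a < l → l ≤ s₁ → ¬ (u s < u l × u l < u a))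

    CW-≤ : ∀ {u a s} → CW u a s → u s < u s₁ → a ≤ s₁ → u a ≤ u s₁
    CW-≤ {u} {a} (_ , q) l al with m≤n⇒m<n∨m≡n al
    ... | inj₂ refl = ≤-refl
    ... | inj₁ al' = ≮⇒≥ (λ k → q s₁ al' ≤-refl (l , k))

    -- The possible second passes, indexed by the number of bumps. With two bumps the order of the
    -- slot values matters: if u s₃ < u s₂, the slots are exchanged for the count, so `s₂` is bumped
    -- before `s₃` and the descent of `w` at `s₂` remains as a condition.
    data Form (w u : ℕ → ℕ) : ℕ → Set where
      same : (∀ j → j < n → w j ≡ u j) → Form w u 0
      alpha : ∀ a → a ≤ s₁ → CW u a s₃ → (∀ j → j < n → w j ≡ u (tr a s₃ j)) → Form w u 1
      beta : ∀ a → a ≤ s₁ → CW u a s₂ → (∀ j → j < n → w j ≡ u (tr a s₂ j)) → Form w u 1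
      NI : ∀ a₂ a₁ → a₂ ≤ s₁ → a₁ ≤ s₁ → u s₂ < u s₃ → CW u a₂ s₃ → CW (u ∘ tr a₂ s₃) a₁ s₂ →
        (∀ j → j < n → w j ≡ u (tr a₂ s₃ (tr a₁ s₂ j))) → Form w u 2
      IN : ∀ a₁ a₂ → a₁ ≤ s₁ → a₂ ≤ s₁ → u s₃ < u s₂ → CW u a₁ s₂ → CW (u ∘ tr a₁ s₂) a₂ s₃ →
        (∀ j → j < n → w j ≡ u (tr a₁ s₂ (tr a₂ s₃ j))) → w s₃ < w s₂ → Form w u 2

    module Unique (u₁ w : ℕ → ℕ) (inj₁ : Inj n u₁) (injw : Inj n w) (c₁₂ : u₁ s₁ < u₁ s₂) (c₂₃ : u₁ s₂ < u₁ s₃) where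
      open Sum using () renaming (inj₁ to left; inj₂ to right)

      -- A whole path: `Y`, `Z` and `v` are reached after the slots `s₃`, `s₂` and `s₁` of the first
      -- pass, `l₁` and `l₂` make the divided differences between the passes ascents, and `form` is
      -- the second pass.
      record Info (A : ℕ) (v : ℕ → ℕ) : Set where
        field
          Y Z : ℕ → ℕ
          st₃ : Step u₁ s₃ Y
          st₂ : Step Y s₂ Z
          st₁ : Step Z s₁ v
          l₁ : v s₁ < v s₃
          l₂ : v s₂ < v s₃
          form : Form w (U v) A
        injY : Inj n Y
        injY = step-inj s₃<n inj₁ st₃
        injZ : Inj n Z
        injZ = step-inj s₂<n injY st₂
        injv : Inj n v
        injv = step-inj s₁<n injZ st₁
        Y₂ : Y s₂ ≡ u₁ s₂
        Y₂ with step-below st₃ s₂ ≤-refl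
        ... | left e = e
        ... | right (_ , _ , (c , _)) = ⊥-elim (<-asym c c₂₃)
        Y₁ : Y s₁ ≡ u₁ s₁
        Y₁ with step-below st₃ s₁ s₁<s₃
        ... | left e = e
        ... | right (_ , _ , (c , _)) = ⊥-elim (<-asym c (<-trans c₁₂ c₂₃))
        Z₁ : Z s₁ ≡ u₁ s₁
        Z₁ with step-below st₂ s₁ ≤-refl
        ... | left e = trans e Y₁
        ... | right (_ , _ , (c , _)) = ⊥-elim (<-asym (subst₂ _<_ Y₂ Y₁ c) c₁₂)
        v₃ : v s₃ ≡ Y s₃
        v₃ = trans (step-above st₁ s₃ s₁<s₃) (step-above st₂ s₃ ≤-refl)
        v₂ : v s₂ ≡ Z s₂
        v₂ = step-above st₁ s₂ ≤-refl
        v₂≥ : u₁ s₂ ≤ v s₂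
        v₂≥ = subst₂ _≤_ Y₂ (sym v₂) (step-≥ st₂)
        ulo : ∀ {j} → j ≤ m → U v j ≡ v j
        ulo {j} l = U-lo v j l
        bumped-lo : ∀ {i} → i < s₂ → Cov Y i s₂ → i ≤ m
        bumped-lo {i} l (c , _) with m≤n⇒m<n∨m≡n (≤-pred l)
        ... | left k = ≤-pred k
        ... | right refl = ⊥-elim (<-asym (subst₂ _<_ Y₂ Y₁ c) c₁₂)
        small : ∀ {i} → i ≤ m → Z i ≡ u₁ s₂ → v i ≤ u₁ s₂
        small {i} l e with step-below st₁ i (s≤s l)
        ... | left e' = ≤-reflexive (trans e' e)
        ... | right (e' , _) = ≤-trans (≤-reflexive (trans e' Z₁)) (<⇒≤ c₁₂)

      open Info

      sameY : ∀ {A A' v v'} (π : Info A v) (π' : Info A' v') → v s₃ ≡ v' s₃ → Y π ≡ Y π'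
      sameY π π' e = step-det inj₁ s₃<n (st₃ π) (st₃ π') (trans (sym (v₃ π)) (trans e (v₃ π')))

      sameZ : ∀ {A A' v v'} (π : Info A v) (π' : Info A' v') → Y π ≡ Y π' → v s₂ ≡ v' s₂ → Z π ≡ Z π'
      sameZ π π' refl e = step-det (injY π) s₂<n (st₂ π) (st₂ π') (trans (sym (v₂ π)) (trans e (v₂ π')))

      -- In `U v` the value v s₃ stands at `s₁`. It stays there or, for a = s₁, enters `s₃`; the
      -- cover condition or `l₂` bounds the other value.
      α-max : ∀ {v} → v s₁ < v s₃ → v s₂ < v s₃ → ∀ a → a ≤ s₁ → CW (U v) a s₃ → (∀ j → j < n → w j ≡ U v (tr a s₃ j)) → Max₂ (v s₃) (w s₁) (w s₃)
      α-max {v} l₁ l₂ a al cw e with m≤n⇒m<n∨m≡n al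
      ... | right refl = right (sym w₃) , subst (_≤ v s₃) (sym (trans (e s₁ s₁<n) (trans (cong (U v) (tr-l s₁ s₃)) (U₃ v)))) (<⇒≤ l₂) , ≤-reflexive w₃
        where w₃ = trans (e s₃ s₃<n) (trans (cong (U v) (tr-r s₁ s₃)) (U₁ v))
      ... | left a<s₁ = left (sym w₁) , ≤-reflexive w₁ , subst₂ _≤_ (sym (trans (e s₃ s₃<n) (cong (U v) (tr-r a s₃)))) (U₁ v) (CW-≤ {U v} {a} {s₃} cw (subst₂ _<_ (sym (U₃ v)) (sym (U₁ v)) l₂) al)
        where w₁ = trans (e s₁ s₁<n) (trans (cong (U v) (tr-o a s₃ s₁ (λ q → <⇒≢ a<s₁ (sym q)) (<⇒≢ s₁<s₃))) (U₁ v))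

      β-max : ∀ {v} → v s₁ < v s₃ → v s₂ < v s₃ → ∀ a → a ≤ s₁ → CW (U v) a s₂ → (∀ j → j < n → w j ≡ U v (tr a s₂ j)) → Max₂ (v s₃) (w s₁) (w s₂)
      β-max {v} l₁ l₂ a al cw e with m≤n⇒m<n∨m≡n al
      ... | right refl = right (sym w₂) , subst (_≤ v s₃) (sym (trans (e s₁ s₁<n) (trans (cong (U v) (tr-l s₁ s₂)) (U₂ v)))) (<⇒≤ l₁) , ≤-reflexive w₂
        where w₂ = trans (e s₂ s₂<n) (trans (cong (U v) (tr-r s₁ s₂)) (U₁ v))
      ... | left a<s₁ = left (sym w₁) , ≤-reflexive w₁ , subst₂ _≤_ (sym (trans (e s₂ s₂<n) (cong (U v) (tr-r a s₂)))) (U₁ v) (CW-≤ {U v} {a} {s₂} cw (subst₂ _<_ (sym (U₂ v)) (sym (U₁ v)) l₁) al)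
        where w₁ = trans (e s₁ s₁<n) (trans (cong (U v) (tr-o a s₂ s₁ (λ q → <⇒≢ a<s₁ (sym q)) (<⇒≢ ≤-refl))) (U₁ v))

      -- Say `π` bumped v s₂ from position `i`. In `π'` this value is still at `i`, so `w` has it
      -- there or in `s₃`, whereas `π` puts it at `a`. Hence i = a; but in `π` position `i` holds at
      -- most u₁ s₂, so it cannot be bumped over v s₂.
      α-clash : ∀ {A A' v v'} (π : Info A v) (π' : Info A' v') → Y π ≡ Y π' → v s₁ ≡ v' s₁ →
        ∀ a → a ≤ s₁ → CW (U v) a s₃ → (∀ j → j < n → w j ≡ U v (tr a s₃ j)) →
        ∀ a' → a' ≤ s₁ → (∀ j → j < n → w j ≡ U v' (tr a' s₃ j)) →
        ∀ i → i < s₂ → Cov (Y π) i s₂ → Z π s₂ ≡ Y π i → Z π i ≡ Y π s₂ → v s₂ ≢ v' s₂ → ⊥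
      α-clash {v = v} {v'} π π' refl f₁ a al (c , _) e a' al' e' i il ci zi iz ne with step-below (st₂ π') i il
      ... | right (_ , z' , _) = ne (trans (v₂ π) (trans zi (sym (trans (v₂ π') z'))))
      ... | left z' with bumped-lo π il ci
      ... | im with step-below (st₁ π') i (s≤s im)
      ... | right (_ , q , _) = <⇒≢ ≤-refl (injv π s₁<n s₂<n (trans f₁ (trans q (trans z' (trans (sym zi) (sym (v₂ π)))))))
      ... | left q = final (i ≟ a')
        where
        f₂ : v' i ≡ v s₂
        f₂ = trans q (trans z' (trans (sym zi) (sym (v₂ π))))
        wa : w a ≡ v s₂
        wa = trans (e a (lo<n al)) (trans (cong (U v) (tr-l a s₃)) (U₃ v))
        contra : i ≡ a → ⊥
        contra refl = <⇒≱ c (subst₂ _≤_ (sym (ulo π im)) (sym (U₃ v)) (≤-trans (small π im (trans iz (Y₂ π))) (v₂≥ π)))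
        final : Dec (i ≡ a') → ⊥
        final (yes refl) = lo≢₃ al (injw (lo<n al) s₃<n (trans wa (sym (trans (e' s₃ s₃<n) (trans (cong (U v') (tr-r i s₃)) (trans (U-lo v' i im) f₂))))))
        final (no na) = contra (injw (lo<n (m≤n⇒m≤1+n im)) (lo<n al) (trans (e' i (lo<n (m≤n⇒m≤1+n im))) (trans (cong (U v') (tr-o a' s₃ i na (lo≢₃ (m≤n⇒m≤1+n im)))) (trans (U-lo v' i im) (trans f₂ (sym wa))))))

      α-uniq : ∀ {A A' v v'} (π : Info A v) (π' : Info A' v') →
        ∀ a → a ≤ s₁ → CW (U v) a s₃ → (∀ j → j < n → w j ≡ U v (tr a s₃ j)) →
        ∀ a' → a' ≤ s₁ → CW (U v') a' s₃ → (∀ j → j < n → w j ≡ U v' (tr a' s₃ j)) → v s₃ ≡ v' s₃ × v s₂ ≡ v' s₂ × v s₁ ≡ v' s₁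
      α-uniq {v = v} {v'} π π' a al cw e a' al' cw' e' = f₃ , go (v s₂ ≟ v' s₂) , f₁
        where
        f₃ = Max₂-uniq (α-max {v} (l₁ π) (l₂ π) a al cw e) (α-max {v'} (l₁ π') (l₂ π') a' al' cw' e')
        w₂ : ∀ v a → a ≤ s₁ → (∀ j → j < n → w j ≡ U v (tr a s₃ j)) → w s₂ ≡ v s₁
        w₂ v a al e = trans (e s₂ s₂<n) (trans (cong (U v) (tr-o a s₃ s₂ (λ q → lo≢₂ al (sym q)) (<⇒≢ ≤-refl))) (U₂ v))
        f₁ = trans (sym (w₂ v a al e)) (w₂ v' a' al' e')
        yy = sameY π π' f₃
        go : Dec (v s₂ ≡ v' s₂) → v s₂ ≡ v' s₂
        go (yes q) = q
        go (no ne) with step-slot (st₂ π) | step-slot (st₂ π')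
        ... | right (i , il , c , p , q) | _ = ⊥-elim (α-clash π π' yy f₁ a al cw e a' al' e' i il c p q ne)
        ... | left p | right (i , il , c , p' , q) = ⊥-elim (α-clash π' π (sym yy) (sym f₁) a' al' cw' e' a al e i il c p' q (λ k → ne (sym k)))
        ... | left p | left p' = ⊥-elim (ne (trans (v₂ π) (trans p (trans (Y₂ π) (sym (trans (v₂ π') (trans p' (Y₂ π'))))))))

      -- The argument of `α-clash` one slot later: the contested value is v s₁, and it returns
      -- through `s₂`.
      β-clash : ∀ {A A' v v'} (π : Info A v) (π' : Info A' v') → Z π ≡ Z π' →
        ∀ a → a ≤ s₁ → CW (U v) a s₂ → (∀ j → j < n → w j ≡ U v (tr a s₂ j)) →
        ∀ a' → a' ≤ s₁ → (∀ j → j < n → w j ≡ U v' (tr a' s₂ j)) →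
        ∀ i → i < s₁ → v s₁ ≡ Z π i → v i ≡ Z π s₁ → v s₁ ≢ v' s₁ → ⊥
      β-clash {v = v} {v'} π π' refl a al (c , _) e a' al' e' i (s≤s im) zi iz ne with step-below (st₁ π') i (s≤s im)
      ... | right (_ , z' , _) = ne (trans zi (sym z'))
      ... | left q = final (i ≟ a')
        where
        f₁ : v' i ≡ v s₁
        f₁ = trans q (sym zi)
        wa : w a ≡ v s₁
        wa = trans (e a (lo<n al)) (trans (cong (U v) (tr-l a s₂)) (U₂ v))
        contra : i ≡ a → ⊥
        contra refl = <⇒≱ c (subst₂ _≤_ (sym (trans (ulo π im) iz)) (sym (U₂ v)) (step-≥ (st₁ π)))
        final : Dec (i ≡ a') → ⊥
        final (yes refl) = lo≢₂ al (injw (lo<n al) s₂<n (trans wa (sym (trans (e' s₂ s₂<n) (trans (cong (U v') (tr-r i s₂)) (trans (U-lo v' i im) f₁))))))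
        final (no na) = contra (injw (lo<n (m≤n⇒m≤1+n im)) (lo<n al) (trans (e' i (lo<n (m≤n⇒m≤1+n im))) (trans (cong (U v') (tr-o a' s₂ i na (lo≢₂ (m≤n⇒m≤1+n im)))) (trans (U-lo v' i im) (trans f₁ (sym wa))))))

      β-uniq : ∀ {A A' v v'} (π : Info A v) (π' : Info A' v') →
        ∀ a → a ≤ s₁ → CW (U v) a s₂ → (∀ j → j < n → w j ≡ U v (tr a s₂ j)) →
        ∀ a' → a' ≤ s₁ → CW (U v') a' s₂ → (∀ j → j < n → w j ≡ U v' (tr a' s₂ j)) → v s₃ ≡ v' s₃ × v s₂ ≡ v' s₂ × v s₁ ≡ v' s₁
      β-uniq {v = v} {v'} π π' a al cw e a' al' cw' e' = f₃ , f₂ , go (v s₁ ≟ v' s₁)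
        where
        f₃ = Max₂-uniq (β-max {v} (l₁ π) (l₂ π) a al cw e) (β-max {v'} (l₁ π') (l₂ π') a' al' cw' e')
        w₃ : ∀ v a → a ≤ s₁ → (∀ j → j < n → w j ≡ U v (tr a s₂ j)) → w s₃ ≡ v s₂
        w₃ v a al e = trans (e s₃ s₃<n) (trans (cong (U v) (tr-o a s₂ s₃ (λ q → lo≢₃ al (sym q)) (λ q → <⇒≢ ≤-refl (sym q)))) (U₃ v))
        f₂ = trans (sym (w₃ v a al e)) (w₃ v' a' al' e')
        zz = sameZ π π' (sameY π π' f₃) f₂
        go : Dec (v s₁ ≡ v' s₁) → v s₁ ≡ v' s₁
        go (yes q) = q
        go (no ne) with step-slot (st₁ π) | step-slot (st₁ π')
        ... | right (i , il , c , p , q) | _ = ⊥-elim (β-clash π π' zz a al cw e a' al' e' i il p q ne)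
        ... | left p | right (i , il , c , p' , q) = ⊥-elim (β-clash π' π (sym zz) a' al' cw' e' a al e i il p' q (λ k → ne (sym k)))
        ... | left p | left p' = ⊥-elim (ne (trans p (trans (Z₁ π) (sym (trans p' (Z₁ π'))))))

      -- Traces the value at `s₂` through two bumps. The second alternative arises when both bumps
      -- of `IN` use the same position: the value is then carried on to `s₃`.
      place₁ : ∀ {u} → Form w u 2 → (Σ ℕ λ a → a ≤ s₁ × w a ≡ u s₂ × u s₂ < u a)
        ⊎ (Σ ℕ λ a → a ≤ s₁ × w s₃ ≡ u s₂ × w a ≡ u s₃ × u s₂ < u a)
      place₁ {u} (NI a₂ a₁ al₂ al₁ lt (c , _) (c' , _) e) = left (a₁ , al₁ , trans (e a₁ (lo<n al₁)) (trans (cong (u ∘ tr a₂ s₃) (tr-l a₁ s₂)) x₂) , go (a₁ ≟ a₂))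
        where
        x₂ : u (tr a₂ s₃ s₂) ≡ u s₂
        x₂ = cong u (tr-o a₂ s₃ s₂ (λ q → lo≢₂ al₂ (sym q)) (<⇒≢ ≤-refl))
        go : Dec (a₁ ≡ a₂) → u s₂ < u a₁
        go (yes refl) = <-trans lt c
        go (no ne) = subst₂ _<_ x₂ (cong u (tr-o a₂ s₃ a₁ ne (lo≢₃ al₁))) c'
      place₁ {u} (IN a₁ a₂ al₁ al₂ lt (c , _) (c' , _) e _) = go (a₁ ≟ a₂)
        where
        go : Dec (a₁ ≡ a₂) → _
        go (yes refl) = right (a₁ , al₁ , trans (e s₃ s₃<n) (cong u (trans (cong (tr a₁ s₂) (tr-r a₁ s₃)) (tr-l a₁ s₂)))
          , trans (e a₁ (lo<n al₁)) (cong u (trans (cong (tr a₁ s₂) (tr-l a₁ s₃)) (tr-o a₁ s₂ s₃ (λ q → lo≢₃ al₁ (sym q)) (λ q → <⇒≢ ≤-refl (sym q))))) , c)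
        go (no ne) = left (a₁ , al₁ , trans (e a₁ (lo<n al₁)) (cong u (trans (cong (tr a₁ s₂) (tr-o a₂ s₃ a₁ ne (lo≢₃ al₁))) (tr-l a₁ s₂))) , c)

      place₂ : ∀ {u} → Form w u 2 → (Σ ℕ λ a → a ≤ s₁ × w a ≡ u s₃ × u s₃ < u a) ⊎ (w s₂ ≡ u s₃ × u s₂ < u s₃)
      place₂ {u} (NI a₂ a₁ al₂ al₁ lt (c , _) (c' , _) e) = go (a₁ ≟ a₂)
        where
        go : Dec (a₁ ≡ a₂) → _
        go (yes refl) = right (trans (e s₂ s₂<n) (cong u (trans (cong (tr a₂ s₃) (tr-r a₁ s₂)) (tr-l a₂ s₃))) , lt)
        go (no ne) = left (a₂ , al₂ , trans (e a₂ (lo<n al₂)) (cong u (trans (cong (tr a₂ s₃) (tr-o a₁ s₂ a₂ (λ q → ne (sym q)) (lo≢₂ al₂))) (tr-l a₂ s₃))) , c)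
      place₂ {u} (IN a₁ a₂ al₁ al₂ lt (c , _) (c' , _) e _) = left (a₂ , al₂ , trans (e a₂ (lo<n al₂)) (trans (cong (u ∘ tr a₁ s₂) (tr-l a₂ s₃)) v₃') , go (a₁ ≟ a₂))
        where
        v₃' : u (tr a₁ s₂ s₃) ≡ u s₃
        v₃' = cong u (tr-o a₁ s₂ s₃ (λ q → lo≢₃ al₁ (sym q)) (λ q → <⇒≢ ≤-refl (sym q)))
        go : Dec (a₁ ≡ a₂) → u s₃ < u a₂
        go (yes refl) = <-trans lt c
        go (no ne) = subst₂ _<_ v₃' (cong u (tr-o a₁ s₂ a₂ (λ q → ne (sym q)) (lo≢₂ al₂))) c'

      place-lo : ∀ {u} → Form w u 2 → ∀ i → i ≤ s₁ → w i ≡ u i ⊎ w s₂ ≡ u i ⊎ (w s₃ ≡ u i × (w i ≡ u s₃ ⊎ w s₂ ≡ u s₃))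
      place-lo {u} (NI a₂ a₁ al₂ al₁ lt _ _ e) i il = go (i ≟ a₂) (i ≟ a₁)
        where
        go : Dec (i ≡ a₂) → Dec (i ≡ a₁) → _
        go (yes refl) d = right (right (trans (e s₃ s₃<n) (cong u (trans (cong (tr a₂ s₃) (tr-o a₁ s₂ s₃ (λ q → lo≢₃ al₁ (sym q)) (λ q → <⇒≢ ≤-refl (sym q)))) (tr-r a₂ s₃))) , sub d))
          where
          sub : Dec (i ≡ a₁) → w i ≡ u s₃ ⊎ w s₂ ≡ u s₃
          sub (yes refl) = right (trans (e s₂ s₂<n) (cong u (trans (cong (tr a₂ s₃) (tr-r a₁ s₂)) (tr-l a₂ s₃))))
          sub (no ne) = left (trans (e i (lo<n il)) (cong u (trans (cong (tr a₂ s₃) (tr-o a₁ s₂ i ne (lo≢₂ il))) (tr-l a₂ s₃))))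
        go (no ne) (yes refl) = right (left (trans (e s₂ s₂<n) (cong u (trans (cong (tr a₂ s₃) (tr-r a₁ s₂)) (tr-o a₂ s₃ i ne (lo≢₃ il))))))
        go (no ne) (no ne') = left (trans (e i (lo<n il)) (cong u (trans (cong (tr a₂ s₃) (tr-o a₁ s₂ i ne' (lo≢₂ il))) (tr-o a₂ s₃ i ne (lo≢₃ il)))))
      place-lo {u} (IN a₁ a₂ al₁ al₂ lt _ _ e _) i il = go (i ≟ a₁) (i ≟ a₂)
        where
        go : Dec (i ≡ a₁) → Dec (i ≡ a₂) → _
        go (yes refl) d = right (left (trans (e s₂ s₂<n) (cong u (trans (cong (tr a₁ s₂) (tr-o a₂ s₃ s₂ (λ q → lo≢₂ al₂ (sym q)) (<⇒≢ ≤-refl))) (tr-r a₁ s₂)))))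
        go (no ne) (yes refl) = right (right (trans (e s₃ s₃<n) (cong u (trans (cong (tr a₁ s₂) (tr-r a₂ s₃)) (tr-o a₁ s₂ i ne (lo≢₂ il))))
          , left (trans (e i (lo<n il)) (cong u (trans (cong (tr a₁ s₂) (tr-l a₂ s₃)) (tr-o a₁ s₂ s₃ (λ q → lo≢₃ al₁ (sym q)) (λ q → <⇒≢ ≤-refl (sym q))))))))
        go (no ne) (no ne') = left (trans (e i (lo<n il)) (cong u (trans (cong (tr a₁ s₂) (tr-o a₂ s₃ i ne' (lo≢₃ il))) (tr-o a₁ s₂ i ne (lo≢₂ il)))))

      -- The value brought to `s₁` stays or enters a slot, and the covers bound the rest. In `IN` it
      -- cannot enter `s₃`, for then `w` would not descend at `s₂`.
      γ-max : ∀ {u} → Form w u 2 → u s₂ < u s₁ → u s₃ < u s₁ → Max₃ (u s₁) (w s₁) (w s₂) (w s₃)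
      γ-max {u} (NI a₂ a₁ al₂ al₁ lt cw cw' e) k₁ k₂ = go (m≤n⇒m<n∨m≡n al₂) (m≤n⇒m<n∨m≡n al₁)
        where
        w₃ : w s₃ ≡ u a₂
        w₃ = trans (e s₃ s₃<n) (cong u (trans (cong (tr a₂ s₃) (tr-o a₁ s₂ s₃ (λ q → lo≢₃ al₁ (sym q)) (λ q → <⇒≢ ≤-refl (sym q)))) (tr-r a₂ s₃)))
        w₃≤ : w s₃ ≤ u s₁
        w₃≤ = subst (_≤ u s₁) (sym w₃) (CW-≤ {u} {a₂} {s₃} cw k₂ al₂)
        w₂ : w s₂ ≡ u (tr a₂ s₃ a₁)
        w₂ = trans (e s₂ s₂<n) (cong (u ∘ tr a₂ s₃) (tr-r a₁ s₂))
        x₂ : u (tr a₂ s₃ s₂) ≡ u s₂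
        x₂ = cong u (tr-o a₂ s₃ s₂ (λ q → lo≢₂ al₂ (sym q)) (<⇒≢ ≤-refl))
        go : a₂ < s₁ ⊎ a₂ ≡ s₁ → a₁ < s₁ ⊎ a₁ ≡ s₁ → Max₃ (u s₁) (w s₁) (w s₂) (w s₃)
        go (left l) (left l') = left (sym w₁) , ≤-reflexive w₁ , subst₂ _≤_ (sym w₂) v₁ (CW-≤ {u ∘ tr a₂ s₃} {a₁} {s₂} cw' (subst₂ _<_ (sym x₂) (sym v₁) k₁) al₁) , w₃≤
          where
          v₁ : u (tr a₂ s₃ s₁) ≡ u s₁
          v₁ = cong u (tr-o a₂ s₃ s₁ (λ q → <⇒≢ l (sym q)) (<⇒≢ s₁<s₃))
          w₁ : w s₁ ≡ u s₁
          w₁ = trans (e s₁ s₁<n) (trans (cong (u ∘ tr a₂ s₃) (tr-o a₁ s₂ s₁ (λ q → <⇒≢ l' (sym q)) (<⇒≢ ≤-refl))) v₁)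
        go (left l) (right refl) = right (left (sym w₂')) , <⇒≤ (subst (_< u s₁) (sym (trans (e s₁ s₁<n) (trans (cong (u ∘ tr a₂ s₃) (tr-l s₁ s₂)) x₂))) k₁) , ≤-reflexive w₂' , w₃≤
          where
          w₂' : w s₂ ≡ u s₁
          w₂' = trans w₂ (cong u (tr-o a₂ s₃ s₁ (λ q → <⇒≢ l (sym q)) (<⇒≢ s₁<s₃)))
        go (right refl) (left l') = right (right (sym w₃)) , ≤-trans (≤-reflexive w₁) (<⇒≤ k₂) , ≤-trans (subst₂ _≤_ (sym w₂) v₁ (CW-≤ {u ∘ tr a₂ s₃} {a₁} {s₂} cw' (subst₂ _<_ (sym x₂) (sym v₁) lt) al₁)) (<⇒≤ k₂) , w₃≤
          where
          v₁ : u (tr s₁ s₃ s₁) ≡ u s₃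
          v₁ = cong u (tr-l s₁ s₃)
          w₁ : w s₁ ≡ u s₃
          w₁ = trans (e s₁ s₁<n) (trans (cong (u ∘ tr s₁ s₃) (tr-o a₁ s₂ s₁ (λ q → <⇒≢ l' (sym q)) (<⇒≢ ≤-refl))) v₁)
        go (right refl) (right refl) = right (right (sym w₃)) , ≤-trans (≤-reflexive (trans (e s₁ s₁<n) (trans (cong (u ∘ tr s₁ s₃) (tr-l s₁ s₂)) x₂))) (<⇒≤ k₁) , ≤-trans (≤-reflexive (trans w₂ (cong u (tr-l s₁ s₃)))) (<⇒≤ k₂) , w₃≤
      γ-max {u} (IN a₁ a₂ al₁ al₂ lt cw cw' e desc) k₁ k₂ = go (m≤n⇒m<n∨m≡n al₁) (m≤n⇒m<n∨m≡n al₂)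
        where
        w₂ : w s₂ ≡ u a₁
        w₂ = trans (e s₂ s₂<n) (cong u (trans (cong (tr a₁ s₂) (tr-o a₂ s₃ s₂ (λ q → lo≢₂ al₂ (sym q)) (<⇒≢ ≤-refl))) (tr-r a₁ s₂)))
        w₂≤ : w s₂ ≤ u s₁
        w₂≤ = subst (_≤ u s₁) (sym w₂) (CW-≤ {u} {a₁} {s₂} cw k₁ al₁)
        w₃≤ : w s₃ ≤ u s₁
        w₃≤ = ≤-trans (<⇒≤ desc) w₂≤
        v₃' : u (tr a₁ s₂ s₃) ≡ u s₃
        v₃' = cong u (tr-o a₁ s₂ s₃ (λ q → lo≢₃ al₁ (sym q)) (λ q → <⇒≢ ≤-refl (sym q)))
        go : a₁ < s₁ ⊎ a₁ ≡ s₁ → a₂ < s₁ ⊎ a₂ ≡ s₁ → Max₃ (u s₁) (w s₁) (w s₂) (w s₃)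
        go (right refl) (left l) = right (left (sym w₂)) , ≤-trans (≤-reflexive (trans (e s₁ s₁<n) (cong u (trans (cong (tr s₁ s₂) (tr-o a₂ s₃ s₁ (λ q → <⇒≢ l (sym q)) (<⇒≢ s₁<s₃))) (tr-l s₁ s₂))))) (<⇒≤ k₁) , w₂≤ , w₃≤
        go (right refl) (right refl) = right (left (sym w₂)) , ≤-trans (≤-reflexive (trans (e s₁ s₁<n) (trans (cong (u ∘ tr s₁ s₂) (tr-l s₁ s₃)) v₃'))) (<⇒≤ k₂) , w₂≤ , w₃≤
        go (left l) (left l') = left (sym w₁) , ≤-reflexive w₁ , w₂≤ , w₃≤
          where
          w₁ : w s₁ ≡ u s₁
          w₁ = trans (e s₁ s₁<n) (cong u (trans (cong (tr a₁ s₂) (tr-o a₂ s₃ s₁ (λ q → <⇒≢ l' (sym q)) (<⇒≢ s₁<s₃))) (tr-o a₁ s₂ s₁ (λ q → <⇒≢ l (sym q)) (<⇒≢ ≤-refl))))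
        go (left l) (right refl) = ⊥-elim (<⇒≱ desc (≤-trans w₂≤ (≤-reflexive (sym (trans (e s₃ s₃<n) (cong u (trans (cong (tr a₁ s₂) (tr-r s₁ s₃)) (tr-o a₁ s₂ s₁ (λ q → <⇒≢ l (sym q)) (<⇒≢ ≤-refl)))))))))

      γ-f₃ : ∀ {v v'} (π : Info 2 v) (π' : Info 2 v') → v s₃ ≡ v' s₃
      γ-f₃ {v} {v'} π π' = ≤-antisym (Max₃-≤ (M π) (M π')) (Max₃-≤ (M π') (M π))
        where
        M : ∀ {v} → Info 2 v → Max₃ (v s₃) (w s₁) (w s₂) (w s₃)
        M {v} π = subst (λ z → Max₃ z (w s₁) (w s₂) (w s₃)) (U₁ v) (γ-max (form π) (subst₂ _<_ (sym (U₂ v)) (sym (U₁ v)) (l₁ π)) (subst₂ _<_ (sym (U₃ v)) (sym (U₁ v)) (l₂ π)))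

      -- The argument of `β-clash` for two bumps; the further cases are those in which a value is
      -- carried on to `s₃`.
      γ-clash₁ : ∀ {v v'} (π : Info 2 v) (π' : Info 2 v') → Z π ≡ Z π' → v s₂ ≡ v' s₂ →
        ∀ i → i < s₁ → v s₁ ≡ Z π i → v i ≡ Z π s₁ → v s₁ ≢ v' s₁ → ⊥
      γ-clash₁ {v} {v'} π π' refl f₂ i (s≤s im) zi iz ne with step-below (st₁ π') i (s≤s im)
      ... | right (_ , z' , _) = ne (trans zi (sym z'))
      ... | left q = go (place₁ (form π)) (place-lo (form π') i il)
        where
        il = m≤n⇒m≤1+n im
        ui : U v' i ≡ U v s₂
        ui = trans (U-lo v' i im) (trans q (trans (sym zi) (sym (U₂ v))))
        u₃ : U v' s₃ ≡ U v s₃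
        u₃ = trans (U₃ v') (trans (sym f₂) (sym (U₃ v)))
        contra : ∀ {a} → i ≡ a → U v s₂ < U v a → ⊥
        contra refl c = <⇒≱ c (subst₂ _≤_ (sym (trans (ulo π im) iz)) (sym (U₂ v)) (step-≥ (st₁ π)))
        go : (Σ ℕ λ a → a ≤ s₁ × w a ≡ U v s₂ × U v s₂ < U v a) ⊎ (Σ ℕ λ a → a ≤ s₁ × w s₃ ≡ U v s₂ × w a ≡ U v s₃ × U v s₂ < U v a) →
          w i ≡ U v' i ⊎ w s₂ ≡ U v' i ⊎ (w s₃ ≡ U v' i × (w i ≡ U v' s₃ ⊎ w s₂ ≡ U v' s₃)) → ⊥
        go (left (a , al , wa , c)) (left e) = contra (injw (lo<n il) (lo<n al) (trans e (trans ui (sym wa)))) c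
        go (left (a , al , wa , c)) (right (left e)) = lo≢₂ al (injw (lo<n al) s₂<n (trans wa (trans (sym ui) (sym e))))
        go (left (a , al , wa , c)) (right (right (e , _))) = lo≢₃ al (injw (lo<n al) s₃<n (trans wa (trans (sym ui) (sym e))))
        go (right (a , al , w₃ , wa , c)) (left e) = lo≢₃ il (injw (lo<n il) s₃<n (trans e (trans ui (sym w₃))))
        go (right (a , al , w₃ , wa , c)) (right (left e)) = <⇒≢ ≤-refl (injw s₂<n s₃<n (trans e (trans ui (sym w₃))))
        go (right (a , al , w₃ , wa , c)) (right (right (e , left e'))) = contra (injw (lo<n il) (lo<n al) (trans e' (trans u₃ (sym wa)))) c
        go (right (a , al , w₃ , wa , c)) (right (right (e , right e'))) = lo≢₂ al (injw (lo<n al) s₂<n (trans wa (trans (sym u₃) (sym e'))))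

      γ-f₁ : ∀ {v v'} (π : Info 2 v) (π' : Info 2 v') → v s₂ ≡ v' s₂ → v s₁ ≡ v' s₁
      γ-f₁ {v} {v'} π π' f₂ = go (v s₁ ≟ v' s₁)
        where
        zz = sameZ π π' (sameY π π' (γ-f₃ π π')) f₂
        go : Dec (v s₁ ≡ v' s₁) → v s₁ ≡ v' s₁
        go (yes q) = q
        go (no ne) with step-slot (st₁ π) | step-slot (st₁ π')
        ... | right (i , il , c , p , q) | _ = ⊥-elim (γ-clash₁ π π' zz f₂ i il p q ne)
        ... | left p | right (i , il , c , p' , q) = ⊥-elim (γ-clash₁ π' π (sym zz) (sym f₂) i il p' q (λ k → ne (sym k)))
        ... | left p | left p' = ⊥-elim (ne (trans p (trans (Z₁ π) (sym (trans p' (Z₁ π'))))))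

      -- After the bump at `s₂`, position `i` holds u₁ s₂, which exceeds u₁ s₁. If `i` lay right of
      -- `i'`, this value would spoil the cover that bumps from `i'` into `s₁`.
      chain-lt : ∀ {A v} (π : Info A v) i i' → i ≤ m → i' ≤ m → i ≢ i' → Z π i ≡ u₁ s₂ → v s₁ ≡ Z π i' → Z π i' ≡ Y π i' → u₁ s₂ < Y π i' → Step (Z π) s₁ v → i < i'
      chain-lt {v = v} π i i' im im' ne zi vi zy gt st with <-cmp i i'
      ... | tri< l _ _ = l
      ... | tri≈ _ e _ = ⊥-elim (ne e)
      ... | tri> _ _ l with step-below (st₁ π) i' (s≤s im')
      ...   | right (_ , _ , (_ , cv)) = ⊥-elim (cv (s≤s im) l (subst₂ _<_ (sym (Z₁ π)) (sym zi) c₁₂ , subst₂ _<_ (sym zi) (sym zy) gt))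
      ...   | left e = ⊥-elim (<⇒≢ (s≤s im') (injv π (<-trans (s≤s im') s₁<n) s₁<n (trans e (sym vi))))

      -- Tracing v s₂ as in `α-clash` leaves the case that it ends in `s₂`. Then v' s₂ is traced
      -- through `π`; the one case that survives has v' s₂ in `s₁`, and there `chain-lt` puts `i'`
      -- to the right of `i`, against the cover from `i` to `s₂`.
      γ-clash₂ : ∀ {v v'} (π : Info 2 v) (π' : Info 2 v') → Y π ≡ Y π' →
        ∀ i → i < s₂ → Cov (Y π) i s₂ → Z π s₂ ≡ Y π i → Z π i ≡ Y π s₂ →
        ∀ i' → i' < s₂ → Cov (Y π') i' s₂ → Z π' s₂ ≡ Y π' i' → Z π' i' ≡ Y π' s₂ →
        v s₂ ≢ v' s₂ → v' s₁ ≢ v s₂ → ⊥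
      γ-clash₂ {v} {v'} π π' refl i il ci zi iz i' il' ci' zi' iz' ne nf with step-below (st₂ π') i il
      ... | right (_ , z' , _) = ne (trans (v₂ π) (trans zi (sym (trans (v₂ π') z'))))
      ... | left z' with bumped-lo π il ci | bumped-lo π' il' ci'
      ... | im | im' with step-below (st₁ π') i (s≤s im)
      ... | right (_ , q , _) = nf (trans q (trans z' (trans (sym zi) (sym (v₂ π)))))
      ... | left q = go (place₂ (form π)) (place-lo (form π') i (m≤n⇒m≤1+n im))
        where
        ile = m≤n⇒m≤1+n im
        ile' = m≤n⇒m≤1+n im'
        f₂ : v s₂ ≡ Y π i
        f₂ = trans (v₂ π) zi
        f₂' : v' s₂ ≡ Y π i'
        f₂' = trans (v₂ π') zi'
        ui : U v' i ≡ U v s₃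
        ui = trans (U-lo v' i im) (trans q (trans z' (trans (sym f₂) (sym (U₃ v)))))
        i≢i' : i ≢ i'
        i≢i' e = ne (trans f₂ (trans (cong (Y π) e) (sym f₂')))
        contra : ∀ {a} → i ≡ a → U v s₃ < U v a → ⊥
        contra refl c = <⇒≱ c (subst₂ _≤_ (sym (ulo π im)) (sym (U₃ v)) (≤-trans (small π im (trans iz (Y₂ π))) (v₂≥ π)))
        contra' : ∀ {a} → i' ≡ a → U v' s₃ < U v' a → ⊥
        contra' refl c = <⇒≱ c (subst₂ _≤_ (sym (ulo π' im')) (sym (U₃ v')) (≤-trans (small π' im' (trans iz' (Y₂ π'))) (v₂≥ π')))
        zi'' : Z π i' ≡ Y π i'
        zi'' with step-below (st₂ π) i' il'
        ... | left e = e
        ... | right (_ , e , _) = ⊥-elim (i≢i' (injY π (<-trans il s₂<n) (<-trans il' s₂<n) (trans (sym zi) e)))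
        sub : w s₂ ≡ U v s₃ → U v s₂ < U v s₃ → (Σ ℕ λ a → a ≤ s₁ × w a ≡ U v' s₃ × U v' s₃ < U v' a) ⊎ (w s₂ ≡ U v' s₃ × U v' s₂ < U v' s₃) → ⊥
        sub w₂ lt (right (w₂' , _)) = ne (trans (sym (U₃ v)) (trans (sym w₂) (trans w₂' (U₃ v'))))
        sub w₂ lt (left (a , al , wa , c)) with step-below (st₁ π) i' (s≤s im')
        ... | left e = fin (place-lo (form π) i' ile')
          where
          ui' : U v i' ≡ U v' s₃
          ui' = trans (U-lo v i' im') (trans e (trans zi'' (trans (sym f₂') (sym (U₃ v')))))
          fin : w i' ≡ U v i' ⊎ w s₂ ≡ U v i' ⊎ (w s₃ ≡ U v i' × (w i' ≡ U v s₃ ⊎ w s₂ ≡ U v s₃)) → ⊥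
          fin (left k) = contra' (injw (lo<n ile') (lo<n al) (trans k (trans ui' (sym wa)))) c
          fin (right (left k)) = lo≢₂ al (injw (lo<n al) s₂<n (trans wa (trans (sym ui') (sym k))))
          fin (right (right (k , _))) = lo≢₃ al (injw (lo<n al) s₃<n (trans wa (trans (sym ui') (sym k))))
        ... | right (_ , e , _) = proj₂ ci (≤-trans (s≤s im') (n≤1+n _)) (chain-lt π i i' im im' i≢i' (trans iz (Y₂ π)) e zi'' (subst (_< Y π i') (Y₂ π) (proj₁ ci')) (st₁ π))
              (proj₁ ci' , subst₂ _<_ (trans (U₂ v) (trans e zi'')) (trans (U₃ v) f₂) lt)
        go : (Σ ℕ λ a → a ≤ s₁ × w a ≡ U v s₃ × U v s₃ < U v a) ⊎ (w s₂ ≡ U v s₃ × U v s₂ < U v s₃) →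
          w i ≡ U v' i ⊎ w s₂ ≡ U v' i ⊎ (w s₃ ≡ U v' i × (w i ≡ U v' s₃ ⊎ w s₂ ≡ U v' s₃)) → ⊥
        go (left (a , al , wa , c)) (left e) = contra (injw (lo<n ile) (lo<n al) (trans e (trans ui (sym wa)))) c
        go (left (a , al , wa , c)) (right (left e)) = lo≢₂ al (injw (lo<n al) s₂<n (trans wa (trans (sym ui) (sym e))))
        go (left (a , al , wa , c)) (right (right (e , _))) = lo≢₃ al (injw (lo<n al) s₃<n (trans wa (trans (sym ui) (sym e))))
        go (right (w₂ , lt)) _ = sub w₂ lt (place₂ (form π'))

      -- The choice is whether `s₂` was bumped in the first pass. If it was in both paths,
      -- `γ-clash₂` fails in both directions only if each path has in `s₁` what the other has in
      -- `s₂`; then `chain-lt` orders `i` and `i'` both ways.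
      γ-f₂ : ∀ {v v'} (π : Info 2 v) (π' : Info 2 v') → (v s₂ ≡ u₁ s₂ × v' s₂ ≡ u₁ s₂) ⊎ (¬ v s₂ ≡ u₁ s₂ × ¬ v' s₂ ≡ u₁ s₂) → v s₂ ≡ v' s₂
      γ-f₂ π π' (left (p , q)) = trans p (sym q)
      γ-f₂ {v} {v'} π π' (right (p , q)) = go (v s₂ ≟ v' s₂)
        where
        yy = sameY π π' (γ-f₃ π π')
        go : Dec (v s₂ ≡ v' s₂) → v s₂ ≡ v' s₂
        go (yes k) = k
        go (no ne) with step-slot (st₂ π) | step-slot (st₂ π')
        ... | left k | _ = ⊥-elim (p (trans (v₂ π) (trans k (Y₂ π))))
        ... | right _ | left k = ⊥-elim (q (trans (v₂ π') (trans k (Y₂ π'))))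
        ... | right (i , il , c , zi , iz) | right (i' , il' , c' , zi' , iz') = ⊥-elim (dec (v' s₁ ≟ v s₂) (v s₁ ≟ v' s₂))
          where
          dec : Dec (v' s₁ ≡ v s₂) → Dec (v s₁ ≡ v' s₂) → ⊥
          dec (no a) _ = γ-clash₂ π π' yy i il c zi iz i' il' c' zi' iz' ne a
          dec (yes a) (no b) = γ-clash₂ π' π (sym yy) i' il' c' zi' iz' i il c zi iz (λ k → ne (sym k)) b
          dec (yes a) (yes b) = both yy a b
            where
            both : Y π ≡ Y π' → v' s₁ ≡ v s₂ → v s₁ ≡ v' s₂ → ⊥
            both refl a b = <-asym (chain-lt π i i' im im' i≢i' (trans iz (Y₂ π)) (trans b (trans (v₂ π') (trans zi' (sym za)))) za (subst (_< Y π i') (Y₂ π) (proj₁ c')) (st₁ π))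
                 (chain-lt π' i' i im' im (λ e → i≢i' (sym e)) (trans iz' (Y₂ π')) (trans a (trans (v₂ π) (trans zi (sym zb)))) zb (subst (_< Y π i) (Y₂ π) (proj₁ c)) (st₁ π'))
              where
              im = bumped-lo π il c
              im' = bumped-lo π' il' c'
              i≢i' : i ≢ i'
              i≢i' e = ne (trans (v₂ π) (trans zi (trans (cong (Y π) e) (sym (trans (v₂ π') zi')))))
              za : Z π i' ≡ Y π i'
              za with step-below (st₂ π) i' il'
              ... | left e = e
              ... | right (_ , e , _) = ⊥-elim (i≢i' (injY π (<-trans il s₂<n) (<-trans il' s₂<n) (trans (sym zi) e)))
              zb : Z π' i ≡ Y π i
              zb with step-below (st₂ π') i il
              ... | left e = e
              ... | right (_ , e , _) = ⊥-elim (i≢i' (injY π (<-trans il s₂<n) (<-trans il' s₂<n) (trans (sym e) zi')))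

      -- A largest w s₃ rules out `IN` and forces the first bump of `NI` to come from `s₁`. This
      -- leaves u s₃ at `s₁`, where the remaining bump treats it as in `β-max`.
      γ-top : (∀ j → j < s₃ → w j < w s₃) → ∀ {u} → Form w u 2 → u s₂ < u s₁ → u s₃ < u s₁ → Max₂ (u s₃) (w s₁) (w s₂)
      γ-top tp {u} (NI a₂ a₁ al₂ al₁ lt cw cw' e) k₁ k₂ with m≤n⇒m<n∨m≡n al₂
      ... | left l = ⊥-elim (go (m≤n⇒m<n∨m≡n al₁))
        where
        w₃≤ : w s₃ ≤ u s₁
        w₃≤ = subst (_≤ u s₁) (sym (trans (e s₃ s₃<n) (cong u (trans (cong (tr a₂ s₃) (tr-o a₁ s₂ s₃ (λ q → lo≢₃ al₁ (sym q)) (λ q → <⇒≢ ≤-refl (sym q)))) (tr-r a₂ s₃))))) (CW-≤ {u} {a₂} {s₃} cw k₂ al₂)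
        v₁ : u (tr a₂ s₃ s₁) ≡ u s₁
        v₁ = cong u (tr-o a₂ s₃ s₁ (λ q → <⇒≢ l (sym q)) (<⇒≢ s₁<s₃))
        go : a₁ < s₁ ⊎ a₁ ≡ s₁ → ⊥
        go (left l') = <⇒≱ (tp s₁ s₁<s₃) (≤-trans w₃≤ (≤-reflexive (sym (trans (e s₁ s₁<n) (trans (cong (u ∘ tr a₂ s₃) (tr-o a₁ s₂ s₁ (λ q → <⇒≢ l' (sym q)) (<⇒≢ ≤-refl))) v₁)))))
        go (right refl) = <⇒≱ (tp s₂ ≤-refl) (≤-trans w₃≤ (≤-reflexive (sym (trans (e s₂ s₂<n) (trans (cong (u ∘ tr a₂ s₃) (tr-r s₁ s₂)) v₁)))))
      ... | right refl = go (m≤n⇒m<n∨m≡n al₁)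
        where
        v₁ : u (tr s₁ s₃ s₁) ≡ u s₃
        v₁ = cong u (tr-l s₁ s₃)
        v₂' : u (tr s₁ s₃ s₂) ≡ u s₂
        v₂' = cong u (tr-o s₁ s₃ s₂ (λ q → <⇒≢ ≤-refl (sym q)) (<⇒≢ ≤-refl))
        w₂ : w s₂ ≡ u (tr s₁ s₃ a₁)
        w₂ = trans (e s₂ s₂<n) (cong (u ∘ tr s₁ s₃) (tr-r a₁ s₂))
        go : a₁ < s₁ ⊎ a₁ ≡ s₁ → Max₂ (u s₃) (w s₁) (w s₂)
        go (left l') = left (sym w₁) , ≤-reflexive w₁ , subst₂ _≤_ (sym w₂) v₁ (CW-≤ {u ∘ tr s₁ s₃} {a₁} {s₂} cw' (subst₂ _<_ (sym v₂') (sym v₁) lt) al₁)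
          where
          w₁ : w s₁ ≡ u s₃
          w₁ = trans (e s₁ s₁<n) (trans (cong (u ∘ tr s₁ s₃) (tr-o a₁ s₂ s₁ (λ q → <⇒≢ l' (sym q)) (<⇒≢ ≤-refl))) v₁)
        go (right refl) = right (sym (trans w₂ v₁)) , ≤-trans (≤-reflexive (trans (e s₁ s₁<n) (trans (cong (u ∘ tr s₁ s₃) (tr-l s₁ s₂)) v₂'))) (<⇒≤ lt) , ≤-reflexive (trans w₂ v₁)
      γ-top tp (IN a₁ a₂ al₁ al₂ lt cw cw' e desc) k₁ k₂ = ⊥-elim (<-asym desc (tp s₂ ≤-refl))

      γ-f₂-top : (∀ j → j < s₃ → w j < w s₃) → ∀ {v v'} (π : Info 2 v) (π' : Info 2 v') → v s₂ ≡ v' s₂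
      γ-f₂-top tp {v} {v'} π π' = Max₂-uniq (M π) (M π')
        where
        M : ∀ {v} → Info 2 v → Max₂ (v s₂) (w s₁) (w s₂)
        M {v} π = subst (λ z → Max₂ z (w s₁) (w s₂)) (U₃ v) (γ-top tp (form π) (subst₂ _<_ (sym (U₂ v)) (sym (U₁ v)) (l₁ π)) (subst₂ _<_ (sym (U₃ v)) (sym (U₁ v)) (l₂ π)))

-- Bounds for the path numbers.

module PathBounds where
  open DividedDifferences using (sw; sw-at; sw-at'; sw-fix; sw-invol)
  open Words
  open Transpositions
  open PathCounting
  open SlotPaths
  open import Data.Nat using (_+_)
  open ℕₚ
  open ≡

  reach-last : ∀ ss {s B u v} → Reach (ss ++ s ∷ []) (suc B) u v →
    Reach ss (suc B) u v ⊎ Σ (ℕ → ℕ) λ z → Σ ℕ λ i → Reach ss B u z × i < s × Cov z i s × v ≡ z ∘ tr i s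
  reach-last [] (bump i il c done) = inj₂ (_ , i , done , il , c , refl)
  reach-last (_ ∷ ss) (skip r) with reach-last ss r
  ... | inj₁ r' = inj₁ (skip r')
  ... | inj₂ (z , i , r' , q) = inj₂ (z , i , skip r' , q)
  reach-last (_ ∷ []) {B = zero} (bump i il c (skip done)) = inj₁ (bump i il c done)
  reach-last (_ ∷ t ∷ ss) {B = zero} (bump i il c r) = inj₁ (bump i il c (none (t ∷ ss) r))
    where
    none : ∀ ss {s u v} → Reach (ss ++ s ∷ []) 0 u v → Reach ss 0 u v
    none [] (skip done) = done
    none (_ ∷ ss) (skip r) = skip (none ss r)
  reach-last (_ ∷ ss) {B = suc B} (bump i il c r) with reach-last ss r
  ... | inj₁ r' = inj₁ (bump i il c r')
  ... | inj₂ (z , i' , r' , q) = inj₂ (z , i' , bump i il c r' , q)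

  reach-skip-last : ∀ {ss B u v} s → Reach ss B u v → Reach (ss ++ s ∷ []) B u v
  reach-skip-last s done = skip done
  reach-skip-last s (skip r) = skip (reach-skip-last s r)
  reach-skip-last s (bump i il c r) = bump i il c (reach-skip-last s r)

  sw-conj : ∀ i a b j → sw i (tr a b (sw i j)) ≡ tr (sw i a) (sw i b) j
  sw-conj i a b j = go (j ≟ sw i a) (j ≟ sw i b)
    where
    go : Dec (j ≡ sw i a) → Dec (j ≡ sw i b) → sw i (tr a b (sw i j)) ≡ tr (sw i a) (sw i b) j
    go (yes refl) _ = trans (cong (sw i) (trans (cong (tr a b) (sw-invol i a)) (tr-l a b))) (sym (tr-l (sw i a) (sw i b)))
    go (no _) (yes refl) = trans (cong (sw i) (trans (cong (tr a b) (sw-invol i b)) (tr-r a b))) (sym (tr-r (sw i a) (sw i b)))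
    go (no p) (no q) = trans (cong (sw i) (tr-o a b (sw i j) (λ e → p (trans (sym (sw-invol i j)) (cong (sw i) e))) (λ e → q (trans (sym (sw-invol i j)) (cong (sw i) e)))))
       (trans (sw-invol i j) (sym (tr-o (sw i a) (sw i b) j p q)))

  module Count (m : ℕ) where
    open Slots m public

    eqOn? : ∀ (u w : ℕ → ℕ) → Dec (∀ {j} → j < n → u j ≡ w j)
    eqOn? u w = allUpTo? (λ j → u j ≟ w j) n

    -- `leaf w` gives the values of the functionals on the Schubert polynomial of `w`, and `leaf' w`
    -- those on its divided difference at `s₂`.
    leaf leaf' : (ℕ → ℕ) → (ℕ → ℕ) → ℕ
    leaf w v = whenᴺ (eqOn? v w) 1
    leaf' w v = whenᴺ (v s₂ <? v s₃) (leaf w (v ∘ sw s₂))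

    -- The Monk rule wants u s₂ < u s₃. Otherwise the letter `s₂` is split off the word; it commutes
    -- with symmetric polynomials of the two slots and so acts on the last factor, whence `leaf'`.
    N₂′ : ∀ (w : ℕ → ℕ) (A : ℕ) (u : ℕ → ℕ) → Dec (u s₂ < u s₃) → ℕ
    N₂′ w A u (yes _) = cnt (s₃ ∷ s₂ ∷ []) A (leaf w) u
    N₂′ w A u (no _) = cnt (s₃ ∷ s₂ ∷ []) A (leaf' w) (u ∘ sw s₂)

    N₂ : (ℕ → ℕ) → ℕ → (ℕ → ℕ) → ℕ
    N₂ w A u = N₂′ w A u (u s₂ <? u s₃)

    -- The divided differences at `s₁` and `s₂` between the passes meet ascents exactly if the value
    -- at `s₃` exceeds the other two; they then act as `U`.
    K₁ : (ℕ → ℕ) → ℕ → (ℕ → ℕ) → ℕ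
    K₁ w A v = whenᴺ (v s₂ <? v s₃) (whenᴺ (v s₁ <? v s₃) (N₂ w A (U v)))

    -- Counts the paths from u₁ to w with B bumps in the first pass and A bumps in the second.
    Ω : (ℕ → ℕ) → (ℕ → ℕ) → ℕ → ℕ → ℕ
    Ω w u₁ A B = cnt (s₃ ∷ s₂ ∷ s₁ ∷ []) B (K₁ w A) u₁

    sws-lo : ∀ {a} → a ≤ s₁ → sw s₂ a ≡ a
    sws-lo l = sw-fix s₂ _ (lo≢₂ l) (lo≢₃ l)

    conj₂ : ∀ {a} j → a ≤ s₁ → sw s₂ (tr a s₂ (sw s₂ j)) ≡ tr a s₃ j
    conj₂ {a} j l = trans (sw-conj s₂ a s₂ j) (cong₂ (λ p q → tr p q j) (sws-lo l) (sw-at s₂))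
    conj₃ : ∀ {a} j → a ≤ s₁ → sw s₂ (tr a s₃ (sw s₂ j)) ≡ tr a s₂ j
    conj₃ {a} j l = trans (sw-conj s₂ a s₃ j) (cong₂ (λ p q → tr p q j) (sws-lo l) (sw-at' s₂))

    cov⇒cw : ∀ {u a s} → s₁ < s → Cov u a s → CW u a s
    cov⇒cw l (c , q) = c , λ k a b → q (≤-<-trans b l) a

    below₂ : ∀ {u a} → ¬ (u s₃ < u s₂) → a < s₃ → Cov u a s₃ → a ≤ s₁
    below₂ {u} {a} nd al (c , _) with m≤n⇒m<n∨m≡n (≤-pred al)
    ... | inj₁ l = ≤-pred l
    ... | inj₂ refl = ⊥-elim (nd c)

    leaf-eq : ∀ w v → 0 < leaf w v → ∀ j → j < n → w j ≡ v j
    leaf-eq w v p j l = sym (proj₁ (when-pos (eqOn? v w) 1 p) l)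

    cw-conj₃ : ∀ {u a} → a ≤ s₁ → CW (u ∘ sw s₂) a s₃ → CW u a s₂
    cw-conj₃ {u} l (c , q) = subst₂ _<_ (cong u (sw-at' s₂)) (cong u (sws-lo l)) c , λ k a b (x , y) → q k a b
       (subst₂ _<_ (sym (cong u (sw-at' s₂))) (cong u (sym (sws-lo b))) x , subst₂ _<_ (cong u (sym (sws-lo b))) (cong u (sym (sws-lo l))) y)
    cw-conj₂ : ∀ {u a} → a ≤ s₁ → CW (u ∘ sw s₂) a s₂ → CW u a s₃
    cw-conj₂ {u} l (c , q) = subst₂ _<_ (cong u (sw-at s₂)) (cong u (sws-lo l)) c , λ k a b (x , y) → q k a b
       (subst₂ _<_ (sym (cong u (sw-at s₂))) (cong u (sym (sws-lo b))) x , subst₂ _<_ (cong u (sym (sws-lo b))) (cong u (sym (sws-lo l))) y)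
    cw-ext : ∀ {u u' a s} → (∀ j → u j ≡ u' j) → CW u a s → CW u' a s
    cw-ext {a = a} {s} e (c , q) = subst₂ _<_ (e s) (e a) c , λ k x y (p , r) → q k x y (subst₂ _<_ (sym (e s)) (sym (e k)) p , subst₂ _<_ (sym (e k)) (sym (e a)) r)

    N₂-form : ∀ w A u → Inj n u → 0 < N₂ w A u → Form w u A
    N₂-form w A u inj = go (u s₂ <? u s₃)
      where
      go : (d : Dec (u s₂ < u s₃)) → 0 < N₂′ w A u d → Form w u A
      go (yes lt) p with cnt-pos (s₃ ∷ s₂ ∷ []) A (leaf w) u p
      ... | v , skip (skip done) , k = same (leaf-eq w v k)
      ... | v , skip (bump a al c done) , k = beta a (≤-pred al) (cov⇒cw {u} ≤-refl c) (leaf-eq w v k)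
      ... | v , bump a al c (skip done) , k = alpha a (below₂ {u} (<-asym lt) al c) (cov⇒cw {u} s₁<s₃ c) (leaf-eq w v k)
      ... | v , bump a al c (bump a' al' c' done) , k = NI a a' (below₂ {u} (<-asym lt) al c) (≤-pred al') lt (cov⇒cw {u} s₁<s₃ c) (cov⇒cw {u ∘ tr a s₃} ≤-refl c') (leaf-eq w v k)
      go (no nlt) p with cnt-pos (s₃ ∷ s₂ ∷ []) A (leaf' w) (u ∘ sw s₂) p
      ... | v , r , k with when-pos (v s₂ <? v s₃) (leaf w (v ∘ sw s₂)) k
      ... | asc , k' = cases r (leaf-eq w (v ∘ sw s₂) k')
        where
        ũ = u ∘ sw s₂
        lt : u s₃ < u s₂
        lt = ≤∧≢⇒< (≮⇒≥ nlt) (λ e → <⇒≢ {s₂} ≤-refl (inj s₂<n s₃<n (sym e)))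
        nd : ¬ (ũ s₃ < ũ s₂)
        nd c = <-asym (subst₂ _<_ (cong u (sw-at' s₂)) (cong u (sw-at s₂)) c) lt
        cases : Reach (s₃ ∷ s₂ ∷ []) A ũ v → (∀ j → j < n → w j ≡ v (sw s₂ j)) → Form w u A
        cases (skip (skip done)) e = same (λ j l → trans (e j l) (cong u (sw-invol s₂ j)))
        cases (skip (bump a al c done)) e = alpha a a≤ (cw-conj₂ {u} a≤ (cov⇒cw {ũ} ≤-refl c)) (λ j l → trans (e j l) (cong u (conj₂ j a≤)))
          where a≤ = ≤-pred al
        cases (bump a al c (skip done)) e = beta a a≤ (cw-conj₃ {u} a≤ (cov⇒cw {ũ} s₁<s₃ c)) (λ j l → trans (e j l) (cong u (conj₃ j a≤)))
          where a≤ = below₂ {ũ} nd al c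
        cases (bump a al c (bump a' al' c' done)) e = IN a a' a≤ a'≤ lt (cw-conj₃ {u} a≤ (cov⇒cw {ũ} s₁<s₃ c))
            (cw-conj₂ {u ∘ tr a s₂} a'≤ (cw-ext {ũ ∘ tr a s₃} {u ∘ tr a s₂ ∘ sw s₂} {a'} {s₂} (λ j → cong u (trans (cong (sw s₂ ∘ tr a s₃) (sym (sw-invol s₂ j))) (conj₃ (sw s₂ j) a≤))) (cov⇒cw {ũ ∘ tr a s₃} ≤-refl c')))
            (λ j l → trans (e j l) (cong u (trans (cong (sw s₂ ∘ tr a s₃) (sym (sw-invol s₂ (tr a' s₂ (sw s₂ j))))) (trans (conj₃ (sw s₂ (tr a' s₂ (sw s₂ j))) a≤) (cong (tr a s₂) (conj₂ j a'≤))))))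
            (subst₂ _<_ (sym (trans (e s₃ s₃<n) (cong v (sw-at' s₂)))) (sym (trans (e s₂ s₂<n) (cong v (sw-at s₂)))) asc)
          where
          a≤ = below₂ {ũ} nd al c
          a'≤ = ≤-pred al'

    Inj-U : ∀ {v} → Inj n v → Inj n (U v)
    Inj-U {v} inj = Inj-sw {u = v ∘ sw s₂} s₁ s₂<n (Inj-sw {u = v} s₂ s₃<n inj)

    slots₂-desc : Desc (s₃ ∷ s₂ ∷ [])
    slots₂-desc = ≤-refl ∷ [-]
    slots₃-desc : Desc (s₃ ∷ s₂ ∷ s₁ ∷ [])
    slots₃-desc = ≤-refl ∷ ≤-refl ∷ [-]

    leaf≤1 : ∀ w v → leaf w v ≤ 1
    leaf≤1 w v = when-≤ (eqOn? v w) ≤-refl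

    N₂≤1 : ∀ w A u → Inj n u → N₂ w A u ≤ 1
    N₂≤1 w A u inj = go (u s₂ <? u s₃)
      where
      go : (d : Dec (u s₂ < u s₃)) → N₂′ w A u d ≤ 1
      go (yes _) = cnt≤1 n (s₃ ∷ s₂ ∷ []) A (leaf w) u inj slots₂-desc (s₃<n ∷ s₂<n ∷ []) (λ v _ → leaf≤1 w v)
        (λ v v' _ _ k k' → trans (sym (leaf-eq w v k s₃ s₃<n)) (leaf-eq w v' k' s₃ s₃<n) ∷ trans (sym (leaf-eq w v k s₂ s₂<n)) (leaf-eq w v' k' s₂ s₂<n) ∷ [])
      go (no _) = cnt≤1 n (s₃ ∷ s₂ ∷ []) A (leaf' w) (u ∘ sw s₂) (Inj-sw {u = u} s₂ s₃<n inj) slots₂-desc (s₃<n ∷ s₂<n ∷ []) (λ v _ → when-≤ (v s₂ <? v s₃) (leaf≤1 w _))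
        (λ v v' _ _ k k' → let k₁ = proj₂ (when-pos (v s₂ <? v s₃) _ k) ; k₂ = proj₂ (when-pos (v' s₂ <? v' s₃) _ k') in
           trans (cong v (sym (sw-at s₂))) (trans (trans (sym (leaf-eq w (v ∘ sw s₂) k₁ s₂ s₂<n)) (leaf-eq w (v' ∘ sw s₂) k₂ s₂ s₂<n)) (cong v' (sw-at s₂)))
           ∷ trans (cong v (sym (sw-at' s₂))) (trans (trans (sym (leaf-eq w (v ∘ sw s₂) k₁ s₃ s₃<n)) (leaf-eq w (v' ∘ sw s₂) k₂ s₃ s₃<n)) (cong v' (sw-at' s₂))) ∷ [])

    Reach-inj : ∀ {ss B u v} → All (_< n) ss → Inj n u → Reach ss B u v → Inj n v
    Reach-inj a inj done = inj
    Reach-inj (_ ∷ a) inj (skip r) = Reach-inj a inj r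
    Reach-inj (l ∷ a) inj (bump i il c r) = Reach-inj a (Inj-tr (<-trans il l) l inj) r

    slots₃<n : All (_< n) (s₃ ∷ s₂ ∷ s₁ ∷ [])
    slots₃<n = s₃<n ∷ s₂<n ∷ s₁<n ∷ []

    K₁≤1 : ∀ w A v → Inj n v → K₁ w A v ≤ 1
    K₁≤1 w A v inj = when-≤ (v s₂ <? v s₃) (when-≤ (v s₁ <? v s₃) (N₂≤1 w A (U v) (Inj-U {v} inj)))

    module Bounds (u₁ w : ℕ → ℕ) (inju : Inj n u₁) (injw : Inj n w) (c₁₂ : u₁ s₁ < u₁ s₂) (c₂₃ : u₁ s₂ < u₁ s₃) where
      open Unique u₁ w inju injw c₁₂ c₂₃

      K₁-info : ∀ {A B v} → Reach (s₃ ∷ s₂ ∷ s₁ ∷ []) B u₁ v → 0 < K₁ w A v → Info A v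
      K₁-info {A} {B} {v} r k with when-pos (v s₂ <? v s₃) _ k
      ... | l₂ , k' with when-pos (v s₁ <? v s₃) _ k'
      ... | l₁ , k'' = build r
        where
        frm = N₂-form w A (U v) (Inj-U {v} (Reach-inj slots₃<n inju r)) k''
        build : ∀ {B} → Reach (s₃ ∷ s₂ ∷ s₁ ∷ []) B u₁ v → Info A v
        build (skip (skip (skip done))) = record { Y = _ ; Z = _ ; st₃ = stay ; st₂ = stay ; st₁ = stay ; l₁ = l₁ ; l₂ = l₂ ; form = frm }
        build (skip (skip (bump i a c done))) = record { Y = _ ; Z = _ ; st₃ = stay ; st₂ = stay ; st₁ = hop i a c ; l₁ = l₁ ; l₂ = l₂ ; form = frm }
        build (skip (bump i a c (skip done))) = record { Y = _ ; Z = _ ; st₃ = stay ; st₂ = hop i a c ; st₁ = stay ; l₁ = l₁ ; l₂ = l₂ ; form = frm }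
        build (skip (bump i a c (bump i' a' c' done))) = record { Y = _ ; Z = _ ; st₃ = stay ; st₂ = hop i a c ; st₁ = hop i' a' c' ; l₁ = l₁ ; l₂ = l₂ ; form = frm }
        build (bump i a c (skip (skip done))) = record { Y = _ ; Z = _ ; st₃ = hop i a c ; st₂ = stay ; st₁ = stay ; l₁ = l₁ ; l₂ = l₂ ; form = frm }
        build (bump i a c (skip (bump i' a' c' done))) = record { Y = _ ; Z = _ ; st₃ = hop i a c ; st₂ = stay ; st₁ = hop i' a' c' ; l₁ = l₁ ; l₂ = l₂ ; form = frm }
        build (bump i a c (bump i' a' c' (skip done))) = record { Y = _ ; Z = _ ; st₃ = hop i a c ; st₂ = hop i' a' c' ; st₁ = stay ; l₁ = l₁ ; l₂ = l₂ ; form = frm }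
        build (bump i a c (bump i' a' c' (bump i'' a'' c'' done))) = record { Y = _ ; Z = _ ; st₃ = hop i a c ; st₂ = hop i' a' c' ; st₁ = hop i'' a'' c'' ; l₁ = l₁ ; l₂ = l₂ ; form = frm }

      open Info

      bound1 : ∀ A B → (∀ {v v'} → Info A v → Info A v' → v s₃ ≡ v' s₃ × v s₂ ≡ v' s₂ × v s₁ ≡ v' s₁) → Ω w u₁ A B ≤ 1
      bound1 A B q = cnt≤1 n _ B (K₁ w A) u₁ inju slots₃-desc slots₃<n (λ v r → K₁≤1 w A v (Reach-inj slots₃<n inju r))
        (λ v v' r r' k k' → let (a , b , c) = q (K₁-info r k) (K₁-info r' k') in a ∷ b ∷ c ∷ [])

      bound2 : ∀ A B {P : (ℕ → ℕ) → Set} (P? : ∀ v → Dec (P v)) → (∀ {v v'} → Info A v → Info A v' → (P v × P v') ⊎ (¬ P v × ¬ P v') → v s₃ ≡ v' s₃ × v s₂ ≡ v' s₂ × v s₁ ≡ v' s₁) → Ω w u₁ A B ≤ 2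
      bound2 A B P? q = cnt≤2 n _ B (K₁ w A) u₁ P? inju slots₃-desc slots₃<n (λ v r → K₁≤1 w A v (Reach-inj slots₃<n inju r))
        (λ v v' r r' k k' p → let (a , b , c) = q (K₁-info r k) (K₁-info r' k') p in a ∷ b ∷ c ∷ [])

      uniq₀ : ∀ {v v'} → Info 0 v → Info 0 v' → v s₃ ≡ v' s₃ × v s₂ ≡ v' s₂ × v s₁ ≡ v' s₁
      uniq₀ {v} {v'} π π' with form π | form π'
      ... | same e | same e' = trans (sym (U₁ v)) (trans (trans (sym (e s₁ s₁<n)) (e' s₁ s₁<n)) (U₁ v'))
                             , trans (sym (U₃ v)) (trans (trans (sym (e s₃ s₃<n)) (e' s₃ s₃<n)) (U₃ v'))
                             , trans (sym (U₂ v)) (trans (trans (sym (e s₂ s₂<n)) (e' s₂ s₂<n)) (U₂ v'))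

      alpha-class : ∀ v {a} → a ≤ s₁ → (∀ j → j < n → w j ≡ U v (tr a s₃ j)) → v s₁ ≡ w s₂
      alpha-class v {a} al e = sym (trans (e s₂ s₂<n) (trans (cong (U v) (tr-o a s₃ s₂ (λ q → lo≢₂ al (sym q)) (<⇒≢ ≤-refl))) (U₂ v)))

      beta-class : ∀ v {a} → a ≤ s₁ → CW (U v) a s₂ → (∀ j → j < n → w j ≡ U v (tr a s₂ j)) → ¬ (v s₁ ≡ w s₂)
      beta-class v {a} al (c , _) e q = <⇒≢ c (trans (U₂ v) (trans q (trans (e s₂ s₂<n) (cong (U v) (tr-r a s₂)))))

      -- Among one-bump passes v s₁ = w s₂ singles out `alpha`, which leaves the slot `s₂` of `U v`
      -- alone.
      uniq₁ : ∀ {v v'} → Info 1 v → Info 1 v' → (v s₁ ≡ w s₂ × v' s₁ ≡ w s₂) ⊎ (¬ v s₁ ≡ w s₂ × ¬ v' s₁ ≡ w s₂) → v s₃ ≡ v' s₃ × v s₂ ≡ v' s₂ × v s₁ ≡ v' s₁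
      uniq₁ {v} {v'} π π' cl with form π | form π'
      ... | alpha a al cw e | alpha a' al' cw' e' = α-uniq π π' a al cw e a' al' cw' e'
      ... | beta a al cw e | beta a' al' cw' e' = β-uniq π π' a al cw e a' al' cw' e'
      uniq₁ {v} {v'} π π' (inj₁ (p , q)) | alpha a al cw e | beta a' al' cw' e' = ⊥-elim (beta-class v' al' cw' e' q)
      uniq₁ {v} {v'} π π' (inj₂ (p , q)) | alpha a al cw e | beta a' al' cw' e' = ⊥-elim (p (alpha-class v al e))
      uniq₁ {v} {v'} π π' (inj₁ (p , q)) | beta a al cw e | alpha a' al' cw' e' = ⊥-elim (beta-class v al cw e p)
      uniq₁ {v} {v'} π π' (inj₂ (p , q)) | beta a al cw e | alpha a' al' cw' e' = ⊥-elim (q (alpha-class v' al' e'))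

      no-form : ∀ {A v} → Info (suc (suc (suc A))) v → ⊥
      no-form π with form π
      ... | ()

      Ω≤2 : ∀ A B → Ω w u₁ A B ≤ 2
      Ω≤2 0 B = ≤-trans (bound1 0 B uniq₀) (n≤1+n 1)
      Ω≤2 1 B = bound2 1 B (λ v → v s₁ ≟ w s₂) uniq₁
      Ω≤2 2 B = bound2 2 B (λ v → v s₂ ≟ u₁ s₂) (λ π π' p → let q = γ-f₂ π π' p in γ-f₃ π π' , q , γ-f₁ π π' q)
      Ω≤2 (suc (suc (suc A))) B = ≤-trans (bound1 (3 + A) B (λ π → ⊥-elim (no-form π))) (n≤1+n 1)

      Ω₀≤1 : ∀ B → Ω w u₁ 0 B ≤ 1
      Ω₀≤1 B = bound1 0 B uniq₀

      Ω≤1-top : (∀ j → j < s₃ → w j < w s₃) → ∀ A B → Ω w u₁ A B ≤ 1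
      Ω≤1-top tp 0 B = bound1 0 B uniq₀
      Ω≤1-top tp 1 B = bound1 1 B uq
        where
        -- For `beta`, w s₃ is v s₂ while v s₃ is w s₁ or w s₂; a largest w s₃ would give v s₃ < v
        -- s₂, against `l₂`.
        noβ : ∀ {v} → Info 1 v → ∀ a → a ≤ s₁ → CW (U v) a s₂ → (∀ j → j < n → w j ≡ U v (tr a s₂ j)) → ⊥
        noβ {v} π a al cw e with β-max {v} (l₁ π) (l₂ π) a al cw e
        ... | mx , _ , _ = <-asym (l₂ π) (subst (_< v s₂) (sym′ mx) (subst (λ z → pick mx < z) w₃ (lt mx)))
          where
          w₃ : w s₃ ≡ v s₂
          w₃ = trans (e s₃ s₃<n) (trans (cong (U v) (tr-o a s₂ s₃ (λ q → lo≢₃ al (sym q)) (λ q → <⇒≢ ≤-refl (sym q)))) (U₃ v))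
          pick : v s₃ ≡ w s₁ ⊎ v s₃ ≡ w s₂ → ℕ
          pick (inj₁ _) = w s₁
          pick (inj₂ _) = w s₂
          sym′ : (q : v s₃ ≡ w s₁ ⊎ v s₃ ≡ w s₂) → pick q ≡ v s₃
          sym′ (inj₁ q) = sym q
          sym′ (inj₂ q) = sym q
          lt : (q : v s₃ ≡ w s₁ ⊎ v s₃ ≡ w s₂) → pick q < w s₃
          lt (inj₁ _) = tp s₁ s₁<s₃
          lt (inj₂ _) = tp s₂ ≤-refl
        uq : ∀ {v v'} → Info 1 v → Info 1 v' → v s₃ ≡ v' s₃ × v s₂ ≡ v' s₂ × v s₁ ≡ v' s₁
        uq π π' with form π | form π'
        ... | alpha a al cw e | alpha a' al' cw' e' = α-uniq π π' a al cw e a' al' cw' e'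
        ... | beta a al cw e | _ = ⊥-elim (noβ π a al cw e)
        ... | alpha _ _ _ _ | beta a al cw e = ⊥-elim (noβ π' a al cw e)
      Ω≤1-top tp 2 B = bound1 2 B (λ π π' → let q = γ-f₂-top tp π π' in γ-f₃ π π' , q , γ-f₁ π π' q)
      Ω≤1-top tp (suc (suc (suc A))) B = bound1 (3 + A) B (λ π → ⊥-elim (no-form π))

      -- A path without bumps in the second pass whose last bump is at s₁ can delay that bump to the second pass.
      delay : ∀ B → (∀ v → ¬ Reach (s₃ ∷ s₂ ∷ []) (suc B) u₁ v) → 0 < Ω w u₁ 0 (suc B) → 0 < Ω w u₁ 1 B
      delay B nb p with cnt-pos (s₃ ∷ s₂ ∷ s₁ ∷ []) (suc B) (K₁ w 0) u₁ p
      ... | v , r , k with reach-last (s₃ ∷ s₂ ∷ []) r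
      ... | inj₁ r' = ⊥-elim (nb v r')
      ... | inj₂ (z , i , rz , s≤s im , (c , cv) , refl) = pos-cnt (K₁ w 1) (reach-skip-last s₁ rz) K>0
        where
        π : Info 0 v
        π = K₁-info r k
        eqs : ∀ j → j < n → w j ≡ U v j
        eqs with form π
        ... | same e = e
        z₃ : z s₃ ≡ v s₃
        z₃ = cong z (sym (tr-o i s₁ s₃ (λ e → <⇒≢ (≤-trans (s≤s im) (≤-trans (n≤1+n _) (n≤1+n _))) (sym e)) (λ e → <⇒≢ s₁<s₃ (sym e))))
        z₂ : z s₂ ≡ v s₂
        z₂ = cong z (sym (tr-o i s₁ s₂ (λ e → <⇒≢ (≤-trans (s≤s im) (n≤1+n _)) (sym e)) (λ e → <⇒≢ ≤-refl (sym e))))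
        vi : v i ≡ z s₁
        vi = cong z (tr-l i s₁)
        v₁ : v s₁ ≡ z i
        v₁ = cong z (tr-r i s₁)
        la : z s₂ < z s₃
        la = subst₂ _<_ (sym z₂) (sym z₃) (l₂ π)
        lb : z s₁ < z s₃
        lb = subst (z s₁ <_) (sym z₃) (<-trans c (subst (_< v s₃) v₁ (l₁ π)))
        u = U z
        -- Bumps at `s₃` and `s₂` keep the value at `s₁` below the one at `s₂`, so the second pass
        -- begins without an exchange.
        lc : u s₂ < u s₃
        lc = subst₂ _<_ (sym (U₂ z)) (sym (U₃ z)) (z₁<z₂ rz)
          where
          z₁<z₂ : ∀ {B} → Reach (s₃ ∷ s₂ ∷ []) B u₁ z → z s₁ < z s₂
          z₁<z₂ (skip (skip done)) = c₁₂
          z₁<z₂ (skip (bump a al (d , _) done)) = subst₂ _<_ (cong u₁ (sym (tr-o a s₂ s₁ ne (<⇒≢ ≤-refl)))) (cong u₁ (sym (tr-r a s₂))) (<-trans c₁₂ d)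
            where ne : s₁ ≢ a
                  ne refl = <-asym d c₁₂
          z₁<z₂ (bump a al (d , _) (skip done)) = subst₂ _<_ (cong u₁ (sym (tr-o a s₃ s₁ ne (<⇒≢ s₁<s₃)))) (cong u₁ (sym (tr-o a s₃ s₂ ne' (<⇒≢ ≤-refl)))) c₁₂
            where ne : s₁ ≢ a
                  ne refl = <-asym d (<-trans c₁₂ c₂₃)
                  ne' : s₂ ≢ a
                  ne' refl = <-asym d c₂₃
          z₁<z₂ (bump a al (d , _) (bump a' al' (d' , _) done)) = subst₂ _<_ (trans y₁ (cong (u₁ ∘ tr a s₃) (sym (tr-o a' s₂ s₁ na (<⇒≢ ≤-refl))))) (cong (u₁ ∘ tr a s₃) (sym (tr-r a' s₂))) (<-trans c₁₂ (subst (_< u₁ (tr a s₃ a')) (sym y₂) d'))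
            where ne : s₁ ≢ a
                  ne refl = <-asym d (<-trans c₁₂ c₂₃)
                  ne' : s₂ ≢ a
                  ne' refl = <-asym d c₂₃
                  y₁ : u₁ s₁ ≡ u₁ (tr a s₃ s₁)
                  y₁ = cong u₁ (sym (tr-o a s₃ s₁ ne (<⇒≢ s₁<s₃)))
                  y₂ : u₁ s₂ ≡ u₁ (tr a s₃ s₂)
                  y₂ = cong u₁ (sym (tr-o a s₃ s₂ ne' (<⇒≢ ≤-refl)))
                  na : s₁ ≢ a'
                  na refl = <-asym d' (subst₂ _<_ y₁ y₂ c₁₂)
        -- The only new position between `i` and the slot is `s₁`; it now carries v s₃, which
        -- exceeds the bumped value.
        cov' : Cov u i s₂
        cov' = subst₂ _<_ (sym (U₂ z)) (sym (U-lo z i im)) c , λ {l} ls il → chk l (≤-pred ls) il (m≤n⇒m<n∨m≡n (≤-pred ls))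
          where
          chk : ∀ l → l ≤ s₁ → i < l → l < s₁ ⊎ l ≡ s₁ → ¬ (u s₂ < u l × u l < u i)
          chk l _ il (inj₁ l<) (x , y) = cv l< il (subst₂ _<_ (U₂ z) (U-lo z l (≤-pred l<)) x , subst₂ _<_ (U-lo z l (≤-pred l<)) (U-lo z i im) y)
          chk l _ il (inj₂ refl) (x , y) = <-asym (subst₂ _<_ (U₁ z) (U-lo z i im) y) (subst₂ _<_ v₁ (sym z₃) (l₁ π))
        lf : 0 < leaf w (u ∘ tr i s₂)
        lf = subst (0 <_) (sym (when-yes (eqOn? (u ∘ tr i s₂) w) 1 (λ {j} l → trans (tt j l (j ≟ i) (j ≟ s₂)) (sym (eqs j l))))) (s≤s z≤n)
          where
          tt : ∀ j → j < n → Dec (j ≡ i) → Dec (j ≡ s₂) → u (tr i s₂ j) ≡ U v j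
          tt j l (yes refl) _ = trans (cong u (tr-l i s₂)) (trans (U₂ z) (sym (trans (U-lo v i im) vi)))
          tt j l (no _) (yes refl) = trans (cong u (tr-r i s₂)) (trans (U-lo z i im) (sym (trans (U₂ v) v₁)))
          tt j l (no p) (no q) = trans (cong u (tr-o i s₂ j p q)) (cong z (sym (tr-o i s₁ (sw s₂ (sw s₁ j))
              (λ e → p (sw-inj s₁ (sw-inj s₂ (trans e (sym (trans (cong (sw s₂) (sw-fix s₁ i (<⇒≢ (s≤s im)) (<⇒≢ (s≤s (m≤n⇒m≤1+n im))))) (sws-lo (m≤n⇒m≤1+n im))))))))
              (λ e → q (sw-inj s₁ (sw-inj s₂ (trans e (sym (trans (cong (sw s₂) (sw-at' s₁)) (sws-lo ≤-refl)))))))))) 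
        K>0 : 0 < K₁ w 1 z
        K>0 = subst (0 <_) (sym (trans (when-yes (z s₂ <? z s₃) _ la) (when-yes (z s₁ <? z s₃) _ lb))) (go (u s₂ <? u s₃))
          where
          go : (d : Dec (u s₂ < u s₃)) → 0 < N₂′ w 1 u d
          go (yes _) = pos-cnt {s₃ ∷ s₂ ∷ []} (leaf w) (skip (bump i (s≤s (m≤n⇒m≤1+n im)) cov' done)) lf
          go (no nl) = ⊥-elim (nl lc)

-- The functionals evaluate to path numbers.

module PathEvaluation where
  open DividedDifferences using (sw; sw-at; sw-at'; sw-invol)
  open DifferenceRings
  open Functionals
  open Words
  open Transpositions
  open PathCounting
  open SlotPaths
  open PathBounds

  opaque
    unfolding ∑ᴺ
    ∑-+ : ∀ s (f : ℕ → ℕ) → ∑ s (λ i → + f i) ≡ + ∑ᴺ s f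
    ∑-+ zero f = ≡.refl
    ∑-+ (suc s) f = cong (ℤ._+ + f s) (∑-+ s f)

  module Link (DR : DiffRing) where
    open DiffRing DR
    open Alg DR
    open Eps DR
    open RingIds R using (neg-mul)

    -- Elementary symmetric polynomial of degree b in the variables -x_s, s ∈ ss, times G.
    EE : List ℕ → ℕ → Carrier → Carrier
    EE [] zero G = G
    EE [] (suc b) G = 0#
    EE (s ∷ ss) zero G = EE ss zero G
    EE (s ∷ ss) (suc b) G = EE ss (suc b) G + X s (EE ss b G)

    OS : ℕ → List ℕ → (ℕ → ℕ) → Set
    OS n ss u = All (λ s → ∀ j → s < j → j < n → u s < u j) ss

    -- After the bump, `i` and `s` carry u s and u i; both exceed u t for every smaller slot `t`.
    OS-tr : ∀ {n u i s} ss → i < s → s < n → u s < u i → All (_< s) ss → OS n ss u → OS n ss (u ∘ tr i s)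
    OS-tr [] il sn c a o = []
    OS-tr {n} {u} {i} {s} (t ∷ ss) il sn c (ts ∷ a) (q ∷ o) = (λ j tj jn → subst (_< u (tr i s j)) (cong u (≡.sym (tr-o i s t t≢i (ℕₚ.<⇒≢ ts)))) (go j tj jn (j ≟ i) (j ≟ s))) ∷ OS-tr ss il sn c a o
      where
      t≢i : t ≢ i
      t≢i ≡.refl = ℕₚ.<-asym c (q s ts sn)
      go : ∀ j → t < j → j < n → Dec (j ≡ i) → Dec (j ≡ s) → u t < u (tr i s j)
      go j tj jn (yes ≡.refl) _ = subst (u t <_) (cong u (≡.sym (tr-l i s))) (q s ts sn)
      go j tj jn (no _) (yes ≡.refl) = subst (u t <_) (cong u (≡.sym (tr-r i s))) (ℕₚ.<-trans (q s ts sn) c)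
      go j tj jn (no a) (no b) = subst (u t <_) (cong u (≡.sym (tr-o i s j a b))) (q j tj jn)

    -- Each chosen slot is a factor -x_s, evaluated by `monk`. The descending order of the slots
    -- keeps its hypothesis alive through `OS-tr`.
    pass : ∀ n ss b u G K → Perm[ n ] u → Desc ss → All (_< n) ss → OS n ss u → (∀ v → Perm[ n ] v → ε n v G ≡ + K v) →
      ε n u (EE ss b G) ≡ + cnt ss b K u
    pass n [] zero u G K pu d a o h = h u pu
    pass n [] (suc b) u G K pu d a o h = ε-0 n u
    pass n (s ∷ ss) zero u G K pu d (_ ∷ a) (_ ∷ o) h = pass n ss zero u G K pu (Linked.tail d) a o h
    pass n (s ∷ ss) (suc b) u G K pu d (sn ∷ a) (q ∷ o) h = ≡.trans (ε-+ n u _ _) (cong₂ ℤ._+_ (pass n ss (suc b) u G K pu (Linked.tail d) a o h)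
      (≡.trans (monk n u s _ (proj₂ pu) sn q) (≡.trans (∑-cong s each) (∑-+ s _))))
      where
      each : ∀ i → i < s → κ n u i s (EE ss b G) ≡ + whenᴺ (cov? u i s) (cnt ss b K (u ∘ tr i s))
      each i il with cov? u i s
      ... | no _ = ≡.refl
      ... | yes (c , _) = pass n ss b (u ∘ tr i s) G K (Perm-tr (ℕₚ.<-trans il sn) sn pu) (Linked.tail d) a (OS-tr ss il sn c (desc-all d) o) h

    X-0 : ∀ s → X s 0# ≈ 0#
    X-0 s = trans (-‿cong (zeroʳ (x s))) (-0#≈0#)
      where open import Algebra.Properties.Ring ring using (-0#≈0#)

    -- In each degree the factor is symmetric in x_s and x_(s+1), and `∂ s` is linear over such
    -- polynomials.
    EE₂-∂ : ∀ s b F → ∂ s (EE (suc s ∷ s ∷ []) b F) ≈ EE (suc s ∷ s ∷ []) b (∂ s F)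
    EE₂-∂ s zero F = refl
    EE₂-∂ s (suc zero) F = trans (∂-cong s (e₁ F)) (trans (∂-inv* s k F inv) (sym (e₁ (∂ s F))))
      where
      open import Algebra.Properties.Ring ring using (-‿+-comm; -‿distribˡ-*)
      k = - (x s + x (suc s))
      e₁ : ∀ F → (0# + X s F) + X (suc s) F ≈ k * F
      e₁ F = trans (+-congʳ (+-identityˡ _)) (trans (-‿+-comm _ _) (trans (-‿cong (sym (distribʳ F _ _))) (-‿distribˡ-* _ F)))
      inv : DiffRing.s DR s k ≈ k
      inv = trans (s-neg s _) (-‿cong (trans (s-+ s _ _) (trans (+-cong (trans (s-x s s) (x-cong (sw-at s))) (trans (s-x s (suc s)) (x-cong (sw-at' s)))) (+-comm _ _))))
    EE₂-∂ s (suc (suc zero)) F = trans (∂-cong s (e₂ F)) (trans (∂-inv* s k F inv) (sym (e₂ (∂ s F))))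
      where
      open import Algebra.Properties.Ring ring using (-‿distribˡ-*; -‿distribʳ-*; -‿involutive)
      k = x (suc s) * x s
      e₂ : ∀ F → (0# + X s 0#) + X (suc s) (0# + X s F) ≈ k * F
      e₂ F = trans (+-cong (trans (+-identityˡ _) (X-0 s)) (X-cong (suc s) (+-identityˡ _))) (trans (+-identityˡ _)
        (trans (-‿cong (sym (-‿distribʳ-* _ _))) (trans (-‿involutive _) (sym (*-assoc _ _ _)))))
      inv : DiffRing.s DR s k ≈ k
      inv = trans (s-* s _ _) (trans (*-cong (trans (s-x s (suc s)) (x-cong (sw-at' s))) (trans (s-x s s) (x-cong (sw-at s)))) (*-comm _ _))
    EE₂-∂ s (suc (suc (suc b))) F = trans (∂-cong s (e₃ F)) (trans (∂-0 s) (sym (e₃ (∂ s F))))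
      where
      e₃ : ∀ F → (0# + X s 0#) + X (suc s) (0# + X s 0#) ≈ 0#
      e₃ F = trans (+-cong z (trans (X-cong (suc s) z) (X-0 (suc s)))) (+-identityˡ 0#)
        where z = trans (+-identityˡ _) (X-0 s)

    module _ (m : ℕ) where
      open Count m

      module _ (w : ℕ → ℕ) (F : Carrier) (dual : ∀ u → Perm[ n ] u → ε n u F ≡ + leaf w u) where

        ε-N₂ : ∀ A u → Perm[ n ] u → ε n u (EE (s₃ ∷ s₂ ∷ []) A F) ≡ + N₂ w A u
        ε-N₂ A u pu = go (u s₂ <? u s₃)
          where
          inj = proj₂ pu
          os : ∀ {u} → u s₂ < u s₃ → OS n (s₃ ∷ s₂ ∷ []) u
          os {u} l = (λ j a b → ⊥-elim (ℕₚ.<⇒≱ a (ℕₚ.≤-pred b))) ∷ (λ j a b → subst (λ z → u s₂ < u z) (ℕₚ.≤-antisym a (ℕₚ.≤-pred b)) l) ∷ []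
          go : (d : Dec (u s₂ < u s₃)) → ε n u (EE (s₃ ∷ s₂ ∷ []) A F) ≡ + N₂′ w A u d
          go (yes l) = pass n (s₃ ∷ s₂ ∷ []) A u F (leaf w) pu slots₂-desc (s₃<n ∷ s₂<n ∷ []) (os l) dual
          go (no nl) = ≡.trans (ε-permcong n _ (λ j _ → cong u (≡.sym (sw-invol s₂ j)))) (≡.trans (≡.sym (ε-asc n (u ∘ sw s₂) s₂ _ s₃<n (proj₂ pũ) asc))
             (≡.trans (ε-cong n (u ∘ sw s₂) (EE₂-∂ s₂ A F)) (pass n (s₃ ∷ s₂ ∷ []) A (u ∘ sw s₂) (∂ s₂ F) (leaf' w) pũ slots₂-desc (s₃<n ∷ s₂<n ∷ []) (os asc) lf)))
            where
            pũ = Perm-sw {n} {u} s₂ s₃<n pu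
            lt : u s₃ < u s₂
            lt = ℕₚ.≤∧≢⇒< (ℕₚ.≮⇒≥ nl) (λ e → ℕₚ.<⇒≢ {s₂} ℕₚ.≤-refl (inj s₂<n s₃<n (≡.sym e)))
            asc : u (sw s₂ s₂) < u (sw s₂ s₃)
            asc = subst₂ _<_ (cong u (≡.sym (sw-at s₂))) (cong u (≡.sym (sw-at' s₂))) lt
            lf : ∀ v → Perm[ n ] v → ε n v (∂ s₂ F) ≡ + leaf' w v
            lf v pv with v s₂ <? v s₃
            ... | yes a = ≡.trans (ε-asc n v s₂ F s₃<n (proj₂ pv) a) (dual (v ∘ sw s₂) (Perm-sw {n} {v} s₂ s₃<n pv))
            ... | no b = ε-desc n v s₂ F s₃<n (proj₂ pv) (ℕₚ.≤∧≢⇒< (ℕₚ.≮⇒≥ b) (λ e → ℕₚ.<⇒≢ {s₂} ℕₚ.≤-refl (proj₂ pv s₂<n s₃<n (≡.sym e))))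

        ε-K₁ : ∀ A v → Perm[ n ] v → ε n v (∂ s₂ (∂ s₁ (EE (s₃ ∷ s₂ ∷ []) A F))) ≡ + K₁ w A v
        ε-K₁ A v pv with v s₂ <? v s₃
        ... | no b = ε-desc n v s₂ _ s₃<n (proj₂ pv) (ℕₚ.≤∧≢⇒< (ℕₚ.≮⇒≥ b) (λ e → ℕₚ.<⇒≢ {s₂} ℕₚ.≤-refl (proj₂ pv s₂<n s₃<n (≡.sym e))))
        ... | yes a = ≡.trans (ε-asc n v s₂ _ s₃<n (proj₂ pv) a) (go (v s₁ <? v s₃))
          where
          pv' = Perm-sw {n} {v} s₂ s₃<n pv
          e₁ : v (sw s₂ s₁) ≡ v s₁
          e₁ = cong v (sws-lo ℕₚ.≤-refl)
          e₂ : v (sw s₂ s₂) ≡ v s₃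
          e₂ = cong v (sw-at s₂)
          go : (d : Dec (v s₁ < v s₃)) → ε n (v ∘ sw s₂) (∂ s₁ (EE (s₃ ∷ s₂ ∷ []) A F)) ≡ + whenᴺ d (N₂ w A (U v))
          go (yes l) = ≡.trans (ε-asc n (v ∘ sw s₂) s₁ _ s₂<n (proj₂ pv') (subst₂ _<_ (≡.sym e₁) (≡.sym e₂) l)) (ε-N₂ A (U v) (Perm-sw {n} {v ∘ sw s₂} s₁ s₂<n pv'))
          go (no nl) = ε-desc n (v ∘ sw s₂) s₁ _ s₂<n (proj₂ pv') (subst₂ _<_ (≡.sym e₂) (≡.sym e₁) (ℕₚ.≤∧≢⇒< (ℕₚ.≮⇒≥ nl) (λ e → ℕₚ.<⇒≢ s₁<s₃ (proj₂ pv s₁<n s₃<n (≡.sym e)))))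

        ε-Ω : ∀ A b u → Perm[ n ] u → u s₁ < u s₂ → u s₂ < u s₃ → ε n u (EE (s₃ ∷ s₂ ∷ s₁ ∷ []) b (∂ s₂ (∂ s₁ (EE (s₃ ∷ s₂ ∷ []) A F)))) ≡ + Ω w u A b
        ε-Ω A b u pu l₁ l₂ = pass n (s₃ ∷ s₂ ∷ s₁ ∷ []) b u _ (K₁ w A) pu slots₃-desc slots₃<n os (ε-K₁ A)
          where
          os : OS n (s₃ ∷ s₂ ∷ s₁ ∷ []) u
          os = (λ j a b → ⊥-elim (ℕₚ.<⇒≱ a (ℕₚ.≤-pred b))) ∷ (λ j a b → subst (λ z → u s₂ < u z) (ℕₚ.≤-antisym a (ℕₚ.≤-pred b)) l₂) ∷ third ∷ []
            where
            third : ∀ j → s₁ < j → j < n → u s₁ < u j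
            third j a b with ℕₚ.m≤n⇒m<n∨m≡n a
            ... | inj₂ ≡.refl = l₁
            ... | inj₁ a' = subst (λ z → u s₁ < u z) (ℕₚ.≤-antisym a' (ℕₚ.≤-pred b)) (ℕₚ.<-trans l₁ l₂)

-- Row operators and elementary symmetric polynomials.

module RowOperators where
  open DifferenceRings
  open Functionals
  open Words
  open PathBounds
  open PathEvaluation

  Asc : ℕ → ℕ → (ℕ → ℕ) → Set
  Asc a b u = ∀ j → a ≤ j → suc j < b → u j < u (suc j)

  asc-lt : ∀ {a b u} → Asc a b u → ∀ {i} j → a ≤ i → i < j → j < b → u i < u j
  asc-lt {a} {b} {u} asc {i} (suc j) ai (s≤s ij) jb with ℕₚ.m≤n⇒m<n∨m≡n ij
  ... | inj₂ ≡.refl = asc i ai jb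
  ... | inj₁ l = ℕₚ.<-trans (asc-lt {u = u} asc j ai l (ℕₚ.<-trans (ℕₚ.n<1+n j) jb)) (asc j (ℕₚ.≤-trans ai (ℕₚ.<⇒≤ l)) jb)

  -- For permutations of [0,N) this says that n, ..., N - 1 are fixed (`records-fix`), stated
  -- through maxima because these steer the recursion of `word`.
  Records : ℕ → ℕ → (ℕ → ℕ) → Set
  Records n N u = ∀ j → n ≤ j → j < N → ∀ i → i < j → u i < u j

  Perm-punch : ∀ {N u p} → Perm[ suc N ] u → IsMax N u p → Perm[ N ] (u ∘ punch p)
  Perm-punch {N} {u} {p} (b , inj) (pl , q) = (λ {i} l → ℕₚ.<-≤-trans (q (punch p i) (punch-< pl l) (punch-≢ p i)) (ℕₚ.≤-pred (b (s≤s pl)))) , Inj-punch pl inj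

  Perm-drop : ∀ {N u} → Perm[ suc N ] u → (∀ i → i < N → u i < u N) → Perm[ N ] u
  Perm-drop (b , inj) q = (λ {i} l → ℕₚ.<-≤-trans (q i l) (ℕₚ.≤-pred (b ℕₚ.≤-refl))) , λ x y → inj (ℕₚ.m≤n⇒m≤1+n x) (ℕₚ.m≤n⇒m≤1+n y)

  Perm-drops : ∀ {n u} N → n ≤ N → Perm[ N ] u → Records n N u → Perm[ n ] u
  Perm-drops {n} {u} N l pu r with ℕₚ.m≤n⇒m<n∨m≡n l
  ... | inj₂ ≡.refl = pu
  Perm-drops {n} {u} (suc N) l pu r | inj₁ (s≤s l') = Perm-drops N l' (Perm-drop pu (r N l' ℕₚ.≤-refl)) (λ j a b → r j a (ℕₚ.m≤n⇒m≤1+n b))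

  module Rows (DR : DiffRing) where
    open DiffRing DR
    open Alg DR
    open Eps DR
    open Link DR
    open RingIds R using (A-lin; comm3)

    ε-records : ∀ n N u f → n ≤ N → Records n N u → ε N u f ≡ ε n u f
    ε-records n N u f l r with ℕₚ.m≤n⇒m<n∨m≡n l
    ... | inj₂ ≡.refl = ≡.refl
    ε-records n (suc N) u f l r | inj₁ (s≤s l') = ≡.trans (ε-ext N u f (r N l' ℕₚ.≤-refl)) (ε-records n N u f l' (λ j a b → r j a (ℕₚ.m≤n⇒m≤1+n b)))

    ε-asc-id : ∀ N u f → Asc 0 N u → ε N u f ≡ c₀ f
    ε-asc-id N u f asc = ≡.trans (ε-records 0 N u f z≤n (λ j _ jN i ij → asc-lt {0} {N} {u} asc j z≤n ij jN)) (ε-nil u f)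

    ∂*-rng-vanish : ∀ {p n f} c q → p ≤ q → n ≤ suc (c ℕ.+ q) → V p n f → ∂* (rng (suc c) q) f ≈ 0#
    ∂*-rng-vanish zero q pq l v = V-vanish q pq l v
    ∂*-rng-vanish {p} {n} (suc c) q pq l v = ∂*-rng-vanish c (suc q) (ℕₚ.m≤n⇒m≤1+n pq) (subst (λ z → n ≤ suc z) (≡.sym (ℕₚ.+-suc c q)) l) (V-∂ q pq v)

    -- A maximum that is not last starts a run whose last letter i satisfies n ≤ i + 1; the bound
    -- `V` leaves neither x_i nor x_(i+1) for it to act on.
    V-records : ∀ n N u → n ≤ N → Inj N u → Records n N u ⊎ (∀ H → V 0 n H → ε N u H ≡ 0ℤ)
    V-records n N u l inj with ℕₚ.m≤n⇒m<n∨m≡n l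
    ... | inj₂ ≡.refl = inj₁ (λ j a b → ⊥-elim (ℕₚ.<⇒≱ b a))
    V-records n (suc N) u l inj | inj₁ (s≤s l') = go (ℕₚ.m≤n⇒m<n∨m≡n (proj₁ im))
      where
      p = mp N u
      im = mp-isMax N u inj
      go : p < N ⊎ p ≡ N → Records n (suc N) u ⊎ (∀ H → V 0 n H → ε (suc N) u H ≡ 0ℤ)
      go (inj₁ pN) = inj₂ (λ H v → ≡.trans (ε-max N u p H im) (ε-≈0 N (u ∘ punch p) (trans (reflexive (cong (λ c → ∂* (rng c p) H) (≡.sym e)))
          (∂*-rng-vanish (N ∸ suc p) p z≤n (ℕₚ.≤-trans l' (ℕₚ.≤-reflexive (≡.sym (≡.trans (cong (ℕ._+ p) e) (ℕₚ.m∸n+n≡m (ℕₚ.<⇒≤ pN)))))) v))))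
        where
        e : suc (N ∸ suc p) ≡ N ∸ p
        e = ≡.sym (ℕₚ.+-∸-assoc 1 pN)
      go (inj₂ pe) with V-records n N u l' (λ x y → inj (ℕₚ.m≤n⇒m≤1+n x) (ℕₚ.m≤n⇒m≤1+n y))
      ... | inj₁ r = inj₁ (λ j a b → rec j a b (ℕₚ.m≤n⇒m<n∨m≡n (ℕₚ.≤-pred b)))
        where
        rec : ∀ j → n ≤ j → j < suc N → j < N ⊎ j ≡ N → ∀ i → i < j → u i < u j
        rec j a b (inj₁ jN) = r j a jN
        rec j a b (inj₂ ≡.refl) i ij = subst (λ z → u i < u z) pe (proj₂ im i (ℕₚ.<⇒≤ ij) (λ e → ℕₚ.<⇒≢ ij (≡.trans e pe)))
      ... | inj₂ z = inj₂ (λ H v → ≡.trans (ε-ext N u H (λ j jl → subst (λ z → u j < u z) pe (proj₂ im j (ℕₚ.<⇒≤ jl) (λ e → ℕₚ.<⇒≢ jl (≡.trans e pe))))) (z H v))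

    ZZ-end : ∀ c p z → ZZ (suc c) p z ≡ stepZ (c ℕ.+ p) (ZZ c p z)
    ZZ-end zero p z = ≡.refl
    ZZ-end (suc c) p z = ≡.trans (ZZ-end c (suc p) (stepZ p z)) (cong (λ q → stepZ q (ZZ c (suc p) (stepZ p z))) (ℕₚ.+-suc c p))

    sl : ℕ → ℕ → List ℕ
    sl zero p = []
    sl (suc c) p = suc (c ℕ.+ p) ∷ sl c p

    ∂*-snoc : ∀ c p f → ∂* (rng (suc c) p) f ≡ ∂ (c ℕ.+ p) (∂* (rng c p) f)
    ∂*-snoc zero p f = ≡.refl
    ∂*-snoc (suc c) p f = ≡.trans (∂*-snoc c (suc p) (∂ p f)) (cong (λ q → ∂ q (∂* (rng c (suc p)) (∂ p f))) (ℕₚ.+-suc c p))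

    -- Each row operator is ∂_q after multiplication by 1 - t x_(q+1). This factor commutes with the
    -- earlier divided differences, so all factors can be collected in front; their product
    -- generates the elementary symmetric polynomials in the -x_(q+1).
    ZZ-EE : ∀ c p F b → ∂* (rng c p) (EE (sl c p) b F) ≈ ZZ c p (z0 F) b
    ZZ-EE zero p F zero = refl
    ZZ-EE zero p F (suc b) = refl
    ZZ-EE (suc c) p F zero = trans (reflexive (∂*-snoc c p _)) (trans (∂-cong (c ℕ.+ p) (ZZ-EE c p F zero)) (reflexive (cong (λ z → z zero) (≡.sym (ZZ-end c p (z0 F))))))
    ZZ-EE (suc c) p F (suc b) = trans (reflexive (∂*-snoc c p _)) (trans (trans (∂-cong q (trans (∂*-+ (rng c p) _ _) (+-cong (ZZ-EE c p F (suc b)) (trans (∂*-X (rng c p) (suc q) _ far) (X-cong (suc q) (ZZ-EE c p F b))))))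
        (trans (∂-+ q _ _) (+-congˡ (∂-X q _)))) (reflexive (cong (λ z → z (suc b)) (≡.sym (ZZ-end c p (z0 F))))))
      where
      q = c ℕ.+ p
      far : All (λ i → suc q ≢ i × suc q ≢ suc i) (rng c p)
      far = rng-≥ c p (λ i _ l → (λ e → ℕₚ.<⇒≢ (ℕₚ.m≤n⇒m≤1+n l) (≡.sym e)) , (λ e → ℕₚ.<⇒≢ l (≡.sym (ℕₚ.suc-injective e))))

    ZZ-cong : ∀ c p {z z'} → (∀ b → z b ≈ z' b) → ∀ b → ZZ c p z b ≈ ZZ c p z' b
    ZZ-cong zero p e b = e b
    ZZ-cong (suc c) p {z} {z'} e = ZZ-cong c (suc p) st
      where
      st : ∀ b → stepZ p z b ≈ stepZ p z' b
      st zero = ∂-cong p (e zero)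
      st (suc b) = +-cong (∂-cong p (e (suc b))) (A-cong p (e b))

    A-inv : ∀ i k f → s i k ≈ k → A i (k * f) ≈ k * A i f
    A-inv i k f e = trans (-‿cong₂ refl (*-congˡ (∂-inv* i k f e))) (A-lin k (x i) f (∂ i f))

    ZZ-inv : ∀ c p k z → (∀ i → p ≤ i → s i k ≈ k) → ∀ b → ZZ c p (λ b → k * z b) b ≈ k * ZZ c p z b
    ZZ-inv zero p k z e b = refl
    ZZ-inv (suc c) p k z e b = trans (ZZ-cong c (suc p) st b) (ZZ-inv c (suc p) k (stepZ p z) (λ i l → e i (ℕₚ.<⇒≤ l)) b)
      where
      st : ∀ b → stepZ p (λ b → k * z b) b ≈ k * stepZ p z b
      st zero = ∂-inv* p k _ (e p ℕₚ.≤-refl)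
      st (suc b) = trans (+-cong (∂-inv* p k _ (e p ℕₚ.≤-refl)) (A-inv p k _ (e p ℕₚ.≤-refl))) (sym (distribˡ k _ _))

    z0-inv : ∀ k F b → z0 (k * F) b ≈ k * z0 F b
    z0-inv k F zero = refl
    z0-inv k F (suc b) = sym (zeroʳ k)

    A-0 : ∀ i → A i 0# ≈ 0#
    A-0 i = trans (-‿cong₂ refl (trans (*-congˡ (∂-0 i)) (zeroʳ _))) (-‿inverseʳ 0#)

    ZZ-over : ∀ c p z d → (∀ b → d < b → z b ≈ 0#) → ∀ b → d ℕ.+ c < b → ZZ c p z b ≈ 0#
    ZZ-over zero p z d e b l = e b (subst (_< b) (ℕₚ.+-identityʳ d) l)
    ZZ-over (suc c) p z d e b l = ZZ-over c (suc p) (stepZ p z) (suc d) st b (subst (_< b) (ℕₚ.+-suc d c) l)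
      where
      st : ∀ b → suc d < b → stepZ p z b ≈ 0#
      st (suc b) (s≤s k) = trans (+-cong (trans (∂-cong p (e (suc b) (ℕₚ.m≤n⇒m≤1+n k))) (∂-0 p)) (trans (A-cong p (e b k)) (A-0 p))) (+-identityˡ 0#)

    ZZ-z0-over : ∀ c p F b → c < b → ZZ c p (z0 F) b ≈ 0#
    ZZ-z0-over c p F b l = ZZ-over c p (z0 F) 0 (λ { (suc b) _ → refl }) b l

    ZZ-V : ∀ {n} c p q z → p ≤ q → (∀ b → V p n (z b)) → ∀ b → V p n (ZZ c q z b)
    ZZ-V zero p q z l v b = v b
    ZZ-V {n} (suc c) p q z l v = ZZ-V c p (suc q) (stepZ q z) (ℕₚ.m≤n⇒m≤1+n l) st
      where
      st : ∀ b → V p n (stepZ q z b)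
      st zero = V-∂ q l (v zero)
      st (suc b) = V-+ (V-∂ q l (v (suc b))) (V-+ (v b) (V-neg (V-x∂ q l (v b))))

    z0-V : ∀ {p n F} → V p n F → ∀ b → V p n (z0 F b)
    z0-V v zero = v
    z0-V v (suc b) = V-0

    step-triv : ∀ {p n} q z → p ≤ q → n ≤ suc q → (∀ b → V p n (z b)) → stepZ q z 0 ≈ 0# × (∀ b → stepZ q z (suc b) ≈ z b)
    step-triv q z l l' v = V-vanish q l l' (v 0) , λ b → trans (+-cong (V-vanish q l l' (v (suc b))) (trans (-‿cong₂ refl (trans (*-congˡ (V-vanish q l l' (v b))) (zeroʳ _)))
       (trans (+-congˡ (-0#≈0#)) (+-identityʳ _)))) (+-identityˡ _)
      where open import Algebra.Properties.Ring ring using (-0#≈0#)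

    sh : ℕ → (ℕ → Carrier) → ℕ → Carrier
    sh zero z b = z b
    sh (suc d) z zero = 0#
    sh (suc d) z (suc b) = sh d z b

    sh-V : ∀ {p n} d z → (∀ b → V p n (z b)) → ∀ b → V p n (sh d z b)
    sh-V zero z v b = v b
    sh-V (suc d) z v zero = V-0
    sh-V (suc d) z v (suc b) = sh-V d z v b

    sh-1 : ∀ d z b → sh d (sh 1 z) b ≈ sh (suc d) z b
    sh-1 zero z b = refl
    sh-1 (suc d) z zero = refl
    sh-1 (suc d) z (suc b) = trans (sh-1 d z b) refl

    sh-cong : ∀ d {z z'} → (∀ b → z b ≈ z' b) → ∀ b → sh d z b ≈ sh d z' b
    sh-cong zero e b = e b
    sh-cong (suc d) e zero = refl
    sh-cong (suc d) e (suc b) = sh-cong d e b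

    -- Beyond the last variable the row operators only shift the index.
    ZZ-triv : ∀ {p n} d q z → p ≤ q → n ≤ suc q → (∀ b → V p n (z b)) → ∀ b → ZZ d q z b ≈ sh d z b
    ZZ-triv zero q z l l' v b = refl
    ZZ-triv {p} {n} (suc d) q z l l' v b = trans (ZZ-cong d (suc q) st b) (trans (ZZ-triv d (suc q) (sh 1 z) (ℕₚ.m≤n⇒m≤1+n l) (ℕₚ.m≤n⇒m≤1+n l') (sh-V 1 z v) b) (sh-1 d z b))
      where
      st : ∀ b → stepZ q z b ≈ sh 1 z b
      st zero = proj₁ (step-triv q z l l' v)
      st (suc b) = proj₂ (step-triv q z l l' v) b

    ZZ-split : ∀ c d p z → ZZ (c ℕ.+ d) p z ≡ ZZ d (c ℕ.+ p) (ZZ c p z)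
    ZZ-split zero d p z = ≡.refl
    ZZ-split (suc c) d p z = ≡.trans (ZZ-split c d (suc p) (stepZ p z)) (cong (λ q → ZZ d q (ZZ c (suc p) (stepZ p z))) (ℕₚ.+-suc c p))

    ZZ-EE-triv : ∀ {n} c d p F → n ≤ suc (c ℕ.+ p) → V p n F → ∀ b → ZZ (c ℕ.+ d) p (z0 F) b ≈ sh d (λ b → ∂* (rng c p) (EE (sl c p) b F)) b
    ZZ-EE-triv c d p F l v b = trans (reflexive (cong (λ z → z b) (ZZ-split c d p (z0 F)))) (trans (ZZ-triv d (c ℕ.+ p) _ (ℕₚ.m≤n+m p c) l (ZZ-V c p p (z0 F) ℕₚ.≤-refl (z0-V v)) b)
      (sh-cong d (λ b → sym (ZZ-EE c p F b)) b))

    -- h_a(x_0..x_{k-1}) is expanded in the h_b(x_0..x_{k+l-1}) with elementary symmetric coefficients.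

    upZ : ℕ → (ℕ → Carrier) → ℕ → Carrier
    upZ k z zero = z zero
    upZ k z (suc b) = z (suc b) + X k (z b)

    h-X : ∀ a k f → h (suc a) k * f ≈ h (suc a) (suc k) * f + h a (suc k) * X k f
    h-X a k f = sym (trans (+-congˡ (trans (sym (-‿distribʳ-* _ _)) (-‿cong (trans (comm3 _ _ _) (sym (*-assoc _ _ _)))))) (trans (+-congʳ (distribʳ f _ _)) (plus-minus _ _)))
      where open import Algebra.Properties.Ring ring using (-‿distribʳ-*)
            open RingIds R using (plus-minus)

    cv-up : ∀ a k z → cv a k z ≈ cv a (suc k) (upZ k z)
    cv-up zero k z = refl
    cv-up (suc a) k z = trans (+-cong (h-X a k (z 0)) (cv-up a k (λ c → z (suc c)))) (fix a)
      where
      open RingIds R using (fix-id₁; fix-id₂)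
      fix : ∀ a → (h (suc a) (suc k) * z 0 + h a (suc k) * X k (z 0)) + cv a (suc k) (upZ k (λ c → z (suc c))) ≈ h (suc a) (suc k) * z 0 + cv a (suc k) (λ c → upZ k z (suc c))
      fix zero = trans (+-congʳ (+-comm _ _)) (fix-id₁ _ _ _ _)
      fix (suc a) = trans (+-congʳ (+-comm _ _)) (fix-id₂ _ _ _ _ _)

    cv-EE : ∀ l a p G → h a (suc p) * G ≈ cv a (suc (l ℕ.+ p)) (λ b → EE (sl l p) b G)
    cv-EE zero a p G = trans (sym (cv-z0 a (suc p) G)) (cv-cong a (suc p) (λ { zero → refl ; (suc b) → refl }))
    cv-EE (suc l) a p G = trans (cv-EE l a p G) (trans (cv-up a (suc (l ℕ.+ p)) _) (cv-cong a _ (λ { zero → refl ; (suc b) → refl })))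

    -- Once the `h` have as many variables as the permutation has positions, only h_0 survives. So
    -- h_a in the first variables acts as e_a in the negatives of the missing ones.
    ε-EE : ∀ l a p u G → ε (suc (l ℕ.+ p)) u (h a (suc p) * G) ≡ ε (suc (l ℕ.+ p)) u (EE (sl l p) a G)
    ε-EE l a p u G = ≡.trans (ε-cong (suc (l ℕ.+ p)) u (cv-EE l a p G)) (ε-cv (suc (l ℕ.+ p)) (suc (l ℕ.+ p)) u a (λ b → EE (sl l p) b G) ℕₚ.≤-refl)

-- Coefficients at Grassmannian permutations.

module GrassmannianCoefficients where
  open DifferenceRings
  open Functionals
  open Words
  open Transpositions
  open PathCounting using (Reach; skip; bump)
  open PathBounds
  open PathEvaluation
  open RowOperators

  ext : ℕ → (ℕ → ℕ) → ℕ → ℕ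
  ext N u j with j <? N
  ... | yes _ = u j
  ... | no _ = j

  ext-in : ∀ {N u j} → j < N → ext N u j ≡ u j
  ext-in {N} {u} {j} l with j <? N
  ... | yes _ = ≡.refl
  ... | no n = ⊥-elim (n l)

  ext-out : ∀ {N u j} → N ≤ j → ext N u j ≡ j
  ext-out {N} {u} {j} l with j <? N
  ... | yes k = ⊥-elim (ℕₚ.<⇒≱ k l)
  ... | no _ = ≡.refl

  ext-< : ∀ {N u M j} → Perm[ N ] u → N ≤ M → j < M → ext N u j < M
  ext-< {N} {u} {M} {j} pu l k with j <? N
  ... | yes a = ℕₚ.<-≤-trans (proj₁ pu a) l
  ... | no _ = k

  ext-lt : ∀ {N u} → Perm[ N ] u → ∀ {i j} → N ≤ j → i < j → ext N u i < ext N u j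
  ext-lt {N} {u} pu {i} {j} l ij = subst (ext N u i <_) (≡.sym (ext-out {N} {u} l)) (ext-< {N} {u} pu l ij)

  ext-inj : ∀ {N u} → Perm[ N ] u → ∀ {i j} → ext N u i ≡ ext N u j → i ≡ j
  ext-inj {N} {u} pu {i} {j} e = go (i <? N) (j <? N)
    where
    go : Dec (i < N) → Dec (j < N) → i ≡ j
    go (yes a) (yes b) = proj₂ pu a b (≡.trans (≡.sym (ext-in {N} {u} a)) (≡.trans e (ext-in {N} {u} b)))
    go (no a) (no b) = ≡.trans (≡.sym (ext-out {N} {u} (ℕₚ.≮⇒≥ a))) (≡.trans e (ext-out {N} {u} (ℕₚ.≮⇒≥ b)))
    go (yes a) (no b) = ⊥-elim (ℕₚ.<⇒≢ (ext-lt {N} {u} pu (ℕₚ.≮⇒≥ b) (ℕₚ.<-≤-trans a (ℕₚ.≮⇒≥ b))) e)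
    go (no a) (yes b) = ⊥-elim (ℕₚ.<⇒≢ (ext-lt {N} {u} pu (ℕₚ.≮⇒≥ a) (ℕₚ.<-≤-trans b (ℕₚ.≮⇒≥ a))) (≡.sym e))

  ext-Perm : ∀ {N u M} → N ≤ M → Perm[ N ] u → Perm[ M ] (ext N u)
  ext-Perm {N} {u} l pu = (λ k → ext-< {N} {u} pu l k) , λ _ _ e → ext-inj {N} {u} pu e

  module Grass (DR : DiffRing) (m : ℕ) where
    open DiffRing DR
    open Alg DR
    open Eps DR
    open Link DR
    open Rows DR
    open Count m

    EE-over : ∀ ss b G → length ss < b → EE ss b G ≈ 0#
    EE-over [] (suc b) G l = refl
    EE-over (t ∷ ss) (suc b) G (s≤s l) = trans (+-cong (EE-over ss (suc b) G (ℕₚ.m≤n⇒m≤1+n l)) (trans (X-cong t (EE-over ss b G l)) (X-0 t))) (+-identityˡ 0#)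

    sl-length : ∀ c p → length (sl c p) ≡ c
    sl-length zero p = ≡.refl
    sl-length (suc c) p = cong suc (sl-length c p)

    shℤ : ℕ → (ℕ → ℤ) → ℕ → ℤ
    shℤ zero z b = z b
    shℤ (suc d) z zero = 0ℤ
    shℤ (suc d) z (suc b) = shℤ d z b

    shℤ-+ : ∀ d z b → shℤ d z (d ℕ.+ b) ≡ z b
    shℤ-+ zero z b = ≡.refl
    shℤ-+ (suc d) z b = shℤ-+ d z b

    shℤ-< : ∀ d z b → b < d → shℤ d z b ≡ 0ℤ
    shℤ-< (suc d) z zero l = ≡.refl
    shℤ-< (suc d) z (suc b) (s≤s l) = shℤ-< d z b l

    shℤ-cong : ∀ d {z z'} → (∀ b → z b ≡ z' b) → ∀ b → shℤ d z b ≡ shℤ d z' b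
    shℤ-cong zero e b = e b
    shℤ-cong (suc d) e zero = ≡.refl
    shℤ-cong (suc d) e (suc b) = shℤ-cong d e b

    ε-sh : ∀ N u k d z b → ε N u (k * sh d z b) ≡ shℤ d (λ b → ε N u (k * z b)) b
    ε-sh N u k zero z b = ≡.refl
    ε-sh N u k (suc d) z zero = ε-≈0 N u (zeroʳ k)
    ε-sh N u k (suc d) z (suc b) = ε-sh N u k d z b

    -- Schur polynomial of the partition (a , b + 1) in x_0 .. x_{m+1}
    Sch : ℕ → ℕ → Carrier
    Sch a b = h a s₂ * h (suc b) s₁ - h b s₂ * h (suc a) s₁

    module _ (w : ℕ → ℕ) (F : Carrier) (VF : V 0 n F) (injw : Inj n w) (dual : ∀ u → Perm[ n ] u → ε n u F ≡ + leaf w u) where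

      -- What the row stripped first makes of `F`: by `ZZ-EE` these are the row operators at `s₁`
      -- and `s₂`; those further right only shift `A`.
      Y : ℕ → Carrier
      Y A = ∂ s₂ (∂ s₁ (EE (s₃ ∷ s₂ ∷ []) A F))

      Y-V : ∀ A → V 0 n (Y A)
      Y-V A = V-cong (sym (ZZ-EE 2 s₁ F A)) (ZZ-V 2 0 s₁ (z0 F) z≤n (z0-V VF) A)

      Top : Set
      Top = ∀ j → j < s₃ → w j < w s₃

      Good : ℤ → Set
      Good z = Σ ℕ λ q → z ≡ + q × q ≤ 2 × (Top → q ≤ 1)

      good0 : ∀ {z} → z ≡ 0ℤ → Good z
      good0 e = 0 , e , z≤n , λ _ → z≤n

      goodΩ : ∀ {z} u₁ → Perm[ n ] u₁ → u₁ s₁ < u₁ s₂ → u₁ s₂ < u₁ s₃ → ∀ A b → z ≡ + Ω w u₁ A b → Good z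
      goodΩ u₁ pu a₁ a₂ A b e = Ω w u₁ A b , e , Ω≤2 A b , λ tp → Ω≤1-top tp A b
        where open Bounds u₁ w (proj₂ pu) injw a₁ a₂

      -- The ways in which the remaining row can be stripped. `small` has at most three positions
      -- from `s₁` on; `big` has a longer row, whose operators past the slots shift the degree by
      -- `d`. Both record a path formula and a degree beyond which everything vanishes; `small` also
      -- records when `s₃` cannot be bumped.
      data Out (N : ℕ) (v : ℕ → ℕ) : Set where
        none : 4 ℕ.+ s₁ ≤ N → (∀ c A → ε N v (h c s₁ * Y A) ≡ 0ℤ) → Out N v
        small : ∀ r u₁ → Perm[ n ] u₁ → u₁ s₁ < u₁ s₂ → u₁ s₂ < u₁ s₃ → r ≤ 3 → r ℕ.+ s₁ ≤ N →
          (∀ c A → ε N v (h c s₁ * Y A) ≡ + Ω w u₁ A c) → (∀ c G → r < c → ε N v (h c s₁ * G) ≡ 0ℤ) →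
          (r ≤ 2 → ∀ i → i < s₃ → ¬ Cov u₁ i s₃) → Out N v
        big : ∀ d u₁ → Perm[ n ] u₁ → u₁ s₁ < u₁ s₂ → u₁ s₂ < u₁ s₃ → 3 ℕ.+ d ℕ.+ s₁ ≤ N →
          (∀ c A → ε N v (h c s₁ * Y A) ≡ shℤ d (λ b → + Ω w u₁ A b) c) → (∀ c G → 3 ℕ.+ d < c → ε N v (h c s₁ * G) ≡ 0ℤ) → Out N v

      out-small : ∀ r v → r ≤ 3 → Perm[ r ℕ.+ s₁ ] v → Asc s₁ (r ℕ.+ s₁) v → Out (r ℕ.+ s₁) v
      out-small r v r3 pv asc = small r û (ext-Perm {N} {v} N≤n pv) (rise s₁ ℕₚ.≤-refl s₂<n) (rise s₂ (ℕₚ.n≤1+n _) s₃<n) r3 ℕₚ.≤-refl main over unb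
        where
        N = r ℕ.+ s₁
        -- Fixed points are added until all three slots exist, so that one path number serves every
        -- `r`.
        û = ext N v
        N≤n : N ≤ n
        N≤n = ℕₚ.+-monoˡ-≤ s₁ r3
        rise : ∀ j → s₁ ≤ j → suc j < n → û j < û (suc j)
        rise j l _ = go (suc j <? N)
          where
          go : Dec (suc j < N) → û j < û (suc j)
          go (yes a) = subst₂ _<_ (≡.sym (ext-in {N} {v} (ℕₚ.<-trans (ℕₚ.n<1+n j) a))) (≡.sym (ext-in {N} {v} a)) (asc j l a)
          go (no b) = ext-lt {N} {v} pv (ℕₚ.≮⇒≥ b) ℕₚ.≤-refl
        up : ∀ f → ε N v f ≡ ε n û f
        up f = ≡.trans (ε-permcong N f (λ j l → ≡.sym (ext-in {N} {v} l))) (≡.sym (ε-records N n û f N≤n (λ j a _ i l → ext-lt {N} {v} pv a l)))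
        main : ∀ c A → ε N v (h c s₁ * Y A) ≡ + Ω w û A c
        main c A = ≡.trans (up _) (≡.trans (ε-EE 3 c m û (Y A)) (ε-Ω m w F dual A c û (ext-Perm {N} {v} N≤n pv) (rise s₁ ℕₚ.≤-refl s₂<n) (rise s₂ (ℕₚ.n≤1+n _) s₃<n)))
        over : ∀ c G → r < c → ε N v (h c s₁ * G) ≡ 0ℤ
        over c G l = ≡.trans (cong (λ z → ε z v (h c s₁ * G)) (ℕₚ.+-suc r m)) (≡.trans (ε-EE r c m v G) (ε-≈0 _ v (EE-over (sl r m) c G (subst (_< c) (≡.sym (sl-length r m)) l))))
        -- Here `s₃` is an added fixed point and carries the largest value.
        unb : r ≤ 2 → ∀ i → i < s₃ → ¬ Cov û i s₃
        unb r2 i l (c , _) = ℕₚ.<-asym c (ext-lt {N} {v} pv (ℕₚ.+-monoˡ-≤ s₁ r2) l)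

      out-ext : ∀ N v → (∀ j → j < N → v j < v N) → Out N v → Out (suc N) v
      out-ext N v q (none l z) = none (ℕₚ.m≤n⇒m≤1+n l) (λ c A → ≡.trans (ε-ext N v _ q) (z c A))
      out-ext N v q (small r u₁ p a b r3 rl e o ub) = small r u₁ p a b r3 (ℕₚ.m≤n⇒m≤1+n rl) (λ c A → ≡.trans (ε-ext N v _ q) (e c A)) (λ c G l → ≡.trans (ε-ext N v _ q) (o c G l)) ub
      out-ext N v q (big d u₁ p a b rl e o) = big d u₁ p a b (ℕₚ.m≤n⇒m≤1+n rl) (λ c A → ≡.trans (ε-ext N v _ q) (e c A)) (λ c G l → ≡.trans (ε-ext N v _ q) (o c G l))

      -- After the row is stripped, a permutation outside S_n contributes nothing by `V-records`.
      -- Otherwise the first three row operators yield the slots and the others a shift.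
      out-big : ∀ N v → n ≤ N → Perm[ suc N ] v → Asc s₁ (suc N) v → IsMax N v m → Out (suc N) v
      out-big N v nN pv asc im with V-records n N (v ∘ punch m) nN (proj₂ (Perm-punch {N} {v} {m} pv im))
      ... | inj₂ z = none (s≤s nN) (λ c A → ≡.trans (ε-row N v m c (Y A) im) (z _ (ZZ-V (N ∸ m) 0 m (z0 (Y A)) z≤n (z0-V (Y-V A)) c)))
      ... | inj₁ rec = big D u₁ pu a₁ a₂ (ℕₚ.≤-reflexive arith) main over
        where
        v'' = v ∘ punch m
        D = N ∸ s₃
        Nm : N ∸ m ≡ 3 ℕ.+ D
        Nm = ≡.trans (ℕₚ.+-∸-assoc 1 {N} (ℕₚ.≤-trans (ℕₚ.n≤1+n _) (ℕₚ.≤-trans (ℕₚ.n≤1+n _) (ℕₚ.≤-trans (ℕₚ.n≤1+n _) nN))))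
          (cong suc (≡.trans (ℕₚ.+-∸-assoc 1 {N} (ℕₚ.≤-trans (ℕₚ.n≤1+n _) (ℕₚ.≤-trans (ℕₚ.n≤1+n _) nN))) (cong suc (ℕₚ.+-∸-assoc 1 {N} (ℕₚ.≤-trans (ℕₚ.n≤1+n _) nN)))))
        arith : 3 ℕ.+ D ℕ.+ s₁ ≡ suc N
        arith = ≡.trans (cong (ℕ._+ s₁) (≡.sym Nm)) (≡.trans (ℕₚ.+-suc (N ∸ m) m) (cong suc (ℕₚ.m∸n+n≡m (proj₁ im))))
        pv'' : Perm[ n ] v''
        pv'' = Perm-drops N nN (Perm-punch {N} {v} {m} pv im) rec
        asc'' : Asc m n v''
        asc'' j l k = subst₂ _<_ (cong v (≡.sym (punch-hi m j l))) (cong v (≡.sym (punch-hi m (suc j) (ℕₚ.m≤n⇒m≤1+n l)))) (asc (suc j) (s≤s l) (s≤s (ℕₚ.≤-trans k nN)))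
        -- The three divided differences that `ZZ-EE` leaves outside are absorbed by `ε-chain` at
        -- the price of this cycle.
        u₁ = v'' ∘ cy 3 m
        pu : Perm[ n ] u₁
        pu = (λ l → proj₁ pv'' (cy-< 3 m ℕₚ.≤-refl l)) , λ a b e → cy-inj 3 m (proj₂ pv'' (cy-< 3 m ℕₚ.≤-refl a) (cy-< 3 m ℕₚ.≤-refl b) e)
        mid : ∀ j → m ≤ j → j < 3 ℕ.+ m → u₁ (suc j) ≡ v'' j
        mid j a b = cong v'' (cy-mid 3 m j a b)
        m1 = mid m ℕₚ.≤-refl (s≤s (ℕₚ.m≤n⇒m≤1+n (ℕₚ.n≤1+n m)))
        m2 = mid s₁ (ℕₚ.n≤1+n m) (s≤s (s≤s (ℕₚ.n≤1+n m)))
        m3 = mid s₂ (ℕₚ.m≤n⇒m≤1+n (ℕₚ.n≤1+n m)) ℕₚ.≤-refl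
        a₁ : u₁ s₁ < u₁ s₂
        a₁ = subst₂ _<_ (≡.sym m1) (≡.sym m2) (asc'' m ℕₚ.≤-refl s₁<n)
        a₂ : u₁ s₂ < u₁ s₃
        a₂ = subst₂ _<_ (≡.sym m2) (≡.sym m3) (asc'' s₁ (ℕₚ.n≤1+n m) s₂<n)
        row' : ∀ c G → ε (suc N) v (h c s₁ * G) ≡ ε N v'' (ZZ (3 ℕ.+ D) m (z0 G) c)
        row' c G = ≡.trans (ε-row N v m c G im) (cong (λ k → ε N v'' (ZZ k m (z0 G) c)) Nm)
        main : ∀ c A → ε (suc N) v (h c s₁ * Y A) ≡ shℤ D (λ b → + Ω w u₁ A b) c
        main c A = ≡.trans (row' c (Y A)) (≡.trans (ε-cong N v'' (trans (ZZ-EE-triv 3 D m (Y A) ℕₚ.≤-refl (V-mono z≤n ℕₚ.≤-refl (Y-V A)) c) (sym (*-identityˡ _))))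
          (≡.trans (ε-sh N v'' 1# D _ c) (shℤ-cong D (λ b → ≡.trans (ε-cong N v'' (*-identityˡ _)) (≡.trans (ε-records n N v'' _ nN rec)
            (≡.trans (ε-chain n v'' 3 m _ (proj₂ pv'') ℕₚ.≤-refl (λ l a k → asc-lt {m} {n} {v''} asc'' (3 ℕ.+ m) a k ℕₚ.≤-refl)) (ε-Ω m w F dual A b u₁ pu a₁ a₂)))) c)))
        over : ∀ c G → 3 ℕ.+ D < c → ε (suc N) v (h c s₁ * G) ≡ 0ℤ
        over c G l = ≡.trans (row' c G) (ε-≈0 N v'' (ZZ-z0-over (3 ℕ.+ D) m G c l))

      out : ∀ N v → s₁ ≤ N → Perm[ N ] v → Asc 0 s₁ v → Asc s₁ N v → Out N v
      out N v l pv a₁ a₂ with N ≤? n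
      ... | yes k = subst (λ z → Out z v) e (out-small (N ∸ s₁) v (ℕₚ.≤-trans (ℕₚ.∸-monoˡ-≤ s₁ k) (ℕₚ.≤-reflexive (ℕₚ.m+n∸n≡m 3 s₁))) (subst (λ z → Perm[ z ] v) (≡.sym e) pv) (subst (λ z → Asc s₁ z v) (≡.sym e) a₂))
        where e = ℕₚ.m∸n+n≡m l
      out zero v () pv a₁ a₂ | no _
      out (suc N) v l pv a₁ a₂ | no k = go (ℕₚ.m≤n⇒m<n∨m≡n pl)
        where
        nN : n ≤ N
        nN = ℕₚ.≤-pred (ℕₚ.≰⇒> k)
        p = mp N v
        im = mp-isMax N v (proj₂ pv)
        pl = proj₁ im
        go : p < N ⊎ p ≡ N → Out (suc N) v
        go (inj₂ pe) = out-ext N v rec (out N v (ℕₚ.≤-trans (ℕₚ.<⇒≤ s₁<n) nN) (Perm-drop pv rec) a₁ (λ j a b → a₂ j a (ℕₚ.m≤n⇒m≤1+n b)))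
          where
          rec : ∀ j → j < N → v j < v N
          rec j jl = subst (λ z → v j < v z) pe (proj₂ im j (ℕₚ.<⇒≤ jl) (λ e → ℕₚ.<⇒≢ jl (≡.trans e pe)))
        go (inj₁ pN) = out-big N v nN pv a₂ (subst (IsMax N v) (pm (ℕₚ.<-cmp p m)) im)
          where
          open import Relation.Binary.Definitions using (Tri; tri<; tri≈; tri>)
          bad : v p < v (suc p) → ⊥
          bad c = ℕₚ.<-asym c (proj₂ im (suc p) pN (λ e → ℕₚ.1+n≢n e))
          pm : Tri (p < m) (p ≡ m) (m < p) → p ≡ m
          pm (tri≈ _ e _) = e
          pm (tri< a _ _) = ⊥-elim (bad (a₁ p z≤n (s≤s a)))
          pm (tri> _ _ b) = ⊥-elim (bad (a₂ p b (s≤s pN)))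

      goodE : ∀ {N v} → Out N v → ∀ c A → Good (ε N v (h c s₁ * Y A))
      goodE (none _ z) c A = good0 (z c A)
      goodE (small r u₁ p a b _ _ e _ _) c A = goodΩ u₁ p a b A c (e c A)
      goodE (big d u₁ p a b _ e _) c A with c <? d
      ... | yes l = good0 (≡.trans (e c A) (shℤ-< d _ c l))
      ... | no l = goodΩ u₁ p a b A (c ∸ d) (≡.trans (e c A) (≡.trans (cong (shℤ d _) (≡.sym (ℕₚ.m+[n∸m]≡n (ℕₚ.≮⇒≥ l)))) (shℤ-+ d _ (c ∸ d))))

      -- The subtracted number is at most 1, and by `delay` positive only if the other is; the
      -- difference thus lies between 0 and the first number.
      good-diff : ∀ {y z} u₁ → Perm[ n ] u₁ → u₁ s₁ < u₁ s₂ → u₁ s₂ < u₁ s₃ → ∀ b → (∀ v → ¬ Reach (s₃ ∷ s₂ ∷ []) (suc b) u₁ v) →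
        y ≡ + Ω w u₁ 1 b → z ≡ + Ω w u₁ 0 (suc b) → Good (y ℤ.- z)
      good-diff u₁ pu a₁ a₂ b nb ey ez = go (Ω w u₁ 1 b) (Ω w u₁ 0 (suc b)) ≡.refl ≡.refl ey ez
        where
        open Bounds u₁ w (proj₂ pu) injw a₁ a₂
        go : ∀ P Q → P ≡ Ω w u₁ 1 b → Q ≡ Ω w u₁ 0 (suc b) → ∀ {y z} → y ≡ + P → z ≡ + Q → Good (y ℤ.- z)
        go P zero eP eQ ≡.refl ≡.refl = P , ℤₚ.+-identityʳ (+ P) , subst (_≤ 2) (≡.sym eP) (Ω≤2 1 b) , λ t → subst (_≤ 1) (≡.sym eP) (Ω≤1-top t 1 b)
        go zero (suc Q) eP eQ _ _ = ⊥-elim (ℕₚ.<-irrefl eP (delay b nb (subst (0 <_) eQ (s≤s z≤n))))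
        go (suc P) (suc zero) eP eQ ≡.refl ≡.refl = P , ≡.refl , ℕₚ.≤-trans (ℕₚ.n≤1+n P) (subst (_≤ 2) (≡.sym eP) (Ω≤2 1 b)) , λ t → ℕₚ.≤-trans (ℕₚ.n≤1+n P) (subst (_≤ 1) (≡.sym eP) (Ω≤1-top t 1 b))
        go (suc P) (suc (suc Q)) eP eQ _ _ = ⊥-elim (ℕₚ.<⇒≱ (s≤s (s≤s z≤n)) (subst (_≤ 1) (≡.sym eQ) (Ω₀≤1 (suc b))))

      no-reach : ∀ {b u v} → ¬ Reach (s₃ ∷ s₂ ∷ []) (3 ℕ.+ b) u v
      no-reach (skip (skip ()))
      no-reach (skip (bump _ _ _ ()))
      no-reach (bump _ _ _ (skip ()))
      no-reach (bump _ _ _ (bump _ _ _ ()))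

      module _ (N : ℕ) (v : ℕ → ℕ) (sN : s₁ < N) (pv : Perm[ suc N ] v) (im : IsMax N v s₁) (asc₁ : Asc 0 s₂ v) (asc₂ : Asc s₂ (suc N) v) where
        v' : ℕ → ℕ
        v' = v ∘ punch s₁

        r : ℕ
        r = N ∸ s₁

        main : ℕ → ℕ → ℤ
        main a c = ε N v' (h c s₁ * ZZ r s₁ (z0 F) a)

        ε-main : ∀ a c → ε (suc N) v ((h a s₂ * h c s₁) * F) ≡ main a c
        ε-main a c = ≡.trans (ε-cong (suc N) v (*-assoc _ _ _)) (≡.trans (ε-row N v s₁ a (h c s₁ * F) im)
          (ε-cong N v' (trans (ZZ-cong r s₁ (z0-inv (h c s₁) F) a) (ZZ-inv r s₁ (h c s₁) (z0 F) (λ i l → s-h-above i c s₁ l) a))))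

        O : Out N v'
        O = out N v' (ℕₚ.<⇒≤ sN) (Perm-punch {N} {v} {s₁} pv im)
          (λ j _ l → subst₂ _<_ (cong v (≡.sym (punch-lo s₁ j (ℕₚ.<-trans (ℕₚ.n<1+n j) l)))) (cong v (≡.sym (punch-lo s₁ (suc j) l))) (asc₁ j z≤n (ℕₚ.m≤n⇒m≤1+n l)))
          (λ j a l → subst₂ _<_ (cong v (≡.sym (punch-hi s₁ j a))) (cong v (≡.sym (punch-hi s₁ (suc j) (ℕₚ.m≤n⇒m≤1+n a)))) (asc₂ (suc j) (s≤s a) (s≤s l)))

        main-2 : ∀ d → r ≡ 2 ℕ.+ d → ∀ a c → main a c ≡ shℤ d (λ A → ε N v' (h c s₁ * Y A)) a
        main-2 d e a c = ≡.trans (ε-cong N v' (*-congˡ (trans (reflexive (cong (λ k → ZZ k s₁ (z0 F) a) e)) (ZZ-EE-triv 2 d s₁ F ℕₚ.≤-refl (V-mono z≤n ℕₚ.≤-refl VF) a)))) (ε-sh N v' (h c s₁) d Y a)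

        -- For r = 1 the missing operator acts trivially.
        main-1 : r ≡ 1 → ∀ c → main 1 c ≡ ε N v' (h c s₁ * Y 2)
        main-1 e c = ≡.trans (ε-cong N v' (*-congˡ (trans (reflexive (cong (λ k → ZZ k s₁ (z0 F) 1) e)) (trans (+-congʳ (∂-0 s₁)) (+-identityˡ _)))))
            (≡.sym (≡.trans (ε-cong N v' (trans (*-congˡ y2) (trans (distribˡ _ _ _) (+-congˡ (trans (sym (-‿distribʳ-* _ _)) (-‿cong (comm3 _ _ _))))))) (≡.trans (ε-+ N v' _ _) (≡.trans (cong (λ z → ε N v' (h c s₁ * A s₁ F) ℤ.+ z) (ε-X-top N v' s₂ _ (ℕₚ.≤-reflexive Ne))) (ℤₚ.+-identityʳ _)))))
          where
          open import Algebra.Properties.Ring ring using (-‿distribʳ-*)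
          open RingIds R using (comm3)
          Ne : N ≡ s₂
          Ne = ≡.trans (≡.sym (ℕₚ.m∸n+n≡m (ℕₚ.<⇒≤ sN))) (cong (ℕ._+ s₁) e)
          -- On `s₂` positions the functional kills multiples of x at index `s₂`, so only `A s₁ F`
          -- counts.
          y2 : Y 2 ≈ A s₁ F + X s₂ (∂ s₂ (A s₁ F))
          y2 = trans (ZZ-EE 2 s₁ F 2) (trans (+-cong (trans (∂-cong s₂ (trans (+-cong (∂-0 s₁) (A-0 s₁)) (+-identityˡ 0#))) (∂-0 s₂)) (A-cong s₂ (trans (+-congʳ (∂-0 s₁)) (+-identityˡ _)))) (+-identityˡ _))

        r-pos : r ≡ 0 → ⊥
        r-pos e = ℕₚ.<⇒≱ sN (ℕₚ.m∸n≡0⇒m≤n e)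

        -- Positivity of `a` matters for r = 1: there `main-1` treats index 1 and all larger indices
        -- vanish.
        good-main : ∀ a c → 0 < a → Good (main a c)
        good-main a c pa = go r ≡.refl
          where
          go : ∀ k → r ≡ k → Good (main a c)
          go zero e = ⊥-elim (r-pos e)
          go (suc (suc d)) e with a <? d
          ... | yes l = good0 (≡.trans (main-2 d e a c) (shℤ-< d _ a l))
          ... | no l = subst Good (≡.sym (≡.trans (main-2 d e a c) (≡.trans (cong (shℤ d _) (≡.sym (ℕₚ.m+[n∸m]≡n (ℕₚ.≮⇒≥ l)))) (shℤ-+ d _ (a ∸ d))))) (goodE O c (a ∸ d))
          go (suc zero) e = one a pa
            where
            one : ∀ a → 0 < a → Good (main a c)
            one (suc zero) _ = subst Good (≡.sym (main-1 e c)) (goodE O c 2)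
            one (suc (suc a)) _ = good0 (ε-≈0 N v' (trans (*-congˡ (ZZ-z0-over r s₁ F (2 ℕ.+ a) (subst (_< 2 ℕ.+ a) (≡.sym e) (s≤s (s≤s z≤n))))) (zeroʳ _)))

        minus0 : ∀ {y z} → z ≡ 0ℤ → Good y → Good (y ℤ.- z)
        minus0 {y} ≡.refl g = subst Good (≡.sym (ℤₚ.+-identityʳ y)) g

        good-coef : ∀ a b → b < a → Good (ε (suc N) v (Sch a b * F))
        good-coef a b ba = subst Good (≡.sym (≡.trans (ε-cong (suc N) v (trans (distribʳ F _ _) (+-congˡ (sym (-‿distribˡ-* _ F))))) (≡.trans (ε-minus (suc N) v _ _) (cong₂ ℤ._-_ (ε-main a (suc b)) (ε-main b (suc a)))))) (diff O)
          where
          open import Algebra.Properties.Ring ring using (-‿distribˡ-*)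
          g = good-main a (suc b) (ℕₚ.≤-<-trans z≤n ba)
          -- r₂ bounds the second row; a correction term survives only if both rows equal a + 1 and b + 1 = a
          tight : ∀ r₂ → r₂ ℕ.+ s₁ ≤ N → (r₂ < suc a → main b (suc a) ≡ 0ℤ) →
            (∀ d → r₂ ≡ 2 ℕ.+ d → Good (ε N v' (h (suc d) s₁ * Y 1) ℤ.- ε N v' (h (2 ℕ.+ d) s₁ * Y 0))) → Good (main a (suc b) ℤ.- main b (suc a))
          tight r₂ r₂l ov df with r₂ <? suc a
          ... | yes l = minus0 (ov l) g
          ... | no l = go r ≡.refl
            where
            ar : suc a ≤ r₂
            ar = ℕₚ.≮⇒≥ l
            r₂r : r₂ ≤ r
            r₂r = ℕₚ.+-cancelʳ-≤ s₁ r₂ r (subst (r₂ ℕ.+ s₁ ≤_) (≡.sym (ℕₚ.m∸n+n≡m (ℕₚ.<⇒≤ sN))) r₂l)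
            go : ∀ k → r ≡ k → Good (main a (suc b) ℤ.- main b (suc a))
            go zero e = ⊥-elim (r-pos e)
            go (suc zero) e = ⊥-elim (ℕₚ.<⇒≱ (ℕₚ.<-≤-trans (s≤s (ℕₚ.≤-<-trans z≤n ba)) (ℕₚ.≤-trans ar r₂r)) (ℕₚ.≤-reflexive e))
            go (suc (suc d)) e with b <? d
            ... | yes bd = minus0 (≡.trans (main-2 d e b (suc a)) (shℤ-< d _ b bd)) g
            ... | no bd = fin (ℕₚ.≤-antisym bd' (ℕₚ.≮⇒≥ bd))
              where
              a≤ : a ≤ suc d
              a≤ = ℕₚ.≤-pred (ℕₚ.≤-trans ar (ℕₚ.≤-trans r₂r (ℕₚ.≤-reflexive e)))
              bd' : b ≤ d
              bd' = ℕₚ.≤-pred (ℕₚ.≤-trans ba a≤)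
              -- Now both shifts are exact: `a` leaves one bump for the second pass and `b` leaves
              -- none, which is the situation of `good-diff`.
              fin : b ≡ d → Good (main a (suc b) ℤ.- main b (suc a))
              fin ≡.refl = subst Good (cong₂ ℤ._-_ (≡.sym (≡.trans (main-2 b e a (suc b)) (≡.trans (cong (shℤ b _) (≡.trans ae (ℕₚ.+-comm 1 b))) (shℤ-+ b _ 1))))
                    (≡.sym (≡.trans (main-2 b e b (suc a)) (≡.trans (cong (shℤ b _) (≡.sym (ℕₚ.+-identityʳ b))) (≡.trans (shℤ-+ b _ 0) (cong (λ z → ε N v' (h (suc z) s₁ * Y 0)) ae))))))
                    (df b (ℕₚ.≤-antisym (ℕₚ.≤-trans r₂r (ℕₚ.≤-reflexive e)) (ℕₚ.≤-trans (s≤s (ℕₚ.≤-reflexive (≡.sym ae))) ar)))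
                where
                ae : a ≡ suc b
                ae = ℕₚ.≤-antisym a≤ ba
          diff : Out N v' → Good (main a (suc b) ℤ.- main b (suc a))
          diff (none l z) = minus0 sec0 g
            where
            re : r ≡ 2 ℕ.+ (r ∸ 2)
            re = ≡.sym (ℕₚ.m+[n∸m]≡n (ℕₚ.≤-trans (s≤s (s≤s z≤n)) (ℕₚ.≤-trans (ℕₚ.≤-reflexive (≡.sym (ℕₚ.m+n∸n≡m 4 s₁))) (ℕₚ.∸-monoˡ-≤ s₁ l))))
            sec0 : main b (suc a) ≡ 0ℤ
            sec0 = ≡.trans (main-2 (r ∸ 2) re b (suc a)) (≡.trans (shℤ-cong (r ∸ 2) (z (suc a)) b) (zero-sh (r ∸ 2) b))
              where
              zero-sh : ∀ d b → shℤ d (λ _ → 0ℤ) b ≡ 0ℤ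
              zero-sh zero b = ≡.refl
              zero-sh (suc d) zero = ≡.refl
              zero-sh (suc d) (suc b) = zero-sh d b
          diff (small r₂ u₁ p a₁ a₂ r3 rl e o ub) = tight r₂ rl (o (suc a) _) df
            where
            df : ∀ d → r₂ ≡ 2 ℕ.+ d → Good (ε N v' (h (suc d) s₁ * Y 1) ℤ.- ε N v' (h (2 ℕ.+ d) s₁ * Y 0))
            df d ≡.refl = good-diff u₁ p a₁ a₂ (suc d) (nb d r3 ub) (e (suc d) 1) (e (2 ℕ.+ d) 0)
              where
              -- Two bumps would have to use `s₃`, which is impossible for r₂ = 2; three bumps do
              -- not fit into two slots.
              nb : ∀ d → 2 ℕ.+ d ≤ 3 → (2 ℕ.+ d ≤ 2 → ∀ i → i < s₃ → ¬ Cov u₁ i s₃) → ∀ v → ¬ Reach (s₃ ∷ s₂ ∷ []) (2 ℕ.+ d) u₁ v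
              nb zero _ ub v (skip (skip ()))
              nb zero _ ub v (skip (bump _ _ _ ()))
              nb zero _ ub v (bump i il c r) = ub ℕₚ.≤-refl i il c
              nb (suc zero) _ ub v rr = no-reach rr
              nb (suc (suc d)) (s≤s (s≤s (s≤s ()))) ub v rr
          diff (big d u₁ p a₁ a₂ rl e o) = tight (3 ℕ.+ d) rl (o (suc a) _) df
            where
            df : ∀ d' → 3 ℕ.+ d ≡ 2 ℕ.+ d' → Good (ε N v' (h (suc d') s₁ * Y 1) ℤ.- ε N v' (h (2 ℕ.+ d') s₁ * Y 0))
            df .(suc d) ≡.refl = good-diff u₁ p a₁ a₂ 2 (λ v → no-reach)
              (≡.trans (e (2 ℕ.+ d) 1) (≡.trans (cong (shℤ d _) (ℕₚ.+-comm 2 d)) (shℤ-+ d _ 2)))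
              (≡.trans (e (3 ℕ.+ d) 0) (≡.trans (cong (shℤ d _) (ℕₚ.+-comm 3 d)) (shℤ-+ d _ 3)))

-- Exponent bounds; polynomials as an instance of the interface.

module PolynomialDifferences where
  open Polynomials
  open DividedDifferences
  open DifferenceRings
  open ≡

  pos-terms : ∀ a k → All (λ (c , i , l) → i ≤ a × l ≤ a ℕ.+ k × i ℕ.+ l ≡ a ℕ.+ k) (pos a k)
  pos-terms zero k = (z≤n , ℕₚ.≤-refl , refl) ∷ []
  pos-terms (suc a) k = (ℕₚ.≤-refl , ℕₚ.m≤n+m k (suc a) , refl) ∷
    All.map (λ {(_ , _ , l)} (p , q , e) → ℕₚ.m≤n⇒m≤1+n p , subst (l ≤_) (ℕₚ.+-suc a k) q , trans e (ℕₚ.+-suc a k)) (pos-terms a (suc k))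

  D-terms : ∀ a b → All (λ (c , k , l) → suc k ≤ a ⊔ b × suc l ≤ a ⊔ b × suc (k ℕ.+ l) ≡ a ℕ.+ b) (D a b)
  D-terms zero zero = []
  D-terms (suc a) zero = All.map (λ (p , q , e) → s≤s p , s≤s (ℕₚ.≤-trans q (ℕₚ.≤-reflexive (ℕₚ.+-identityʳ a))) , cong suc e) (pos-terms a 0)
  D-terms zero (suc b) = Allₚ.map⁺ (All.map (λ (p , q , e) → s≤s p , s≤s (ℕₚ.≤-trans q (ℕₚ.≤-reflexive (ℕₚ.+-identityʳ b))) , cong suc (trans e (ℕₚ.+-identityʳ b))) (pos-terms b 0))
  D-terms (suc a) (suc b) = Allₚ.map⁺ (All.map (λ {(c , k , l)} (p , q , e) → s≤s p , s≤s q , cong suc (trans (ℕₚ.+-suc (suc k) l) (trans (cong suc e) (sym (ℕₚ.+-suc a b))))) (D-terms a b))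

  -- What a divided difference does to a monomial: both new exponents stay below the larger old one,
  -- and the degree falls by one. The exponent bounds and the inductions on degree rest on this.
  record Drop (i : ℕ) (m m' : Mono) : Set where
    field
      others : ∀ j → j ≢ i → j ≢ suc i → expo m' j ≡ expo m j
      at : suc (expo m' i) ≤ expo m i ⊔ expo m (suc i)
      at' : suc (expo m' (suc i)) ≤ expo m i ⊔ expo m (suc i)
      degree : suc (sum m') ≡ sum m

  expo-drop1 : ∀ m j → expo (drop 1 m) j ≡ expo m (suc j)
  expo-drop1 [] j = refl
  expo-drop1 (a ∷ m) j = refl

  expo-drop2 : ∀ m j → expo (drop 2 m) j ≡ expo m (suc (suc j))
  expo-drop2 [] j = refl
  expo-drop2 (a ∷ []) j = refl
  expo-drop2 (a ∷ b ∷ m) j = refl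

  sum-drop1 : ∀ m → expo m 0 ℕ.+ sum (drop 1 m) ≡ sum m
  sum-drop1 [] = refl
  sum-drop1 (a ∷ m) = refl

  sum-drop2 : ∀ m → (expo m 0 ℕ.+ expo m 1) ℕ.+ sum (drop 2 m) ≡ sum m
  sum-drop2 [] = refl
  sum-drop2 (a ∷ []) = ℕₚ.+-identityʳ _
  sum-drop2 (a ∷ b ∷ m) = ℕₚ.+-assoc a b (sum m)

  ∂M-terms : ∀ i m → All (λ (_ , m') → Drop i m m') (∂M i m)
  ∂M-terms zero m = Allₚ.map⁺ (All.map (λ {(c , k , l)} (p , q , e) → record
    { others = λ { zero a b → ⊥-elim (a refl) ; (suc zero) a b → ⊥-elim (b refl) ; (suc (suc j)) a b → expo-drop2 m j }
    ; at = p ; at' = q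
    ; degree = trans (cong suc (sym (ℕₚ.+-assoc k l (sum (drop 2 m))))) (trans (cong (ℕ._+ sum (drop 2 m)) e) (sum-drop2 m)) }) (D-terms (expo m 0) (expo m 1)))
  ∂M-terms (suc i) m = Allₚ.map⁺ (All.map (λ {(c , m')} d → record
    { others = λ { zero a b → refl ; (suc j) a b → trans (Drop.others d j (a ∘ cong suc) (b ∘ cong suc)) (expo-drop1 m j) }
    ; at = subst₂ (λ y z → suc (expo m' i) ≤ y ⊔ z) (expo-drop1 m i) (expo-drop1 m (suc i)) (Drop.at d)
    ; at' = subst₂ (λ y z → suc (expo m' (suc i)) ≤ y ⊔ z) (expo-drop1 m i) (expo-drop1 m (suc i)) (Drop.at' d)
    ; degree = trans (sym (ℕₚ.+-suc (expo m 0) (sum m'))) (trans (cong (expo m 0 ℕ.+_) (Drop.degree d)) (sum-drop1 m)) }) (∂M-terms i (drop 1 m)))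

  drop-≐ : ∀ {m m'} → m ≐ m' → drop 1 m ≐ drop 1 m'
  drop-≐ {m} {m'} e j = trans (expo-drop1 m j) (trans (e (suc j)) (sym (expo-drop1 m' j)))

  lin-map-cong : ∀ {A : Set} φ (f g : A → Mono) (l : List (ℤ × A)) → (∀ a → φ (f a) ≡ φ (g a)) →
    lin φ (map (λ (c , a) → (c , f a)) l) ≡ lin φ (map (λ (c , a) → (c , g a)) l)
  lin-map-cong φ f g [] e = refl
  lin-map-cong φ f g ((c , a) ∷ l) e = cong₂ (λ y z → c ℤ.* y ℤ.+ z) (e a) (lin-map-cong φ f g l e)

  ∂M-proper : ∀ {φ} → Proper φ → ∀ i → Proper (λ m → lin φ (∂M i m))
  ∂M-proper {φ} pr zero {m} {m'} e = trans (cong₂ (λ a b → lin φ (map (λ (c , k , l) → (c , k ∷ l ∷ drop 2 m)) (D a b))) (e 0) (e 1))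
    (lin-map-cong φ (λ (k , l) → k ∷ l ∷ drop 2 m) (λ (k , l) → k ∷ l ∷ drop 2 m') (D (expo m' 0) (expo m' 1))
      (λ (k , l) → pr {k ∷ l ∷ drop 2 m} {k ∷ l ∷ drop 2 m'} (λ { zero → refl ; (suc zero) → refl
        ; (suc (suc j)) → trans (expo-drop2 m j) (trans (e (suc (suc j))) (sym (expo-drop2 m' j))) })))
  ∂M-proper {φ} pr (suc i) {m} {m'} e = trans (sh m (∂M i (drop 1 m))) (trans (trans (lin-cong (λ k → pr {expo m 0 ∷ k} {expo m' 0 ∷ k} (λ { zero → e 0 ; (suc j) → refl })) (∂M i (drop 1 m)))
      (∂M-proper {λ k → φ (expo m' 0 ∷ k)} (λ {a} {b} q → pr {expo m' 0 ∷ a} {expo m' 0 ∷ b} (λ { zero → refl ; (suc j) → q j })) i {drop 1 m} {drop 1 m'} (drop-≐ {m} {m'} e)))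
      (sym (sh m' (∂M i (drop 1 m')))))
    where
    sh : ∀ m q → lin φ (map (λ (c , k) → (c , expo m 0 ∷ k)) q) ≡ lin (λ k → φ (expo m 0 ∷ k)) q
    sh m [] = refl
    sh m ((c , k) ∷ q) = cong (λ z → c ℤ.* φ (expo m 0 ∷ k) ℤ.+ z) (sh m q)

  ∂P-cong : ∀ i {p q} → p ≈P q → ∂P i p ≈P ∂P i q
  ∂P-cong i {p} {q} e = lin⇒≈ {∂P i p} {∂P i q} λ {φ} pr → trans (lin-∂P φ i p)
    (trans (lin-resp {p} {q} e (λ {a} {b} → ∂M-proper {φ} pr i {a} {b})) (sym (lin-∂P φ i q)))

  -- Up to `≈P`, because a given list may contain terms that cancel.
  Terms : (Mono → Set) → Poly → Set
  Terms Q f = Σ Poly λ g → f ≈P g × All (Q ∘ proj₂) g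

  Terms-cong : ∀ {Q} f g → f ≈P g → Terms Q f → Terms Q g
  Terms-cong f g e (f' , e' , a) = f' , (λ k → trans (sym (e k)) (e' k)) , a

  Terms-map : ∀ {Q Q'} f → (∀ m → Q m → Q' m) → Terms Q f → Terms Q' f
  Terms-map f q (f' , e , a) = f' , e , All.map (λ {(c , m)} → q m) a

  Terms-+ : ∀ {Q} f g → Terms Q f → Terms Q g → Terms Q (f ++ g)
  Terms-+ f g (f' , e , a) (g' , e' , a') = f' ++ g' , +P-cong {f} {f'} {g} {g'} e e' , Allₚ.++⁺ a a'

  Terms-scale : ∀ {Q} c f → Terms Q f → Terms Q (scaleP c f)
  Terms-scale c f (f' , e , a) = scaleP c f' , scaleP-cong c {f} {f'} e , Allₚ.map⁺ a

  Terms-∂ : ∀ {Q Q'} i f → (∀ m m' → Q m → Drop i m m' → Q' m') → Terms Q f → Terms Q' (∂P i f)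
  Terms-∂ {Q} {Q'} i f q (f' , e , a) = ∂P i f' , ∂P-cong i {f} {f'} e , go f' a
    where
    go : ∀ f → All (Q ∘ proj₂) f → All (Q' ∘ proj₂) (∂P i f)
    go [] [] = []
    go ((c , m) ∷ f) (b ∷ a) = Allₚ.++⁺ (Allₚ.map⁺ (All.map (λ {(_ , m')} d → q m m' b d) (∂M-terms i m))) (go f a)

  Terms-var : ∀ {Q Q'} j f → (∀ m → Q m → Q' (monoMul (vm j) m)) → Terms Q f → Terms Q' (var j *P f)
  Terms-var j f q (f' , e , a) = var j *P f' , *P-cong {var j} {var j} {f} {f'} (λ _ → refl) e , Allₚ.++⁺ (Allₚ.map⁺ (All.map (λ {(c , m)} → q m) a)) []

  Terms-⊥ : ∀ f → Terms (λ _ → ⊥) f → f ≈P []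
  Terms-⊥ f ([] , e , _) = e
  Terms-⊥ f (_ ∷ _ , _ , () ∷ _)

  Bounded : ℕ → ℕ → Mono → Set
  Bounded p n m = ∀ j → p ≤ j → expo m j ≤ n ∸ suc j

  eqℕ-≢ : ∀ i j → i ≢ j → eqℕ i j ≡ 0
  eqℕ-≢ zero zero ne = ⊥-elim (ne refl)
  eqℕ-≢ zero (suc j) ne = refl
  eqℕ-≢ (suc i) zero ne = refl
  eqℕ-≢ (suc i) (suc j) ne = eqℕ-≢ i j (ne ∘ cong suc)

  expo-var : ∀ i m j → i ≢ j → expo (monoMul (vm i) m) j ≡ expo m j
  expo-var i m j ne = trans (expo-mul (vm i) m j) (cong (ℕ._+ expo m j) (trans (expo-vm i j) (eqℕ-≢ i j ne)))

  expo-var-at : ∀ i m → expo (monoMul (vm i) m) i ≡ suc (expo m i)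
  expo-var-at i m = trans (expo-mul (vm i) m i) (cong (ℕ._+ expo m i) (trans (expo-vm i i) (eqℕ-refl i)))

  top-bound : ∀ {p n m} i → p ≤ i → Bounded p n m → expo m i ⊔ expo m (suc i) ≤ n ∸ suc i
  top-bound {p} {n} {m} i l b = ℕₚ.⊔-lub (b i l) (ℕₚ.≤-trans (b (suc i) (ℕₚ.m≤n⇒m≤1+n l)) (ℕₚ.∸-monoʳ-≤ n (ℕₚ.n≤1+n (suc i))))

  -- At x_i the factor restores the exponent just lost; at x_(i+1) the bound is smaller by one,
  -- which the drop makes up for.
  Drop-x-bounded : ∀ {p n m m'} i → p ≤ i → Bounded p n m → Drop i m m' → Bounded p n (monoMul (vm i) m')
  Drop-x-bounded {p} {n} {m} {m'} i l b d j pj with j ℕ.≟ i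
  ... | yes refl = ℕₚ.≤-trans (ℕₚ.≤-reflexive (expo-var-at i m')) (ℕₚ.≤-trans (Drop.at d) (top-bound {p} {n} {m} i l b))
  ... | no a with j ℕ.≟ suc i
  ...   | yes refl = ℕₚ.≤-trans (ℕₚ.≤-reflexive (expo-var i m' (suc i) (λ e → a (sym e)))) (ℕₚ.≤-trans (ℕₚ.<⇒≤pred (ℕₚ.≤-trans (Drop.at' d) (top-bound {p} {n} {m} i l b)))
            (ℕₚ.≤-reflexive (ℕₚ.pred[m∸n]≡m∸[1+n] n (suc i))))
  ...   | no a' = ℕₚ.≤-trans (ℕₚ.≤-reflexive (trans (expo-var i m' j (λ e → a (sym e))) (Drop.others d j a a'))) (b j pj)

  Drop-bounded : ∀ {p n m m'} i → p ≤ i → Bounded p n m → Drop i m m' → Bounded p n m'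
  Drop-bounded {p} {n} {m} {m'} i l b d j pj = ℕₚ.≤-trans (ℕₚ.≤-trans (ℕₚ.m≤n+m (expo m' j) (expo (vm i) j)) (ℕₚ.≤-reflexive (sym (expo-mul (vm i) m' j)))) (Drop-x-bounded {p} {n} {m} {m'} i l b d j pj)

  PolyDR : DiffRing
  PolyDR = record
    { R = PolyRing ; x = var ; s = swapP ; ∂ = ∂P
    ; s-cong = λ i {f} {g} → swapP-cong i {f} {g} ; s-+ = swapP-+ ; s-* = swapP-* ; s-1 = swapP-1 ; s-x = swapP-var
    ; s-invol = swapP-invol ; s-far = swapP-far ; s-braid = swapP-braid ; cancel = cancelP ; ∂-spec = ∂P-spec
    ; c₀ = λ f → coeff f []
    ; c₀-cong = λ e → e []
    ; c₀-+ = λ f g → trans (coeff-lin (f ++ g) []) (trans (lin-++ (δ []) f g) (sym (cong₂ ℤ._+_ (coeff-lin f []) (coeff-lin g []))))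
    ; c₀-neg = λ f → trans (coeff-lin (negP f) []) (trans (lin-scale (δ []) (ℤ.- 1ℤ) f) (trans (ℤₚ.-1*i≡-i _) (cong ℤ.-_ (sym (coeff-lin f [])))))
    ; c₀-x = λ j f → trans (coeff-lin (var j *P f) []) (trans (lin-var* (δ []) j f) (trans (lin-cong (δ-absent j [] refl) f) (lin-0 f)))
    ; c₀-1 = refl
    ; V = λ p n → Terms (Bounded p n)
    ; V-cong = λ {p} {n} {f} {g} → Terms-cong {Bounded p n} f g
    ; V-+ = λ {p} {n} {f} {g} → Terms-+ {Bounded p n} f g
    ; V-neg = λ {p} {n} {f} → Terms-scale {Bounded p n} (ℤ.- 1ℤ) f
    ; V-0 = [] , (λ _ → refl) , []
    ; V-1 = oneP , (λ _ → refl) , (λ j _ → z≤n) ∷ []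
    ; V-∂ = λ {p} {n} {f} i l → Terms-∂ {Bounded p n} {Bounded p n} i f (λ m m' b d → Drop-bounded {p} {n} {m} {m'} i l b d)
    ; V-x∂ = λ {p} {n} {f} i l v → Terms-var {λ m → Bounded p n (monoMul (vm i) m)} {Bounded p n} i (∂P i f) (λ m b → b)
        (Terms-∂ {Bounded p n} {λ m → Bounded p n (monoMul (vm i) m)} i f (λ m m' b d → Drop-x-bounded {p} {n} {m} {m'} i l b d) v)
    ; V-x = λ {p} {n} {f} j l → Terms-var {Bounded p n} {Bounded p n} j f
        (λ m b i pi → ℕₚ.≤-trans (ℕₚ.≤-reflexive (expo-var j m i (ℕₚ.<⇒≢ (ℕₚ.<-≤-trans l pi)))) (b i pi))
    ; V-vanish = λ {p} {n} {f} i l nl v → Terms-⊥ (∂P i f) (Terms-∂ {Bounded p n} {λ _ → ⊥} i f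
        (λ m m' b d → ℕₚ.<⇒≱ (ℕₚ.≤-trans (Drop.at d) (top-bound {p} {n} {m} i l b)) (subst (_≤ expo m' i) (sym (ℕₚ.m≤n⇒m∸n≡0 nl)) z≤n)) v)
    ; V-mono = λ {p} {p'} {n} {n'} {f} pl nl → Terms-map {Bounded p n} {Bounded p' n'} f (λ m b j pj → ℕₚ.≤-trans (b j (ℕₚ.≤-trans pl pj)) (ℕₚ.∸-monoˡ-≤ (suc j) nl))
    }

-- The functionals are jointly faithful.

module Faithfulness where
  open Polynomials
  open DividedDifferences
  open PolynomialDifferences
  open DifferenceRings
  open Functionals
  open Words
  open RowOperators
  open import Data.Bool using (true; false; if_then_else_)
  open ≡

  open Eps PolyDR using (ε; ε-asc; ε-desc)
  open Alg PolyDR using (∂0⇒inv)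
  open Rows PolyDR using (ε-asc-id)

  find-var : ∀ k → k ≐ [] ⊎ Σ ℕ λ j → 0 < expo k j
  find-var [] = inj₁ (λ _ → refl)
  find-var (suc a ∷ k) = inj₂ (0 , s≤s z≤n)
  find-var (zero ∷ k) with find-var k
  ... | inj₁ e = inj₁ (λ { zero → refl ; (suc j) → e j })
  ... | inj₂ (j , l) = inj₂ (suc j , l)

  coeff-swap : ∀ j g k → coeff (swapP j g) k ≡ coeff g (swapMono j k)
  coeff-swap j g k = trans (coeff-lin (swapP j g) k) (trans (lin-swapP (δ k) j g) (trans (lin-cong each g) (sym (coeff-lin g (swapMono j k)))))
    where
    half : ∀ m k → swapMono j m ≐ k → m ≐ swapMono j k
    half m k e i = trans (cong (expo m) (sym (sw-invol j i))) (trans (sym (expo-swap j m (sw j i))) (trans (e (sw j i)) (sym (expo-swap j k i))))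
    half' : ∀ m k → m ≐ swapMono j k → swapMono j m ≐ k
    half' m k e i = sym (half k m (λ i → sym (e i)) i)
    each : ∀ m → δ k (swapMono j m) ≡ δ (swapMono j k) m
    each m = cong (if_then 1ℤ else 0ℤ) (bool-ext
      (λ t → monoEq-complete m (swapMono j k) (half m k (monoEq-sound (swapMono j m) k t)))
      (λ t → monoEq-complete (swapMono j m) k (half' m k (monoEq-sound m (swapMono j k) t))))

  coeff-absent : ∀ {Q} g k → Terms Q g → (∀ m → Q m → ¬ (m ≐ k)) → coeff g k ≡ 0ℤ
  coeff-absent {Q} g k (g' , e , a) q = trans (e k) (go g' a)
    where
    go : ∀ g → All (Q ∘ proj₂) g → coeff g k ≡ 0ℤ
    go [] [] = refl
    go ((c , m) ∷ g) (b ∷ a) with monoEq m k in eq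
    ... | true = ⊥-elim (q m b (monoEq-sound m k eq))
    ... | false = trans (ℤₚ.+-identityˡ _) (go g a)

  -- Invariance carries a positive exponent from x_j to x_(j+1) and on to the last variable, where
  -- the bound is zero; `n` bounds the number of moves.
  invariant-const : ∀ M g → Terms (Bounded 0 M) g → (∀ i → suc i < M → swapP i g ≈P g) → ∀ n j k → M ≤ n ℕ.+ suc j → 0 < expo k j → coeff g k ≡ 0ℤ
  invariant-const M g v inv n j k l p with suc j <? M
  ... | no nl = coeff-absent {Bounded 0 M} g k v (λ m b e → ℕₚ.<⇒≱ p (ℕₚ.≤-trans (ℕₚ.≤-reflexive (sym (e j))) (ℕₚ.≤-trans (b j z≤n) (ℕₚ.≤-reflexive (ℕₚ.m≤n⇒m∸n≡0 (ℕₚ.≮⇒≥ nl))))))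
  invariant-const M g v inv zero j k l p | yes jl = ⊥-elim (ℕₚ.<⇒≱ jl l)
  invariant-const M g v inv (suc n) j k l p | yes jl = trans (sym (inv j jl k)) (trans (coeff-swap j g k)
    (invariant-const M g v inv n (suc j) (swapMono j k) (subst (M ≤_) (sym (ℕₚ.+-suc n (suc j))) l) (subst (0 <_) (sym (trans (expo-swap j k (suc j)) (cong (expo k) (sw-at' j)))) p)))

  id-Perm : ∀ M → Perm[ M ] (λ j → j)
  id-Perm M = (λ l → l) , (λ _ _ e → e)

  -- Induction on the degree. By `ε-asc` and `ε-desc` all functionals vanish on `∂P i g`, so this is
  -- zero and `g` is invariant under every swap, hence constant; the identity permutation reads off
  -- the constant.
  faithful-deg : ∀ d M g → Terms (λ m → Bounded 0 M m × sum m ≤ d) g → (∀ u → Perm[ M ] u → ε M u g ≡ 0ℤ) → g ≈P []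
  faithful-deg d M g v z k with find-var k
  ... | inj₁ e = trans (trans (coeff-lin g k) (trans (lin-cong (δ-cong {k} {[]} e) g) (sym (coeff-lin g []))))
     (trans (sym (ε-asc-id M (λ j → j) g (λ j _ _ → ℕₚ.≤-refl))) (z (λ j → j) (id-Perm M)))
  ... | inj₂ (j , p) = invariant-const M g (Terms-map g (λ _ → proj₁) v) inv M j k (ℕₚ.m≤m+n M (suc j)) p
    where
    ∂0 : ∀ d → Terms (λ m → Bounded 0 M m × sum m ≤ d) g → ∀ i → suc i < M → ∂P i g ≈P []
    ∂0 zero v i l = Terms-⊥ (∂P i g) (Terms-∂ i g (λ m m' (b , s) d → ℕₚ.<⇒≱ (ℕₚ.≤-trans (ℕₚ.≤-reflexive (Drop.degree d)) s) z≤n) v)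
    ∂0 (suc d) v i l = faithful-deg d M (∂P i g) (Terms-∂ i g (λ m m' (b , s) d → Drop-bounded {0} {M} {m} {m'} i z≤n b d , ℕₚ.≤-pred (ℕₚ.≤-trans (ℕₚ.≤-reflexive (Drop.degree d)) s)) v) zz
      where
      zz : ∀ u → Perm[ M ] u → ε M u (∂P i g) ≡ 0ℤ
      zz u pu with ℕₚ.<-cmp (u i) (u (suc i))
      ... | tri< a _ _ = trans (ε-asc M u i g l (proj₂ pu) a) (z (u ∘ sw i) (Perm-sw {M} {u} i l pu))
      ... | tri> _ _ c = ε-desc M u i g l (proj₂ pu) c
      ... | tri≈ _ e _ = ⊥-elim (ℕₚ.1+n≢n (sym (proj₂ pu (ℕₚ.<-trans (ℕₚ.n<1+n i) l) l e)))
    inv : ∀ i → suc i < M → swapP i g ≈P g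
    inv i l = ∂0⇒inv i g (∂0 d v i l)

  degree-bound : ∀ {Q} f → Terms Q f → Σ ℕ λ d → Terms (λ m → Q m × sum m ≤ d) f
  degree-bound {Q} f (g , e , a) = let (d , b) = go g a in d , g , e , b
    where
    go : ∀ g → All (Q ∘ proj₂) g → Σ ℕ λ d → All (λ (_ , m) → Q m × sum m ≤ d) g
    go [] [] = 0 , []
    go ((c , m) ∷ g) (q ∷ a) = let (d , b) = go g a in sum m ⊔ d , (q , ℕₚ.m≤m⊔n (sum m) d) ∷ All.map (λ (q , l) → q , ℕₚ.≤-trans l (ℕₚ.m≤n⊔m (sum m) d)) b

  faithful : ∀ M g → Terms (Bounded 0 M) g → (∀ u → Perm[ M ] u → ε M u g ≡ 0ℤ) → g ≈P []
  faithful M g v z = let (d , b) = degree-bound g v in faithful-deg d M g b z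

  expo-≤-sum : ∀ m j → expo m j ≤ sum m
  expo-≤-sum [] j = z≤n
  expo-≤-sum (a ∷ m) zero = ℕₚ.m≤m+n a (sum m)
  expo-≤-sum (a ∷ m) (suc j) = ℕₚ.≤-trans (expo-≤-sum m j) (ℕₚ.m≤n+m (sum m) a)

  mono-bounded : ∀ m → Bounded 0 (sum m ℕ.+ length m) m
  mono-bounded m j _ with j <? length m
  ... | yes l = ℕₚ.≤-trans (expo-≤-sum m j) (ℕₚ.≤-trans (ℕₚ.≤-reflexive (sym (ℕₚ.m+n∸n≡m (sum m) (suc j)))) (ℕₚ.∸-monoˡ-≤ (suc j) (ℕₚ.+-monoʳ-≤ (sum m) l)))
  ... | no l = ℕₚ.≤-trans (ℕₚ.≤-reflexive (expo-beyond m j (ℕₚ.≮⇒≥ l))) z≤n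

  bounded : ∀ f → Σ ℕ λ M → Terms (Bounded 0 M) f
  bounded f = let (M , a) = go f in M , f , (λ _ → refl) , a
    where
    widen : ∀ {M M'} → M ≤ M' → ∀ m → Bounded 0 M m → Bounded 0 M' m
    widen l m b j p = ℕₚ.≤-trans (b j p) (ℕₚ.∸-monoˡ-≤ (suc j) l)
    go : ∀ f → Σ ℕ λ M → All (Bounded 0 M ∘ proj₂) f
    go [] = 0 , []
    go ((c , m) ∷ f) = let (M , a) = go f ; K = sum m ℕ.+ length m in
      K ⊔ M , widen (ℕₚ.m≤m⊔n K M) m (mono-bounded m) ∷ All.map (λ {(_ , m')} → widen (ℕₚ.m≤n⊔m K M) m') a

-- Duality, and reduction to Grassmannian permutations.

module DualBasis where
  open DividedDifferences using (sw; sw-at; sw-at'; sw-fix; sw-invol)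
  open IntegerSolver
  open DifferenceRings
  open Functionals
  open Words
  open Transpositions
  open PathCounting using (whenᴺ; when-yes)
  open SlotPaths
  open PathBounds
  open RowOperators
  open GrassmannianCoefficients

  EqOn : ℕ → (ℕ → ℕ) → (ℕ → ℕ) → Set
  EqOn N u w = ∀ {j} → j < N → u j ≡ w j

  eqOn-dec : ∀ N u w → Dec (EqOn N u w)
  eqOn-dec N u w = ℕₚ.allUpTo? (λ j → u j ≟ w j) N

  ind : ℕ → (ℕ → ℕ) → (ℕ → ℕ) → ℕ
  ind N w u = whenᴺ (eqOn-dec N u w) 1

  ind-yes : ∀ {N w u} → EqOn N u w → ind N w u ≡ 1
  ind-yes {N} {w} {u} e = when-yes (eqOn-dec N u w) 1 e

  when-no : ∀ {A : Set} (d : Dec A) z → ¬ A → whenᴺ d z ≡ 0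
  when-no (yes a) z n = ⊥-elim (n a)
  when-no (no _) z n = ≡.refl

  ind-no : ∀ {N w u} → ¬ EqOn N u w → ind N w u ≡ 0
  ind-no {N} {w} {u} n = when-no (eqOn-dec N u w) 1 n

  ind-iff : ∀ {N w u N' w' u'} → (EqOn N u w → EqOn N' u' w') → (EqOn N' u' w' → EqOn N u w) → ind N w u ≡ ind N' w' u'
  ind-iff {N} {w} {u} {N'} {w'} {u'} f g with eqOn-dec N u w
  ... | yes e = ≡.sym (ind-yes {N'} {w'} {u'} (f e))
  ... | no n = ≡.sym (ind-no {N'} {w'} {u'} (λ e → n (g e)))

  pigeonhole : ∀ n {K u} → Inj n u → (∀ {i} → i < n → u i < K) → n ≤ K
  pigeonhole zero inj b = z≤n
  pigeonhole (suc n) {K} {u} inj b = ℕₚ.<-≤-trans (s≤s (pigeonhole n {u p} {u ∘ punch p} (Inj-punch pl inj) (λ {i} l → proj₂ im (punch p i) (punch-< pl l) (punch-≢ p i)))) (b (s≤s pl))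
    where
    p = mp n u
    im = mp-isMax n u inj
    pl = proj₁ im

  max-value : ∀ {N u p} → Perm[ suc N ] u → IsMax N u p → u p ≡ N
  max-value {N} {u} {p} (b , inj) (pl , q) = ℕₚ.≤-antisym (ℕₚ.≤-pred (b (s≤s pl)))
    (pigeonhole N {u p} {u ∘ punch p} (Inj-punch pl inj) (λ {i} l → q (punch p i) (punch-< pl l) (punch-≢ p i)))

  records-fix : ∀ {n N u} → Perm[ N ] u → Records n N u → ∀ {j} → n ≤ j → j < N → u j ≡ j
  records-fix {n} {N} {u} pu r {j} nj jN = max-value {j} {u} {j} (Perm-drops N jN pu (λ i a b → r i (ℕₚ.≤-trans nj (ℕₚ.<⇒≤ a)) b))
    (ℕₚ.≤-refl , λ i l ne → r j nj jN i (ℕₚ.≤∧≢⇒< l ne))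

  EqOn-records : ∀ {n N u w} → n ≤ N → Perm[ n ] w → EqOn N u (ext n w) → Records n N u
  EqOn-records {n} {N} {u} {w} l pw e j a b i ij = subst₂ _<_ (≡.sym (e (ℕₚ.<-trans ij b))) (≡.sym (e b)) (ext-lt {n} {w} pw a ij)

  split-last : ∀ {N u} → Inj (suc N) u → (∀ j → j < N → u j < u N) ⊎ Σ ℕ λ p → p < N × IsMax N u p
  split-last {N} {u} inj with ℕₚ.m≤n⇒m<n∨m≡n (proj₁ im)
    where im = mp-isMax N u inj
  ... | inj₁ l = inj₂ (mp N u , l , mp-isMax N u inj)
  ... | inj₂ e = inj₁ (λ j l → subst (λ z → u j < u z) e (proj₂ (mp-isMax N u inj) j (ℕₚ.<⇒≤ l) (λ e' → ℕₚ.<⇒≢ l (≡.trans e' e))))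

  lastMax : ∀ {N u} → (∀ j → j < N → u j < u N) → IsMax N u N
  lastMax q = ℕₚ.≤-refl , λ j l ne → q j (ℕₚ.≤∧≢⇒< l ne)

  max-descent : ∀ {N u p} → p < N → IsMax N u p → ¬ (u p < u (suc p))
  max-descent {N} {u} {p} l im a = ℕₚ.<-asym a (proj₂ im (suc p) l (λ e → ℕₚ.1+n≢n e))

  AscBut : ℕ → ℕ → (ℕ → ℕ) → Set
  AscBut p L u = ∀ {i} → suc i < L → i ≢ p → u i < u (suc i)

  ascBut? : ∀ p L u → AscBut p L u ⊎ Σ ℕ λ i → suc i < L × i ≢ p × ¬ (u i < u (suc i))
  ascBut? p L u with ℕₚ.allUpTo? Q? L
    where
    Q? : ∀ i → Dec (suc i < L → i ≢ p → u i < u (suc i))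
    Q? i = (suc i <? L) →-dec (¬? (i ≟ p) →-dec (u i <? u (suc i)))
  ... | yes q = inj₁ (λ {i} l → q (ℕₚ.<-trans (ℕₚ.n<1+n i) l) l)
  ... | no q with counterexample L (λ i → (suc i <? L) →-dec (¬? (i ≟ p) →-dec (u i <? u (suc i)))) q
  ...   | i , l , r = inj₂ (go (suc i <? L) (i ≟ p))
    where
    go : Dec (suc i < L) → Dec (i ≡ p) → Σ ℕ λ i → suc i < L × i ≢ p × ¬ (u i < u (suc i))
    go (no a) _ = ⊥-elim (r (λ b → ⊥-elim (a b)))
    go (yes _) (yes e) = ⊥-elim (r (λ _ ne → ⊥-elim (ne e)))
    go (yes a) (no b) = i , a , b , λ c → r (λ _ _ → c)

  desc-of : ∀ {L u i} → Inj L u → suc i < L → ¬ (u i < u (suc i)) → u (suc i) < u i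
  desc-of {L} {u} {i} inj l n = ℕₚ.≤∧≢⇒< (ℕₚ.≮⇒≥ n) (λ e → ℕₚ.1+n≢n (inj l (ℕₚ.<-trans (ℕₚ.n<1+n i) l) e))

  asc-sw : ∀ {u i} → u (suc i) < u i → (u ∘ sw i) i < (u ∘ sw i) (suc i)
  asc-sw {u} {i} a = subst₂ _<_ (cong u (≡.sym (sw-at i))) (cong u (≡.sym (sw-at' i))) a

  desc-sw : ∀ {u i} → u i < u (suc i) → (u ∘ sw i) (suc i) < (u ∘ sw i) i
  desc-sw {u} {i} a = subst₂ _<_ (cong u (≡.sym (sw-at' i))) (cong u (≡.sym (sw-at i))) a

  EqOn-sw : ∀ {N u w} i → suc i < N → EqOn N (u ∘ sw i) w → EqOn N u (w ∘ sw i)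
  EqOn-sw {N} {u} {w} i l e {j} jl = ≡.trans (cong u (≡.sym (sw-invol i j))) (e (sw-< i l jl))

  EqOn-sw' : ∀ {N u w} i → suc i < N → EqOn N u (w ∘ sw i) → EqOn N (u ∘ sw i) w
  EqOn-sw' {N} {u} {w} i l e {j} jl = ≡.trans (e (sw-< i l jl)) (cong w (sw-invol i j))

  module Duality (DR : DiffRing) where
    open DiffRing DR
    open Alg DR
    open Eps DR
    open Rows DR

    -- Characterises the Schubert polynomial of `w` by the functionals; the exponent bound brings it
    -- within reach of `faithful`.
    record Dual (N : ℕ) (w : ℕ → ℕ) (F : Carrier) : Set where
      field
        permutes : Perm[ N ] w
        bound : V 0 N F
        eval : ∀ u → Perm[ N ] u → ε N u F ≡ + ind N w u

    ε-desc-inv : ∀ L u i f → suc i < L → Inj L u → u (suc i) < u i → ε L u f ≡ ε L (u ∘ sw i) (∂ i f)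
    ε-desc-inv L u i f l inj a = ≡.trans (ε-permcong L f (λ j _ → cong u (≡.sym (sw-invol i j)))) (≡.sym (ε-asc L (u ∘ sw i) i f l (Inj-sw {L} {u} i l inj) (asc-sw {u} a)))

    Dual-step : ∀ {N w F} i → suc i < N → w (suc i) < w i → Dual N w F → Dual N (w ∘ sw i) (∂ i F)
    Dual-step {N} {w} {F} i l a D = record { permutes = Perm-sw {N} {w} i l permutes ; bound = V-∂ i z≤n bound ; eval = ev }
      where
      open Dual D
      ev : ∀ u → Perm[ N ] u → ε N u (∂ i F) ≡ + ind N (w ∘ sw i) u
      ev u pu = go (u i <? u (suc i))
        where
        go : Dec (u i < u (suc i)) → ε N u (∂ i F) ≡ + ind N (w ∘ sw i) u
        go (yes b) = ≡.trans (ε-asc N u i F l (proj₂ pu) b) (≡.trans (eval (u ∘ sw i) (Perm-sw {N} {u} i l pu))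
           (cong +_ (ind-iff {N} {w} {u ∘ sw i} {N} {w ∘ sw i} {u} (EqOn-sw {N} {u} {w} i l) (EqOn-sw' {N} {u} {w} i l))))
        go (no b) = ≡.trans (ε-desc N u i F l (proj₂ pu) (desc-of {N} {u} (proj₂ pu) l b)) (≡.sym (cong +_ (ind-no {N} {w ∘ sw i} {u}
           (λ e → b (subst₂ _<_ (≡.sym (e (ℕₚ.<-trans (ℕₚ.n<1+n i) l))) (≡.sym (e l)) (asc-sw {w} a))))))

    -- Stability under the embedding of S_N: by `V-records` a functional of S_L either comes from
    -- S_N or vanishes on `F`.
    Dual-extend : ∀ {N w F L} → N ≤ L → Dual N w F → Dual L (ext N w) F
    Dual-extend {N} {w} {F} {L} l D = record { permutes = ext-Perm {N} {w} l permutes ; bound = V-mono z≤n l bound ; eval = ev }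
      where
      open Dual D
      ev : ∀ u → Perm[ L ] u → ε L u F ≡ + ind L (ext N w) u
      ev u pu = go (V-records N L u l (proj₂ pu))
        where
        rec-case : Records N L u → ε L u F ≡ + ind L (ext N w) u
        rec-case r = ≡.trans (ε-records N L u F l r) (≡.trans (eval u (Perm-drops L l pu r)) (cong +_ (ind-iff {N} {w} {u} {L} {ext N w} {u}
            (λ e {j} jl → up e jl (j <? N)) (λ e {j} jl → ≡.trans (e (ℕₚ.<-≤-trans jl l)) (ext-in {N} {w} jl)))))
          where
          up : EqOn N u w → ∀ {j} → j < L → Dec (j < N) → u j ≡ ext N w j
          up e jl (yes a) = ≡.trans (e a) (≡.sym (ext-in {N} {w} a))
          up e jl (no a) = ≡.trans (records-fix {N} {L} {u} pu r (ℕₚ.≮⇒≥ a) jl) (≡.sym (ext-out {N} {w} (ℕₚ.≮⇒≥ a)))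
        go : Records N L u ⊎ (∀ H → V 0 N H → ε L u H ≡ 0ℤ) → ε L u F ≡ + ind L (ext N w) u
        go (inj₁ r) = rec-case r
        go (inj₂ z) with eqOn-dec L u (ext N w)
        ... | no _ = z F bound
        ... | yes e = ≡.trans (rec-case (EqOn-records {N} {L} {u} {w} l permutes e)) (cong +_ (ind-yes {L} {ext N w} {u} e))

    Dual-1 : Dual 0 (λ j → j) 1#
    Dual-1 = record { permutes = (λ ()) , (λ ()) ; bound = V-1 ; eval = λ u pu → ≡.trans (ε-nil u 1#) (≡.trans c₀-1 (≡.sym (cong +_ (ind-yes {0} {λ j → j} {u} (λ ()))))) }

    module _ (faithful : ∀ M g → V 0 M g → (∀ u → Perm[ M ] u → ε M u g ≡ 0ℤ) → g ≈ 0#) where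

      -- A functional that does not vanish on `∂ i F` for trivial reasons equals one of a
      -- permutation with a descent at `i`, hence different from `w`.
      Dual-asc : ∀ {N w F} i → suc i < N → w i < w (suc i) → Dual N w F → ∂ i F ≈ 0#
      Dual-asc {N} {w} {F} i l a D = faithful N (∂ i F) (V-∂ i z≤n bound) ev
        where
        open Dual D
        ev : ∀ u → Perm[ N ] u → ε N u (∂ i F) ≡ 0ℤ
        ev u pu = go (u i <? u (suc i))
          where
          go : Dec (u i < u (suc i)) → ε N u (∂ i F) ≡ 0ℤ
          go (no b) = ε-desc N u i F l (proj₂ pu) (desc-of {N} {u} (proj₂ pu) l b)
          go (yes b) = ≡.trans (ε-asc N u i F l (proj₂ pu) b) (≡.trans (eval (u ∘ sw i) (Perm-sw {N} {u} i l pu)) (cong +_ (ind-no {N} {w} {u ∘ sw i}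
            (λ e → ℕₚ.<-asym a (subst₂ _<_ (e l) (e (ℕₚ.<-trans (ℕₚ.n<1+n i) l)) (desc-sw {u} b))))))

      Dual-unique : ∀ {N w F G} → Dual N w F → Dual N w G → F ≈ G
      Dual-unique {N} {w} {F} {G} D E = diff0 (faithful N (F - G) (V-+ (bound D) (V-neg (bound E)))
         (λ u pu → ≡.trans (ε-minus N u F G) (≡.trans (cong₂ ℤ._-_ (eval D u pu) (eval E u pu)) (ℤₚ.+-inverseʳ (+ ind N w u)))))
        where open Dual

      module Reduce (m : ℕ) where
        open Slots m using (s₁; s₂; s₃; n)
        open Grass DR m

        Topped : (ℕ → ℕ) → Set
        Topped w = ∀ j → j < s₃ → w j < w s₃

        Small : (ℕ → ℕ) → ℤ → Set
        Small w z = Σ ℕ λ q → z ≡ + q × q ≤ 2 × (Topped w → q ≤ 1)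

        module _ (a b : ℕ) (ba : b < a) where

          private S = Sch a b

          -- `Sch` uses one variable less in its second factors, as the stripping of rows requires.
          -- Adding x times one row to the other gives the usual determinant, whose symmetry is
          -- visible.
          Sch-JT : S ≈ h a s₂ * h (suc b) s₂ - h b s₂ * h (suc a) s₂
          Sch-JT = solve 5 (λ A B C E y → (A :* C :- B :* E) := (A :* (C :+ y :* B) :- B :* (E :+ y :* A))) refl (h a s₂) (h b s₂) (h (suc b) s₁) (h (suc a) s₁) (x s₁)
            where open RingSolve R

          h-inv : ∀ c i → i ≢ s₁ → s i (h c s₂) ≈ h c s₂
          h-inv c i ne with ℕₚ.<-cmp i s₁
          ... | tri< l _ _ = s-h-below i c s₂ (s≤s l)
          ... | tri≈ _ e _ = ⊥-elim (ne e)
          ... | tri> _ _ l = s-h-above i c s₂ l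

          Sch-inv : ∀ i → i ≢ s₁ → s i S ≈ S
          Sch-inv i ne = trans (s-cong i Sch-JT) (trans (s-minus i _ _) (trans (-‿cong₂ (trans (s-* i _ _) (*-cong (h-inv a i ne) (h-inv (suc b) i ne)))
            (trans (s-* i _ _) (*-cong (h-inv b i ne) (h-inv (suc a) i ne)))) (sym Sch-JT)))

          Sch-* : ∀ F → S * F ≈ h a s₂ * (h (suc b) s₁ * F) - h (suc a) s₁ * (h b s₂ * F)
          Sch-* F = solve 5 (λ A B C E y → ((A :* C :- B :* E) :* y) := (A :* (C :* y) :- E :* (B :* y))) refl (h a s₂) (h b s₂) (h (suc b) s₁) (h (suc a) s₁) F
            where open RingSolve R

          c₀-Sch : ∀ F → c₀ (S * F) ≡ 0ℤ
          c₀-Sch F = ≡.trans (≡.sym (ε-nil (λ j → j) (S * F))) (≡.trans (ε-cong 0 (λ j → j) (Sch-* F)) (≡.trans (ε-minus 0 (λ j → j) _ _)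
             (cong₂ ℤ._-_ (pos a ba) (ε-h 0 s₁ (λ j → j) a _ z≤n))))
            where
            pos : ∀ a → b < a → ε 0 (λ j → j) (h a s₂ * (h (suc b) s₁ * F)) ≡ 0ℤ
            pos (suc a) _ = ε-h 0 s₂ (λ j → j) a _ z≤n

          small0 : ∀ {w z} → z ≡ 0ℤ → Small w z
          small0 e = 0 , e , z≤n , λ _ → z≤n

          -- Largest values at the end are dropped; the next maximum can only stand at the one
          -- possible descent `s₁`.
          grassmannian : ∀ L v w F → Perm[ L ] v → AscBut s₁ L v → Dual n w F → Small w (ε L v (S * F))
          grassmannian zero v w F pv asc D = small0 {w} (≡.trans (ε-nil v (S * F)) (c₀-Sch F))
          grassmannian (suc N) v w F pv asc D = go (split-last {N} {v} (proj₂ pv))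
            where
            open Dual D
            go : (∀ j → j < N → v j < v N) ⊎ (Σ ℕ λ p → p < N × IsMax N v p) → Small w (ε (suc N) v (S * F))
            go (inj₁ q) = subst (Small w) (≡.sym (ε-ext N v (S * F) q)) (grassmannian N v w F (Perm-drop pv q) (λ l → asc (ℕₚ.m≤n⇒m≤1+n l)) D)
            go (inj₂ (p , pN , im)) = at (p ≟ s₁)
              where
              at : Dec (p ≡ s₁) → Small w (ε (suc N) v (S * F))
              at (no ne) = ⊥-elim (max-descent {N} {v} pN im (asc (s≤s pN) ne))
              at (yes ≡.refl) = good-coef w F bound (proj₂ permutes) eval N v pN pv im
                (λ j _ l → asc (ℕₚ.≤-trans l (ℕₚ.m≤n⇒m≤1+n pN)) (ℕₚ.<⇒≢ (ℕₚ.≤-pred l))) (λ j sj l → asc l (λ e → ℕₚ.<⇒≢ sj (≡.sym e))) a b ba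

          -- A largest value at `s₃` excludes a descent at `s₂`; the other admissible swaps do not
          -- touch `s₃`.
          Topped-sw : ∀ {w} i → i ≢ s₁ → suc i < n → w (suc i) < w i → Topped w → Topped (w ∘ sw i)
          Topped-sw {w} i ne l d t with ℕₚ.<-cmp i s₁
          ... | tri≈ _ e _ = ⊥-elim (ne e)
          ... | tri> _ _ g with ℕₚ.≤-antisym g (ℕₚ.≤-pred (ℕₚ.≤-pred l))
          ...   | ≡.refl = ⊥-elim (ℕₚ.<-asym d (t s₂ ℕₚ.≤-refl))
          Topped-sw {w} i ne l d t | tri< g _ _ = λ j jl → subst (w (sw i j) <_) (cong w (≡.sym fix)) (t (sw i j) (sw-< i (ℕₚ.m≤n⇒m≤1+n (s≤s g)) jl))
            where
            fix : sw i s₃ ≡ s₃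
            fix = sw-fix i s₃ (λ e → ℕₚ.<⇒≢ (ℕₚ.m≤n⇒m≤1+n (ℕₚ.m≤n⇒m≤1+n g)) (≡.sym e)) (λ e → ℕₚ.<⇒≢ (ℕₚ.m≤n⇒m≤1+n (s≤s g)) (≡.sym e))

          -- A descent `i` of `v` other than `s₁` commutes with the symmetric factor and acts on
          -- `F`: it replaces `w` by `w ∘ sw i` or gives zero. The word of `v` loses a letter, and
          -- `k` bounds its length.
          reduce : ∀ k L v w F → length (word L v) ≤ k → Perm[ L ] v → Dual n w F → Small w (ε L v (S * F))
          reduce k L v w F lk pv D with ascBut? s₁ L v
          ... | inj₁ asc = grassmannian L v w F pv asc D
          ... | inj₂ (i , l , ne , nd) = go k lk (suc i <? n)
            where
            open Dual D
            d' : v (suc i) < v i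
            d' = desc-of {L} {v} (proj₂ pv) l nd
            e₀ : ε L v (S * F) ≡ ε L (v ∘ sw i) (S * ∂ i F)
            e₀ = ≡.trans (ε-desc-inv L v i (S * F) l (proj₂ pv) d') (ε-cong L (v ∘ sw i) (∂-inv* i S F (Sch-inv i ne)))
            zero-case : ∂ i F ≈ 0# → Small w (ε L v (S * F))
            zero-case e = small0 {w} (≡.trans e₀ (ε-≈0 L (v ∘ sw i) (trans (*-congˡ e) (zeroʳ S))))
            len : suc (length (word L (v ∘ sw i))) ≡ length (word L v)
            len = ≡.trans (~length (asc-word L (v ∘ sw i) i l (Inj-sw {L} {v} i l (proj₂ pv)) (asc-sw {v} d'))) (cong length (word-cong L (λ j _ → cong v (sw-invol i j))))
            go : ∀ k → length (word L v) ≤ k → Dec (suc i < n) → Small w (ε L v (S * F))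
            go k lk (no a) = zero-case (V-vanish i z≤n (ℕₚ.≮⇒≥ a) bound)
            go zero lk (yes a) = ⊥-elim (ℕₚ.<⇒≱ (s≤s z≤n) (ℕₚ.≤-trans (ℕₚ.≤-reflexive len) lk))
            go (suc k) lk (yes a) = go' (w i <? w (suc i))
              where
              go' : Dec (w i < w (suc i)) → Small w (ε L v (S * F))
              go' (yes c) = zero-case (Dual-asc i a c D)
              go' (no c) = let (q , e , q2 , q1) = reduce k L (v ∘ sw i) (w ∘ sw i) (∂ i F) (ℕₚ.≤-pred (ℕₚ.≤-trans (ℕₚ.≤-reflexive len) lk)) (Perm-sw {L} {v} i l pv) (Dual-step i a dw D)
                           in q , ≡.trans e₀ e , q2 , λ t → q1 (Topped-sw {w} i ne a dw t)
                where
                dw = desc-of {n} {w} (proj₂ permutes) a c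

-- The two-row Schur polynomial is dual to its Grassmannian permutation.

module TwoRowSchur where
  open DividedDifferences using (sw)
  open DifferenceRings
  open Functionals
  open Words
  open SlotPaths
  open PathEvaluation
  open RowOperators
  open GrassmannianCoefficients
  open DualBasis

  unpunch : ∀ p j → j ≢ p → Σ ℕ λ i → punch p i ≡ j
  unpunch zero zero ne = ⊥-elim (ne ≡.refl)
  unpunch zero (suc j) ne = j , ≡.refl
  unpunch (suc p) zero ne = 0 , ≡.refl
  unpunch (suc p) (suc j) ne = let (i , e) = unpunch p j (λ e → ne (cong suc e)) in suc i , cong suc e

  ind-punch : ∀ {N p u τ} → IsMax N u p → IsMax N τ p → Perm[ suc N ] u → Perm[ suc N ] τ → ind (suc N) τ u ≡ ind N (τ ∘ punch p) (u ∘ punch p)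
  ind-punch {N} {p} {u} {τ} mu mτ pu pτ = ind-iff {suc N} {τ} {u} {N} {τ ∘ punch p} {u ∘ punch p}
    (λ e l → e (s≤s (punch-< (proj₁ mu) l))) (λ e {j} l → go e l (j ≟ p))
    where
    go : EqOn N (u ∘ punch p) (τ ∘ punch p) → ∀ {j} → j < suc N → Dec (j ≡ p) → u j ≡ τ j
    go e l (yes ≡.refl) = ≡.trans (max-value {N} {u} pu mu) (≡.sym (max-value {N} {τ} pτ mτ))
    go e {j} l (no ne) with unpunch p j ne
    ... | i , ≡.refl = e (lt (i <? p))
      where
      lt : Dec (i < p) → i < N
      lt (yes a) = ℕₚ.<-≤-trans a (proj₁ mu)
      lt (no a) = ℕₚ.≤-pred (subst (_< suc N) (punch-hi p i (ℕₚ.≮⇒≥ a)) l)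

  module Schur (DR : DiffRing) where
    open DiffRing DR
    open Alg DR
    open Eps DR
    open Link DR
    open Rows DR
    open Duality DR

    ε-over : ∀ l p u c G → l < c → ε (suc (l ℕ.+ p)) u (h c (suc p) * G) ≡ 0ℤ
    ε-over l p u c G lc = ≡.trans (ε-EE l c p u G) (ε-≈0 (suc (l ℕ.+ p)) u (EE-over (sl l p) c G (subst (_< c) (≡.sym (sl-length l p)) lc)))
      where open Grass DR 0 using (EE-over; sl-length)

    sh-hit : ∀ r → sh r (z0 1#) r ≈ 1#
    sh-hit zero = refl
    sh-hit (suc r) = sh-hit r

    sh-miss : ∀ r c → c ≢ r → sh r (z0 1#) c ≈ 0#
    sh-miss zero zero ne = ⊥-elim (ne ≡.refl)
    sh-miss zero (suc c) ne = refl
    sh-miss (suc r) zero ne = refl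
    sh-miss (suc r) (suc c) ne = sh-miss r c (λ e → ne (cong suc e))

    -- An invariant factor passes through the row operators, and on 1 they only shift. So a row of
    -- length r is detected by degree r alone.
    ZZ-sym : ∀ r p G c → (∀ i → p ≤ i → s i G ≈ G) → ZZ r p (z0 G) c ≈ G * sh r (z0 1#) c
    ZZ-sym r p G c inv = trans (ZZ-cong r p (λ { zero → sym (*-identityʳ G) ; (suc b) → sym (zeroʳ G) }) c)
      (trans (ZZ-inv r p G (z0 1#) inv c) (*-congˡ (ZZ-triv {0} {0} r p (z0 1#) z≤n z≤n (z0-V V-1) c)))

    row-hit : ∀ N u p c G → IsMax N u p → (∀ i → p ≤ i → s i G ≈ G) → N ∸ p ≡ c → ε (suc N) u (h c (suc p) * G) ≡ ε N (u ∘ punch p) G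
    row-hit N u p c G im inv ≡.refl = ≡.trans (ε-row N u p c G im) (ε-cong N (u ∘ punch p) (trans (ZZ-sym (N ∸ p) p G c inv) (trans (*-congˡ (sh-hit (N ∸ p))) (*-identityʳ G))))

    row-miss : ∀ N u p c G → IsMax N u p → (∀ i → p ≤ i → s i G ≈ G) → c ≢ N ∸ p → ε (suc N) u (h c (suc p) * G) ≡ 0ℤ
    row-miss N u p c G im inv ne = ≡.trans (ε-row N u p c G im) (ε-≈0 N (u ∘ punch p) (trans (ZZ-sym (N ∸ p) p G c inv) (trans (*-congˡ (sh-miss (N ∸ p) c ne)) (zeroʳ G))))

    record Top (N p : ℕ) (u : ℕ → ℕ) : Set where
      field
        permutes : Perm[ suc N ] u
        isMax : IsMax N u p
        asc : AscBut p (suc N) u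

    -- As u and τ descend only at p, their maxima are last or at p; removing them strips a row off λ.
    row-dual : ∀ L p c G τ u → 0 < c → p < L → τ p ≡ c ℕ.+ p → Perm[ L ] τ → AscBut p L τ → Perm[ L ] u → AscBut p L u → (∀ i → p ≤ i → s i G ≈ G) →
      (∀ N → N ≡ c ℕ.+ p → Top N p u → Top N p τ → ε N (u ∘ punch p) G ≡ + ind N (τ ∘ punch p) (u ∘ punch p)) →
      ε L u (h c (suc p) * G) ≡ + ind L τ u
    row-dual (suc N) p c G τ u c0 pL τp pτ aτ pu au inv inner = go (split-last {N} {τ} (proj₂ pτ)) (split-last {N} {u} (proj₂ pu))
      where
      pos : ∀ {v} → AscBut p (suc N) v → (Σ ℕ λ q → q < N × IsMax N v q) → p < N × IsMax N v p
      pos {v} a (q , qN , im) with q ≟ p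
      ... | yes ≡.refl = qN , im
      ... | no ne = ⊥-elim (max-descent {N} {v} qN im (a (s≤s qN) ne))
      differ : IsMax N τ p → (∀ j → j < N → u j < u N) → p < N → ¬ EqOn (suc N) u τ
      differ im q pN e = ℕₚ.<-asym (q p pN) (subst₂ _<_ (≡.sym (e ℕₚ.≤-refl)) (≡.sym (e pL)) (proj₂ im N ℕₚ.≤-refl (λ e → ℕₚ.<⇒≢ pN (≡.sym e))))
      differ' : IsMax N u p → (∀ j → j < N → τ j < τ N) → p < N → ¬ EqOn (suc N) u τ
      differ' im q pN e = ℕₚ.<-asym (q p pN) (subst₂ _<_ (e ℕₚ.≤-refl) (e pL) (proj₂ im N ℕₚ.≤-refl (λ e → ℕₚ.<⇒≢ pN (≡.sym e))))
      go : (∀ j → j < N → τ j < τ N) ⊎ (Σ ℕ λ q → q < N × IsMax N τ q) → (∀ j → j < N → u j < u N) ⊎ (Σ ℕ λ q → q < N × IsMax N u q) → ε (suc N) u (h c (suc p) * G) ≡ + ind (suc N) τ u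
      go (inj₁ qτ) (inj₁ qu) = ≡.trans (ε-ext N u _ qu) (≡.trans (row-dual N p c G τ u c0 pN τp (Perm-drop pτ qτ) (λ l → aτ (ℕₚ.m≤n⇒m≤1+n l)) (Perm-drop pu qu) (λ l → au (ℕₚ.m≤n⇒m≤1+n l)) inv inner)
          (cong +_ (ind-iff {N} {τ} {u} {suc N} {τ} {u} (λ e l → up e (ℕₚ.m≤n⇒m<n∨m≡n (ℕₚ.≤-pred l))) (λ e l → e (ℕₚ.m≤n⇒m≤1+n l)))))
        where
        τN : τ N ≡ N
        τN = max-value {N} {τ} pτ (lastMax {N} {τ} qτ)
        pN : p < N
        pN = ℕₚ.≤∧≢⇒< (ℕₚ.≤-pred pL) (λ { ≡.refl → ℕₚ.<-irrefl (≡.trans (≡.sym τN) τp) (ℕₚ.+-monoˡ-≤ p c0) })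
        up : EqOn N u τ → ∀ {j} → j < N ⊎ j ≡ N → u j ≡ τ j
        up e (inj₁ l) = e l
        up e (inj₂ ≡.refl) = ≡.trans (max-value {N} {u} pu (lastMax {N} {u} qu)) (≡.sym τN)
      go (inj₁ qτ) (inj₂ mu) = let (pN , im) = pos {u} au mu in
        ≡.trans (row-miss N u p c G im inv (λ e → ℕₚ.<⇒≢ (qτ p pN) (≡.trans τp (≡.trans (cong (ℕ._+ p) e) (≡.trans (ℕₚ.m∸n+n≡m (ℕₚ.<⇒≤ pN)) (≡.sym (max-value {N} {τ} pτ (lastMax {N} {τ} qτ))))))))
          (≡.sym (cong +_ (ind-no {suc N} {τ} {u} (differ' im qτ pN))))
      go (inj₂ mτ) (inj₁ qu) = let (pN , im) = pos {τ} aτ mτ in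
        ≡.trans (ε-ext N u _ qu) (≡.trans (over c c0 (≡.trans (≡.sym (max-value {N} {τ} pτ im)) τp)) (≡.sym (cong +_ (ind-no {suc N} {τ} {u} (differ im qu pN)))))
        where
        over : ∀ c → 0 < c → N ≡ c ℕ.+ p → ε N u (h c (suc p) * G) ≡ 0ℤ
        over (suc l) _ ≡.refl = ε-over l p u (suc l) G ℕₚ.≤-refl
      go (inj₂ mτ) (inj₂ mu) = let (pN , im) = pos {τ} aτ mτ ; (_ , im') = pos {u} au mu ; Ne = ≡.trans (≡.sym (max-value {N} {τ} pτ im)) τp in
        ≡.trans (row-hit N u p c G im' inv (≡.trans (cong (_∸ p) Ne) (ℕₚ.m+n∸n≡m c p)))
          (≡.trans (inner N Ne (record { permutes = pu ; isMax = im' ; asc = au }) (record { permutes = pτ ; isMax = im ; asc = aτ })) (≡.sym (cong +_ (ind-punch {N} {p} {u} {τ} im' im pu pτ))))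

    module _ (m : ℕ) where
      open Slots m using (s₁; s₂)
      open Grass DR m using (Sch)

      -- After a first row of length `d`, only `d` variables are missing from the second factor, so
      -- its degree c > d gives zero by `ε-over`.
      correction-0 : ∀ L u d c → d < c → Perm[ L ] u → AscBut s₁ L u → ε L u (h d s₂ * h c s₁) ≡ 0ℤ
      correction-0 zero u d (suc c) dc pu au = ≡.trans (ε-cong 0 u (*-comm _ _)) (ε-h 0 s₁ u c _ z≤n)
      correction-0 (suc N) u d c dc pu au = go (split-last {N} {u} (proj₂ pu))
        where
        inv : ∀ i → s₁ ≤ i → s i (h c s₁) ≈ h c s₁
        inv i l = s-h-above i c s₁ l
        go : (∀ j → j < N → u j < u N) ⊎ (Σ ℕ λ q → q < N × IsMax N u q) → ε (suc N) u (h d s₂ * h c s₁) ≡ 0ℤ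
        go (inj₁ q) = ≡.trans (ε-ext N u _ q) (correction-0 N u d c dc (Perm-drop pu q) (λ l → au (ℕₚ.m≤n⇒m≤1+n l)))
        go (inj₂ (q , qN , im)) with q ≟ s₁
        ... | no ne = ⊥-elim (max-descent {N} {u} qN im (au (s≤s qN) ne))
        ... | yes ≡.refl with d ≟ N ∸ s₁
        ...   | no ne = row-miss N u s₁ d (h c s₁) im inv ne
        ...   | yes ≡.refl = ≡.trans (row-hit N u s₁ d (h c s₁) im inv ≡.refl) (subst (λ z → ε z (u ∘ punch s₁) (h c s₁) ≡ 0ℤ) e
                  (≡.trans (ε-cong _ (u ∘ punch s₁) (sym (*-identityʳ _))) (ε-over (N ∸ s₁) m (u ∘ punch s₁) c 1# dc)))
          where
          e : suc (N ∸ s₁ ℕ.+ m) ≡ N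
          e = ≡.trans (≡.sym (ℕₚ.+-suc (N ∸ s₁) m)) (ℕₚ.m∸n+n≡m (ℕₚ.<⇒≤ qN))

      AscBut-punch : ∀ {N u} → AscBut s₁ (suc N) u → AscBut m N (u ∘ punch s₁)
      AscBut-punch {N} {u} asc {i} l ne with ℕₚ.<-cmp i m
      ... | tri< a _ _ = subst₂ _<_ (cong u (≡.sym (punch-lo s₁ i (ℕₚ.m≤n⇒m≤1+n a)))) (cong u (≡.sym (punch-lo s₁ (suc i) (s≤s a)))) (asc (ℕₚ.m≤n⇒m≤1+n l) (ℕₚ.<⇒≢ (ℕₚ.m≤n⇒m≤1+n a)))
      ... | tri≈ _ e _ = ⊥-elim (ne e)
      ... | tri> _ _ a = subst₂ _<_ (cong u (≡.sym (punch-hi s₁ i a))) (cong u (≡.sym (punch-hi s₁ (suc i) (ℕₚ.m≤n⇒m≤1+n a)))) (asc (s≤s l) (λ e → ne (ℕₚ.suc-injective e)))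

      id-of : ∀ {N u} → Perm[ N ] u → (∀ {j} → j < m → u j ≡ j) → (∀ {j} → m ≤ j → suc j < N → u j < u (suc j)) → EqOn N u (λ j → j)
      id-of {N} {u} pu lo hi = records-fix {0} {N} {u} pu (λ j _ jN i ij → asc-lt {0} {N} {u} (λ i _ l → rise i l (ℕₚ.<-cmp (suc i) m)) j z≤n ij jN) z≤n
        where
        rise : ∀ i → suc i < N → Tri (suc i < m) (suc i ≡ m) (m < suc i) → u i < u (suc i)
        rise i l (tri< a _ _) = subst₂ _<_ (≡.sym (lo (ℕₚ.<-trans (ℕₚ.n<1+n i) a))) (≡.sym (lo a)) ℕₚ.≤-refl
        rise i l (tri> _ _ a) = hi (ℕₚ.≤-pred a) l
        rise i l (tri≈ _ e _) = subst (_< u (suc i)) (≡.sym (lo im)) (ℕₚ.≰⇒> (λ q → ℕₚ.<⇒≱ (s≤s q) (ℕₚ.≤-reflexive (proj₂ pu l (ℕₚ.<-trans (s≤s q) l) (≡.sym (lo (ℕₚ.≤-<-trans q im)))))))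
          where
          im : i < m
          im = ℕₚ.≤-reflexive e

      module _ (faithful : ∀ M g → V 0 M g → (∀ u → Perm[ M ] u → ε M u g ≡ 0ℤ) → g ≈ 0#) (a b : ℕ) (ba : b < a) where
        open Reduce faithful m using (Sch-inv)

        -- Functionals with another descent kill a polynomial symmetric there. For the rest the
        -- correction vanishes, and both rows of the product are stripped by `row-dual`.
        Sch-eval : ∀ L τ → s₁ < L → Perm[ L ] τ → AscBut s₁ L τ → τ s₁ ≡ a ℕ.+ s₁ → τ m ≡ suc b ℕ.+ m → (∀ {j} → j < m → τ j ≡ j) →
          ∀ u → Perm[ L ] u → ε L u (Sch a b) ≡ + ind L τ u
        Sch-eval L τ sL pτ aτ τ₁ τ₂ τ₀ u pu with ascBut? s₁ L u
        ... | inj₂ (i , l , ne , nd) = ≡.trans (ε-desc-inv L u i (Sch a b) l (proj₂ pu) (desc-of {L} {u} (proj₂ pu) l nd))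
            (≡.trans (ε-≈0 L (u ∘ sw i) (∂-inv0 i (Sch a b) (Sch-inv a b ba i ne))) (≡.sym (cong +_ (ind-no {L} {τ} {u} (λ e → nd (subst₂ _<_ (≡.sym (e (ℕₚ.<-trans (ℕₚ.n<1+n i) l))) (≡.sym (e l)) (aτ l ne)))))))
        ... | inj₁ au = ≡.trans (ε-minus L u _ _) (≡.trans (cong₂ ℤ._-_ first (correction-0 L u b (suc a) (ℕₚ.m≤n⇒m≤1+n ba) pu au)) (ℤₚ.+-identityʳ _))
          where
          -- Without its two rows `τ` is increasing, hence the identity, to which 1 is dual.
          inner₂ : ∀ N → N ≡ suc b ℕ.+ m → Top N m (u ∘ punch s₁) → Top N m (τ ∘ punch s₁) → ε N (u ∘ punch s₁ ∘ punch m) 1# ≡ + ind N (τ ∘ punch s₁ ∘ punch m) (u ∘ punch s₁ ∘ punch m)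
          inner₂ N _ tu tτ = ≡.trans (Dual.eval (Dual-extend z≤n Dual-1) u'' (Perm-punch {N} {u ∘ punch s₁} (Top.permutes tu) (Top.isMax tu))) (cong +_ (ind-iff {N} {ext 0 (λ j → j)} {u''} {N} {τ''} {u''}
               (λ e {j} l → ≡.trans (e l) (≡.trans (ext-out {0} {λ j → j} z≤n) (≡.sym (idτ l)))) (λ e {j} l → ≡.trans (e l) (≡.trans (idτ l) (≡.sym (ext-out {0} {λ j → j} z≤n))))))
            where
            u'' = u ∘ punch s₁ ∘ punch m
            τ'' = τ ∘ punch s₁ ∘ punch m
            idτ : EqOn N τ'' (λ j → j)
            idτ = id-of {N} {τ''} (Perm-punch {N} {τ ∘ punch s₁} (Top.permutes tτ) (Top.isMax tτ))
              (λ {j} l → ≡.trans (cong (τ ∘ punch s₁) (punch-lo m j l)) (≡.trans (cong τ (punch-lo s₁ j (ℕₚ.m≤n⇒m≤1+n l))) (τ₀ l)))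
              (λ {j} mj l → subst₂ (λ y z → τ (punch s₁ y) < τ (punch s₁ z)) (≡.sym (punch-hi m j mj)) (≡.sym (punch-hi m (suc j) (ℕₚ.m≤n⇒m≤1+n mj))) (Top.asc tτ (s≤s l) (λ e → ℕₚ.<⇒≢ (s≤s mj) (≡.sym e))))
          inner₁ : ∀ N → N ≡ a ℕ.+ s₁ → Top N s₁ u → Top N s₁ τ → ε N (u ∘ punch s₁) (h (suc b) s₁) ≡ + ind N (τ ∘ punch s₁) (u ∘ punch s₁)
          inner₁ N Ne tu tτ = ≡.trans (ε-cong N (u ∘ punch s₁) (sym (*-identityʳ _))) (row-dual N m (suc b) 1# (τ ∘ punch s₁) (u ∘ punch s₁) (s≤s z≤n)
            (subst (m <_) (≡.sym Ne) (ℕₚ.m≤n+m s₁ a)) (≡.trans (cong τ (punch-lo s₁ m ℕₚ.≤-refl)) τ₂)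
            (Perm-punch {N} {τ} (Top.permutes tτ) (Top.isMax tτ)) (AscBut-punch {N} {τ} (Top.asc tτ)) (Perm-punch {N} {u} (Top.permutes tu) (Top.isMax tu)) (AscBut-punch {N} {u} (Top.asc tu)) (λ i _ → s-1 i) inner₂)
          first : ε L u (h a s₂ * h (suc b) s₁) ≡ + ind L τ u
          first = row-dual L s₁ a (h (suc b) s₁) τ u (ℕₚ.≤-<-trans z≤n ba) sL τ₁ pτ aτ pu au (λ i l → s-h-above i (suc b) s₁ l) inner₁

-- Schubert polynomials: duality and existence.

module SchubertPolynomials where
  open Polynomials
  open DividedDifferences
  open PolynomialDifferences
  open DifferenceRings
  open Functionals
  open Words
  open Transpositions
  open RowOperators
  open GrassmannianCoefficients
  open Faithfulness
  open DualBasis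
  open TwoRowSchur
  import Data.List.Properties as Listₚ
  open import Data.Vec as Vec using (Vec; []; _∷_; lookup; tabulate)
  import Data.Vec.Properties as Vecₚ
  open import Data.Fin as F using (Fin; toℕ; fromℕ<)
  import Data.Fin.Properties as Finₚ
  open ≡

  open Eps PolyDR
  open Alg PolyDR using (∂-uniq; ∂-cong)
  open Rows PolyDR
  open Duality PolyDR

  -- One-line notation as a function on ℕ; the values outside [0,N) are junk.
  vf : ∀ {M N} → Vec (Fin M) N → ℕ → ℕ
  vf [] j = 0
  vf (x ∷ w) zero = toℕ x
  vf (x ∷ w) (suc j) = vf w j

  vf-lookup : ∀ {M N} (w : Vec (Fin M) N) i → vf w (toℕ i) ≡ toℕ (lookup w i)
  vf-lookup (x ∷ w) F.zero = refl
  vf-lookup (x ∷ w) (F.suc i) = vf-lookup w i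

  on-Fin : ∀ {N} {P : ℕ → Set} → (∀ (i : Fin N) → P (toℕ i)) → ∀ {j} → j < N → P j
  on-Fin {P = P} f l = subst P (Finₚ.toℕ-fromℕ< l) (f (fromℕ< l))

  vf-Perm : ∀ {N} (w : Perm N) → IsPerm w → Perm[ N ] (vf w)
  vf-Perm {N} w p = on-Fin {P = λ j → vf w j < N} (λ i → subst (_< N) (sym (vf-lookup w i)) (Finₚ.toℕ<n (lookup w i))) ,
    λ {i} {j} il jl → on-Fin {P = λ i → vf w i ≡ vf w j → i ≡ j} (λ i → on-Fin {P = λ j → vf w (toℕ i) ≡ vf w j → toℕ i ≡ j}
      (λ j e → cong toℕ (p i j (Finₚ.toℕ-injective (trans (sym (vf-lookup w i)) (trans e (vf-lookup w j)))))) jl) il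

  vf-IsPerm : ∀ {N} (w : Perm N) → Perm[ N ] (vf w) → IsPerm w
  vf-IsPerm w (_ , inj) i j e = Finₚ.toℕ-injective (inj (Finₚ.toℕ<n i) (Finₚ.toℕ<n j) (trans (vf-lookup w i) (trans (cong toℕ e) (sym (vf-lookup w j)))))

  vf-injective : ∀ {N} (u w : Perm N) → EqOn N (vf u) (vf w) → u ≡ w
  vf-injective u w e = trans (sym (Vecₚ.tabulate∘lookup u)) (trans (Vecₚ.tabulate-cong (λ i → Finₚ.toℕ-injective (trans (sym (vf-lookup u i)) (trans (e (Finₚ.toℕ<n i)) (vf-lookup w i))))) (Vecₚ.tabulate∘lookup w))

  toVec : ∀ {N} u → Perm[ N ] u → Perm N
  toVec u (b , _) = tabulate (λ i → fromℕ< (b (Finₚ.toℕ<n i)))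

  vf-toVec : ∀ {N} u (pu : Perm[ N ] u) → EqOn N (vf (toVec u pu)) u
  vf-toVec u pu@(b , _) = on-Fin {P = λ j → vf (toVec u pu) j ≡ u j} (λ i → trans (vf-lookup (toVec u pu) i) (trans (cong toℕ (Vecₚ.lookup∘tabulate _ i)) (Finₚ.toℕ-fromℕ< (b (Finₚ.toℕ<n i)))))

  EqOn-Perm : ∀ {N u w} → EqOn N u w → Perm[ N ] u → Perm[ N ] w
  EqOn-Perm {N} e (b , inj) = (λ l → subst (_< N) (e l) (b l)) , λ il jl q → inj il jl (trans (e il) (trans q (sym (e jl))))

  vf-swap : ∀ {N} (w : Perm N) i j → toℕ j ≡ suc (toℕ i) → EqOn N (vf (swapPos w i j)) (vf w ∘ sw (toℕ i))
  vf-swap w i j ij = on-Fin {P = λ l → vf (swapPos w i j) l ≡ vf w (sw (toℕ i) l)} (λ l → trans (vf-lookup (swapPos w i j) l) (at l (l F.≟ j) (l F.≟ i)))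
    where
    at : ∀ l → Dec (l ≡ j) → Dec (l ≡ i) → toℕ (lookup (swapPos w i j) l) ≡ vf w (sw (toℕ i) (toℕ l))
    at l (yes refl) _ = trans (cong toℕ (Vecₚ.lookup∘update l (w Vec.[ i ]≔ lookup w l) (lookup w i))) (trans (sym (vf-lookup w i)) (cong (vf w) (sym (trans (cong (sw (toℕ i)) ij) (sw-at' (toℕ i))))))
    at l (no a) (yes refl) = trans (cong toℕ (trans (Vecₚ.lookup∘update′ a (w Vec.[ l ]≔ lookup w j) (lookup w l)) (Vecₚ.lookup∘update l w (lookup w j))))
      (trans (sym (vf-lookup w j)) (cong (vf w) (trans ij (sym (sw-at (toℕ l))))))
    at l (no a) (no b) = trans (cong toℕ (trans (Vecₚ.lookup∘update′ a (w Vec.[ i ]≔ lookup w j) (lookup w i)) (Vecₚ.lookup∘update′ b w (lookup w j))))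
      (trans (sym (vf-lookup w l)) (cong (vf w) (sym (sw-fix (toℕ i) (toℕ l) (λ e → b (Finₚ.toℕ-injective e)) (λ e → a (Finₚ.toℕ-injective (trans e (sym ij))))))))

  expo-tabulated : ∀ L (e : ℕ → ℕ) → (∀ j → L ≤ j → e j ≡ 0) → ∀ j → expo (applyUpTo e L) j ≡ e j
  expo-tabulated zero e z j = sym (z j z≤n)
  expo-tabulated (suc L) e z zero = refl
  expo-tabulated (suc L) e z (suc j) = expo-tabulated L (e ∘ suc) (λ j l → z (suc j) (s≤s l)) j

  expo-staircase : ∀ N j → expo (map (λ i → N ∸ suc i) (upTo N)) j ≡ N ∸ suc j
  expo-staircase N j = trans (cong (λ m → expo m j) (Listₚ.map-upTo (λ i → N ∸ suc i) N)) (expo-tabulated N (λ i → N ∸ suc i) (λ j l → ℕₚ.m≤n⇒m∸n≡0 (ℕₚ.m≤n⇒m≤1+n l)) j)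

  mono≈ : ∀ m m' → m ≐ m' → ((1ℤ , m) ∷ []) ≈P ((1ℤ , m') ∷ [])
  mono≈ m m' e = lin⇒≈ {(1ℤ , m) ∷ []} {(1ℤ , m') ∷ []} (λ {φ} pr → cong (λ z → 1ℤ ℤ.* z ℤ.+ 0ℤ) (pr {m} {m'} e))

  -- x_i times the new monomial is the old one, and x_(i+1) times it is the swapped old one.
  ∂-mono : ∀ i m m' a → expo m i ≡ suc a → expo m (suc i) ≡ a → expo m' i ≡ a → expo m' (suc i) ≡ a → (∀ j → j ≢ i → j ≢ suc i → expo m' j ≡ expo m j) →
    ∂P i ((1ℤ , m) ∷ []) ≈P ((1ℤ , m') ∷ [])
  ∂-mono i m m' a e₁ e₂ e₃ e₄ e₅ = λ k → sym (∂-uniq i M {M'} (lin⇒≈ {(var i -P var (suc i)) *P M'} {M -P swapP i M} (λ {φ} pr → trans (lin-vv* φ i (suc i) M')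
      (trans (cong₂ (λ y z → (1ℤ ℤ.* y ℤ.+ 0ℤ) ℤ.- (1ℤ ℤ.* z ℤ.+ 0ℤ)) (pr {monoMul (vm i) m'} {m} lo) (pr {monoMul (vm (suc i)) m'} {swapMono i m} hi)) (sym (lin-minus φ M (swapP i M)))))) k)
    where
    M = (1ℤ , m) ∷ []
    M' = (1ℤ , m') ∷ []
    lo : monoMul (vm i) m' ≐ m
    lo j with j ≟ i
    ... | yes refl = trans (expo-var-at i m') (trans (cong suc e₃) (sym e₁))
    ... | no p with j ≟ suc i
    ...   | yes refl = trans (expo-var i m' j (λ e → p (sym e))) (trans e₄ (sym e₂))
    ...   | no q = trans (expo-var i m' j (λ e → p (sym e))) (e₅ j p q)
    hi : monoMul (vm (suc i)) m' ≐ swapMono i m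
    hi j with j ≟ i
    ... | yes refl = trans (expo-var (suc i) m' j (λ e → ℕₚ.1+n≢n e)) (trans e₃ (sym (trans (expo-swap i m i) (trans (cong (expo m) (sw-at i)) e₂))))
    ... | no p with j ≟ suc i
    ...   | yes refl = trans (expo-var-at (suc i) m') (trans (cong suc e₄) (sym (trans (expo-swap i m (suc i)) (trans (cong (expo m) (sw-at' i)) e₁))))
    ...   | no q = trans (expo-var (suc i) m' j (λ e → q (sym e))) (trans (e₅ j p q) (sym (trans (expo-swap i m j) (cong (expo m) (sw-fix i j p q)))))

  -- Exponents after applying the first t divided differences to the staircase monomial of S_{n+1}.
  stage : ℕ → ℕ → ℕ → ℕ
  stage n t j with j <? t
  ... | yes _ = n ∸ suc j
  ... | no _ = n ∸ j

  stage-lo : ∀ n {t j} → j < t → stage n t j ≡ n ∸ suc j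
  stage-lo n {t} {j} l with j <? t
  ... | yes _ = refl
  ... | no a = ⊥-elim (a l)

  stage-hi : ∀ n {t j} → t ≤ j → stage n t j ≡ n ∸ j
  stage-hi n {t} {j} l with j <? t
  ... | yes a = ⊥-elim (ℕₚ.<⇒≱ a l)
  ... | no _ = refl

  stageM : ℕ → ℕ → Mono
  stageM n t = applyUpTo (stage n t) (suc n)

  stageP : ℕ → ℕ → Poly
  stageP n t = (1ℤ , stageM n t) ∷ []

  stairM : ℕ → Mono
  stairM N = map (λ i → N ∸ suc i) (upTo N)

  expo-stage : ∀ n t j → t ≤ n → expo (stageM n t) j ≡ stage n t j
  expo-stage n t j l = expo-tabulated (suc n) (stage n t) (λ j nj → trans (stage-hi n (ℕₚ.≤-trans l (ℕₚ.<⇒≤ nj))) (ℕₚ.m≤n⇒m∸n≡0 (ℕₚ.<⇒≤ nj))) j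

  ∂*-stage : ∀ c t n → c ℕ.+ t ≡ n → ∂* (rng c t) (stageP n t) ≈P stageP n n
  ∂*-stage zero t .t refl = λ _ → refl
  ∂*-stage (suc c) t n e = λ k → trans (∂*-cong (rng c (suc t)) {∂P t (stageP n t)} {stageP n (suc t)} one k) (∂*-stage c (suc t) n (trans (ℕₚ.+-suc c t) e) k)
    where
    tn : t < n
    tn = subst (t <_) e (s≤s (ℕₚ.m≤n+m t c))
    T = ℕₚ.<⇒≤ tn
    one : ∂P t (stageP n t) ≈P stageP n (suc t)
    one = ∂-mono t (stageM n t) (stageM n (suc t)) (n ∸ suc t) (trans (expo-stage n t t T) (trans (stage-hi n {t} ℕₚ.≤-refl) (ℕₚ.+-∸-assoc 1 tn)))
      (trans (expo-stage n t (suc t) T) (stage-hi n (ℕₚ.n≤1+n t)))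
      (trans (expo-stage n (suc t) t tn) (stage-lo n ℕₚ.≤-refl)) (trans (expo-stage n (suc t) (suc t) tn) (stage-hi n {suc t} ℕₚ.≤-refl))
      (λ j a b → trans (expo-stage n (suc t) j tn) (trans (oth j a b (ℕₚ.<-cmp j t)) (sym (expo-stage n t j T))))
      where
      oth : ∀ j → j ≢ t → j ≢ suc t → Tri (j < t) (j ≡ t) (t < j) → stage n (suc t) j ≡ stage n t j
      oth j a b (tri< l _ _) = trans (stage-lo n (ℕₚ.m≤n⇒m≤1+n l)) (sym (stage-lo n l))
      oth j a b (tri≈ _ e _) = ⊥-elim (a e)
      oth j a b (tri> _ _ l) = trans (stage-hi n l) (sym (stage-hi n (ℕₚ.<⇒≤ l)))

  -- Letter `t` meets the exponents n - t and n - t - 1 and lowers the first by one; n letters turn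
  -- one staircase into the next smaller one.
  staircase-step : ∀ n → ∂* (rng n 0) (staircase (suc n)) ≈P staircase n
  staircase-step n = λ k → trans (∂*-cong (rng n 0) {staircase (suc n)} {stageP n 0} start k) (trans (∂*-stage n 0 n (ℕₚ.+-identityʳ n) k) (end k))
    where
    start : staircase (suc n) ≈P stageP n 0
    start = mono≈ (stairM (suc n)) (stageM n 0) (λ j → trans (expo-staircase (suc n) j) (sym (trans (expo-stage n 0 j z≤n) (stage-hi n {0} {j} z≤n))))
    end : stageP n n ≈P staircase n
    end = mono≈ (stageM n n) (stairM n) (λ j → trans (expo-stage n n j ℕₚ.≤-refl) (trans (last j (j <? n)) (sym (expo-staircase n j))))
      where
      last : ∀ j → Dec (j < n) → stage n n j ≡ n ∸ suc j
      last j (yes l) = stage-lo n l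
      last j (no l) = trans (stage-hi n (ℕₚ.≮⇒≥ l)) (trans (ℕₚ.m≤n⇒m∸n≡0 (ℕₚ.≮⇒≥ l)) (sym (ℕₚ.m≤n⇒m∸n≡0 (ℕₚ.m≤n⇒m≤1+n (ℕₚ.≮⇒≥ l)))))

  -- The degree of the staircase monomial, and the length of the longest permutation.
  triangle : ℕ → ℕ
  triangle zero = 0
  triangle (suc n) = n ℕ.+ triangle n

  rng-length : ∀ c p → length (rng c p) ≡ c
  rng-length zero p = refl
  rng-length (suc c) p = cong suc (rng-length c (suc p))

  word-length-max : ∀ n u p → IsMax n u p → length (word (suc n) u) ≡ (n ∸ p) ℕ.+ length (word n (u ∘ punch p))
  word-length-max n u p im = trans (cong length (word-max n u p im)) (trans (Listₚ.length-++ (rng (n ∸ p) p)) (cong (ℕ._+ length (word n (u ∘ punch p))) (rng-length (n ∸ p) p)))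

  word-length : ∀ N u → Inj N u → length (word N u) ≤ triangle N
  word-length zero u inj = z≤n
  word-length (suc n) u inj = ℕₚ.≤-trans (ℕₚ.≤-reflexive (word-length-max n u p im)) (ℕₚ.+-mono-≤ (ℕₚ.m∸n≤m n p) (word-length n (u ∘ punch p) (Inj-punch (proj₁ im) inj)))
    where
    p = mp n u
    im = mp-isMax n u inj

  sum-staircase : ∀ N → sum (map (λ i → N ∸ suc i) (upTo N)) ≡ triangle N
  sum-staircase N = trans (cong sum (Listₚ.map-upTo (λ i → N ∸ suc i) N)) (go N)
    where
    go : ∀ N → sum (applyUpTo (λ i → N ∸ suc i) N) ≡ triangle N
    go zero = refl
    go (suc n) = cong (n ℕ.+_) (go n)

  sum-one : ∀ m → m ≐ [] → sum m ≡ 0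
  sum-one [] e = refl
  sum-one (a ∷ m) e = cong₂ ℕ._+_ (e 0) (sum-one m (e ∘ suc))

  -- Each letter lowers the degree by one, so too few letters leave no constant term.
  c₀-high : ∀ w f → Terms (λ m → length w < sum m) f → coeff (∂* w f) [] ≡ 0ℤ
  c₀-high [] f v = coeff-absent f [] v (λ m l e → ℕₚ.<⇒≢ l (sym (sum-one m e)))
  c₀-high (i ∷ w) f v = c₀-high w (∂P i f) (Terms-∂ i f (λ m m' l d → ℕₚ.≤-pred (subst (suc (length w) <_) (sym (Drop.degree d)) l)) v)

  reverse : ℕ → ℕ → ℕ
  reverse N j = N ∸ suc j

  reverse-Max : ∀ n → IsMax n (reverse (suc n)) 0
  reverse-Max n = z≤n , λ { zero _ ne → ⊥-elim (ne refl) ; (suc j) l _ → ℕₚ.∸-monoʳ-< (s≤s z≤n) l }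

  reverse-Perm : ∀ N → Perm[ N ] (reverse N)
  reverse-Perm N = (λ {i} l → ℕₚ.∸-monoʳ-< {N} {suc i} {0} (s≤s z≤n) l) , λ a b e → ℕₚ.suc-injective (ℕₚ.∸-cancelˡ-≡ a b e)

  -- With the maximum at 0, the first run leads to the smaller staircase. Otherwise the word of `u`
  -- is shorter than the degree.
  staircase-eval : ∀ N u → Perm[ N ] u → ε N u (staircase N) ≡ + ind N (reverse N) u
  staircase-eval zero u pu = trans (ε-nil u (staircase 0)) (sym (cong +_ (ind-yes {0} {reverse 0} {u} (λ ()))))
  staircase-eval (suc n) u pu = go (mp n u) (mp-isMax n u (proj₂ pu))
    where
    go : ∀ p → IsMax n u p → ε (suc n) u (staircase (suc n)) ≡ + ind (suc n) (reverse (suc n)) u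
    go zero im = trans (ε-max n u 0 (staircase (suc n)) im) (trans (ε-cong n (u ∘ suc) {∂* (rng n 0) (staircase (suc n))} {staircase n} (staircase-step n))
      (trans (staircase-eval n (u ∘ suc) (Perm-punch {n} {u} {0} pu im)) (cong +_ (sym (ind-punch {n} {0} {u} {reverse (suc n)} im (reverse-Max n) pu (reverse-Perm (suc n)))))))
    go (suc p) im = trans (ε-def (suc n) u (staircase (suc n))) (trans (c₀-high (word (suc n) u) (staircase (suc n)) (staircase (suc n) , (λ _ → refl) , short ∷ []))
      (sym (cong +_ (ind-no {suc n} {reverse (suc n)} {u} (λ e → ℕₚ.<⇒≢ (proj₂ im 0 z≤n (λ ())) (trans (e (s≤s z≤n)) (sym (max-value {n} {u} pu im))))))))
      where
      short : length (word (suc n) u) < sum (map (λ i → suc n ∸ suc i) (upTo (suc n)))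
      short = subst₂ _<_ (sym (word-length-max n u (suc p) im)) (sym (sum-staircase (suc n)))
        (ℕₚ.+-mono-<-≤ (ℕₚ.∸-monoʳ-< {n} {suc p} {0} (s≤s z≤n) (proj₁ im)) (word-length n _ (Inj-punch (proj₁ im) (proj₂ pu))))

  Dual-cong : ∀ {N w w'} F G → F ≈P G → EqOn N w w' → Dual N w F → Dual N w' G
  Dual-cong {N} {w} {w'} F G e q D = record
    { permutes = EqOn-Perm {N} {w} {w'} q permutes
    ; bound = Terms-cong F G e bound
    ; eval = λ u pu → trans (ε-cong N u {G} {F} (λ k → sym (e k))) (trans (eval u pu) (cong +_ (ind-iff {N} {w} {u} {N} {w'} {u} (λ r l → trans (r l) (q l)) (λ r l → trans (r l) (sym (q l)))))) }
    where open Dual D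

  vf-longest : ∀ N → EqOn N (reverse N) (vf (longest N))
  vf-longest N = on-Fin {P = λ j → reverse N j ≡ vf (longest N) j} (λ i → sym (trans (vf-lookup (longest N) i) (trans (cong toℕ (Vecₚ.lookup∘tabulate F.opposite i)) (Finₚ.opposite-prop i))))

  -- A step admits any quotient `g`; uniqueness identifies it with `∂P`, to which `Dual-step`
  -- applies.
  schubert-dual : ∀ {N w f} → Schubert N w f → Dual N (vf w) f
  schubert-dual {N} top = Dual-cong (staircase N) (staircase N) (λ _ → refl) (vf-longest N) (record
    { permutes = reverse-Perm N
    ; bound = staircase N , (λ _ → refl) , (λ j _ → ℕₚ.≤-reflexive (expo-staircase N j)) ∷ []
    ; eval = staircase-eval N })
  schubert-dual {N} (step {w} {f} {g} i j ij d isd S) = Dual-cong (∂P (toℕ i) f) g (λ k → sym (∂-uniq (toℕ i) f {g} isd k))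
    (λ l → sym (vf-swap w i j ij l)) (Dual-step (toℕ i) (subst (_< N) ij (Finₚ.toℕ<n j)) (subst₂ _<_ (trans (sym (vf-lookup w j)) (cong (vf w) ij)) (sym (vf-lookup w i)) d) (schubert-dual S))

  desc⇒reverse : ∀ N u → Perm[ N ] u → (∀ {i} → i < N → suc i < N → ¬ (u i < u (suc i))) → EqOn N u (reverse N)
  desc⇒reverse (suc n) u pu d = go (mp n u) (mp-isMax n u (proj₂ pu))
    where
    go : ∀ p → IsMax n u p → EqOn (suc n) u (reverse (suc n))
    go (suc p) im = ⊥-elim (d (ℕₚ.m≤n⇒m≤1+n (proj₁ im)) (s≤s (proj₁ im)) (proj₂ im p (ℕₚ.<⇒≤ (proj₁ im)) (λ e → ℕₚ.1+n≢n (sym e))))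
    go zero im {zero} l = max-value {n} {u} pu im
    go zero im {suc j} (s≤s l) = desc⇒reverse n (u ∘ suc) (Perm-punch {n} {u} {0} pu im) (λ a b → d (s≤s a) (s≤s b)) l

  -- Induction on the number of non-inversions.
  schubert-exists : ∀ {N} k (w : Perm N) → IsPerm w → triangle N ≤ length (word N (vf w)) ℕ.+ k → Σ Poly (Schubert N w)
  schubert-exists {N} k w pw lk with ℕₚ.allUpTo? (λ i → (suc i <? N) →-dec ¬? (vf w i <? vf w (suc i))) N
  ... | yes q = staircase N , subst (λ w → Schubert N w (staircase N)) (sym (vf-injective w (longest N) (λ l → trans (desc⇒reverse N (vf w) (vf-Perm w pw) q l) (vf-longest N l)))) top
  ... | no q with counterexample N (λ i → (suc i <? N) →-dec ¬? (vf w i <? vf w (suc i))) q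
  ...   | i , l , r = go (suc i <? N) (vf w i <? vf w (suc i))
    where
    go : Dec (suc i < N) → Dec (vf w i < vf w (suc i)) → Σ Poly (Schubert N w)
    go (no a) _ = ⊥-elim (r (λ a' → ⊥-elim (a a')))
    go (yes _) (no b) = ⊥-elim (r (λ _ → b))
    go (yes a) (yes b) = up k lk
      where
      iᶠ = fromℕ< l
      jᶠ = fromℕ< a
      eᶠ : toℕ iᶠ ≡ i
      eᶠ = Finₚ.toℕ-fromℕ< l
      ij : toℕ jᶠ ≡ suc (toℕ iᶠ)
      ij = trans (Finₚ.toℕ-fromℕ< a) (cong suc (sym eᶠ))
      w' = swapPos w iᶠ jᶠ
      vw : Perm[ N ] (vf w)
      vw = vf-Perm w pw
      e' : EqOn N (vf w') (vf w ∘ sw i)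
      e' {j} jl = trans (vf-swap w iᶠ jᶠ ij jl) (cong (λ z → vf w (sw z j)) eᶠ)
      pw' : IsPerm w'
      pw' = vf-IsPerm w' (EqOn-Perm {N} {vf w ∘ sw i} {vf w'} (λ jl → sym (e' jl)) (Perm-sw {N} {vf w} i a vw))
      back : swapPos w' iᶠ jᶠ ≡ w
      back = vf-injective (swapPos w' iᶠ jᶠ) w (λ {j} jl → trans (vf-swap w' iᶠ jᶠ ij jl) (trans (cong (λ z → vf w' (sw z j)) eᶠ) (trans (e' (sw-< i a jl)) (cong (vf w) (sw-invol i j)))))
      len : suc (length (word N (vf w))) ≡ length (word N (vf w'))
      len = trans (~length (asc-word N (vf w) i a (proj₂ vw) b)) (cong length (word-cong N (λ j jl → sym (e' jl))))
      dsc : lookup w' jᶠ F.< lookup w' iᶠ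
      dsc = subst₂ _<_ (trans (trans (cong (vf w) (sym (sw-at' i))) (sym (e' a))) (trans (cong (vf w') (sym (Finₚ.toℕ-fromℕ< a))) (vf-lookup w' jᶠ)))
        (trans (trans (cong (vf w) (sym (sw-at i))) (sym (e' l))) (trans (cong (vf w') (sym eᶠ)) (vf-lookup w' iᶠ))) b
      up : ∀ k → triangle N ≤ length (word N (vf w)) ℕ.+ k → Σ Poly (Schubert N w)
      up zero lk = ⊥-elim (ℕₚ.<⇒≱ (ℕₚ.≤-trans (ℕₚ.≤-reflexive len) (word-length N (vf w') (proj₂ (vf-Perm w' pw')))) (subst (triangle N ≤_) (ℕₚ.+-identityʳ _) lk))
      up (suc k) lk = let (f , S) = schubert-exists k w' pw' (subst (triangle N ≤_) (trans (ℕₚ.+-suc _ k) (cong (ℕ._+ k) len)) lk) in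
        ∂P (toℕ iᶠ) f , subst (λ w → Schubert N w (∂P (toℕ iᶠ) f)) back (step iᶠ jᶠ ij dsc (∂P-spec (toℕ iᶠ) f) S)

-- The shape of a Grassmannian permutation with two rows.

module TwoRowPartitions where
  open Words
  open RowOperators
  open DualBasis
  open SchubertPolynomials
  open import Data.List.Membership.Propositional using (_∈_)
  open import Data.List.Membership.Propositional.Properties using (∈-filter⁺; ∈-filter⁻; ∈-allFin)
  open import Data.List.Relation.Unary.Any using (here; there)
  open import Data.List.Relation.Unary.AllPairs using ([]; _∷_)
  open import Data.List.Relation.Unary.Unique.Propositional using (Unique)
  import Data.List.Relation.Unary.Unique.Propositional.Properties as Uniqueₚ
  open import Data.Vec using (lookup)
  open import Data.Fin as F using (toℕ; fromℕ<)
  import Data.Fin.Properties as Finₚ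
  open ≡

  -- t is a Grassmannian permutation with descent at m + 1 and partition (a , b + 1).
  record TwoRows (N k : ℕ) (t : ℕ → ℕ) : Set where
    field
      m a b : ℕ
      k≡ : k ≡ 2 ℕ.+ m
      in-range : suc m < N
      descent : AscBut (suc m) N t
      b<a : b < a
      row₁ : t (suc m) ≡ a ℕ.+ suc m
      row₂ : t m ≡ suc b ℕ.+ m
      fixed : ∀ {j} → j < m → t j ≡ j

  module Partition {N : ℕ} (k : ℕ) (τ : Perm N) (pτ : IsPerm τ) (gr : IsGrassmannian k τ) (rows : numRows k τ ≡ 2) where
    private
      t = vf τ
      pt : Perm[ N ] t
      pt = vf-Perm τ pτ

    Row : ℕ → Set
    Row j = j < N × j < k × j < t j

    asc : ∀ {i} → suc i < N → suc i < k ⊎ k ≤ i → t i < t (suc i)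
    asc {i} l c = subst₂ _<_ (trans (sym (vf-lookup τ iᶠ)) (cong t ei)) (trans (sym (vf-lookup τ jᶠ)) (cong t ej))
        (gr iᶠ jᶠ (subst₂ _<_ (sym ei) (sym ej) ℕₚ.≤-refl) (subst₂ (λ y z → z < k ⊎ k ≤ y) (sym ei) (sym ej) c))
      where
      iᶠ = fromℕ< (ℕₚ.<-trans (ℕₚ.n<1+n i) l)
      jᶠ = fromℕ< l
      ei = Finₚ.toℕ-fromℕ< (ℕₚ.<-trans (ℕₚ.n<1+n i) l)
      ej = Finₚ.toℕ-fromℕ< l

    -- Values increase before `k`, so the part at a position never shrinks to the right: the nonzero
    -- parts occupy a final segment.
    row-up : ∀ {i} d → Row i → d ℕ.+ i < N → d ℕ.+ i < k → Row (d ℕ.+ i)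
    row-up zero r _ _ = r
    row-up {i} (suc d) r l lk = l , lk , ℕₚ.≤-<-trans (proj₂ (proj₂ (row-up d r (ℕₚ.<-trans (ℕₚ.n<1+n _) l) (ℕₚ.<-trans (ℕₚ.n<1+n _) lk)))) (asc l (inj₁ lk))

    row-≤ : ∀ {i j} → Row i → i ≤ j → j < N → j < k → Row j
    row-≤ {i} {j} r l jN jk = subst Row e (row-up (j ∸ i) r (subst (_< N) (sym e) jN) (subst (_< k) (sym e) jk))
      where e = ℕₚ.m∸n+n≡m l

    above : ∀ j → j < N → j < k → j ≤ t j
    above zero _ _ = z≤n
    above (suc j) l lk = ℕₚ.≤-<-trans (above j (ℕₚ.<-trans (ℕₚ.n<1+n j) l) (ℕₚ.<-trans (ℕₚ.n<1+n j) lk)) (asc l (inj₁ lk))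

    non-row : ∀ {j} → j < N → j < k → ¬ Row j → t j ≡ j
    non-row {j} l lk n = ℕₚ.≤-antisym (ℕₚ.≮⇒≥ (λ q → n (l , lk , q))) (above j l lk)

    private
      P? : ∀ i → Dec (toℕ i < k × toℕ i < toℕ (lookup τ i))
      P? i = (toℕ i <? k) ×-dec (toℕ i <? toℕ (lookup τ i))

      two : Σ ℕ λ x → Σ ℕ λ y → x ≢ y × Row x × Row y × (∀ {j} → Row j → j ≡ x ⊎ j ≡ y)
      two = go (filter P? (allFin N)) refl rows (Uniqueₚ.filter⁺ P? (Uniqueₚ.allFin⁺ N))
        where
        go : ∀ l → l ≡ filter P? (allFin N) → length l ≡ 2 → Unique l → Σ ℕ λ x → Σ ℕ λ y → x ≢ y × Row x × Row y × (∀ {j} → Row j → j ≡ x ⊎ j ≡ y)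
        go (x ∷ y ∷ []) e _ ((ne ∷ []) ∷ _) = toℕ x , toℕ y , (λ q → ne (Finₚ.toℕ-injective q)) , row x (here refl) , row y (there (here refl)) , λ r → only r
          where
          row : ∀ i → i ∈ (x ∷ y ∷ []) → Row (toℕ i)
          row i p = let (_ , l , q) = ∈-filter⁻ P? {xs = allFin N} (subst (i ∈_) e p) in Finₚ.toℕ<n i , l , subst (toℕ i <_) (sym (vf-lookup τ i)) q
          only : ∀ {j} → Row j → j ≡ toℕ x ⊎ j ≡ toℕ y
          only {j} (jN , jk , q) with subst (i ∈_) (sym e) (∈-filter⁺ P? {xs = allFin N} (∈-allFin i) (subst (_< k) (sym ei) jk , subst₂ _<_ (sym ei) (trans (cong t (sym ei)) (vf-lookup τ i)) q))
            where
            i = fromℕ< jN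
            ei = Finₚ.toℕ-fromℕ< jN
          ... | here p = inj₁ (trans (sym (Finₚ.toℕ-fromℕ< jN)) (cong toℕ p))
          ... | there (here p) = inj₂ (trans (sym (Finₚ.toℕ-fromℕ< jN)) (cong toℕ p))

      -- For N ≤ k the permutation would be increasing, hence the identity, which has no rows.
      k<N : ∀ {x} → Row x → k < N
      k<N {x} (xN , _ , q) = ℕₚ.≰⇒> (λ Nk → ℕₚ.<-irrefl (sym (records-fix {0} {N} {t} pt (λ j _ jN i ij → asc-lt {0} {N} {t} (λ i _ l → asc l (inj₁ (ℕₚ.<-≤-trans l Nk))) j z≤n ij jN) z≤n xN)) q)

      -- The two rows form a final segment of the positions below `k`, so they are k - 1 and k - 2.
      core : ∀ e z → k ≡ suc e → Row e → Row z → z ≢ e → (∀ {j} → Row j → j ≡ e ⊎ j ≡ z) → TwoRows N k t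
      core zero z refl re (_ , s≤s z≤n , _) ne only = ⊥-elim (ne refl)
      core (suc m) z refl re rz ne only = record
        -- The second row has length b + 1, so `b` subtracts one more than the position m.
        { m = m ; a = t (suc m) ∸ suc m ; b = t m ∸ suc m ; k≡ = refl ; in-range = proj₁ re
        ; descent = λ {i} l n → asc l (side i n (suc i <? k))
        ; b<a = ℕₚ.+-cancelʳ-< (suc m) _ _ (subst₂ _<_ (sym eb) (sym ea) (asc (proj₁ re) (inj₁ (proj₁ (proj₂ re)))))
        ; row₁ = sym ea ; row₂ = trans (sym eb) (ℕₚ.+-suc _ m)
        ; fixed = λ {j} l → non-row (ℕₚ.<-trans l (proj₁ rm)) (ℕₚ.<-trans l (proj₁ (proj₂ rm))) (λ r → not-row l (only r)) }
        where
        zm : z ≤ m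
        zm = ℕₚ.≤-pred (ℕₚ.≤∧≢⇒< (ℕₚ.≤-pred (proj₁ (proj₂ rz))) ne)
        rm : Row m
        rm = row-≤ rz zm (ℕₚ.<-trans (ℕₚ.n<1+n m) (proj₁ re)) (ℕₚ.m≤n⇒m≤1+n ℕₚ.≤-refl)
        m≡z : m ≡ suc m ⊎ m ≡ z → m ≡ z
        m≡z (inj₁ q) = ⊥-elim (ℕₚ.1+n≢n (sym q))
        m≡z (inj₂ q) = q
        not-row : ∀ {j} → j < m → j ≡ suc m ⊎ j ≡ z → ⊥
        not-row l (inj₁ q) = ℕₚ.<⇒≢ (ℕₚ.m≤n⇒m≤1+n l) q
        not-row l (inj₂ q) = ℕₚ.<⇒≢ l (trans q (sym (m≡z (only rm))))
        ea : t (suc m) ∸ suc m ℕ.+ suc m ≡ t (suc m)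
        ea = ℕₚ.m∸n+n≡m (ℕₚ.<⇒≤ (proj₂ (proj₂ re)))
        eb : t m ∸ suc m ℕ.+ suc m ≡ t m
        eb = ℕₚ.m∸n+n≡m (proj₂ (proj₂ rm))
        side : ∀ i → i ≢ suc m → Dec (suc i < k) → suc i < k ⊎ k ≤ i
        side i n (yes l) = inj₁ l
        side i n (no l) = inj₂ (ℕₚ.≤∧≢⇒< (ℕₚ.≤-pred (ℕₚ.≮⇒≥ l)) (λ q → n (sym q)))

      last-row : ∀ {x} → Row x → Σ ℕ λ e → k ≡ suc e × Row e
      last-row {x} rx = go k refl
        where
        go : ∀ k' → k' ≡ k → Σ ℕ λ e → k ≡ suc e × Row e
        go zero refl = ⊥-elim (ℕₚ.<⇒≱ (proj₁ (proj₂ rx)) z≤n)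
        go (suc e) refl = e , refl , row-≤ rx (ℕₚ.≤-pred (proj₁ (proj₂ rx))) (ℕₚ.<-trans (ℕₚ.n<1+n e) (k<N rx)) ℕₚ.≤-refl

    two-rows : TwoRows N k t
    two-rows with two
    ... | x , y , ne , rx , ry , only with last-row rx
    ...   | e , ke , re with only re
    ...     | inj₁ refl = core e y ke re ry (λ q → ne (sym q)) only
    ...     | inj₂ refl = core e x ke re rx ne (λ r → Sum.swap (only r))

-- Existence of expansions and their coefficients.

module Expansions where
  open Polynomials
  open DividedDifferences
  open PolynomialDifferences
  open DifferenceRings
  open Functionals
  open Words
  open SlotPaths
  open RowOperators
  open GrassmannianCoefficients
  open Faithfulness
  open DualBasis
  open TwoRowSchur
  open SchubertPolynomials
  open TwoRowPartitions
  open import Data.List.Membership.Propositional using (_∈_)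
  open import Data.List.Membership.Propositional.Properties using (∈-filter⁺; ∈-allFin; ∈-cartesianProductWith⁺; ∈-map⁻)
  open import Data.List.Relation.Unary.Any using (here; there)
  open import Data.List.Relation.Unary.AllPairs using ([]; _∷_)
  open import Data.List.Relation.Unary.Unique.Propositional using (Unique)
  import Data.List.Relation.Unary.Unique.Propositional.Properties as Uniqueₚ
  open import Data.Vec as Vec using (Vec; []; _∷_; lookup)
  import Data.Vec.Properties as Vecₚ
  open import Data.Fin as F using (Fin)
  import Data.Fin.Properties as Finₚ
  open ≡

  open Eps PolyDR
  open Alg PolyDR using (diff0)
  open Duality PolyDR

  ∂*-scale : ∀ w c f → ∂* w (scaleP c f) ≈P scaleP c (∂* w f)
  ∂*-scale [] c f = λ _ → refl
  ∂*-scale (i ∷ w) c f = λ k → trans (∂*-cong w {∂P i (scaleP c f)} {scaleP c (∂P i f)} one k) (∂*-scale w c (∂P i f) k)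
    where
    one : ∂P i (scaleP c f) ≈P scaleP c (∂P i f)
    one = lin⇒≈ {∂P i (scaleP c f)} {scaleP c (∂P i f)} (λ {φ} pr → trans (lin-∂P φ i (scaleP c f)) (trans (lin-scale (λ m → lin φ (∂M i m)) c f)
      (trans (cong (c ℤ.*_) (sym (lin-∂P φ i f))) (sym (lin-scale φ c (∂P i f))))))

  ε-scale : ∀ N u c f → ε N u (scaleP c f) ≡ c ℤ.* ε N u f
  ε-scale N u c f = trans (ε-def N u (scaleP c f)) (trans (∂*-scale (word N u) c f []) (trans (coeff-lin (scaleP c (∂* (word N u) f)) [])
    (trans (lin-scale (δ []) c (∂* (word N u) f)) (cong (c ℤ.*_) (trans (sym (coeff-lin (∂* (word N u) f) [])) (sym (ε-def N u f)))))))

  module _ {M : ℕ} where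
    eval-term : ∀ (t : Term M) v → IsPerm v → ε M (vf v) (poly t) ≡ + ind M (vf (perm t)) (vf v)
    eval-term t v pv = Dual.eval (schubert-dual (isSch t)) (vf v) (vf-Perm v pv)

    ε-cons : ∀ u (t : Term M) E → ε M u (sumTerms (t ∷ E)) ≡ coef t ℤ.* ε M u (poly t) ℤ.+ ε M u (sumTerms E)
    ε-cons u t E = trans (ε-+ M u (scaleP (coef t) (poly t)) (sumTerms E)) (cong (ℤ._+ ε M u (sumTerms E)) (ε-scale M u (coef t) (poly t)))

    ε-absent : ∀ v → IsPerm v → ∀ E → All (λ t → v ≢ perm t) E → ε M (vf v) (sumTerms E) ≡ 0ℤ
    ε-absent v pv [] [] = ε-0 M (vf v)
    ε-absent v pv (t ∷ E) (ne ∷ a) = trans (ε-cons (vf v) t E) (cong₂ ℤ._+_ (trans (cong (coef t ℤ.*_) (trans (eval-term t v pv) (cong +_ (ind-no {M} {vf (perm t)} {vf v} (λ e → ne (vf-injective v (perm t) e))))))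
      (ℤₚ.*-zeroʳ (coef t))) (ε-absent v pv E a))

    -- The functional of `perm t` is 1 on the polynomial of `t` and 0 on all others, as their
    -- permutations are distinct.
    ε-coef : ∀ E → Unique (map perm E) → ∀ {t : Term M} → t ∈ E → ε M (vf (perm t)) (sumTerms E) ≡ coef t
    ε-coef (t ∷ E) (a ∷ u) (here refl) = trans (ε-cons (vf (perm t)) t E) (trans (cong₂ ℤ._+_ (trans (cong (coef t ℤ.*_) (trans (eval-term t (perm t) pt) (cong +_ (ind-yes {M} {vf (perm t)} {vf (perm t)} (λ _ → refl)))))
        (ℤₚ.*-identityʳ (coef t))) (ε-absent (perm t) pt E (Allₚ.map⁻ a))) (ℤₚ.+-identityʳ (coef t)))
      where
      pt : IsPerm (perm t)
      pt = vf-IsPerm (perm t) (Dual.permutes (schubert-dual (isSch t)))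
    ε-coef (t' ∷ E) (a ∷ u) {t} (there p) = trans (ε-cons (vf (perm t)) t' E) (trans (cong₂ ℤ._+_ (trans (cong (coef t' ℤ.*_) (trans (eval-term t' (perm t) pt)
        (cong +_ (ind-no {M} {vf (perm t')} {vf (perm t)} (λ e → All.lookup (Allₚ.map⁻ a) p (sym (vf-injective (perm t) (perm t') e))))))) (ℤₚ.*-zeroʳ (coef t'))) (ε-coef E u p)) (ℤₚ.+-identityˡ (coef t)))
      where
      pt : IsPerm (perm t)
      pt = vf-IsPerm (perm t) (Dual.permutes (schubert-dual (isSch t)))

  vectors : ∀ M N → List (Vec (Fin M) N)
  vectors M zero = [] ∷ []
  vectors M (suc N) = cartesianProductWith _∷_ (allFin M) (vectors M N)

  vectors-unique : ∀ M N → Unique (vectors M N)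
  vectors-unique M zero = [] ∷ []
  vectors-unique M (suc N) = Uniqueₚ.cartesianProductWith⁺ _∷_ Vecₚ.∷-injective (Uniqueₚ.allFin⁺ M) (vectors-unique M N)

  vectors-complete : ∀ {M N} (v : Vec (Fin M) N) → v ∈ vectors M N
  vectors-complete [] = here refl
  vectors-complete (x ∷ v) = ∈-cartesianProductWith⁺ _∷_ (∈-allFin x) (vectors-complete v)

  isPerm? : ∀ {N} (w : Perm N) → Dec (IsPerm w)
  isPerm? w = Finₚ.all? (λ i → Finₚ.all? (λ j → (lookup w i F.≟ lookup w j) →-dec (i F.≟ j)))

  perms : ∀ M → List (Perm M)
  perms M = filter isPerm? (vectors M M)

  module Expansion (P : Poly) (M : ℕ) (bP : Terms (Bounded 0 M) P) where
    term : ∀ w → IsPerm w → Term M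
    term w pw = let (f , S) = schubert-exists (triangle M) w pw (ℕₚ.m≤n+m (triangle M) _) in
      record { perm = w ; coef = ε M (vf w) P ; poly = f ; isSch = S }

    terms : ∀ ws → All IsPerm ws → List (Term M)
    terms [] [] = []
    terms (w ∷ ws) (p ∷ a) = term w p ∷ terms ws a

    terms-perm : ∀ ws a → map perm (terms ws a) ≡ ws
    terms-perm [] [] = refl
    terms-perm (w ∷ ws) (p ∷ a) = cong (w ∷_) (terms-perm ws a)

    terms-coef : ∀ ws a → All (λ t → coef t ≡ ε M (vf (perm t)) P) (terms ws a)
    terms-coef [] [] = []
    terms-coef (w ∷ ws) (p ∷ a) = refl ∷ terms-coef ws a

    E : List (Term M)
    E = terms (perms M) (Allₚ.all-filter isPerm? (vectors M M))

    E-unique : Unique (map perm E)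
    E-unique = subst Unique (sym (terms-perm (perms M) _)) (Uniqueₚ.filter⁺ isPerm? (vectors-unique M M))

    sum-bounded : ∀ (E : List (Term M)) → Terms (Bounded 0 M) (sumTerms E)
    sum-bounded [] = [] , (λ _ → refl) , []
    sum-bounded (t ∷ E) = Terms-+ (scaleP (coef t) (poly t)) (sumTerms E) (Terms-scale (coef t) (poly t) (Dual.bound (schubert-dual (isSch t)))) (sum-bounded E)

    -- The coefficients are the values of the functionals, so every functional vanishes on the
    -- difference, and `faithful` applies.
    expansion : P ≈P sumTerms E
    expansion = diff0 {P} {sumTerms E} (faithful M (P -P sumTerms E) (Terms-+ P (negP (sumTerms E)) bP (Terms-scale (ℤ.- 1ℤ) (sumTerms E) (sum-bounded E))) vanish)
      where
      vanish : ∀ u → Perm[ M ] u → ε M u (P -P sumTerms E) ≡ 0ℤ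
      vanish u pu = trans (ε-minus M u P (sumTerms E)) (ℤₚ.i≡j⇒i-j≡0 (same (∈-map⁻ perm (subst (û ∈_) (sym (terms-perm (perms M) _)) (∈-filter⁺ isPerm? (vectors-complete û) pû)))))
        where
        û = toVec u pu
        pû : IsPerm û
        pû = vf-IsPerm û (EqOn-Perm {M} {u} {vf û} (λ l → sym (vf-toVec u pu l)) pu)
        same : (Σ (Term M) λ t → t ∈ E × û ≡ perm t) → ε M u P ≡ ε M u (sumTerms E)
        same (t , p , e) = trans (at P) (trans (sym (All.lookup (terms-coef (perms M) _) p)) (trans (sym (ε-coef E E-unique p)) (sym (at (sumTerms E)))))
          where
          at : ∀ f → ε M u f ≡ ε M (vf (perm t)) f
          at f = ε-permcong M f (λ j l → trans (sym (vf-toVec u pu l)) (cong (λ v → vf v j) e))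

  module Bound {n₁ n₂ k : ℕ} (τ : Perm n₁) (w : Perm n₂) {fτ fw : Poly} (Sτ : Schubert n₁ τ fτ) (Sw : Schubert n₂ w fw) (T : TwoRows n₁ k (vf τ)) where
    open TwoRows T
    open Slots m using (s₁; s₂; s₃; n)
    open Grass PolyDR m using (Sch)
    open Schur PolyDR using (Sch-eval)
    open Reduce faithful m using (Small; Topped; reduce)

    -- Both sides are dual to `τ` in one S_L, with `L` at least n₁ and large enough to bound the
    -- exponents of `Sch a b`.
    fτ≈Sch : fτ ≈P Sch a b
    fτ≈Sch = Dual-unique faithful {L} {ext n₁ t} {fτ} {Sch a b} (Dual-extend (ℕₚ.m≤m⊔n n₁ M) Dτ) (record
      { permutes = pL
      ; bound = Terms-map (Sch a b) (λ mo q j _ → ℕₚ.≤-trans (q j z≤n) (ℕₚ.∸-monoˡ-≤ (suc j) (ℕₚ.m≤n⊔m n₁ M))) (proj₂ (bounded (Sch a b)))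
      ; eval = Sch-eval m faithful a b b<a L (ext n₁ t) (ℕₚ.<-≤-trans in-range (ℕₚ.m≤m⊔n n₁ M)) pL asc (trans (ext-in {n₁} {t} in-range) row₁)
          (trans (ext-in {n₁} {t} m<) row₂) (λ l → trans (ext-in {n₁} {t} (ℕₚ.<-trans l m<)) (fixed l)) })
      where
      t = vf τ
      M = proj₁ (bounded (Sch a b))
      L = n₁ ⊔ M
      Dτ : Dual n₁ t fτ
      Dτ = schubert-dual Sτ
      pL : Perm[ L ] (ext n₁ t)
      pL = ext-Perm {n₁} {t} (ℕₚ.m≤m⊔n n₁ M) (Dual.permutes Dτ)
      m< : m < n₁
      m< = ℕₚ.<-trans (ℕₚ.n<1+n m) in-range
      asc : AscBut s₁ L (ext n₁ t)
      asc {i} l ne = go (suc i <? n₁)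
        where
        go : Dec (suc i < n₁) → ext n₁ t i < ext n₁ t (suc i)
        go (yes q) = subst₂ _<_ (sym (ext-in {n₁} {t} (ℕₚ.<-trans (ℕₚ.n<1+n i) q))) (sym (ext-in {n₁} {t} q)) (descent q ne)
        go (no q) = ext-lt {n₁} {t} (Dual.permutes Dτ) (ℕₚ.≮⇒≥ q) ℕₚ.≤-refl

    small : n₂ ≤ n → ∀ {M E} → IsExpansion (fw *P fτ) M E → ∀ {t} → t ∈ E → Small (ext n₂ (vf w)) (coef t)
    small l {M} {E} (uq , e) {t} p = subst (Small (ext n₂ (vf w))) (trans (ε-cong M v {Sch a b *P fw} {sumTerms E} eq) (ε-coef E uq p))
        (reduce a b b<a (length (word M v)) M v (ext n₂ (vf w)) fw ℕₚ.≤-refl (Dual.permutes (schubert-dual (isSch t))) (Dual-extend l (schubert-dual Sw)))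
      where
      v = vf (perm t)
      eq : Sch a b *P fw ≈P sumTerms E
      eq k = trans (*P-comm (Sch a b) fw k) (trans (*P-cong {fw} {fw} {Sch a b} {fτ} (λ _ → refl) (λ k → sym (fτ≈Sch k)) k) (e k))

    -- For n₂ ≤ s₃ the position `s₃` is an added fixed point of `w`.
    topped : n₂ ≤ s₃ → Topped (ext n₂ (vf w))
    topped l j jl = ext-lt {n₂} {vf w} (Dual.permutes (schubert-dual Sw)) l jl

    01-bound : n₂ ≤ s₃ → ∀ {M E} → IsExpansion (fw *P fτ) M E → All (λ t → coef t ≡ + 0 ⊎ coef t ≡ + 1) E
    01-bound l {M} {E} ex = All.tabulate (λ {t} p → fin {t} (small (ℕₚ.m≤n⇒m≤1+n l) ex p))
      where
      fin : ∀ {t : Term M} → Small (ext n₂ (vf w)) (coef t) → coef t ≡ + 0 ⊎ coef t ≡ + 1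
      fin (zero , e , _) = inj₁ e
      fin (suc zero , e , _) = inj₂ e
      fin (suc (suc q) , e , _ , q≤1) with q≤1 (topped l)
      ... | s≤s ()

    012-bound : n₂ ≤ n → ∀ {M E} → IsExpansion (fw *P fτ) M E → All (λ t → coef t ≡ + 0 ⊎ coef t ≡ + 1 ⊎ coef t ≡ + 2) E
    012-bound l {M} {E} ex = All.tabulate (λ {t} p → fin {t} (small l ex p))
      where
      fin : ∀ {t : Term M} → Small (ext n₂ (vf w)) (coef t) → coef t ≡ + 0 ⊎ coef t ≡ + 1 ⊎ coef t ≡ + 2
      fin (zero , e , _) = inj₁ e
      fin (suc zero , e , _) = inj₂ (inj₁ e)
      fin (suc (suc zero) , e , _) = inj₂ (inj₂ e)
      fin (suc (suc (suc q)) , e , s≤s (s≤s ()) , _)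

open Faithfulness using (bounded)
open TwoRowPartitions
open Expansions
open ≡

theorem1p1 : ∀ (n₁ n₂ k : ℕ) (τ : Perm n₁) (w : Perm n₂) →
    IsPerm τ → IsPerm w →
    IsGrassmannian k τ → numRows k τ ≡ 2 →
    ∀ {fτ fw : Poly} → Schubert n₁ τ fτ → Schubert n₂ w fw →
    (Σ ℕ λ M → Σ (List (Term M)) λ E → IsExpansion (fw *P fτ) M E)
    ×
    (∀ (M : ℕ) (E : List (Term M)) → IsExpansion (fw *P fτ) M E →
      (k ≡ n₂ → All (λ t → coef t ≡ + 0 ⊎ coef t ≡ + 1) E)
      × (suc k ≡ n₂ → All (λ t → coef t ≡ + 0 ⊎ coef t ≡ + 1) E)
      × (suc (suc k) ≡ n₂ → All (λ t → coef t ≡ + 0 ⊎ coef t ≡ + 1 ⊎ coef t ≡ + 2) E))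
theorem1p1 n₁ n₂ k τ w pτ pw gr rows {fτ} {fw} Sτ Sw =
  (M₀ , E , E-unique , expansion) ,
  -- Since `s₃` is k + 1 and `n` is k + 2, the first two cases fall under n₂ ≤ s₃ and the third
  -- under n₂ ≤ n.
  λ M E ex → (λ e → 01-bound (≤-of {0} e (ℕₚ.m≤n⇒m≤1+n ℕₚ.≤-refl)) ex) , (λ e → 01-bound (≤-of {1} e ℕₚ.≤-refl) ex) , (λ e → 012-bound (≤-of {2} e ℕₚ.≤-refl) ex)
  where
  M₀ = proj₁ (bounded (fw *P fτ))
  open Expansion (fw *P fτ) M₀ (proj₂ (bounded (fw *P fτ)))
  T = Partition.two-rows k τ pτ gr rows
  open TwoRows T using (k≡)
  open Bound τ w Sτ Sw T
  ≤-of : ∀ {d c} → d ℕ.+ k ≡ n₂ → d ℕ.+ (2 ℕ.+ TwoRows.m T) ≤ c → n₂ ≤ c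
  ≤-of {d} {c} e l = subst (_≤ c) (trans (cong (d ℕ.+_) (sym k≡)) e) l
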